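{- For each integer $n \ge 0$, let $v_n, w_n$ be the integers defined by $v_n + w_n\sqrt{3} = (1+\sqrt{3})(2+\sqrt{3})^n$. If $x$ and $y$ are positive rational numbers for which $x^y = y^{3x}$, then either (a) $x = \left(3 + \frac{3}{n}\right)^{n}$ and $y = \left(3 + \frac{3}{n}\right)^{1+n}$ for some $n \in \mathbb{Z}$ with $n \neq 0, -1$; or (b) $x = \left(\frac{3 w_n}{v_n}\right)^{v_n^2}$ and $y = \left(\frac{3 w_n}{v_n}\right)^{3 w_n^2}$ for some integer $n \ge 0$; or (c) $x = \left(\frac{w_n}{v_n}\right)^{3 w_n^2}$ and $y = \left(\frac{w_n}{v_n}\right)^{v_n^2}$ for some integer $n \ge 0$. -}

module Defs where

open import Data.Nat as ℕ using (ℕ; zero; suc)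
open import Data.Integer as ℤ using (ℤ; +_; -[1+_])
open import Data.Rational as ℚ using (ℚ; 0ℚ; 1ℚ; _/_; ↥_; ↧ₙ_; 1/_; ≢-nonZero)
open import Data.Rational.Properties using (_≟_)
open import Relation.Binary.PropositionalEquality using (_≡_)
open import Relation.Nullary using (yes; no)
open import Data.Product using (_×_; _,_; proj₁; proj₂)

ℤtoℚ : ℤ → ℚ
ℤtoℚ z = z / 1

ℕtoℚ : ℕ → ℚ
ℕtoℚ n = (+ n) / 1

-- total inverse on ℚ (convention: inv 0 = 0); only ever applied to nonzero values
inv : ℚ → ℚ
inv q with q ≟ 0ℚ
... | yes _ = 0ℚ
... | no q≢0 = (1/ q) {{≢-nonZero q≢0}}

_^ℕ_ : ℚ → ℕ → ℚ
q ^ℕ zero = 1ℚ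
q ^ℕ suc k = q ℚ.* (q ^ℕ k)

_^ℤ_ : ℚ → ℤ → ℚ
q ^ℤ (+ k) = q ^ℕ k
q ^ℤ -[1+ k ] = inv q ^ℕ suc k

-- v n + w n √3 = (1 + √3)(2 + √3)^n ;  multiplying by (2 + √3):
-- (v + w√3)(2 + √3) = (2v + 3w) + (v + 2w)√3
vw : ℕ → ℕ × ℕ
vw zero = 1 , 1
vw (suc n) = let (a , b) = vw n in (2 ℕ.* a ℕ.+ 3 ℕ.* b) , (a ℕ.+ 2 ℕ.* b)

v : ℕ → ℕ
v n = proj₁ (vw n)

w : ℕ → ℕ
w n = proj₂ (vw n)

-- For positive rationals x, y and positive rational exponents p, q, the real-number
-- equation  x ^ p = y ^ q.  Writing p = a/b, q = c/d (a,b,c,d positive integers),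
-- x^(a/b) = y^(c/d) holds in the positive reals iff x^(a d) = y^(c b)
-- (since t ↦ t^(bd) is injective on positive reals), which is an equation in ℚ.
RealPowEq : ℚ → ℚ → ℚ → ℚ → Set
RealPowEq x p y q = x ^ℕ (ℤ.∣ ↥ p ∣ ℕ.* ↧ₙ q) ≡ y ^ℕ (ℤ.∣ ↥ q ∣ ℕ.* ↧ₙ p)

{-# OPTIONS --safe #-}

-- Write y/(3x) = p/q in lowest terms; then x = r^q and y = r^p for a rational r = m/n, and r^(p−q) = 3p/q. Hence with
-- k = |p − q| two coprime numbers differing by k are, up to a factor 3 in one of them, k-th powers. For k = 1 this gives
-- (a), and for k = 2 a Pell equation whose solutions give (b) and (c). It remains to show that |a^k − 3b^k| is neither
-- k nor 3k when k ≥ 3.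
--   For k ≥ 41370 the ratio a/b is so close to 3^(1/k) that Gelfond's method applies: an auxiliary exponential
-- polynomial with small integer coefficients, found by the pigeonhole principle, vanishes at too many points.
--   For smaller k the equation has no solution modulo 3, modulo 8, or modulo some prime ℓ = jk + 1, except for
-- a^k = 3b^k ± 3k with k = 5 or 7, which is solvable everywhere locally. There a = 3c, and b − cη^(k−1) is a unit of
-- ℤ[η], η^k = 3, times a fixed element of norm k. All units are found by descent on the sum of the squares of their
-- absolute values, and modulo k none of them has the required form.
module Submission where

-- The threshold 41370 has to be low enough for a direct sieve below it, and this shapes the
-- analytic part. The function is Σ p_ij C(u, j) A_i^u with the thirteen bases A_i = a^i b^(12-i),
-- which lie within a relative distance 7/k of the middle one. Its Newton coefficients at a⁶b⁶
-- therefore decay geometrically, and only the first ones have to be made small. Near a multiple ks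
-- of k, a^k ≈ 3b^k turns the value, up to a common factor, into an integer combination of the
-- 3^(is); since A_i A_(12-i) is constant, this works on both sides of ks and doubles the number of
-- points. The resulting budget, counted in powers of ρ = k/1379, is met from ρ = 30 on, whence
-- 41370 = 30 · 1379. For 5 and 7 a list of units must be proved complete with integer arithmetic
-- alone. Embeddings are rounded to integers at scale 10¹², with explicit bounds for all errors, and
-- the possible proportions between the absolute values of a reduced unit are covered by boxes. What
-- enters the obstruction is the class of a unit modulo k, up to integer factors.

-- Coprime powers, common roots and the Pell equation V² + 2 = 3W²

module Arithmetic where

  open import Defs
  open import Data.Nat as ℕ using (ℕ; zero; suc; _+_; _*_; _^_; _∸_; _≤_; _<_; z≤n; s≤s; NonZero)
  open import Data.Nat.Properties
  open import Data.Nat.Divisibility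
  open import Data.Nat.Coprimality as Cop using (Coprime; coprime-divisor)
  open import Data.Nat.GCD using (gcd; gcd[m,n]∣m; gcd[m,n]∣n; gcd-greatest; gcd[m,n]≢0)
  open import Data.Nat.Induction using (<-rec)
  open import Data.Nat.Tactic.RingSolver using (solve-∀)
  open import Data.Product using (_×_; ∃-syntax; _,_; proj₁; proj₂)
  open import Data.Sum using (_⊎_; inj₁; inj₂)
  open import Relation.Nullary using (contradiction)
  open import Relation.Binary.Definitions using (tri<; tri≈; tri>)
  open import Relation.Binary.PropositionalEquality

  ^-distribʳ-* : ∀ m n k → (m * n) ^ k ≡ m ^ k * n ^ k
  ^-distribʳ-* m n zero = refl
  ^-distribʳ-* m n (suc k) = trans (cong ((m * n) *_) (^-distribʳ-* m n k)) (lem m n (m ^ k) (n ^ k))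
    where lem : ∀ a b c d → a * b * (c * d) ≡ a * c * (b * d)
          lem = solve-∀

  ^-injectiveˡ : ∀ k .{{_ : NonZero k}} {m n} → m ^ k ≡ n ^ k → m ≡ n
  ^-injectiveˡ k {m} {n} eq with <-cmp m n
  ... | tri< m<n _ _ = contradiction eq (<⇒≢ (^-monoˡ-< k m<n))
  ... | tri≈ _ m≡n _ = m≡n
  ... | tri> _ _ n<m = contradiction (sym eq) (<⇒≢ (^-monoˡ-< k n<m))

  coprime-* : ∀ {m n o} → Coprime m o → Coprime n o → Coprime (m * n) o
  coprime-* {m} {n} {o} c₁ c₂ {d} (d∣mn , d∣o) = c₂ (coprime-divisor d⊥m d∣mn , d∣o)
    where d⊥m : Coprime d m
          d⊥m (e∣d , e∣m) = c₁ (e∣m , ∣-trans e∣d d∣o)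

  coprime-^ˡ : ∀ {m o} k → Coprime m o → Coprime (m ^ k) o
  coprime-^ˡ zero    c (d∣1 , _) = ∣1⇒≡1 d∣1
  coprime-^ˡ (suc k) c = coprime-* c (coprime-^ˡ k c)

  coprime-^ : ∀ {m n} k l → Coprime m n → Coprime (m ^ k) (n ^ l)
  coprime-^ k l c = Cop.sym (coprime-^ˡ l (Cop.sym (coprime-^ˡ k c)))

  coprime-∣ : ∀ {m n m′ n′} → m′ ∣ m → n′ ∣ n → Coprime m n → Coprime m′ n′
  coprime-∣ m′∣m n′∣n c (d∣m′ , d∣n′) = c (∣-trans d∣m′ m′∣m , ∣-trans d∣n′ n′∣n)

  record Reduced (m n : ℕ) : Set where
    constructor reduced
    field
      d m′ n′  : ℕ
      m≡ : m ≡ m′ * d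
      n≡ : n ≡ n′ * d
      coprime : Coprime m′ n′

  reduce : ∀ m n → n ≢ 0 → Reduced m n
  reduce m n n≢0 with gcd[m,n]∣m m n | gcd[m,n]∣n m n
  ... | divides m′ m≡ | divides n′ n≡ = reduced g m′ n′ m≡ n≡ cop
    where
    g = gcd m n
    instance
      g≢0 : NonZero g
      g≢0 = ℕ.≢-nonZero (gcd[m,n]≢0 m n (inj₂ n≢0))
    cop : Coprime m′ n′
    cop {e} (divides a m′≡ , divides b n′≡) = ∣1⇒≡1 (*-cancelʳ-∣ g (subst (e * g ∣_) (sym (*-identityˡ g)) eg∣g))
      where
      eg∣g : e * g ∣ g
      eg∣g = gcd-greatest
        (divides a (trans m≡ (trans (cong (_* g) m′≡) (*-assoc a e g))))
        (divides b (trans n≡ (trans (cong (_* g) n′≡) (*-assoc b e g))))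

  -- After division by the gcd, `m′ ^ k` divides `n′ ^ k` and is coprime to it, hence is 1.
  ^-cancel-∣ : ∀ k .{{_ : NonZero k}} {m n} → m ≢ 0 → m ^ k ∣ n ^ k → m ∣ n
  ^-cancel-∣ k {m} {n} m≢0 mk∣nk with reduce n m m≢0
  ... | reduced d n′ m′ refl refl cop = subst (λ z → z * d ∣ n′ * d) (sym m′≡1) (*-monoʳ-∣′ d)
    where
    d^k≢0 : NonZero (d ^ k)
    d^k≢0 = m^n≢0 d k {{ℕ.≢-nonZero (λ { refl → m≢0 (*-zeroʳ m′) })}}
    step : m′ ^ k ∣ n′ ^ k
    step = *-cancelʳ-∣ (d ^ k) {{d^k≢0}} (subst₂ _∣_ (^-distribʳ-* m′ d k) (^-distribʳ-* n′ d k) mk∣nk)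
    m′^k≡1 : m′ ^ k ≡ 1 ^ k
    m′^k≡1 = trans (coprime-^ k k cop (step , ∣-refl)) (sym (^-zeroˡ k))
    m′≡1 : m′ ≡ 1
    m′≡1 = ^-injectiveˡ k m′^k≡1
    *-monoʳ-∣′ : ∀ d → 1 * d ∣ n′ * d
    *-monoʳ-∣′ d = divides n′ (cong (n′ *_) (sym (*-identityˡ d)))

  -- Euclid's algorithm on the exponents.
  common-root : ∀ p q X Y → Coprime p q → X ≢ 0 → Y ≢ 0 → X ^ p ≡ Y ^ q → ∃[ m ] (X ≡ m ^ q × Y ≡ m ^ p)
  common-root p q X Y = go (p + q) p q X Y ≤-refl
    where
    go : ∀ f p q X Y → p + q ≤ f → Coprime p q → X ≢ 0 → Y ≢ 0 → X ^ p ≡ Y ^ q → ∃[ m ] (X ≡ m ^ q × Y ≡ m ^ p)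
    go f zero q X Y _ c _ _ eq with Cop.0-coprimeTo-m⇒m≡1 c
    ... | refl = X , sym (*-identityʳ X) , trans (sym (*-identityʳ Y)) (sym eq)
    go f (suc p) zero X Y _ c _ _ eq with Cop.0-coprimeTo-m⇒m≡1 (Cop.sym c)
    ... | refl = Y , trans (sym (*-identityʳ X)) eq , sym (*-identityʳ Y)
    go (suc f) p@(suc _) q@(suc _) X Y (s≤s le) c X≢0 Y≢0 eq with ≤-total p q
    ... | inj₁ p≤q with ≤⇒∃+ p≤q
      where ≤⇒∃+ : ∀ {m n} → m ≤ n → ∃[ o ] n ≡ m + o
            ≤⇒∃+ {m} {n} m≤n = n ∸ m , sym (m+[n∸m]≡n m≤n)
    ...   | e , refl = m , trans X≡ (trans (cong₂ _*_ Z≡ Y≡) (trans (*-comm (m ^ e) (m ^ p)) (sym (^-distribˡ-+-* m p e)))) , Y≡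
      where
      -- With q = p + e, `Y ^ p` divides `X ^ p`. For X = Z·Y the equation becomes `Z ^ p ≡ Y ^ e`,
      -- and a common root of Z and Y serves X and Y as well.
      Y∣X : Y ∣ X
      Y∣X = ^-cancel-∣ p Y≢0 (divides (Y ^ e) (trans eq (trans (^-distribˡ-+-* Y p e) (*-comm (Y ^ p) (Y ^ e)))))
      Z = quotient Y∣X
      X≡ : X ≡ Z * Y
      X≡ = _∣_.equality Y∣X
      Z≢0 : Z ≢ 0
      Z≢0 z = X≢0 (trans X≡ (cong (_* Y) z))
      eq′ : Z ^ p ≡ Y ^ e
      eq′ = *-cancelʳ-≡ (Z ^ p) (Y ^ e) (Y ^ p) {{m^n≢0 Y p {{ℕ.≢-nonZero Y≢0}}}}
        (trans (sym (^-distribʳ-* Z Y p)) (trans (cong (_^ p) (sym X≡)) (trans eq (trans (^-distribˡ-+-* Y p e) (*-comm (Y ^ p) (Y ^ e))))))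
      c′ : Coprime p e
      c′ (d∣p , d∣e) = c (d∣p , ∣m∣n⇒∣m+n d∣p d∣e)
      rec = go f p e Z Y (≤-trans (m≤n+m (p + e) _) le) c′ Z≢0 Y≢0 eq′
      m = proj₁ rec
      Z≡ = proj₁ (proj₂ rec)
      Y≡ = proj₂ (proj₂ rec)
    go (suc f) p@(suc p₁) q@(suc _) X Y (s≤s le) c X≢0 Y≢0 eq | inj₂ q≤p with ≤⇒∃+ q≤p
      where ≤⇒∃+ : ∀ {m n} → m ≤ n → ∃[ o ] n ≡ m + o
            ≤⇒∃+ {m} {n} m≤n = n ∸ m , sym (m+[n∸m]≡n m≤n)
    ...   | e , p≡ = m , X≡m , trans Y≡ (trans (cong₂ _*_ Z≡ X≡m) (trans (*-comm (m ^ e) (m ^ q)) (trans (sym (^-distribˡ-+-* m q e)) (cong (m ^_) (sym p≡)))))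
      where
      eqp : Y ^ q ≡ X ^ e * X ^ q
      eqp = trans (sym eq) (trans (cong (X ^_) p≡) (trans (^-distribˡ-+-* X q e) (*-comm (X ^ q) (X ^ e))))
      X∣Y : X ∣ Y
      X∣Y = ^-cancel-∣ q X≢0 (divides (X ^ e) eqp)
      Z = quotient X∣Y
      Y≡ : Y ≡ Z * X
      Y≡ = _∣_.equality X∣Y
      Z≢0 : Z ≢ 0
      Z≢0 z = Y≢0 (trans Y≡ (cong (_* X) z))
      eq′ : X ^ e ≡ Z ^ q
      eq′ = sym (*-cancelʳ-≡ (Z ^ q) (X ^ e) (X ^ q) {{m^n≢0 X q {{ℕ.≢-nonZero X≢0}}}}
        (trans (sym (^-distribʳ-* Z X q)) (trans (cong (_^ q) (sym Y≡)) eqp)))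
      c′ : Coprime e q
      c′ {d} (d∣e , d∣q) = c (subst (d ∣_) (sym p≡) (∣m∣n⇒∣m+n d∣q d∣e) , d∣q)
      bound : e + q ≤ f
      bound = ≤-trans (+-monoˡ-≤ q (≤-pred (≤-trans (s≤s (m≤n+m e _)) (≤-reflexive (sym p≡))))) le
      rec = go f e q X Z bound c′ X≢0 Z≢0 eq′
      m = proj₁ rec
      X≡m = proj₁ (proj₂ rec)
      Z≡ = proj₂ (proj₂ rec)

  -- Since K is coprime to M, q = gK and 3p = gM. A common factor of g and p would divide q too, so
  -- g is coprime to p and divides 3.
  split-3 : ∀ {p q M K} → Coprime p q → Coprime M K → q ≢ 0 → K ≢ 0 → 3 * p * K ≡ q * M →
            (3 * p ≡ M × q ≡ K) ⊎ (p ≡ M × q ≡ 3 * K)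
  split-3 {p} {q} {M} {K} c cMK q≢0 K≢0 eq = cases g refl
    where
    K∣q : K ∣ q
    K∣q = coprime-divisor (Cop.sym cMK) (divides (3 * p) (trans (*-comm M q) (sym eq)))
    g = quotient K∣q
    q≡ : q ≡ g * K
    q≡ = _∣_.equality K∣q
    instance
      K-nonZero : NonZero K
      K-nonZero = ℕ.≢-nonZero K≢0
    3p≡ : 3 * p ≡ g * M
    3p≡ = *-cancelʳ-≡ (3 * p) (g * M) K (trans eq (trans (cong (_* M) q≡) (lem g K M)))
      where lem : ∀ a b c → a * b * c ≡ a * c * b
            lem = solve-∀
    g∣3 : g ∣ 3
    g∣3 = coprime-divisor {m = g} {n = p} {o = 3}
      (λ { (d∣g , d∣p) → c (d∣p , ∣-trans d∣g (divides K (trans q≡ (*-comm g K)))) })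
      (divides M (trans (*-comm p 3) (trans 3p≡ (*-comm g M))))
    cases : ∀ g′ → g ≡ g′ → (3 * p ≡ M × q ≡ K) ⊎ (p ≡ M × q ≡ 3 * K)
    cases 0 g≡ = contradiction (trans q≡ (cong (_* K) g≡)) q≢0
    cases 1 g≡ = inj₁ (trans 3p≡ (trans (cong (_* M) g≡) (*-identityˡ M)) , trans q≡ (trans (cong (_* K) g≡) (*-identityˡ K)))
    cases 2 g≡ = contradiction (subst (_∣ 3) g≡ g∣3) (λ { (divides (suc (suc zero)) ()) ; (divides (suc (suc (suc _))) ()) ; (divides 1 ()) ; (divides 0 ()) })
    cases 3 g≡ = inj₂ (*-cancelˡ-≡ p M 3 (trans 3p≡ (cong (_* M) g≡)) , trans q≡ (cong (_* K) g≡))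
    cases (suc (suc (suc (suc n)))) g≡ = contradiction (∣⇒≤ g∣3) (<⇒≱ (subst (3 <_) (sym g≡) (s≤s (s≤s (s≤s (s≤s z≤n))))))

  -- Descent by 2 − √3, the inverse of 2 + √3.
  pell : ∀ W V → V * V + 2 ≡ 3 * (W * W) → ∃[ n ] (V ≡ v n × W ≡ w n)
  pell = <-rec _ step
    where
    open ≤-Reasoning
    step : ∀ W → (∀ {W′} → W′ < W → ∀ V → V * V + 2 ≡ 3 * (W′ * W′) → ∃[ n ] (V ≡ v n × W′ ≡ w n)) →
           ∀ V → V * V + 2 ≡ 3 * (W * W) → ∃[ n ] (V ≡ v n × W ≡ w n)
    step zero rec V eq = contradiction eq (λ e → 1+n≢0 (trans (lem (V * V)) e))
      where lem : ∀ a → suc (suc a) ≡ a + 2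
            lem = solve-∀
    step 1 rec V eq = 0 , ^-injectiveˡ 2 (trans (cong (V *_) (*-identityʳ V)) (+-cancelʳ-≡ 2 (V * V) 1 eq)) , refl
    step W@(suc (suc W₀)) rec V eq = suc n , V≡v , W≡w
      where
      sq-cancel-< : ∀ {a b} → a * a < b * b → a < b
      sq-cancel-< {a} {b} lt = ≰⇒> (λ b≤a → <⇒≱ lt (*-mono-≤ b≤a b≤a))
      W<V : W < V
      W<V = sq-cancel-< (+-cancelʳ-< 2 (W * W) (V * V) (begin-strict
        W * W + 2 ≤⟨ +-monoʳ-≤ (W * W) (s≤s (s≤s z≤n)) ⟩
        W * W + W <⟨ +-monoʳ-< (W * W) (m<m*n W W (s≤s (s≤s z≤n))) ⟩
        W * W + W * W ≤⟨ m≤n+m _ (W * W) ⟩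
        W * W + (W * W + W * W) ≡⟨ lem (W * W) ⟩
        3 * (W * W) ≡⟨ sym eq ⟩
        V * V + 2 ∎))
        where lem : ∀ a → a + (a + a) ≡ 3 * a
              lem = solve-∀
      V<2W : V < 2 * W
      V<2W = sq-cancel-< (begin-strict
        V * V <⟨ m<m+n (V * V) (s≤s z≤n) ⟩
        V * V + 2 ≡⟨ eq ⟩
        3 * (W * W) ≤⟨ m≤n+m (3 * (W * W)) (W * W) ⟩
        W * W + 3 * (W * W) ≡⟨ lem W ⟩
        2 * W * (2 * W) ∎)
        where lem : ∀ a → a * a + 3 * (a * a) ≡ 2 * a * (2 * a)
              lem = solve-∀
      -- This uses W ≥ 2: then 9W² + 8 ≤ 12W² = 4V² + 8.
      3W≤2V : 3 * W ≤ 2 * V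
      3W≤2V = ≮⇒≥ (λ lt → <⇒≱ (*-mono-< lt lt) (+-cancelʳ-≤ 8 _ _ (begin
        3 * W * (3 * W) + 8 ≤⟨ +-monoʳ-≤ (3 * W * (3 * W)) (m≤m+n 8 (12 * W₀ + 4 + 3 * (W₀ * W₀))) ⟩
        3 * W * (3 * W) + (8 + (12 * W₀ + 4 + 3 * (W₀ * W₀))) ≡⟨ lem W₀ ⟩
        4 * (3 * (W * W)) ≡⟨ cong (4 *_) (sym eq) ⟩
        4 * (V * V + 2) ≡⟨ lem₂ V ⟩
        2 * V * (2 * V) + 8 ∎)))
        where lem : ∀ t → 3 * (2 + t) * (3 * (2 + t)) + (8 + (12 * t + 4 + 3 * (t * t))) ≡ 4 * (3 * ((2 + t) * (2 + t)))
              lem = solve-∀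
              lem₂ : ∀ a → 4 * (a * a + 2) ≡ 2 * a * (2 * a) + 8
              lem₂ = solve-∀
      -- `V<2W` and `3W≤2V` keep both differences from being truncated; `W<V` makes the descent
      -- strict.
      W′ = 2 * W ∸ V
      V′ = 2 * V ∸ 3 * W
      W′+V : W′ + V ≡ 2 * W
      W′+V = m∸n+n≡m (<⇒≤ V<2W)
      V′+3W : V′ + 3 * W ≡ 2 * V
      V′+3W = m∸n+n≡m 3W≤2V
      W≡ : W ≡ V′ + 2 * W′
      W≡ = +-cancelʳ-≡ (3 * W + 2 * V) W (V′ + 2 * W′) (trans (lem₁ W V) (trans (cong₂ (λ a b → a + 2 * b) (sym V′+3W) (sym W′+V)) (lem₂ V′ W V W′)))
        where lem₁ : ∀ W V → W + (3 * W + 2 * V) ≡ 2 * V + 2 * (2 * W)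
              lem₁ = solve-∀
              lem₂ : ∀ V′ W V W′ → V′ + 3 * W + 2 * (W′ + V) ≡ V′ + 2 * W′ + (3 * W + 2 * V)
              lem₂ = solve-∀
      V≡ : V ≡ 2 * V′ + 3 * W′
      V≡ = +-cancelʳ-≡ (6 * W + 3 * V) V (2 * V′ + 3 * W′) (trans (lem₁ W V) (trans (cong₂ (λ a b → 2 * a + 3 * b) (sym V′+3W) (sym W′+V)) (lem₂ V′ W V W′)))
        where lem₁ : ∀ W V → V + (6 * W + 3 * V) ≡ 2 * (2 * V) + 3 * (2 * W)
              lem₁ = solve-∀
              lem₂ : ∀ V′ W V W′ → 2 * (V′ + 3 * W) + 3 * (W′ + V) ≡ 2 * V′ + 3 * W′ + (6 * W + 3 * V)
              lem₂ = solve-∀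
      eq′ : V′ * V′ + 2 ≡ 3 * (W′ * W′)
      eq′ = +-cancelʳ-≡ _ (V′ * V′ + 2) (3 * (W′ * W′)) (trans (lem₁ V′ W′) (trans
          (subst₂ (λ a b → a * a + 2 ≡ 3 * (b * b)) V≡ W≡ eq) (lem₂ V′ W′)))
        where lem₁ : ∀ a b → a * a + 2 + (3 * (a * a) + 12 * (a * b) + 9 * (b * b)) ≡ (2 * a + 3 * b) * (2 * a + 3 * b) + 2
              lem₁ = solve-∀
              lem₂ : ∀ a b → 3 * ((a + 2 * b) * (a + 2 * b)) ≡ 3 * (b * b) + (3 * (a * a) + 12 * (a * b) + 9 * (b * b))
              lem₂ = solve-∀
      W′<W : W′ < W
      W′<W = +-cancelʳ-< V W′ W (begin-strict
        W′ + V ≡⟨ W′+V ⟩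
        2 * W ≡⟨ cong (W +_) (+-identityʳ W) ⟩
        W + W <⟨ +-monoʳ-< W W<V ⟩
        W + V ∎)
      r = rec W′<W V′ eq′
      n = proj₁ r
      V≡v : V ≡ v (suc n)
      V≡v = trans V≡ (cong₂ (λ a b → 2 * a + 3 * b) (proj₁ (proj₂ r)) (proj₂ (proj₂ r)))
      W≡w : W ≡ w (suc n)
      W≡w = trans W≡ (cong₂ (λ a b → a + 2 * b) (proj₁ (proj₂ r)) (proj₂ (proj₂ r)))

-- From the equation in ℚ to x = r^q and y = r^p

module Rationals where

  open import Defs
  open Arithmetic
  open import Data.Nat as ℕ using (ℕ; zero; suc; _+_; _*_; _^_; _∸_; NonZero)
  open import Data.Nat.Properties
  open import Data.Nat.Divisibility
  open import Data.Nat.Coprimality as Cop using (Coprime; coprime-divisor)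
  open import Data.Nat.Tactic.RingSolver using (solve-∀)
  open import Data.Integer as ℤ using (ℤ; +_; -[1+_])
  import Data.Integer.Properties as ℤ
  open import Data.Rational as ℚ using (ℚ; mkℚ; Positive; 0ℚ; 1ℚ; ↥_; ↧ₙ_; toℚᵘ)
  import Data.Rational.Properties as ℚ
  open import Data.Rational.Unnormalised as ℚᵘ using (mkℚᵘ; *≡*)
  import Data.Rational.Unnormalised.Properties as ℚᵘ
  open import Data.Product using (_×_; _,_; proj₁; proj₂)
  open import Data.Sum using (inj₁; inj₂)
  open import Relation.Nullary using (yes; no; contradiction)
  open import Relation.Binary.PropositionalEquality

  ℕtoℚ-* : ∀ m n → ℕtoℚ (m * n) ≡ ℕtoℚ m ℚ.* ℕtoℚ n
  ℕtoℚ-* m n = ℚ.toℚᵘ-injective (begin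
    toℚᵘ (ℕtoℚ (m * n))                   ≈⟨ ℚ.toℚᵘ-fromℚᵘ (mkℚᵘ (+ (m * n)) 0) ⟩
    mkℚᵘ (+ (m * n)) 0                    ≈⟨ *≡* (cong (ℤ._* + 1) (ℤ.pos-* m n)) ⟩
    mkℚᵘ (+ m) 0 ℚᵘ.* mkℚᵘ (+ n) 0        ≈⟨ ℚᵘ.*-cong (ℚ.toℚᵘ-fromℚᵘ (mkℚᵘ (+ m) 0)) (ℚ.toℚᵘ-fromℚᵘ (mkℚᵘ (+ n) 0)) ⟨
    toℚᵘ (ℕtoℚ m) ℚᵘ.* toℚᵘ (ℕtoℚ n)      ≈⟨ ℚ.toℚᵘ-homo-* (ℕtoℚ m) (ℕtoℚ n) ⟨
    toℚᵘ (ℕtoℚ m ℚ.* ℕtoℚ n)              ∎)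
    where open import Relation.Binary.Reasoning.Setoid ℚᵘ.≃-setoid

  ℤtoℚ-+ : ∀ m n → ℤtoℚ (m ℤ.+ n) ≡ ℤtoℚ m ℚ.+ ℤtoℚ n
  ℤtoℚ-+ m n = ℚ.toℚᵘ-injective (begin
    toℚᵘ (ℤtoℚ (m ℤ.+ n))                   ≈⟨ ℚ.toℚᵘ-fromℚᵘ (mkℚᵘ (m ℤ.+ n) 0) ⟩
    mkℚᵘ (m ℤ.+ n) 0                    ≈⟨ *≡* (cong (ℤ._* + 1) (sym (cong₂ ℤ._+_ (ℤ.*-identityʳ m) (ℤ.*-identityʳ n)))) ⟩
    mkℚᵘ m 0 ℚᵘ.+ mkℚᵘ n 0        ≈⟨ ℚᵘ.+-cong (ℚ.toℚᵘ-fromℚᵘ (mkℚᵘ m 0)) (ℚ.toℚᵘ-fromℚᵘ (mkℚᵘ n 0)) ⟨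
    toℚᵘ (ℤtoℚ m) ℚᵘ.+ toℚᵘ (ℤtoℚ n)      ≈⟨ ℚ.toℚᵘ-homo-+ (ℤtoℚ m) (ℤtoℚ n) ⟨
    toℚᵘ (ℤtoℚ m ℚ.+ ℤtoℚ n)              ∎)
    where open import Relation.Binary.Reasoning.Setoid ℚᵘ.≃-setoid

  ℤtoℚ-injective : ∀ {m n} → ℤtoℚ m ≡ ℤtoℚ n → m ≡ n
  ℤtoℚ-injective {m} {n} eq with ℚ./-injective-≃ (mkℚᵘ m 0) (mkℚᵘ n 0) eq
  ... | *≡* e = trans (sym (ℤ.*-identityʳ m)) (trans e (ℤ.*-identityʳ n))

  ℕtoℚ-injective : ∀ {m n} → ℕtoℚ m ≡ ℕtoℚ n → m ≡ n
  ℕtoℚ-injective eq = ℤ.+-injective (ℤtoℚ-injective eq)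

  *-cancelʳ-ℚ : ∀ r {p q} → r ≢ 0ℚ → p ℚ.* r ≡ q ℚ.* r → p ≡ q
  *-cancelʳ-ℚ r {p} {q} r≢0 eq = begin
    p                    ≡⟨ ℚ.*-identityʳ p ⟨
    p ℚ.* 1ℚ             ≡⟨ cong (p ℚ.*_) (ℚ.*-inverseʳ r) ⟨
    p ℚ.* (r ℚ.* ℚ.1/ r) ≡⟨ ℚ.*-assoc p r _ ⟨
    p ℚ.* r ℚ.* ℚ.1/ r   ≡⟨ cong (ℚ._* ℚ.1/ r) eq ⟩
    q ℚ.* r ℚ.* ℚ.1/ r   ≡⟨ ℚ.*-assoc q r _ ⟩
    q ℚ.* (r ℚ.* ℚ.1/ r) ≡⟨ cong (q ℚ.*_) (ℚ.*-inverseʳ r) ⟩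
    q ℚ.* 1ℚ             ≡⟨ ℚ.*-identityʳ q ⟩
    q                    ∎
    where open ≡-Reasoning
          instance _ = ℚ.≢-nonZero r≢0

  ℤtoℚ≢0 : ∀ {n} → n ≢ + 0 → ℤtoℚ n ≢ 0ℚ
  ℤtoℚ≢0 n≢0 eq = n≢0 (ℤtoℚ-injective eq)

  ℕtoℚ≢0 : ∀ {n} → n ≢ 0 → ℕtoℚ n ≢ 0ℚ
  ℕtoℚ≢0 n≢0 eq = n≢0 (ℕtoℚ-injective eq)

  inv-* : ∀ q → q ≢ 0ℚ → inv q ℚ.* q ≡ 1ℚ
  inv-* q q≢0 with q ℚ.≟ 0ℚ
  ... | yes q≡0 = contradiction q≡0 q≢0
  ... | no  q≢0′ = ℚ.*-inverseˡ q {{ℚ.≢-nonZero q≢0′}}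

  infix 4 _≈_/_
  -- A fraction in cross-multiplied and not necessarily reduced form, so that products and powers
  -- can be computed separately on numerators and denominators in ℕ.
  _≈_/_ : ℚ → ℕ → ℕ → Set
  q ≈ m / n = q ℚ.* ℕtoℚ n ≡ ℕtoℚ m

  interchange : ∀ a b c d → (a ℚ.* b) ℚ.* (c ℚ.* d) ≡ (a ℚ.* c) ℚ.* (b ℚ.* d)
  interchange a b c d = begin
    (a ℚ.* b) ℚ.* (c ℚ.* d) ≡⟨ ℚ.*-assoc a b _ ⟩
    a ℚ.* (b ℚ.* (c ℚ.* d)) ≡⟨ cong (a ℚ.*_) (ℚ.*-assoc b c d) ⟨
    a ℚ.* (b ℚ.* c ℚ.* d)   ≡⟨ cong (λ z → a ℚ.* (z ℚ.* d)) (ℚ.*-comm b c) ⟩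
    a ℚ.* (c ℚ.* b ℚ.* d)   ≡⟨ cong (a ℚ.*_) (ℚ.*-assoc c b d) ⟩
    a ℚ.* (c ℚ.* (b ℚ.* d)) ≡⟨ ℚ.*-assoc a c _ ⟨
    (a ℚ.* c) ℚ.* (b ℚ.* d) ∎
    where open ≡-Reasoning

  ≈-* : ∀ {q q′ m m′ n n′} → q ≈ m / n → q′ ≈ m′ / n′ → (q ℚ.* q′) ≈ (m * m′) / (n * n′)
  ≈-* {q} {q′} {m} {m′} {n} {n′} e e′ = begin
    (q ℚ.* q′) ℚ.* ℕtoℚ (n * n′)            ≡⟨ cong (q ℚ.* q′ ℚ.*_) (ℕtoℚ-* n n′) ⟩
    (q ℚ.* q′) ℚ.* (ℕtoℚ n ℚ.* ℕtoℚ n′)     ≡⟨ interchange q q′ _ _ ⟩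
    (q ℚ.* ℕtoℚ n) ℚ.* (q′ ℚ.* ℕtoℚ n′)     ≡⟨ cong₂ ℚ._*_ e e′ ⟩
    ℕtoℚ m ℚ.* ℕtoℚ m′                      ≡⟨ ℕtoℚ-* m m′ ⟨
    ℕtoℚ (m * m′)                           ∎
    where open ≡-Reasoning

  ≈-^ : ∀ {q m n} k → q ≈ m / n → (q ^ℕ k) ≈ (m ^ k) / (n ^ k)
  ≈-^ zero    e = refl
  ≈-^ {q} {m} {n} (suc k) e = ≈-* {q} {q ^ℕ k} {m} {m ^ k} {n} {n ^ k} e (≈-^ {q} {m} {n} k e)

  ≈-unique : ∀ {q q′ m n} → n ≢ 0 → q ≈ m / n → q′ ≈ m / n → q ≡ q′
  ≈-unique {n = n} n≢0 e e′ = *-cancelʳ-ℚ (ℕtoℚ n) (ℕtoℚ≢0 n≢0) (trans e (sym e′))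

  ≈-cross : ∀ {q m n m′ n′} → q ≈ m / n → q ≈ m′ / n′ → m * n′ ≡ m′ * n
  ≈-cross {q} {m} {n} {m′} {n′} e e′ = ℕtoℚ-injective (begin
    ℕtoℚ (m * n′)                    ≡⟨ ℕtoℚ-* m n′ ⟩
    ℕtoℚ m ℚ.* ℕtoℚ n′               ≡⟨ cong (ℚ._* ℕtoℚ n′) e ⟨
    q ℚ.* ℕtoℚ n ℚ.* ℕtoℚ n′         ≡⟨ ℚ.*-assoc q _ _ ⟩
    q ℚ.* (ℕtoℚ n ℚ.* ℕtoℚ n′)       ≡⟨ cong (q ℚ.*_) (ℚ.*-comm (ℕtoℚ n) _) ⟩
    q ℚ.* (ℕtoℚ n′ ℚ.* ℕtoℚ n)       ≡⟨ ℚ.*-assoc q _ _ ⟨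
    q ℚ.* ℕtoℚ n′ ℚ.* ℕtoℚ n         ≡⟨ cong (ℚ._* ℕtoℚ n) e′ ⟩
    ℕtoℚ m′ ℚ.* ℕtoℚ n               ≡⟨ ℕtoℚ-* m′ n ⟨
    ℕtoℚ (m′ * n)                    ∎)
    where open ≡-Reasoning

  ≈-rescale : ∀ {q m n m′ n′} → n ≢ 0 → q ≈ m / n → m * n′ ≡ m′ * n → q ≈ m′ / n′
  ≈-rescale {q} {m} {n} {m′} {n′} n≢0 e eq = *-cancelʳ-ℚ (ℕtoℚ n) (ℕtoℚ≢0 n≢0) (begin
    q ℚ.* ℕtoℚ n′ ℚ.* ℕtoℚ n         ≡⟨ ℚ.*-assoc q _ _ ⟩
    q ℚ.* (ℕtoℚ n′ ℚ.* ℕtoℚ n)       ≡⟨ cong (q ℚ.*_) (ℚ.*-comm (ℕtoℚ n′) _) ⟩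
    q ℚ.* (ℕtoℚ n ℚ.* ℕtoℚ n′)       ≡⟨ ℚ.*-assoc q _ _ ⟨
    q ℚ.* ℕtoℚ n ℚ.* ℕtoℚ n′         ≡⟨ cong (ℚ._* ℕtoℚ n′) e ⟩
    ℕtoℚ m ℚ.* ℕtoℚ n′               ≡⟨ ℕtoℚ-* m n′ ⟨
    ℕtoℚ (m * n′)                    ≡⟨ cong ℕtoℚ eq ⟩
    ℕtoℚ (m′ * n)                    ≡⟨ ℕtoℚ-* m′ n ⟩
    ℕtoℚ m′ ℚ.* ℕtoℚ n               ∎)
    where open ≡-Reasoning

  ℕtoℚ-≈ : ∀ m → ℕtoℚ m ≈ m / 1
  ℕtoℚ-≈ m = ℚ.*-identityʳ (ℕtoℚ m)

  inv-≈ : ∀ {q m n} → n ≢ 0 → m ≢ 0 → q ≈ m / n → inv q ≈ n / m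
  inv-≈ {q} {m} {n} n≢0 m≢0 e = begin
    inv q ℚ.* ℕtoℚ m            ≡⟨ cong (inv q ℚ.*_) e ⟨
    inv q ℚ.* (q ℚ.* ℕtoℚ n)    ≡⟨ ℚ.*-assoc (inv q) q _ ⟨
    inv q ℚ.* q ℚ.* ℕtoℚ n      ≡⟨ cong (ℚ._* ℕtoℚ n) (inv-* q q≢0) ⟩
    1ℚ ℚ.* ℕtoℚ n               ≡⟨ ℚ.*-identityˡ _ ⟩
    ℕtoℚ n                      ∎
    where open ≡-Reasoning
          q≢0 : q ≢ 0ℚ
          q≢0 refl = m≢0 (ℕtoℚ-injective (trans (sym e) (ℚ.*-zeroˡ (ℕtoℚ n))))

  quot-≈ : ∀ m n → n ≢ 0 → (ℕtoℚ m ℚ.* inv (ℕtoℚ n)) ≈ m / n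
  quot-≈ m n n≢0 = begin
    ℕtoℚ m ℚ.* inv (ℕtoℚ n) ℚ.* ℕtoℚ n    ≡⟨ ℚ.*-assoc (ℕtoℚ m) _ _ ⟩
    ℕtoℚ m ℚ.* (inv (ℕtoℚ n) ℚ.* ℕtoℚ n)  ≡⟨ cong (ℕtoℚ m ℚ.*_) (inv-* _ (ℕtoℚ≢0 n≢0)) ⟩
    ℕtoℚ m ℚ.* 1ℚ                         ≡⟨ ℚ.*-identityʳ _ ⟩
    ℕtoℚ m                                ∎
    where open ≡-Reasoning

  pos-≈ : ∀ q → Positive q → q ≈ ℤ.∣ ↥ q ∣ / ↧ₙ q
  pos-≈ q@(mkℚ ℤ.+[1+ n ] d-1 c) _ = ℚ.toℚᵘ-injective (begin
    toℚᵘ (q ℚ.* ℕtoℚ d)              ≈⟨ ℚ.toℚᵘ-homo-* q (ℕtoℚ d) ⟩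
    toℚᵘ q ℚᵘ.* toℚᵘ (ℕtoℚ d)        ≈⟨ ℚᵘ.*-cong (ℚᵘ.≃-refl {toℚᵘ q}) (ℚ.toℚᵘ-fromℚᵘ (mkℚᵘ (+ d) 0)) ⟩
    toℚᵘ q ℚᵘ.* mkℚᵘ (+ d) 0         ≈⟨ *≡* (cong (λ z → + z) lem) ⟩
    mkℚᵘ (+ suc n) 0                 ≈⟨ ℚ.toℚᵘ-fromℚᵘ (mkℚᵘ (+ suc n) 0) ⟨
    toℚᵘ (ℕtoℚ (suc n))              ∎)
    where open import Relation.Binary.Reasoning.Setoid ℚᵘ.≃-setoid
          d = suc d-1
          lem : suc n * d * 1 ≡ suc n * (d * 1)
          lem = *-assoc (suc n) d 1

  module BaseA where
    open ≡-Reasoning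

    base : ℤ → ℚ
    base n = ℕtoℚ 3 ℚ.+ ℕtoℚ 3 ℚ.* inv (ℤtoℚ n)

    base-≈-pos : ∀ q → q ≢ 0 → base (+ q) ≈ 3 * (q + 1) / q
    base-≈-pos q q≢0 = begin
      base (+ q) ℚ.* ℕtoℚ q
        ≡⟨ ℚ.*-distribʳ-+ (ℕtoℚ q) (ℕtoℚ 3) (ℕtoℚ 3 ℚ.* inv (ℤtoℚ (+ q))) ⟩
      ℕtoℚ 3 ℚ.* ℕtoℚ q ℚ.+ ℕtoℚ 3 ℚ.* inv (ℕtoℚ q) ℚ.* ℕtoℚ q
        ≡⟨ cong₂ ℚ._+_ (sym (ℕtoℚ-* 3 q)) (quot-≈ 3 q q≢0) ⟩
      ℕtoℚ (3 * q) ℚ.+ ℕtoℚ 3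
        ≡⟨ ℤtoℚ-+ (+ (3 * q)) (+ 3) ⟨
      ℕtoℚ (3 * q + 3)
        ≡⟨ cong ℕtoℚ (lem q) ⟩
      ℕtoℚ (3 * (q + 1)) ∎
      where lem : ∀ q → 3 * q + 3 ≡ 3 * (q + 1)
            lem = solve-∀

    base-≈-neg : ∀ p → base -[1+ p ] ≈ 3 * p / suc p
    base-≈-neg p = begin
      base -[1+ p ] ℚ.* c
        ≡⟨ ℚ.*-distribʳ-+ c (ℕtoℚ 3) (ℕtoℚ 3 ℚ.* i) ⟩
      ℕtoℚ 3 ℚ.* c ℚ.+ ℕtoℚ 3 ℚ.* i ℚ.* c
        ≡⟨ cong₂ ℚ._+_ (sym (ℕtoℚ-* 3 (suc p))) (trans (ℚ.*-assoc (ℕtoℚ 3) i c) (cong (ℕtoℚ 3 ℚ.*_) ic)) ⟩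
      ℕtoℚ (3 * suc p) ℚ.+ ℤtoℚ -[1+ 2 ]
        ≡⟨ ℤtoℚ-+ (+ (3 * suc p)) -[1+ 2 ] ⟨
      ℤtoℚ ((3 * suc p) ℤ.⊖ 3)
        ≡⟨ cong ℤtoℚ (trans (cong (ℤ._⊖ 3) (lem p)) (trans (cong (ℤ._⊖ 3) (+-comm (3 * p) 3)) (ℤ.⊖-≥ (m≤m+n 3 (3 * p))))) ⟩
      ℕtoℚ (3 + 3 * p ∸ 3)
        ≡⟨ cong ℕtoℚ (m+n∸m≡n 3 (3 * p)) ⟩
      ℕtoℚ (3 * p) ∎
      where
      c = ℕtoℚ (suc p)
      i = inv (ℤtoℚ -[1+ p ])
      lem : ∀ p → 3 * suc p ≡ 3 * p + 3
      lem = solve-∀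
      ic : i ℚ.* c ≡ ℚ.- 1ℚ
      ic = ℚ.neg-injective (trans (ℚ.neg-distribʳ-* i c) (inv-* (ℤtoℚ -[1+ p ]) (ℤtoℚ≢0 { -[1+ p ]} (λ ()))))

  v≢0 : ∀ n → v n ≢ 0
  v≢0 n eq = proj₁ (go n) eq
    where
    go : ∀ n → v n ≢ 0 × w n ≢ 0
    go zero = (λ ()) , (λ ())
    go (suc n) = (λ e → proj₁ (go n) (m+n≡0⇒m≡0 (v n) (m+n≡0⇒m≡0 (2 * v n) e))) , (λ e → proj₁ (go n) (m+n≡0⇒m≡0 (v n) e))

  -- The parametrisation x = r^q, y = r^p with r = m/n and p/q = y/(3x) in lowest terms.
  record Param (x y : ℚ) : Set where
    field
      p q m n : ℕ
      p≢0 : p ≢ 0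
      q≢0 : q ≢ 0
      m≢0 : m ≢ 0
      n≢0 : n ≢ 0
      p⊥q : Coprime p q
      m⊥n : Coprime m n
      x≈  : x ≈ m ^ q / n ^ q
      y≈  : y ≈ m ^ p / n ^ p
      rel : p * 3 * m ^ q * n ^ p ≡ q * m ^ p * n ^ q

  ∣-^ : ∀ m {k} → k ≢ 0 → m ∣ m ^ k
  ∣-^ m {zero} k≢0 = contradiction refl k≢0
  ∣-^ m {suc k} _ = m∣m*n (m ^ k)

  -- The X, Y and T are numerators and denominators of x, y and 3x. Cleared of denominators, the
  -- equation equates products of natural powers. The gcd g of the exponents cancels because g-th
  -- powers are injective on ℕ, and coprimality of numerators and denominators splits the result
  -- into `X₁ ^ p ≡ Y₁ ^ q` and `X₂ ^ p ≡ Y₂ ^ q`, each of which yields a common root.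
  param-core : ∀ {x y} X₁ X₂ Y₁ Y₂ T₁ T₂ → X₁ ≢ 0 → X₂ ≢ 0 → Y₁ ≢ 0 → Y₂ ≢ 0 → T₁ ≢ 0 → T₂ ≢ 0 →
    Coprime X₁ X₂ → Coprime Y₁ Y₂ → x ≈ X₁ / X₂ → y ≈ Y₁ / Y₂ → 3 * X₁ * T₂ ≡ T₁ * X₂ →
    x ^ℕ (Y₁ * T₂) ≡ y ^ℕ (T₁ * Y₂) → Param x y
  param-core {x} {y} X₁ X₂ Y₁ Y₂ T₁ T₂ X₁≢0 X₂≢0 Y₁≢0 Y₂≢0 T₁≢0 T₂≢0 X₁⊥X₂ Y₁⊥Y₂ xe ye t-cross eq
    = record { p = p ; q = q ; m = m ; n = n ; p≢0 = p≢0 ; q≢0 = q≢0 ; m≢0 = m≢0 ; n≢0 = n≢0 ; p⊥q = p⊥q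
             ; m⊥n = coprime-∣ (subst (m ∣_) (sym X₁≡) (∣-^ m q≢0)) (subst (n ∣_) (sym X₂≡) (∣-^ n q≢0)) X₁⊥X₂
             ; x≈ = subst₂ (x ≈_/_) X₁≡ X₂≡ xe
             ; y≈ = subst₂ (y ≈_/_) Y₁≡ Y₂≡ ye
             ; rel = rel }
    where
    p₀ = Y₁ * T₂
    q₀ = T₁ * Y₂
    q₀≢0 : q₀ ≢ 0
    q₀≢0 e with m*n≡0⇒m≡0∨n≡0 T₁ e
    ... | inj₁ z = T₁≢0 z
    ... | inj₂ z = Y₂≢0 z
    red = reduce p₀ q₀ q₀≢0
    open Reduced red renaming (d to g; m′ to p; n′ to q; m≡ to p₀≡; n≡ to q₀≡; coprime to p⊥q)
    q≢0 : q ≢ 0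
    q≢0 e = q₀≢0 (trans q₀≡ (cong (_* g) e))
    p≢0 : p ≢ 0
    p≢0 e with m*n≡0⇒m≡0∨n≡0 Y₁ (trans p₀≡ (cong (_* g) e))
    ... | inj₁ z = Y₁≢0 z
    ... | inj₂ z = T₂≢0 z
    g≢0 : g ≢ 0
    g≢0 e = q₀≢0 (trans q₀≡ (trans (cong (q *_) e) (*-zeroʳ q)))
    instance
      g-nonZero : NonZero g
      g-nonZero = ℕ.≢-nonZero g≢0
    powers : X₁ ^ p₀ * Y₂ ^ q₀ ≡ Y₁ ^ q₀ * X₂ ^ p₀
    powers = ≈-cross {x ^ℕ p₀} {X₁ ^ p₀} {X₂ ^ p₀} {Y₁ ^ q₀} {Y₂ ^ q₀} (≈-^ {x} {X₁} {X₂} p₀ xe)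
      (subst (_≈ Y₁ ^ q₀ / Y₂ ^ q₀) (sym eq) (≈-^ {y} {Y₁} {Y₂} q₀ ye))
    gth : ∀ A B → A ^ p₀ * B ^ q₀ ≡ (A ^ p * B ^ q) ^ g
    gth A B = trans (cong₂ _*_ (trans (cong (A ^_) p₀≡) (sym (^-*-assoc A p g))) (trans (cong (B ^_) q₀≡) (sym (^-*-assoc B q g))))
      (sym (^-distribʳ-* (A ^ p) (B ^ q) g))
    reducedPowers : X₁ ^ p * Y₂ ^ q ≡ X₂ ^ p * Y₁ ^ q
    reducedPowers = ^-injectiveˡ g (trans (sym (gth X₁ Y₂)) (trans powers (trans (*-comm (Y₁ ^ q₀) _) (gth X₂ Y₁))))
    eq₁ : X₁ ^ p ≡ Y₁ ^ q
    eq₁ = ∣-antisym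
      (coprime-divisor (coprime-^ p p X₁⊥X₂) (divides (Y₂ ^ q) (trans (sym reducedPowers) (*-comm (X₁ ^ p) _))))
      (coprime-divisor (coprime-^ q q Y₁⊥Y₂) (divides (X₂ ^ p) (trans (*-comm (Y₂ ^ q) _) reducedPowers)))
    eq₂ : X₂ ^ p ≡ Y₂ ^ q
    eq₂ = ∣-antisym
      (coprime-divisor (coprime-^ p p (Cop.sym X₁⊥X₂)) (divides (Y₁ ^ q) (trans reducedPowers (*-comm (X₂ ^ p) _))))
      (coprime-divisor (coprime-^ q q (Cop.sym Y₁⊥Y₂)) (divides (X₁ ^ p) (trans (*-comm (Y₁ ^ q) _) (sym reducedPowers))))
    root₁ = common-root p q X₁ Y₁ p⊥q X₁≢0 Y₁≢0 eq₁
    root₂ = common-root p q X₂ Y₂ p⊥q X₂≢0 Y₂≢0 eq₂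
    m = proj₁ root₁
    n = proj₁ root₂
    X₁≡ = proj₁ (proj₂ root₁)
    Y₁≡ = proj₂ (proj₂ root₁)
    X₂≡ = proj₁ (proj₂ root₂)
    Y₂≡ = proj₂ (proj₂ root₂)
    root≢0 : ∀ {A B} e → e ≢ 0 → A ≢ 0 → A ≡ B ^ e → B ≢ 0
    root≢0 zero e≢0 _ _ _ = e≢0 refl
    root≢0 (suc e) _ A≢0 A≡ refl = A≢0 A≡
    m≢0 = root≢0 q q≢0 X₁≢0 X₁≡
    n≢0 = root≢0 q q≢0 X₂≢0 X₂≡
    -- The equation p · 3x = q · y without denominators, from which r is eliminated later.
    rel₀ : (p * (3 * X₁) * Y₂) * g ≡ (q * Y₁ * X₂) * g
    rel₀ = begin
      (p * (3 * X₁) * Y₂) * g    ≡⟨ lem₁ p X₁ Y₂ g ⟩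
      (p * g) * (3 * X₁) * Y₂    ≡⟨ cong (λ z → z * (3 * X₁) * Y₂) (sym p₀≡) ⟩
      Y₁ * T₂ * (3 * X₁) * Y₂    ≡⟨ lem₂ Y₁ T₂ X₁ Y₂ ⟩
      (3 * X₁ * T₂) * (Y₁ * Y₂)  ≡⟨ cong (_* (Y₁ * Y₂)) t-cross ⟩
      T₁ * X₂ * (Y₁ * Y₂)  ≡⟨ lem₃ T₁ X₂ Y₁ Y₂ ⟩
      (T₁ * Y₂) * Y₁ * X₂        ≡⟨ cong (λ z → z * Y₁ * X₂) q₀≡ ⟩
      (q * g) * Y₁ * X₂          ≡⟨ lem₄ q g Y₁ X₂ ⟩
      (q * Y₁ * X₂) * g          ∎
      where
      open ≡-Reasoning
      lem₁ : ∀ p X Y g → (p * (3 * X) * Y) * g ≡ (p * g) * (3 * X) * Y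
      lem₁ = solve-∀
      lem₂ : ∀ Y T X Z → Y * T * (3 * X) * Z ≡ (3 * X * T) * (Y * Z)
      lem₂ = solve-∀
      lem₃ : ∀ T X Y Z → T * X * (Y * Z) ≡ (T * Z) * Y * X
      lem₃ = solve-∀
      lem₄ : ∀ q g Y X → (q * g) * Y * X ≡ (q * Y * X) * g
      lem₄ = solve-∀
    rel : p * 3 * m ^ q * n ^ p ≡ q * m ^ p * n ^ q
    rel = begin
      p * 3 * m ^ q * n ^ p     ≡⟨ cong₂ (λ a b → p * 3 * a * b) X₁≡ Y₂≡ ⟨
      p * 3 * X₁ * Y₂           ≡⟨ cong (_* Y₂) (*-assoc p 3 X₁) ⟩
      p * (3 * X₁) * Y₂         ≡⟨ *-cancelʳ-≡ _ _ g rel₀ ⟩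
      q * Y₁ * X₂               ≡⟨ cong₂ (λ a b → q * a * b) Y₁≡ X₂≡ ⟩
      q * m ^ p * n ^ q         ∎
      where open ≡-Reasoning

  param : ∀ x y → Positive x → Positive y → RealPowEq x y y (ℕtoℚ 3 ℚ.* x) → Param x y
  param x@(mkℚ ℤ.+[1+ x₁ ] x₂ cx) y@(mkℚ ℤ.+[1+ y₁ ] y₂ cy) px py eq
    = param-core (suc x₁) (suc x₂) (suc y₁) (suc y₂) T₁ T₂ 1+n≢0 1+n≢0 1+n≢0 1+n≢0 T₁≢0 1+n≢0
        (Cop.recompute cx) (Cop.recompute cy) (pos-≈ x px) (pos-≈ y py) t-cross eq
    where
    t = ℕtoℚ 3 ℚ.* x
    tpos : Positive t
    tpos = ℚ.pos*pos⇒pos (ℕtoℚ 3) x {{px}}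
    T₁ = ℤ.∣ ↥ t ∣
    T₂ = ↧ₙ t
    t-cross : 3 * suc x₁ * T₂ ≡ T₁ * suc x₂
    t-cross = ≈-cross {t} {3 * suc x₁} {suc x₂} {T₁} {T₂}
      (subst (t ≈ 3 * suc x₁ /_) (*-identityˡ (suc x₂)) (≈-* {ℕtoℚ 3} {x} {3} {suc x₁} {1} {suc x₂} (ℕtoℚ-≈ 3) (pos-≈ x px)))
      (pos-≈ t tpos)
    T₁≢0 : T₁ ≢ 0
    T₁≢0 e = contradiction (trans t-cross (cong (_* suc x₂) e)) λ ()

-- Reduction to two coprime numbers with a given difference

module ToThue where

  open import Defs
  open Arithmetic
  open Rationals
  open import Data.Nat as ℕ using (ℕ; zero; suc; _+_; _*_; _^_; _∸_; _≤_; _<_; z≤n; s≤s; NonZero)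
  open import Data.Nat.Properties
  open import Data.Nat.Divisibility
  open import Data.Nat.DivMod using (_%_; [m+kn]%n≡m%n; %-distribˡ-*; m%n<n)
  open import Data.Nat.Coprimality as Cop using (Coprime)
  open import Data.Nat.Tactic.RingSolver using (solve-∀)
  open import Data.Integer as ℤ using (ℤ; +_; -[1+_])
  open import Data.Rational as ℚ using (ℚ)
  import Data.Rational.Properties as ℚ
  open import Data.Product using (_×_; ∃-syntax; _,_)
  open import Data.Sum using (_⊎_; inj₁; inj₂)
  open import Relation.Nullary using (¬_; contradiction)
  open import Relation.Binary.Definitions using (tri<; tri≈; tri>)
  open import Relation.Binary.PropositionalEquality
  open BaseA

  private
    ring-1 : ∀ c → (c * 3) * (c * 3) ≡ 3 * (3 * (c * c))
    ring-1 = solve-∀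

    ring-2 : ∀ p a b c → 3 * p * a * (b * c) ≡ p * 3 * (b * a) * c
    ring-2 = solve-∀

    ring-3 : ∀ q a b c → q * a * (b * c) ≡ q * c * (a * b)
    ring-3 = solve-∀

    ring-4 : ∀ p a b → 3 * (p * (a * b)) ≡ p * 3 * a * b
    ring-4 = solve-∀

    ring-5 : ∀ p a b → p * a * b ≡ 1 * (p * (a * b))
    ring-5 = solve-∀

    ring-6 : ∀ p a b c → 3 * p * a * (b * c) ≡ p * 3 * b * (c * a)
    ring-6 = solve-∀

    ring-7 : ∀ q a b c → q * (a * b) * c ≡ q * b * (a * c)
    ring-7 = solve-∀


  sq : ∀ a → a ^ 2 ≡ a * a
  sq a = cong (a *_) (*-identityʳ a)

  square≢2mod3 : ∀ a b → a * a ≢ 2 + b * 3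
  square≢2mod3 a b eq = go (a % 3) (m%n<n a 3) (trans (sym (%-distribˡ-* a a 3)) (trans (cong (_% 3) eq) ([m+kn]%n≡m%n 2 b 3)))
    where
    go : ∀ r → r < 3 → (r * r) % 3 ≢ 2
    go 0 _ ()
    go 1 _ ()
    go 2 _ ()
    go (suc (suc (suc _))) (s≤s (s≤s (s≤s ())))

  prime3-∣-sq : ∀ a p → 3 * p ≡ a ^ 2 → ∃[ c ] (a ≡ 3 * c × p ≡ 3 * (c * c))
  prime3-∣-sq a p eq with euclidsLemma a a (toWitness {a? = prime? 3} _) (divides p (trans (sym (sq a)) (trans (sym eq) (*-comm 3 p))))
    where open import Data.Nat.Primality using (euclidsLemma; prime?)
          open import Relation.Nullary.Decidable using (toWitness)
  ... | inj₁ (divides c refl) = c , *-comm c 3 , *-cancelˡ-≡ p (3 * (c * c)) 3 (trans eq (lem c))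
    where lem : ∀ c → (c * 3) ^ 2 ≡ 3 * (3 * (c * c))
          lem c = trans (sq (c * 3)) (lem′ c)
            where lem′ = ring-1
  ... | inj₂ (divides c refl) = c , *-comm c 3 , *-cancelˡ-≡ p (3 * (c * c)) 3 (trans eq (lem c))
    where lem : ∀ c → (c * 3) ^ 2 ≡ 3 * (3 * (c * c))
          lem c = trans (sq (c * 3)) (lem′ c)
            where lem′ = ring-1

  -- The alternatives on the right are the two cases of `split-3`. In the first, a^k - 3b^k is ±3k;
  -- in the second it is ±k.
  ThueSol : ℕ → ℕ → ℕ → ℕ → ℕ → Set
  ThueSol k p q a b = (p ≡ q + k ⊎ q ≡ p + k) × ((3 * p ≡ a ^ k × q ≡ b ^ k) ⊎ (p ≡ a ^ k × q ≡ 3 * b ^ k))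

  Conclusion : ℚ → ℚ → Set
  Conclusion x y =
      (∃[ n ] (n ≢ + 0 × n ≢ -[1+ 0 ] ×
      x ≡ (ℕtoℚ 3 ℚ.+ ℕtoℚ 3 ℚ.* inv (ℤtoℚ n)) ^ℤ n ×
      y ≡ (ℕtoℚ 3 ℚ.+ ℕtoℚ 3 ℚ.* inv (ℤtoℚ n)) ^ℤ (+ 1 ℤ.+ n)))
      ⊎ (∃[ n ] (x ≡ (ℕtoℚ (3 ℕ.* w n) ℚ.* inv (ℕtoℚ (v n))) ^ℕ (v n ℕ.^ 2) ×
      y ≡ (ℕtoℚ (3 ℕ.* w n) ℚ.* inv (ℕtoℚ (v n))) ^ℕ (3 ℕ.* w n ℕ.^ 2)))
      ⊎ (∃[ n ] (x ≡ (ℕtoℚ (w n) ℚ.* inv (ℕtoℚ (v n))) ^ℕ (3 ℕ.* w n ℕ.^ 2) ×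
      y ≡ (ℕtoℚ (w n) ℚ.* inv (ℕtoℚ (v n))) ^ℕ (v n ℕ.^ 2)))

  record Concluded (x y : ℚ) : Set where
    constructor concluded
    field conclusion : Conclusion x y

  module _ (noThue : ∀ k p q a b → 3 ≤ k → Coprime p q → p ≢ 0 → q ≢ 0 → a ≢ 0 → b ≢ 0 → ¬ ThueSol k p q a b)
           {x y : ℚ} (P : Param x y) where
    open Param P

    power≢0 : ∀ e → n ^ e ≢ 0
    power≢0 e = ℕ.≢-nonZero⁻¹ _ {{m^n≢0 n e {{ℕ.≢-nonZero n≢0}}}}

    x≡ : ∀ {r e} → r ≈ m / n → q ≡ e → x ≡ r ^ℕ e
    x≡ {r} re refl = ≈-unique {x} {r ^ℕ q} {m ^ q} {n ^ q} (power≢0 q) x≈ (≈-^ {r} {m} {n} q re)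

    y≡ : ∀ {r e} → r ≈ m / n → p ≡ e → y ≡ r ^ℕ e
    y≡ {r} re refl = ≈-unique {y} {r ^ℕ p} {m ^ p} {n ^ p} (power≢0 p) y≈ (≈-^ {r} {m} {n} p re)

    conclude> : ∀ k → k ≢ 0 → p ≡ q + k → 3 * p * n ^ k ≡ q * m ^ k → Concluded x y
    conclude> zero k≢0 = contradiction refl k≢0
    -- Here r = 3(q + 1)/q = 3 + 3/q, which is family (a) with the positive index q.
    conclude> 1 _ p≡ rel′ = concluded (inj₁ (+ q , (λ e → q≢0 (ℤ-inj e)) , (λ ()) , x≡ {base (+ q)} re refl , y≡ {base (+ q)} re (trans p≡ (+-comm q 1))))
      where
      ℤ-inj : + q ≡ + 0 → q ≡ 0
      ℤ-inj refl = refl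
      re : base (+ q) ≈ m / n
      re = ≈-rescale {base (+ q)} {3 * (q + 1)} {q} {m} {n} q≢0 (base-≈-pos q q≢0)
        (begin 3 * (q + 1) * n     ≡⟨ cong (λ z → 3 * z * n) p≡ ⟨
               3 * p * n           ≡⟨ cong (3 * p *_) (*-identityʳ n) ⟨
               3 * p * n ^ 1       ≡⟨ rel′ ⟩
               q * m ^ 1           ≡⟨ cong (q *_) (*-identityʳ m) ⟩
               q * m               ≡⟨ *-comm q m ⟩
               m * q               ∎)
        where open ≡-Reasoning
    -- From 3p = m² follow m = 3c and p = 3c², so n² + 2 = 3c²: family (b).
    conclude> 2 _ p≡ rel′ with split-3 p⊥q (coprime-^ 2 2 m⊥n) q≢0 (power≢0 2) rel′
    ... | inj₁ (3p≡ , q≡) with prime3-∣-sq m p 3p≡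
    ...   | c , m≡ , p≡′ with pell c n (trans (cong (_+ 2) (trans (sym (sq n)) (sym q≡))) (trans (sym p≡) p≡′))
    ...     | i , n≡v , c≡w = concluded (inj₂ (inj₁ (i , x≡ {r} re (trans q≡ (cong (_^ 2) n≡v)) , y≡ {r} re (trans p≡′ (cong (3 *_) (trans (sym (sq c)) (cong (_^ 2) c≡w)))))))
      where
      r = ℕtoℚ (3 * w i) ℚ.* inv (ℕtoℚ (v i))
      re : r ≈ m / n
      re = subst₂ (r ≈_/_) (trans (cong (3 *_) (sym c≡w)) (sym m≡)) (sym n≡v) (quot-≈ (3 * w i) (v i) (v≢0 i))
    -- Here m² = 3n² + 2, and 2 is not a square modulo 3.
    conclude> 2 _ p≡ rel′ | inj₂ (p≡′ , q≡) = contradiction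
      (trans (sym (sq m)) (trans (sym p≡′) (trans p≡ (trans (+-comm q 2) (cong (λ z → suc (suc z)) (trans q≡ (*-comm 3 (n ^ 2))))))))
      (square≢2mod3 m (n ^ 2))
    conclude> k@(suc (suc (suc _))) _ p≡ rel′ =
      contradiction (inj₁ p≡ , split-3 p⊥q (coprime-^ k k m⊥n) q≢0 (power≢0 k) rel′)
        (noThue k p q m n (s≤s (s≤s (s≤s z≤n))) p⊥q p≢0 q≢0 m≢0 n≢0)

    power′≢0 : ∀ e → m ^ e ≢ 0
    power′≢0 e = ℕ.≢-nonZero⁻¹ _ {{m^n≢0 m e {{ℕ.≢-nonZero m≢0}}}}

    conclude< : ∀ k → k ≢ 0 → q ≡ p + k → 3 * p * m ^ k ≡ q * n ^ k → Concluded x y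
    conclude< zero k≢0 = contradiction refl k≢0
    -- The index is now -(p + 1): the base 3 - 3/(p + 1) = 3p/(p + 1) is 1/r, and its negative
    -- powers are the required powers of r.
    conclude< 1 _ q≡ rel′ = concluded (inj₁ (-[1+ p ] , (λ ()) , (λ { refl → p≢0 refl }) ,
        x≡ {inv (base -[1+ p ])} re (trans q≡ (+-comm p 1)) , y-case p refl))
      where
      be : base -[1+ p ] ≈ n / m
      be = ≈-rescale {base -[1+ p ]} {3 * p} {suc p} {n} {m} 1+n≢0 (base-≈-neg p)
        (begin 3 * p * m           ≡⟨ cong (3 * p *_) (*-identityʳ m) ⟨
               3 * p * m ^ 1       ≡⟨ rel′ ⟩
               q * n ^ 1           ≡⟨ cong (q *_) (*-identityʳ n) ⟩
               q * n               ≡⟨ *-comm q n ⟩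
               n * q               ≡⟨ cong (n *_) (trans q≡ (+-comm p 1)) ⟩
               n * suc p           ∎)
        where open ≡-Reasoning
      re : inv (base -[1+ p ]) ≈ m / n
      re = inv-≈ {base -[1+ p ]} {n} {m} m≢0 n≢0 be
      y-case : ∀ p′ → p ≡ p′ → y ≡ base -[1+ p ] ^ℤ (+ 1 ℤ.+ -[1+ p′ ])
      y-case zero p≡0 = contradiction p≡0 p≢0
      y-case (suc p′) p≡ = y≡ {inv (base -[1+ p ])} re p≡
    conclude< 2 _ q≡ rel′ with split-3 p⊥q (coprime-^ 2 2 (Cop.sym m⊥n)) q≢0 (power′≢0 2) rel′
    ... | inj₁ (3p≡ , q≡′) with prime3-∣-sq n p 3p≡
    ...   | c , n≡ , p≡ = contradiction
      (trans (sym (sq m)) (trans (sym q≡′) (trans q≡ (trans (+-comm p 2) (cong (λ z → suc (suc z)) (trans p≡ (*-comm 3 (c * c))))))))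
      (square≢2mod3 m (c * c))
    -- Now n² + 2 = 3m², the same Pell equation with the roles of m and n changed: family (c).
    conclude< 2 _ q≡ rel′ | inj₂ (p≡ , q≡′) with pell m n (trans (cong (_+ 2) (trans (sym (sq n)) (sym p≡))) (trans (sym q≡) (trans q≡′ (cong (3 *_) (sq m)))))
    ... | i , n≡v , m≡w = concluded (inj₂ (inj₂ (i , x≡ {r} re (trans q≡′ (cong (λ z → 3 * z ^ 2) m≡w)) , y≡ {r} re (trans p≡ (cong (_^ 2) n≡v)))))
      where
      r = ℕtoℚ (w i) ℚ.* inv (ℕtoℚ (v i))
      re : r ≈ m / n
      re = subst₂ (r ≈_/_) (sym m≡w) (sym n≡v) (quot-≈ (w i) (v i) (v≢0 i))
    conclude< k@(suc (suc (suc _))) _ q≡ rel′ =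
      contradiction (inj₂ q≡ , split-3 p⊥q (coprime-^ k k (Cop.sym m⊥n)) q≢0 (power′≢0 k) rel′)
        (noThue k p q n m (s≤s (s≤s (s≤s z≤n))) p⊥q p≢0 q≢0 n≢0 m≢0)

    conclude : Concluded x y
    conclude with <-cmp p q
    ... | tri< p<q _ _ = conclude< (q ∸ p) (m>n⇒m∸n≢0 p<q) q≡ (*-cancelʳ-≡ _ _ (m ^ p * n ^ p) {{mn-nonZero}}
        (begin 3 * p * m ^ k * (m ^ p * n ^ p)    ≡⟨ lem₁ p (m ^ k) (m ^ p) (n ^ p) ⟩
               p * 3 * (m ^ p * m ^ k) * n ^ p    ≡⟨ cong (λ z → p * 3 * z * n ^ p) (trans (sym (^-distribˡ-+-* m p k)) (cong (m ^_) (sym q≡))) ⟩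
               p * 3 * m ^ q * n ^ p              ≡⟨ rel ⟩
               q * m ^ p * n ^ q                  ≡⟨ cong (q * m ^ p *_) (trans (cong (n ^_) q≡) (^-distribˡ-+-* n p k)) ⟩
               q * m ^ p * (n ^ p * n ^ k)        ≡⟨ lem₂ q (m ^ p) (n ^ p) (n ^ k) ⟩
               q * n ^ k * (m ^ p * n ^ p)        ∎))
      where
      open ≡-Reasoning
      k = q ∸ p
      q≡ : q ≡ p + k
      q≡ = sym (m+[n∸m]≡n (<⇒≤ p<q))
      mn-nonZero : NonZero (m ^ p * n ^ p)
      mn-nonZero = m*n≢0 _ _ {{ℕ.≢-nonZero (power′≢0 p)}} {{ℕ.≢-nonZero (power≢0 p)}}
      lem₁ = ring-2
      lem₂ = ring-3
    -- For p = q everything cancels from `rel` except 3 = 1.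
    ... | tri≈ _ p≡q _ = contradiction (*-cancelʳ-≡ 3 1 (p * (m ^ p * n ^ p)) {{nz}} (trans (lem₁ p (m ^ p) (n ^ p)) (trans (subst (λ z → p * 3 * m ^ z * n ^ p ≡ z * m ^ p * n ^ z) (sym p≡q) rel) (lem₂ p (m ^ p) (n ^ p))))) λ ()
      where
      nz : NonZero (p * (m ^ p * n ^ p))
      nz = m*n≢0 _ _ {{ℕ.≢-nonZero p≢0}} {{m*n≢0 _ _ {{ℕ.≢-nonZero (power′≢0 p)}} {{ℕ.≢-nonZero (power≢0 p)}}}}
      lem₁ = ring-4
      lem₂ = ring-5
    ... | tri> _ _ q<p = conclude> (p ∸ q) (m>n⇒m∸n≢0 q<p) p≡ (*-cancelʳ-≡ _ _ (m ^ q * n ^ q) {{mn-nonZero}}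
        (begin 3 * p * n ^ k * (m ^ q * n ^ q)    ≡⟨ lem₁ p (n ^ k) (m ^ q) (n ^ q) ⟩
               p * 3 * m ^ q * (n ^ q * n ^ k)    ≡⟨ cong (p * 3 * m ^ q *_) (trans (sym (^-distribˡ-+-* n q k)) (cong (n ^_) (sym p≡))) ⟩
               p * 3 * m ^ q * n ^ p              ≡⟨ rel ⟩
               q * m ^ p * n ^ q                  ≡⟨ cong (λ z → q * z * n ^ q) (trans (cong (m ^_) p≡) (^-distribˡ-+-* m q k)) ⟩
               q * (m ^ q * m ^ k) * n ^ q        ≡⟨ lem₂ q (m ^ q) (m ^ k) (n ^ q) ⟩
               q * m ^ k * (m ^ q * n ^ q)        ∎))
      where
      open ≡-Reasoning
      k = p ∸ q
      p≡ : p ≡ q + k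
      p≡ = sym (m+[n∸m]≡n (<⇒≤ q<p))
      mn-nonZero : NonZero (m ^ q * n ^ q)
      mn-nonZero = m*n≢0 _ _ {{ℕ.≢-nonZero (power′≢0 q)}} {{ℕ.≢-nonZero (power≢0 q)}}
      lem₁ = ring-6
      lem₂ = ring-7

-- Finite sums, binomial coefficients and the Newton expansion

module Sums where

  open import Data.Nat as ℕ using (ℕ; zero; suc; _≤_; _<_; z≤n; s≤s)
  import Data.Nat.Properties as ℕ
  open import Data.Integer as ℤ using (ℤ; +_; 0ℤ; 1ℤ; ∣_∣; _+_; _*_; -_; _-_; _^_)
  import Data.Integer.Properties as ℤ
  open import Data.Integer.Tactic.RingSolver using (solve-∀)
  import Data.Nat.Tactic.RingSolver as ℕS
  open import Relation.Binary.PropositionalEquality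

  ∑ : ℕ → (ℕ → ℤ) → ℤ
  ∑ zero    f = 0ℤ
  ∑ (suc n) f = ∑ n f + f n

  ∑-cong : ∀ n {f g} → (∀ i → i < n → f i ≡ g i) → ∑ n f ≡ ∑ n g
  ∑-cong zero    eq = refl
  ∑-cong (suc n) eq = cong₂ _+_ (∑-cong n (λ i i<n → eq i (ℕ.m<n⇒m<1+n i<n))) (eq n ℕ.≤-refl)

  ∑-zero : ∀ n → ∑ n (λ _ → 0ℤ) ≡ 0ℤ
  ∑-zero zero    = refl
  ∑-zero (suc n) = cong (_+ 0ℤ) (∑-zero n)

  ∑-+ : ∀ n f g → ∑ n (λ i → f i + g i) ≡ ∑ n f + ∑ n g
  ∑-+ zero    f g = refl
  ∑-+ (suc n) f g = trans (cong (_+ (f n + g n)) (∑-+ n f g)) (lem (∑ n f) (∑ n g) (f n) (g n))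
    where lem : ∀ a b c d → (a + b) + (c + d) ≡ (a + c) + (b + d)
          lem = solve-∀

  ∑-*ˡ : ∀ n c f → ∑ n (λ i → c * f i) ≡ c * ∑ n f
  ∑-*ˡ zero    c f = sym (ℤ.*-zeroʳ c)
  ∑-*ˡ (suc n) c f = trans (cong (_+ c * f n) (∑-*ˡ n c f)) (sym (ℤ.*-distribˡ-+ c (∑ n f) (f n)))

  ∑-*ʳ : ∀ n c f → ∑ n (λ i → f i * c) ≡ ∑ n f * c
  ∑-*ʳ n c f = trans (∑-cong n (λ i _ → ℤ.*-comm (f i) c)) (trans (∑-*ˡ n c f) (ℤ.*-comm c (∑ n f)))

  ∑-neg : ∀ n f → ∑ n (λ i → - f i) ≡ - ∑ n f
  ∑-neg zero    f = refl
  ∑-neg (suc n) f = trans (cong (_+ - f n) (∑-neg n f)) (sym (ℤ.neg-distrib-+ (∑ n f) (f n)))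

  ∑-- : ∀ n f g → ∑ n (λ i → f i - g i) ≡ ∑ n f - ∑ n g
  ∑-- n f g = trans (∑-+ n f (λ i → - g i)) (cong (_+_ (∑ n f)) (∑-neg n g))

  ∑-swap : ∀ m n (f : ℕ → ℕ → ℤ) → ∑ m (λ i → ∑ n (f i)) ≡ ∑ n (λ j → ∑ m (λ i → f i j))
  ∑-swap zero    n f = sym (∑-zero n)
  ∑-swap (suc m) n f = trans (cong (_+ ∑ n (f m)) (∑-swap m n f)) (sym (∑-+ n (λ j → ∑ m (λ i → f i j)) (f m)))

  ∑-suc : ∀ n f → ∑ (suc n) f ≡ f 0 + ∑ n (λ i → f (suc i))
  ∑-suc zero    f = ℤ.+-comm 0ℤ (f 0)
  ∑-suc (suc n) f = trans (cong (_+ f (suc n)) (∑-suc n f)) (ℤ.+-assoc (f 0) _ _)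

  -- The weight c stands for a denominator: every estimate |f| ≤ B/c of the auxiliary function is
  -- stated in this integral form.
  ∣∑∣≤ : ∀ n {f} {c B : ℕ} → (∀ i → i < n → ∣ f i ∣ ℕ.* c ≤ B) → ∣ ∑ n f ∣ ℕ.* c ≤ n ℕ.* B
  ∣∑∣≤ zero    bd = z≤n
  ∣∑∣≤ (suc n) {f} {c} {B} bd = begin
    ∣ ∑ n f + f n ∣ ℕ.* c                  ≤⟨ ℕ.*-monoˡ-≤ c (ℤ.∣i+j∣≤∣i∣+∣j∣ (∑ n f) (f n)) ⟩
    (∣ ∑ n f ∣ ℕ.+ ∣ f n ∣) ℕ.* c          ≡⟨ ℕ.*-distribʳ-+ c ∣ ∑ n f ∣ ∣ f n ∣ ⟩
    ∣ ∑ n f ∣ ℕ.* c ℕ.+ ∣ f n ∣ ℕ.* c      ≤⟨ ℕ.+-mono-≤ (∣∑∣≤ n (λ i i<n → bd i (ℕ.m<n⇒m<1+n i<n))) (bd n ℕ.≤-refl) ⟩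
    n ℕ.* B ℕ.+ B                          ≡⟨ ℕ.+-comm (n ℕ.* B) B ⟩
    suc n ℕ.* B                            ∎
    where open ℕ.≤-Reasoning

  -- P x m j is the coefficient of z^j in (x + z)^m.
  P : ℤ → ℕ → ℕ → ℤ
  P x zero    zero    = 1ℤ
  P x zero    (suc j) = 0ℤ
  P x (suc m) zero    = x * P x m zero
  P x (suc m) (suc j) = x * P x m (suc j) + P x m j

  P-vanish : ∀ x m j → m < j → P x m j ≡ 0ℤ
  P-vanish x zero    (suc j) _         = refl
  P-vanish x (suc m) (suc j) (s≤s m<j) =
    trans (cong₂ (λ a b → x * a + b) (P-vanish x m (suc j) (ℕ.m<n⇒m<1+n m<j)) (P-vanish x m j m<j)) (lem x)
    where lem : ∀ x → x * 0ℤ + 0ℤ ≡ 0ℤ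
          lem = solve-∀

  -- (x + (y + z))^u = Σ_m (coefficient of w^m in (y + w)^u) (x + z)^m.
  P-compose : ∀ x y u j → P (x + y) u j ≡ ∑ (suc u) (λ m → P y u m * P x m j)
  P-compose x y zero zero    = refl
  P-compose x y zero (suc j) = refl
  P-compose x y (suc u) j = sym (begin
    ∑ (suc (suc u)) (λ m → P y (suc u) m * P x m j)
      ≡⟨ ∑-suc (suc u) _ ⟩
    y * P y u 0 * P x 0 j + ∑ (suc u) (λ m → (y * P y u (suc m) + P y u m) * P x (suc m) j)
      ≡⟨ cong (_+_ (y * P y u 0 * P x 0 j)) (trans (∑-cong (suc u) (λ m _ → lem₁ y (P y u (suc m)) (P y u m) (P x (suc m) j))) (∑-+ (suc u) _ _)) ⟩
    y * P y u 0 * P x 0 j + (∑ (suc u) (λ m → y * (P y u (suc m) * P x (suc m) j)) + ∑ (suc u) (λ m → P y u m * P x (suc m) j))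
      ≡⟨ lem₂ y (P y u 0) (P x 0 j) _ _ _ (∑-*ˡ (suc u) y _) ⟩
    y * (P y u 0 * P x 0 j + ∑ (suc u) (λ m → P y u (suc m) * P x (suc m) j)) + ∑ (suc u) (λ m → P y u m * P x (suc m) j)
      ≡⟨ cong (λ z → y * z + ∑ (suc u) (λ m → P y u m * P x (suc m) j)) (trans (sym (∑-suc (suc u) (λ m → P y u m * P x m j))) top) ⟩
    y * ∑ (suc u) (λ m → P y u m * P x m j) + ∑ (suc u) (λ m → P y u m * P x (suc m) j)
      ≡⟨ second j ⟩
    P (x + y) (suc u) j ∎)
    where
    open ≡-Reasoning
    lem₁ : ∀ y a b c → (y * a + b) * c ≡ y * (a * c) + b * c
    lem₁ = solve-∀
    lem₂ : ∀ y a b s t t′ → s ≡ y * t → y * a * b + (s + t′) ≡ y * (a * b + t) + t′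
    lem₂ y a b s t t′ refl = lem y a b t t′
      where lem : ∀ y a b t t′ → y * a * b + (y * t + t′) ≡ y * (a * b + t) + t′
            lem = solve-∀
    top : ∑ (suc (suc u)) (λ m → P y u m * P x m j) ≡ ∑ (suc u) (λ m → P y u m * P x m j)
    top = trans (cong (λ z → ∑ (suc u) (λ m → P y u m * P x m j) + z * P x (suc u) j) (P-vanish y u (suc u) ℕ.≤-refl)) (lem _ (P x (suc u) j))
      where lem : ∀ a b → a + 0ℤ * b ≡ a
            lem = solve-∀
    second : ∀ j → y * ∑ (suc u) (λ m → P y u m * P x m j) + ∑ (suc u) (λ m → P y u m * P x (suc m) j) ≡ P (x + y) (suc u) j
    second zero = begin
      y * S + ∑ (suc u) (λ m → P y u m * (x * P x m 0))
        ≡⟨ cong (_+_ (y * S)) (trans (∑-cong (suc u) (λ m _ → lem (P y u m) x (P x m 0))) (∑-*ˡ (suc u) x _)) ⟩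
      y * S + x * S ≡⟨ lem′ x y S ⟩
      (x + y) * S ≡⟨ cong ((x + y) *_) (P-compose x y u 0) ⟨
      (x + y) * P (x + y) u 0 ∎
      where
      S = ∑ (suc u) (λ m → P y u m * P x m 0)
      lem : ∀ a b c → a * (b * c) ≡ b * (a * c)
      lem = solve-∀
      lem′ : ∀ x y s → y * s + x * s ≡ (x + y) * s
      lem′ = solve-∀
    second (suc j) = begin
      y * S + ∑ (suc u) (λ m → P y u m * (x * P x m (suc j) + P x m j))
        ≡⟨ cong (_+_ (y * S)) (trans (∑-cong (suc u) (λ m _ → lem (P y u m) x (P x m (suc j)) (P x m j))) (trans (∑-+ (suc u) _ _) (cong (_+ S′) (∑-*ˡ (suc u) x _)))) ⟩
      y * S + (x * S + S′) ≡⟨ lem′ x y S S′ ⟩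
      (x + y) * S + S′ ≡⟨ cong₂ (λ a b → (x + y) * a + b) (P-compose x y u (suc j)) (P-compose x y u j) ⟨
      (x + y) * P (x + y) u (suc j) + P (x + y) u j ∎
      where
      S = ∑ (suc u) (λ m → P y u m * P x m (suc j))
      S′ = ∑ (suc u) (λ m → P y u m * P x m j)
      lem : ∀ a b c d → a * (b * c + d) ≡ b * (a * c) + a * d
      lem = solve-∀
      lem′ : ∀ x y s s′ → y * s + (x * s + s′) ≡ (x + y) * s + s′
      lem′ = solve-∀

  C : ℕ → ℕ → ℕ
  C zero    zero    = 1
  C zero    (suc j) = 0
  C (suc m) zero    = C m zero
  C (suc m) (suc j) = C m (suc j) ℕ.+ C m j

  -- `P x m j` is C(m, j) x^(m-j); the factor x^j removes the subtraction in the exponent and covers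
  -- the case m < j.
  P-homogeneous : ∀ x m j → P x m j * x ^ j ≡ + C m j * x ^ m
  P-homogeneous x zero    zero    = refl
  P-homogeneous x zero    (suc j) = refl
  P-homogeneous x (suc m) zero    = trans (ℤ.*-assoc x (P x m 0) 1ℤ) (trans (cong (x *_) (P-homogeneous x m 0)) (lem x (+ C m 0) (x ^ m)))
    where lem : ∀ x a b → x * (a * b) ≡ a * (x * b)
          lem = solve-∀
  P-homogeneous x (suc m) (suc j) = begin
    (x * P x m (suc j) + P x m j) * (x * x ^ j)
      ≡⟨ lem x (P x m (suc j)) (P x m j) (x ^ j) ⟩
    x * (P x m (suc j) * (x * x ^ j)) + x * (P x m j * x ^ j)
      ≡⟨ cong₂ (λ a b → x * a + x * b) (P-homogeneous x m (suc j)) (P-homogeneous x m j) ⟩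
    x * (+ C m (suc j) * x ^ m) + x * (+ C m j * x ^ m)
      ≡⟨ lem′ x (+ C m (suc j)) (+ C m j) (x ^ m) ⟩
    + (C m (suc j) ℕ.+ C m j) * (x * x ^ m) ∎
    where
    open ≡-Reasoning
    lem : ∀ x a b c → (x * a + b) * (x * c) ≡ x * (a * (x * c)) + x * (b * c)
    lem = solve-∀
    lem′ : ∀ x a b c → x * (a * c) + x * (b * c) ≡ (a + b) * (x * c)
    lem′ = solve-∀

  C-vanish : ∀ m j → m < j → C m j ≡ 0
  C-vanish zero    (suc j) _         = refl
  C-vanish (suc m) (suc j) (s≤s m<j) = cong₂ ℕ._+_ (C-vanish m (suc j) (ℕ.m<n⇒m<1+n m<j)) (C-vanish m j m<j)

  P-explicit : ∀ x j l → P x (j ℕ.+ l) j ≡ + C (j ℕ.+ l) j * x ^ l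
  P-explicit x zero    zero    = refl
  P-explicit x zero    (suc l) = trans (cong (x *_) (P-explicit x zero l)) (lem x (+ C l 0) (x ^ l))
    where lem : ∀ x a b → x * (a * b) ≡ a * (x * b)
          lem = solve-∀
  P-explicit x (suc j) zero    = trans (cong₂ (λ a b → x * a + b) (P-vanish x (j ℕ.+ 0) (suc j) (s≤s (ℕ.≤-reflexive (ℕ.+-identityʳ j)))) (P-explicit x j zero))
    (trans (lem x (+ C (j ℕ.+ 0) j)) (cong (λ z → + (z ℕ.+ C (j ℕ.+ 0) j) * 1ℤ) (sym (C-vanish (j ℕ.+ 0) (suc j) (s≤s (ℕ.≤-reflexive (ℕ.+-identityʳ j)))))))
    where lem : ∀ x a → x * 0ℤ + a * 1ℤ ≡ a * 1ℤ
          lem = solve-∀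
  P-explicit x (suc j) (suc l) = trans (cong₂ (λ a b → x * a + b) first (P-explicit x j (suc l)))
    (lem x (+ C (j ℕ.+ suc l) (suc j)) (+ C (j ℕ.+ suc l) j) (x ^ l))
    where
    first : P x (j ℕ.+ suc l) (suc j) ≡ + C (j ℕ.+ suc l) (suc j) * x ^ l
    first = subst (λ z → P x z (suc j) ≡ + C z (suc j) * x ^ l) (sym (ℕ.+-suc j l)) (P-explicit x (suc j) l)
    lem : ∀ x a b c → x * (a * c) + b * (x * c) ≡ (a + b) * (x * c)
    lem = solve-∀

  abs-^ : ∀ x j → ∣ x ^ j ∣ ≡ ∣ x ∣ ℕ.^ j
  abs-^ x zero    = refl
  abs-^ x (suc j) = trans (ℤ.abs-* x (x ^ j)) (cong (∣ x ∣ ℕ.*_) (abs-^ x j))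

  ∣P∣ : ∀ x j l → ∣ P x (j ℕ.+ l) j ∣ ≡ C (j ℕ.+ l) j ℕ.* ∣ x ∣ ℕ.^ l
  ∣P∣ x j l = trans (cong ∣_∣ (P-explicit x j l)) (trans (ℤ.abs-* (+ C (j ℕ.+ l) j) (x ^ l)) (cong (C (j ℕ.+ l) j ℕ.*_) (abs-^ x l)))

-- Elementary estimates for factorials and binomial coefficients

module Bounds where

  open import Data.Nat
  open import Data.Nat.Properties
  open import Data.Nat.Tactic.RingSolver using (solve-∀)
  open import Data.Sum using (inj₁; inj₂)
  open import Relation.Binary.PropositionalEquality
  open Arithmetic using (^-distribʳ-*)
  open Sums using (C)
  open ≤-Reasoning

  C-factorial : ∀ j l → C (j + l) j * (j ! * l !) ≡ (j + l) !
  C-factorial zero    zero    = refl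
  C-factorial zero    (suc l) = trans (lem (C l 0) (suc l) (l !)) (cong (suc l *_) (C-factorial zero l))
    where lem : ∀ a b c → a * (1 * (b * c)) ≡ b * (a * (1 * c))
          lem = solve-∀
  C-factorial (suc j) zero    = trans (cong (λ z → (z + C (j + 0) j) * (suc j ! * 1)) (Sums.C-vanish (j + 0) (suc j) (s≤s (≤-reflexive (+-identityʳ j)))))
    (trans (lem (C (j + 0) j) (suc j) (j !)) (trans (cong (suc j *_) (C-factorial j zero)) (cong (λ z → suc z * (j + 0) !) (sym (+-identityʳ j)))))
    where lem : ∀ a b c → (0 + a) * (b * c * 1) ≡ b * (a * (c * 1))
          lem = solve-∀
  C-factorial (suc j) (suc l) = begin-equality
    (C (j + suc l) (suc j) + C (j + suc l) j) * (suc j * j ! * (suc l * l !))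
      ≡⟨ lem (C (j + suc l) (suc j)) (C (j + suc l) j) (suc j) (j !) (suc l) (l !) ⟩
    suc l * (C (j + suc l) (suc j) * (suc j * j ! * l !)) + suc j * (C (j + suc l) j * (j ! * (suc l * l !)))
      ≡⟨ cong₂ (λ a b → suc l * a + suc j * b) first (C-factorial j (suc l)) ⟩
    suc l * (j + suc l) ! + suc j * (j + suc l) !
      ≡⟨ lem′ l j ((j + suc l) !) ⟩
    (suc j + suc l) ! ∎
    where
    first : C (j + suc l) (suc j) * (suc j * j ! * l !) ≡ (j + suc l) !
    first = subst (λ z → C z (suc j) * (suc j * j ! * l !) ≡ z !) (sym (+-suc j l)) (C-factorial (suc j) l)
    lem : ∀ a b c d e f → (a + b) * (c * d * (e * f)) ≡ e * (a * (c * d * f)) + c * (b * (d * (e * f)))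
    lem = solve-∀
    lem′ : ∀ l j f → suc l * f + suc j * f ≡ suc (j + suc l) * f
    lem′ = solve-∀

  bernoulli : ∀ u m → u ^ suc m + suc m * u ^ m ≤ suc u ^ suc m
  bernoulli u zero = ≤-reflexive (lem u)
    where lem : ∀ u → u * 1 + 1 * 1 ≡ suc u * 1
          lem = solve-∀
  bernoulli u (suc m) = begin
    u * (u * u ^ m) + suc (suc m) * (u * u ^ m)        ≤⟨ m≤m+n _ (suc m * u ^ m) ⟩
    u * (u * u ^ m) + suc (suc m) * (u * u ^ m) + suc m * u ^ m ≡⟨ lem u m (u ^ m) ⟩
    suc u * (u * u ^ m + suc m * u ^ m)                ≤⟨ *-monoʳ-≤ (suc u) (bernoulli u m) ⟩
    suc u * suc u ^ suc m                              ∎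
    where lem : ∀ u m x → u * (u * x) + suc (suc m) * (u * x) + suc m * x ≡ suc u * (u * x + suc m * x)
          lem = solve-∀

  C-pow : ∀ u m → C u m * m ! ≤ u ^ m
  C-pow zero    zero    = ≤-refl
  C-pow zero    (suc m) = z≤n
  C-pow (suc u) zero    = ≤-trans (C-pow u zero) ≤-refl
  C-pow (suc u) (suc m) = begin
    (C u (suc m) + C u m) * (suc m * m !)              ≡⟨ lem (C u (suc m)) (C u m) (suc m) (m !) ⟩
    C u (suc m) * (suc m * m !) + suc m * (C u m * m !) ≤⟨ +-mono-≤ (C-pow u (suc m)) (*-monoʳ-≤ (suc m) (C-pow u m)) ⟩
    u ^ suc m + suc m * u ^ m                          ≤⟨ bernoulli u m ⟩
    suc u ^ suc m                                      ∎
    where lem : ∀ a b c d → (a + b) * (c * d) ≡ a * (c * d) + c * (b * d)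
          lem = solve-∀

  -- (1 + 1/n)^j ≤ 1 + j/n + (j/n)² for j ≤ n.
  euler-step : ∀ n j → j ≤ n → suc n ^ j * (n * n) ≤ n ^ j * (n * n + j * n + j * j)
  euler-step n zero    _   = ≤-reflexive (lem n)
    where lem : ∀ n → 1 * (n * n) ≡ 1 * (n * n + 0 * n + 0 * 0)
          lem = solve-∀
  euler-step n (suc j) j<n = begin
    suc n * suc n ^ j * (n * n)                       ≡⟨ *-assoc (suc n) (suc n ^ j) (n * n) ⟩
    suc n * (suc n ^ j * (n * n))                     ≤⟨ *-monoʳ-≤ (suc n) (euler-step n j (<⇒≤ j<n)) ⟩
    suc n * (n ^ j * (n * n + j * n + j * j))         ≡⟨ lem₁ n (n ^ j) j ⟩
    n ^ j * (n * (n * n + suc j * n + j * j + j) + j * j) ≤⟨ *-monoʳ-≤ (n ^ j) (+-monoʳ-≤ (n * (n * n + suc j * n + j * j + j)) (*-monoˡ-≤ j (<⇒≤ j<n))) ⟩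
    n ^ j * (n * (n * n + suc j * n + j * j + j) + n * j) ≤⟨ *-monoʳ-≤ (n ^ j) (m≤m+n _ n) ⟩
    n ^ j * (n * (n * n + suc j * n + j * j + j) + n * j + n) ≡⟨ lem₂ n (n ^ j) j ⟩
    n * n ^ j * (n * n + suc j * n + suc j * suc j)   ∎
    where
    lem₁ : ∀ n x j → suc n * (x * (n * n + j * n + j * j)) ≡ x * (n * (n * n + suc j * n + j * j + j) + j * j)
    lem₁ = solve-∀
    lem₂ : ∀ n x j → x * (n * (n * n + suc j * n + j * j + j) + n * j + n) ≡ n * x * (n * n + suc j * n + suc j * suc j)
    lem₂ = solve-∀

  euler : ∀ n → suc n ^ n ≤ 3 * n ^ n
  euler zero      = s≤s z≤n
  euler n@(suc _) = *-cancelʳ-≤ _ _ (n * n) (≤-trans (euler-step n n ≤-refl) (≤-reflexive (lem (n ^ n) (n * n))))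
    where lem : ∀ x y → x * (y + y + y) ≡ 3 * x * y
          lem = solve-∀

  -- This is n! ≥ (n/3)^n, which replaces Stirling's formula; the induction step is (1 + 1/n)^n ≤ 3.
  n^n≤n!*3^n : ∀ n → n ^ n ≤ n ! * 3 ^ n
  n^n≤n!*3^n zero    = ≤-refl
  n^n≤n!*3^n (suc n) = begin
    suc n * suc n ^ n            ≤⟨ *-monoʳ-≤ (suc n) (euler n) ⟩
    suc n * (3 * n ^ n)          ≤⟨ *-monoʳ-≤ (suc n) (*-monoʳ-≤ 3 (n^n≤n!*3^n n)) ⟩
    suc n * (3 * (n ! * 3 ^ n))  ≡⟨ lem (suc n) (n !) (3 ^ n) ⟩
    suc n * n ! * (3 * 3 ^ n)    ∎
    where lem : ∀ a b c → a * (3 * (b * c)) ≡ a * b * (3 * c)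
          lem = solve-∀

  -- Passing from j to j + 1 multiplies y^j/j! by y/(j + 1), which is at least 1 while j < y.
  ratio-mono : ∀ y j d → j + d ≤ y → y ^ j * (j + d) ! ≤ j ! * y ^ (j + d)
  ratio-mono y j zero    le = ≤-reflexive (trans (cong (λ z → y ^ j * z !) (+-identityʳ j)) (trans (*-comm (y ^ j) (j !)) (cong (λ z → j ! * y ^ z) (sym (+-identityʳ j)))))
  ratio-mono y j (suc d) le rewrite +-suc j d = begin
    y ^ j * (suc (j + d) * (j + d) !)   ≡⟨ lem (y ^ j) (suc (j + d)) ((j + d) !) ⟩
    suc (j + d) * (y ^ j * (j + d) !)   ≤⟨ *-mono-≤ le (ratio-mono y j d (<⇒≤ le)) ⟩
    y * (j ! * y ^ (j + d))             ≡⟨ lem y (j !) (y ^ (j + d)) ⟩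
    j ! * (y * y ^ (j + d))             ∎
    where lem : ∀ a b c → a * (b * c) ≡ b * (a * c)
          lem = solve-∀

  -- A term x^l/l! of the exponential series, with 3 in place of e. The terms increase up to l = x
  -- and decrease from there, so the largest is the one of `n^n≤n!*3^n`.
  x^l≤l!*3^x : ∀ x l → x ^ l ≤ l ! * 3 ^ x
  x^l≤l!*3^x x l with ≤-total l x
  ... | inj₁ l≤x = *-cancelʳ-≤ _ _ (x !) {{n!≢0}} (begin
    x ^ l * x !                 ≡⟨ cong (λ z → x ^ l * z !) (sym (m+[n∸m]≡n l≤x)) ⟩
    x ^ l * (l + (x ∸ l)) !     ≤⟨ ratio-mono x l (x ∸ l) (≤-reflexive (m+[n∸m]≡n l≤x)) ⟩
    l ! * x ^ (l + (x ∸ l))     ≡⟨ cong (λ z → l ! * x ^ z) (m+[n∸m]≡n l≤x) ⟩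
    l ! * x ^ x                 ≤⟨ *-monoʳ-≤ (l !) (n^n≤n!*3^n x) ⟩
    l ! * (x ! * 3 ^ x)         ≡⟨ lem (l !) (x !) (3 ^ x) ⟩
    l ! * 3 ^ x * x !           ∎)
    where
    lem : ∀ a b c → a * (b * c) ≡ a * c * b
    lem = solve-∀
    n!≢0 : NonZero (x !)
    n!≢0 = >-nonZero (1≤n! x)
  ... | inj₂ x≤l = subst (λ z → x ^ z ≤ z ! * 3 ^ x) (m+[n∸m]≡n x≤l) (up (l ∸ x))
    where
    up : ∀ d → x ^ (x + d) ≤ (x + d) ! * 3 ^ x
    up zero    rewrite +-identityʳ x = n^n≤n!*3^n x
    up (suc d) rewrite +-suc x d = begin
      x * x ^ (x + d)                    ≤⟨ *-mono-≤ (m≤n⇒m≤1+n (m≤m+n x d)) (up d) ⟩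
      suc (x + d) * ((x + d) ! * 3 ^ x)  ≡⟨ sym (*-assoc (suc (x + d)) ((x + d) !) (3 ^ x)) ⟩
      suc (x + d) * (x + d) ! * 3 ^ x    ∎

  -- y^j/j! grows with j up to J ≤ y, and y^J/J! ≤ (3y/J)^J ≤ z^J.
  falling-bound : ∀ y j J z → j ≤ J → J ≤ y → 3 * y ≤ z * J → .{{NonZero J}} → y ^ j ≤ j ! * z ^ J
  falling-bound y j J z j≤J J≤y 3y≤zJ = *-cancelʳ-≤ _ _ (J ^ J) {{m^n≢0 J J}} (begin
    y ^ j * J ^ J                  ≤⟨ *-monoʳ-≤ (y ^ j) (n^n≤n!*3^n J) ⟩
    y ^ j * (J ! * 3 ^ J)          ≡⟨ sym (*-assoc (y ^ j) (J !) (3 ^ J)) ⟩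
    y ^ j * J ! * 3 ^ J            ≡⟨ cong (λ t → y ^ j * t ! * 3 ^ J) (sym (m+[n∸m]≡n j≤J)) ⟩
    y ^ j * (j + (J ∸ j)) ! * 3 ^ J ≤⟨ *-monoˡ-≤ (3 ^ J) (ratio-mono y j (J ∸ j) (≤-trans (≤-reflexive (m+[n∸m]≡n j≤J)) J≤y)) ⟩
    j ! * y ^ (j + (J ∸ j)) * 3 ^ J ≡⟨ cong (λ t → j ! * y ^ t * 3 ^ J) (m+[n∸m]≡n j≤J) ⟩
    j ! * y ^ J * 3 ^ J            ≡⟨ lem (j !) (y ^ J) (3 ^ J) ⟩
    j ! * (3 ^ J * y ^ J)          ≡⟨ cong (j ! *_) (sym (^-distribʳ-* 3 y J)) ⟩
    j ! * (3 * y) ^ J              ≤⟨ *-monoʳ-≤ (j !) (^-monoˡ-≤ J 3y≤zJ) ⟩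
    j ! * (z * J) ^ J              ≡⟨ cong (j ! *_) (^-distribʳ-* z J J) ⟩
    j ! * (z ^ J * J ^ J)          ≡⟨ sym (*-assoc (j !) (z ^ J) (J ^ J)) ⟩
    j ! * z ^ J * J ^ J            ∎)
    where lem : ∀ a b c → a * b * c ≡ a * (c * b)
          lem = solve-∀

  -- Bounds the share of one term in the Newton coefficient of index m = j + l. As C(u, m) ≤ U^m/m!,
  -- the factorials split over j and l: the l-part is at most (Bρ)^l/l! ≤ 3^(Bρ), the j-part at most
  -- KY. The factor ρ^m on the left records the geometric decay on which the pigeonhole argument
  -- lives.
  newton-bound : ∀ {j l u U A D β ρ B K Y} → u ≤ U → U * D ≤ B * β → A ^ j ≤ K * β ^ j → (U * ρ) ^ j ≤ j ! * Y →
    C (j + l) j * D ^ l * A ^ j * C u (j + l) * ρ ^ (j + l) ≤ β ^ (j + l) * (K * 3 ^ (B * ρ) * Y)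
  newton-bound {j} {l} {u} {U} {A} {D} {β} {ρ} {B} {K} {Y} u≤U UD≤ A≤ Uρ≤ =
    *-cancelʳ-≤ _ _ (j ! * l !) {{m*n≢0 _ _ {{>-nonZero (1≤n! j)}} {{>-nonZero (1≤n! l)}}}} (begin
    C (j + l) j * D ^ l * A ^ j * C u (j + l) * ρ ^ (j + l) * (j ! * l !)
      ≡⟨ lem₁ (C (j + l) j) (D ^ l) (A ^ j) (C u (j + l)) (ρ ^ (j + l)) (j ! * l !) ⟩
    C u (j + l) * (C (j + l) j * (j ! * l !)) * (D ^ l * A ^ j * ρ ^ (j + l))
      ≡⟨ cong (λ t → C u (j + l) * t * (D ^ l * A ^ j * ρ ^ (j + l))) (C-factorial j l) ⟩
    C u (j + l) * (j + l) ! * (D ^ l * A ^ j * ρ ^ (j + l))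
      ≤⟨ *-monoˡ-≤ (D ^ l * A ^ j * ρ ^ (j + l)) (≤-trans (C-pow u (j + l)) (^-monoˡ-≤ (j + l) u≤U)) ⟩
    U ^ (j + l) * (D ^ l * A ^ j * ρ ^ (j + l))
      ≡⟨ cong₂ (λ s t → s * (D ^ l * A ^ j * t)) (^-distribˡ-+-* U j l) (^-distribˡ-+-* ρ j l) ⟩
    U ^ j * U ^ l * (D ^ l * A ^ j * (ρ ^ j * ρ ^ l))
      ≡⟨ lem₂ (U ^ j) (U ^ l) (D ^ l) (A ^ j) (ρ ^ j) (ρ ^ l) ⟩
    (U ^ j * ρ ^ j) * A ^ j * (U ^ l * D ^ l * ρ ^ l)
      ≡⟨ cong₂ (λ s t → s * A ^ j * t) (sym (^-distribʳ-* U ρ j)) (trans (cong (_* ρ ^ l) (sym (^-distribʳ-* U D l))) refl) ⟩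
    (U * ρ) ^ j * A ^ j * ((U * D) ^ l * ρ ^ l)
      ≤⟨ *-mono-≤ (*-mono-≤ Uρ≤ A≤) (*-monoˡ-≤ (ρ ^ l) (^-monoˡ-≤ l UD≤)) ⟩
    j ! * Y * (K * β ^ j) * ((B * β) ^ l * ρ ^ l)
      ≡⟨ cong (λ t → j ! * Y * (K * β ^ j) * (t * ρ ^ l)) (^-distribʳ-* B β l) ⟩
    j ! * Y * (K * β ^ j) * (B ^ l * β ^ l * ρ ^ l)
      ≡⟨ lem₃ (j !) Y K (β ^ j) (B ^ l) (β ^ l) (ρ ^ l) ⟩
    (B ^ l * ρ ^ l) * (j ! * Y * K * (β ^ j * β ^ l))
      ≡⟨ cong₂ (λ s t → s * (j ! * Y * K * t)) (sym (^-distribʳ-* B ρ l)) (sym (^-distribˡ-+-* β j l)) ⟩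
    (B * ρ) ^ l * (j ! * Y * K * β ^ (j + l))
      ≤⟨ *-monoˡ-≤ (j ! * Y * K * β ^ (j + l)) (x^l≤l!*3^x (B * ρ) l) ⟩
    l ! * 3 ^ (B * ρ) * (j ! * Y * K * β ^ (j + l))
      ≡⟨ lem₄ (l !) (3 ^ (B * ρ)) (j !) Y K (β ^ (j + l)) ⟩
    β ^ (j + l) * (K * 3 ^ (B * ρ) * Y) * (j ! * l !) ∎)
    where
    lem₁ : ∀ a b c d e f → a * b * c * d * e * f ≡ d * (a * f) * (b * c * e)
    lem₁ = solve-∀
    lem₂ : ∀ a b c d e f → a * b * (c * d * (e * f)) ≡ (a * e) * d * (b * c * f)
    lem₂ = solve-∀
    lem₃ : ∀ a b c d e f g → a * b * (c * d) * (e * f * g) ≡ (e * g) * (a * b * c * (d * f))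
    lem₃ = solve-∀
    lem₄ : ∀ a b c d e f → a * b * (c * d * e * f) ≡ f * (e * b * d) * (c * a)
    lem₄ = solve-∀

-- Pigeonhole principle with boxes of unequal number

module Pigeonhole where

  open import Data.Nat
  open import Data.Nat.Properties
  open import Data.Nat.DivMod
  open import Data.Fin using (Fin; toℕ; fromℕ<)
  open import Data.Fin.Properties using (pigeonhole; toℕ-fromℕ<; toℕ<n)
  open import Data.Product using (_×_; _,_; ∃-syntax)
  open import Data.Nat.Tactic.RingSolver using (solve-∀)
  open import Relation.Nullary using (yes; no; contradiction)
  open import Relation.Binary.PropositionalEquality

  pigeonhole-ℕ : ∀ {M M′} (g : ℕ → ℕ) → M′ < M → (∀ c → c < M → g c < M′) →
                 ∃[ c ] ∃[ d ] (c < d × d < M × g c ≡ g d)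
  pigeonhole-ℕ {M} {M′} g M′<M bd with pigeonhole M′<M (λ i → fromℕ< (bd (toℕ i) (toℕ<n i)))
  ... | i , j , i<j , eq = toℕ i , toℕ j , i<j , toℕ<n j ,
    trans (sym (toℕ-fromℕ< _)) (trans (cong toℕ eq) (toℕ-fromℕ< _))

  ∏ : ℕ → (ℕ → ℕ) → ℕ
  ∏ zero    s = 1
  ∏ (suc m) s = ∏ m s * s m

  -- Mixed radix notation with the radices s 0, s 1, ..., which numbers the boxes of the whole
  -- family.
  encode : ℕ → (ℕ → ℕ) → (ℕ → ℕ) → ℕ
  encode zero    s x = 0
  encode (suc m) s x = encode m s x + x m * ∏ m s

  encode-< : ∀ m s x → (∀ i → i < m → x i < s i) → encode m s x < ∏ m s
  encode-< zero    s x bd = s≤s z≤n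
  encode-< (suc m) s x bd = begin-strict
    encode m s x + x m * ∏ m s   <⟨ +-monoˡ-< (x m * ∏ m s) (encode-< m s x (λ i i<m → bd i (m<n⇒m<1+n i<m))) ⟩
    suc (x m) * ∏ m s            ≤⟨ *-monoˡ-≤ (∏ m s) (bd m ≤-refl) ⟩
    s m * ∏ m s                  ≡⟨ *-comm (s m) (∏ m s) ⟩
    ∏ m s * s m                  ∎
    where open ≤-Reasoning

  remainder-unique : ∀ {P a a′ b b′} → a < P → a′ < P → a + b * P ≡ a′ + b′ * P → a ≡ a′ × b ≡ b′
  remainder-unique {P@(suc _)} {a} {a′} {b} {b′} a<P a′<P eq = a≡ , *-cancelʳ-≡ b b′ P (+-cancelˡ-≡ a _ _ (trans eq (cong (_+ b′ * P) (sym a≡))))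
    where
    a≡ : a ≡ a′
    a≡ = trans (sym (trans ([m+kn]%n≡m%n a b P) (m<n⇒m%n≡m a<P))) (trans (cong (_% P) eq) (trans ([m+kn]%n≡m%n a′ b′ P) (m<n⇒m%n≡m a′<P)))

  encode-injective : ∀ m s x y → (∀ i → i < m → x i < s i) → (∀ i → i < m → y i < s i) →
                     encode m s x ≡ encode m s y → ∀ i → i < m → x i ≡ y i
  encode-injective (suc m) s x y bx by eq i i<1+m with remainder-unique {b = x m} {b′ = y m}
        (encode-< m s x (λ i i<m → bx i (m<n⇒m<1+n i<m))) (encode-< m s y (λ i i<m → by i (m<n⇒m<1+n i<m))) eq
  ... | eq′ , xm≡ym with i ≟ m
  ...   | yes refl = xm≡ym
  ...   | no  i≢m  = encode-injective m s x y (λ i i<m → bx i (m<n⇒m<1+n i<m)) (λ i i<m → by i (m<n⇒m<1+n i<m)) eq′ i (≤∧≢⇒< (≤-pred i<1+m) i≢m)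

  -- The numbers below X^N serve as names for the vectors of N coefficients below X.
  digit : (X : ℕ) .{{_ : NonZero X}} → ℕ → ℕ → ℕ
  digit X zero    c = c % X
  digit X (suc e) c = digit X e (c / X)

  digit<X : ∀ X .{{_ : NonZero X}} e c → digit X e c < X
  digit<X X zero    c = m%n<n c X
  digit<X X (suc e) c = digit<X X e (c / X)

  digits-differ : ∀ X .{{_ : NonZero X}} N c d → c < X ^ N → d < X ^ N → c ≢ d → ∃[ e ] (e < N × digit X e c ≢ digit X e d)
  digits-differ X zero    c d c<1 d<1 c≢d = contradiction (trans (n<1⇒n≡0 c<1) (sym (n<1⇒n≡0 d<1))) c≢d
  digits-differ X (suc N) c d c< d< c≢d with c % X ≟ d % X
  ... | no  c%≢d% = 0 , s≤s z≤n , c%≢d%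
  ... | yes c%≡d% with digits-differ X N (c / X) (d / X) (m<n*o⇒m/o<n (subst (c <_) (*-comm X (X ^ N)) c<)) (m<n*o⇒m/o<n (subst (d <_) (*-comm X (X ^ N)) d<))
                        (λ c/≡d/ → c≢d (trans (m≡m%n+[m/n]*n c X) (trans (cong₂ (λ a b → a + b * X) c%≡d% c/≡d/) (sym (m≡m%n+[m/n]*n d X)))))
  ...   | e , e<N , differ = suc e , s≤s e<N , differ

  same-box : ∀ ω .{{_ : NonZero ω}} x y → x / ω ≡ y / ω → ∣ x - y ∣ < ω
  same-box ω x y eq = begin-strict
    ∣ x - y ∣                                        ≡⟨ cong₂ ∣_-_∣ (m≡m%n+[m/n]*n x ω) (trans (m≡m%n+[m/n]*n y ω) (cong (λ q → y % ω + q * ω) (sym eq))) ⟩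
    ∣ x % ω + x / ω * ω - y % ω + x / ω * ω ∣        ≡⟨ cong₂ ∣_-_∣ (+-comm (x % ω) _) (+-comm (y % ω) _) ⟩
    ∣ x / ω * ω + x % ω - x / ω * ω + y % ω ∣        ≡⟨ ∣m+n-m+o∣≡∣n-o∣ (x / ω * ω) (x % ω) (y % ω) ⟩
    ∣ x % ω - y % ω ∣                                ≤⟨ ∣m-n∣≤m⊔n (x % ω) (y % ω) ⟩
    x % ω ⊔ y % ω                                    <⟨ ⊔-lub (m%n<n x ω) (m%n<n y ω) ⟩
    ω                                                ∎
    where open ≤-Reasoning


  -- The product is ρ^(N(N-1)/2); squaring it avoids the half.
  ∏-powers : ∀ ρ N → ∏ N (ρ ^_) * ∏ N (ρ ^_) * ρ ^ N ≡ ρ ^ (N * N)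
  ∏-powers ρ zero    = refl
  ∏-powers ρ (suc N) = begin
    ∏ N (ρ ^_) * ρ ^ N * (∏ N (ρ ^_) * ρ ^ N) * (ρ * ρ ^ N)   ≡⟨ lem (∏ N (ρ ^_)) (ρ ^ N) ρ ⟩
    ρ * (ρ ^ N * ρ ^ N * (∏ N (ρ ^_) * ∏ N (ρ ^_) * ρ ^ N))   ≡⟨ cong (λ z → ρ * (ρ ^ N * ρ ^ N * z)) (∏-powers ρ N) ⟩
    ρ * (ρ ^ N * ρ ^ N * ρ ^ (N * N))                         ≡⟨ cong (λ z → ρ * (z * ρ ^ (N * N))) (sym (^-distribˡ-+-* ρ N N)) ⟩
    ρ * (ρ ^ (N + N) * ρ ^ (N * N))                           ≡⟨ cong (ρ *_) (sym (^-distribˡ-+-* ρ (N + N) (N * N))) ⟩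
    ρ ^ suc (N + N + N * N)                                   ≡⟨ cong (ρ ^_) (lem′ N) ⟩
    ρ ^ (suc N * suc N)                                       ∎
    where
    open ≡-Reasoning
    lem : ∀ a b c → a * b * (a * b) * (c * b) ≡ c * (b * b * (a * a * b))
    lem = solve-∀
    lem′ : ∀ N → suc (N + N + N * N) ≡ suc N * suc N
    lem′ = solve-∀

  -- With N = 2n the left side is ρ^(N²/2 - n): the vectors of N coefficients below ρ^n outnumber
  -- the boxes. The average exponent N/2 of the box numbers thus decides the size of the
  -- coefficients.
  ∏-powers-< : ∀ ρ n → 1 < ρ → 0 < n → ∏ (2 * n) (ρ ^_) < (ρ ^ n) ^ (2 * n)
  ∏-powers-< ρ n 1<ρ 0<n = ≰⇒> λ le → <⇒≱ {(X * X)} {X * X * ρ ^ N}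
      (m<m*n (X * X) (ρ ^ N) {{m*n≢0 X X {{X≢0}} {{X≢0}}}} (^-monoʳ-< ρ 1<ρ {0} {N} (*-mono-≤ {1} {2} (s≤s z≤n) 0<n)))
      (begin X * X * ρ ^ N                             ≤⟨ *-monoˡ-≤ (ρ ^ N) (*-mono-≤ le le) ⟩
             ∏ N (ρ ^_) * ∏ N (ρ ^_) * ρ ^ N           ≡⟨ ∏-powers ρ N ⟩
             ρ ^ (N * N)                               ≡⟨ cong (ρ ^_) (lem n) ⟩
             ρ ^ (n * N + n * N)                       ≡⟨ ^-distribˡ-+-* ρ (n * N) (n * N) ⟩
             ρ ^ (n * N) * ρ ^ (n * N)                 ≡⟨ cong₂ _*_ (sym (^-*-assoc ρ n N)) (sym (^-*-assoc ρ n N)) ⟩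
             X * X                                     ∎)
    where
    open ≤-Reasoning
    N = 2 * n
    X = (ρ ^ n) ^ N
    instance
      ρ≢0 : NonZero ρ
      ρ≢0 = >-nonZero (<-trans (s≤s z≤n) 1<ρ)
    X≢0 : NonZero X
    X≢0 = m^n≢0 (ρ ^ n) N {{m^n≢0 ρ n}}
    lem : ∀ n → 2 * n * (2 * n) ≡ n * (2 * n) + n * (2 * n)
    lem = solve-∀

  pigeonhole-family : ∀ N M (s : ℕ → ℕ) (x : ℕ → ℕ → ℕ) → ∏ N s < M → (∀ c e → e < N → x c e < s e) →
                      ∃[ c ] ∃[ d ] (c < d × d < M × (∀ e → e < N → x c e ≡ x d e))
  pigeonhole-family N M s x small bd with pigeonhole-ℕ (λ c → encode N s (x c)) small (λ c _ → encode-< N s (x c) (bd c))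
  ... | c , d , c<d , d<M , eq = c , d , c<d , d<M , encode-injective N s (x c) (x d) (bd c) (bd d) eq

-- Construction of the exponential polynomial

module AuxiliaryFunction where

  open import Data.Nat as ℕ using (ℕ; zero; suc; _≤_; _<_; z≤n; s≤s; NonZero; _∸_)
  import Data.Nat.Properties as ℕ
  import Data.Nat.DivMod as ℕ
  open import Data.Integer as ℤ using (ℤ; +_; -[1+_]; 0ℤ; ∣_∣; _+_; _*_; -_; _-_; _^_)
  import Data.Integer.Properties as ℤ
  open import Data.Integer.Tactic.RingSolver using (solve-∀)
  import Data.Nat.Tactic.RingSolver as ℕS
  open import Data.Product using (_×_; _,_; ∃-syntax; proj₁; proj₂)
  open import Relation.Nullary using (yes; no; contradiction)
  open import Relation.Binary.PropositionalEquality
  open Sums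
  open Pigeonhole

  C-pos : ∀ {u m} → m ≤ u → 1 ≤ C u m
  C-pos {zero}  {zero}  _       = s≤s z≤n
  C-pos {suc u} {zero}  _       = C-pos {u} {zero} z≤n
  C-pos {suc u} {suc m} (s≤s le) = ℕ.≤-trans (C-pos le) (ℕ.m≤n+m _ (C u (suc m)))

  C-mono : ∀ {u U} m → u ≤ U → C u m ≤ C U m
  C-mono {u} {U} m u≤U = subst (λ z → C u m ≤ C z m) (ℕ.m∸n+n≡m u≤U) (go (U ∸ u))
    where
    step : ∀ u m → C u m ≤ C (suc u) m
    step u zero    = ℕ.≤-refl
    step u (suc m) = ℕ.m≤m+n (C u (suc m)) (C u m)
    go : ∀ d → C u m ≤ C (d ℕ.+ u) m
    go zero    = ℕ.≤-refl
    go (suc d) = ℕ.≤-trans (go d) (step (d ℕ.+ u) m)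

  m≤n/o : ∀ {m n o} .{{_ : NonZero o}} → m ℕ.* o ≤ n → m ≤ n ℕ./ o
  m≤n/o {m} {n} {o} le = subst (_≤ n ℕ./ o) (ℕ.m*n/n≡m m o) (ℕ./-monoˡ-≤ o le)

  n<[1+n/o]*o : ∀ n o .{{_ : NonZero o}} → n < suc (n ℕ./ o) ℕ.* o
  n<[1+n/o]*o n o = subst (_< suc (n ℕ./ o) ℕ.* o) (sym (ℕ.m≡m%n+[m/n]*n n o)) (ℕ.+-monoˡ-< (n ℕ./ o ℕ.* o) (ℕ.m%n<n n o))

  private
    ring1 : ∀ a b c d → a * (b * (c * d)) ≡ b * c * (a * d)
    ring1 = solve-∀
    ring2 : ∀ a b c d e → a ℕ.* (b ℕ.* c) ℕ.* (d ℕ.* e) ≡ b ℕ.* c ℕ.* a ℕ.* d ℕ.* e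
    ring2 = ℕS.solve-∀
    ring3 : ∀ k t u c r → 2 ℕ.* k ℕ.* (t ℕ.* u ℕ.* c ℕ.* r) ≡ k ℕ.* (c ℕ.* r) ℕ.* (2 ℕ.* (t ℕ.* u))
    ring3 = ℕS.solve-∀
    ring4 : ∀ i j x b z t → i ℕ.* (j ℕ.* (x ℕ.* (b ℕ.* z))) ℕ.* (2 ℕ.* t) ≡ 2 ℕ.* (i ℕ.* (j ℕ.* z)) ℕ.* t ℕ.* (x ℕ.* b)
    ring4 = ℕS.solve-∀
    ring5 : ∀ a b r q → a ℕ.* q ℕ.* b ≡ (a ℕ.* b) ℕ.* q
    ring5 = ℕS.solve-∀
    ring6 : ∀ r g t q → r ℕ.* g ℕ.* (t ℕ.* q) ≡ (r ℕ.* q) ℕ.* (g ℕ.* t)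
    ring6 = ℕS.solve-∀
    ring7 : ∀ a b c → (a - b) * c ≡ a * c - b * c
    ring7 = solve-∀
    ring8 : ∀ a b k → (a + k) - (b + k) ≡ a - b
    ring8 = solve-∀
    ring9 : ∀ a b c d → a ℕ.* (b ℕ.* c) ℕ.* d ≡ a ℕ.* (b ℕ.* d) ℕ.* c
    ring9 = ℕS.solve-∀
    ring10 : ∀ i j x b z t → 2 ℕ.* (i ℕ.* (j ℕ.* (x ℕ.* (b ℕ.* z))) ℕ.* t) ≡ 2 ℕ.* (i ℕ.* (j ℕ.* z)) ℕ.* t ℕ.* (x ℕ.* b)
    ring10 = ℕS.solve-∀
    ring11 : ∀ c b g t → c ℕ.* b ℕ.* g ℕ.* t ≡ b ℕ.* (g ℕ.* (c ℕ.* t))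
    ring11 = ℕS.solve-∀

  -- The A i are the bases of the exponentials and β is the centre of the expansion. There are I · J
  -- coefficients, and half that number is the exponent of ρ that bounds them. `H₁` is the decay of
  -- the Newton coefficients of single terms; `H₂` says that one factor ρ^n′ pays for all other
  -- losses, including the factor τ by which Φ is to fall below β^u.
  module Auxiliary (I J n′ ρ U τ β Z : ℕ) (A : ℕ → ℕ) (D : ℕ → ℤ)
           (A≡ : ∀ i → i < I → + A i ≡ D i + + β)
           (1<ρ : 1 < ρ) (0<β : 0 < β) (0<τ : 0 < τ)
           (N≡ : I ℕ.* J ≡ 2 ℕ.* suc n′) (N≤U : I ℕ.* J ≤ U)
           (H₁ : ∀ i j l u → i < I → j < J → u ≤ U →
                 C (j ℕ.+ l) j ℕ.* ∣ D i ∣ ℕ.^ l ℕ.* A i ℕ.^ j ℕ.* C u (j ℕ.+ l) ℕ.* ρ ℕ.^ (j ℕ.+ l) ≤ β ℕ.^ (j ℕ.+ l) ℕ.* Z)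
           (H₂ : 2 ℕ.* (I ℕ.* (J ℕ.* Z)) ℕ.* (τ ℕ.* suc U) ≤ ρ ℕ.^ n′)
           where

    private
      n = suc n′
      N = I ℕ.* J
      X = ρ ℕ.^ n
      instance
        ρ≢0 : NonZero ρ
        ρ≢0 = ℕ.>-nonZero (ℕ.<-trans (s≤s z≤n) 1<ρ)
        β≢0 : NonZero β
        β≢0 = ℕ.>-nonZero 0<β
        τ≢0 : NonZero τ
        τ≢0 = ℕ.>-nonZero 0<τ
        X≢0 : NonZero X
        X≢0 = ℕ.m^n≢0 ρ n

    coeff : ℕ → ℕ → ℕ → ℤ
    coeff i j m = (+ A i) ^ j * P (D i) m j

    -- `Γ p m` is the Newton coefficient: the factor of C(u, m) β^(u-m) in the expansion of `Φ p u`
    -- at β.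
    Γ : (ℕ → ℕ → ℤ) → ℕ → ℤ
    Γ p m = ∑ I (λ i → ∑ J (λ j → p i j * coeff i j m))

    -- In closed form Σ p i j · C(u, j) · A i ^ u. Written with P it is a coefficient of (A i +
    -- z)^u, to which the expansion `P-compose` around β applies.
    Φ : (ℕ → ℕ → ℤ) → ℕ → ℤ
    Φ p u = ∑ I (λ i → ∑ J (λ j → p i j * ((+ A i) ^ j * P (+ A i) u j)))

    newton : ∀ p u → Φ p u ≡ ∑ (suc u) (λ m → P (+ β) u m * Γ p m)
    newton p u = sym (begin
      ∑ (suc u) (λ m → P (+ β) u m * Γ p m)
        ≡⟨ ∑-cong (suc u) (λ m _ → trans (sym (∑-*ˡ I (P (+ β) u m) (λ i → ∑ J (λ j → p i j * coeff i j m)))) (∑-cong I λ i _ → sym (∑-*ˡ J (P (+ β) u m) (λ j → p i j * coeff i j m)))) ⟩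
      ∑ (suc u) (λ m → ∑ I (λ i → ∑ J (λ j → P (+ β) u m * (p i j * coeff i j m))))
        ≡⟨ ∑-swap (suc u) I (λ m i → ∑ J (λ j → P (+ β) u m * (p i j * coeff i j m))) ⟩
      ∑ I (λ i → ∑ (suc u) (λ m → ∑ J (λ j → P (+ β) u m * (p i j * coeff i j m))))
        ≡⟨ ∑-cong I (λ i i<I → trans (∑-swap (suc u) J (λ m j → P (+ β) u m * (p i j * coeff i j m))) (∑-cong J (λ j _ → inner i i<I j))) ⟩
      Φ p u ∎)
      where
      open ≡-Reasoning
      lem = ring1
      inner : ∀ i → i < I → ∀ j → ∑ (suc u) (λ m → P (+ β) u m * (p i j * coeff i j m)) ≡ p i j * ((+ A i) ^ j * P (+ A i) u j)
      inner i i<I j = begin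
        ∑ (suc u) (λ m → P (+ β) u m * (p i j * coeff i j m))
          ≡⟨ ∑-cong (suc u) (λ m _ → lem (P (+ β) u m) (p i j) ((+ A i) ^ j) (P (D i) m j)) ⟩
        ∑ (suc u) (λ m → p i j * (+ A i) ^ j * (P (+ β) u m * P (D i) m j))
          ≡⟨ ∑-*ˡ (suc u) (p i j * (+ A i) ^ j) _ ⟩
        p i j * (+ A i) ^ j * ∑ (suc u) (λ m → P (+ β) u m * P (D i) m j)
          ≡⟨ cong (p i j * (+ A i) ^ j *_) (sym (P-compose (D i) (+ β) u j)) ⟩
        p i j * (+ A i) ^ j * P (D i + + β) u j
          ≡⟨ cong (λ z → p i j * (+ A i) ^ j * P z u j) (sym (A≡ i i<I)) ⟩
        p i j * (+ A i) ^ j * P (+ A i) u j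
          ≡⟨ ℤ.*-assoc (p i j) _ _ ⟩
        p i j * ((+ A i) ^ j * P (+ A i) u j) ∎

    coeff-bound : ∀ i j m u → i < I → j < J → u ≤ U → ∣ coeff i j m ∣ ℕ.* (C u m ℕ.* ρ ℕ.^ m) ≤ β ℕ.^ m ℕ.* Z
    coeff-bound i j m u i<I j<J u≤U with j ℕ.≤? m
    ... | no j≰m = subst (λ z → ∣ (+ A i) ^ j * z ∣ ℕ.* (C u m ℕ.* ρ ℕ.^ m) ≤ β ℕ.^ m ℕ.* Z) (sym (P-vanish (D i) m j (ℕ.≰⇒> j≰m)))
            (subst (λ z → ∣ z ∣ ℕ.* (C u m ℕ.* ρ ℕ.^ m) ≤ β ℕ.^ m ℕ.* Z) (sym (ℤ.*-zeroʳ ((+ A i) ^ j))) z≤n)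
    ... | yes j≤m = subst (λ m → ∣ coeff i j m ∣ ℕ.* (C u m ℕ.* ρ ℕ.^ m) ≤ β ℕ.^ m ℕ.* Z) (ℕ.m+[n∸m]≡n j≤m) (go (m ∸ j))
      where
      go : ∀ l → ∣ coeff i j (j ℕ.+ l) ∣ ℕ.* (C u (j ℕ.+ l) ℕ.* ρ ℕ.^ (j ℕ.+ l)) ≤ β ℕ.^ (j ℕ.+ l) ℕ.* Z
      go l = ℕ.≤-trans (ℕ.≤-reflexive (trans (cong (ℕ._* (C u (j ℕ.+ l) ℕ.* ρ ℕ.^ (j ℕ.+ l)))
          (trans (ℤ.abs-* ((+ A i) ^ j) _) (cong₂ ℕ._*_ (abs-^ (+ A i) j) (∣P∣ (D i) j l))))
          (lem (A i ℕ.^ j) (C (j ℕ.+ l) j) (∣ D i ∣ ℕ.^ l) (C u (j ℕ.+ l)) (ρ ℕ.^ (j ℕ.+ l)))))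
          (H₁ i j l u i<I j<J u≤U)
        where lem = ring2

    Γ-bound : ∀ p m u → u ≤ U → (∀ i j → ∣ p i j ∣ ≤ X) → ∣ Γ p m ∣ ℕ.* (C u m ℕ.* ρ ℕ.^ m) ≤ I ℕ.* (J ℕ.* (X ℕ.* (β ℕ.^ m ℕ.* Z)))
    Γ-bound p m u u≤U pX = ∣∑∣≤ I λ i i<I → ∣∑∣≤ J λ j j<J → begin
      ∣ p i j * coeff i j m ∣ ℕ.* c      ≡⟨ cong (ℕ._* c) (ℤ.abs-* (p i j) (coeff i j m)) ⟩
      ∣ p i j ∣ ℕ.* ∣ coeff i j m ∣ ℕ.* c ≡⟨ ℕ.*-assoc ∣ p i j ∣ _ c ⟩
      ∣ p i j ∣ ℕ.* (∣ coeff i j m ∣ ℕ.* c) ≤⟨ ℕ.*-mono-≤ (pX i j) (coeff-bound i j m u i<I j<J u≤U) ⟩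
      X ℕ.* (β ℕ.^ m ℕ.* Z)              ∎
      where open ℕ.≤-Reasoning
            c = C u m ℕ.* ρ ℕ.^ m

    private
      digits : ℕ → ℕ → ℕ → ℤ
      digits c i j = + digit X (i ℕ.* J ℕ.+ j) c

      digits≤X : ∀ c i j → ∣ digits c i j ∣ ≤ X
      digits≤X c i j = ℕ.<⇒≤ (digit<X X (i ℕ.* J ℕ.+ j) c)

      CU : ∀ m → m < N → NonZero (C U m)
      CU m m<N = ℕ.>-nonZero (C-pos (ℕ.≤-trans (ℕ.<⇒≤ m<N) N≤U))

      -- |Γ| ≤ K m for every digit vector, and boxes have width suc (G m).
      K G : ∀ m → m < N → ℕ
      K m m<N = ℕ._/_ (I ℕ.* (J ℕ.* (X ℕ.* (β ℕ.^ m ℕ.* Z)))) (C U m ℕ.* ρ ℕ.^ m) {{ℕ.m*n≢0 _ _ {{CU m m<N}} {{ℕ.m^n≢0 ρ m}}}}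
      G m m<N = ℕ._/_ (β ℕ.^ m) (τ ℕ.* suc U ℕ.* C U m) {{ℕ.m*n≢0 _ _ {{ℕ.m*n≢0 τ (suc U)}} {{CU m m<N}}}}

      Γ≤K : ∀ c m (m<N : m < N) → ∣ Γ (digits c) m ∣ ≤ K m m<N
      Γ≤K c m m<N = m≤n/o {{ℕ.m*n≢0 _ _ {{CU m m<N}} {{ℕ.m^n≢0 ρ m}}}} (Γ-bound (digits c) m U ℕ.≤-refl (digits≤X c))

      -- Adding the bound K makes the value nonnegative, so that boxes can be numbered by division
      -- in ℕ.
      shifted : ∀ c m (m<N : m < N) → ℕ
      shifted c m m<N = ∣ Γ (digits c) m + + K m m<N ∣

      i≤∣i∣ : ∀ i → i ℤ.≤ + ∣ i ∣
      i≤∣i∣ (+ n)    = ℤ.≤-refl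
      i≤∣i∣ -[1+ n ] = ℤ.-≤+

      shifted≡ : ∀ c m (m<N : m < N) → + shifted c m m<N ≡ Γ (digits c) m + + K m m<N
      shifted≡ c m m<N = ℤ.0≤i⇒+∣i∣≡i (subst (ℤ._≤ Γ (digits c) m + + K m m<N) (ℤ.+-inverseʳ (Γ (digits c) m))
        (ℤ.+-monoʳ-≤ (Γ (digits c) m) (ℤ.≤-trans (i≤∣i∣ (- Γ (digits c) m)) (ℤ.+≤+ (subst (_≤ K m m<N) (sym (ℤ.∣-i∣≡∣i∣ (Γ (digits c) m))) (Γ≤K c m m<N))))))

      shifted≤2K : ∀ c m (m<N : m < N) → shifted c m m<N ≤ 2 ℕ.* K m m<N
      shifted≤2K c m m<N = begin
        shifted c m m<N                         ≤⟨ ℤ.∣i+j∣≤∣i∣+∣j∣ (Γ (digits c) m) (+ K m m<N) ⟩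
        ∣ Γ (digits c) m ∣ ℕ.+ K m m<N          ≤⟨ ℕ.+-monoˡ-≤ (K m m<N) (Γ≤K c m m<N) ⟩
        K m m<N ℕ.+ K m m<N                     ≡⟨ cong (K m m<N ℕ.+_) (sym (ℕ.+-identityʳ (K m m<N))) ⟩
        2 ℕ.* K m m<N                           ∎
        where open ℕ.≤-Reasoning

      box : ∀ c m → m < N → ℕ
      box c m m<N = shifted c m m<N ℕ./ suc (G m m<N)

      -- In 2K/(G + 1) the factors β^m and C(U, m) cancel. What remains is less than 2IJZ · τ(U + 1)
      -- · ρ^n/ρ^m, and by `H₂` this is at most ρ^(n′ + n - m) = ρ^e.
      box-bound : ∀ c m e (m<N : m < N) → e ℕ.+ m ≡ n′ ℕ.+ n → box c m m<N < ρ ℕ.^ e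
      box-bound c m e m<N em≡ = ℕ.m<n*o⇒m/o<n (ℕ.≤-<-trans (shifted≤2K c m m<N) (ℕ.≰⇒> λ le → ℕ.<⇒≱ width-bound (begin
        ρ ℕ.^ e ℕ.* suc g ℕ.* (τ ℕ.* suc U ℕ.* C U m ℕ.* ρ ℕ.^ m)
          ≤⟨ ℕ.*-monoˡ-≤ (τ ℕ.* suc U ℕ.* C U m ℕ.* ρ ℕ.^ m) le ⟩
        2 ℕ.* k ℕ.* (τ ℕ.* suc U ℕ.* C U m ℕ.* ρ ℕ.^ m)
          ≡⟨ lem₁ k τ (suc U) (C U m) (ρ ℕ.^ m) ⟩
        k ℕ.* (C U m ℕ.* ρ ℕ.^ m) ℕ.* (2 ℕ.* (τ ℕ.* suc U))
          ≤⟨ ℕ.*-monoˡ-≤ (2 ℕ.* (τ ℕ.* suc U)) (ℕ.m/n*n≤m (I ℕ.* (J ℕ.* (X ℕ.* (β ℕ.^ m ℕ.* Z)))) (C U m ℕ.* ρ ℕ.^ m) {{nz}}) ⟩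
        I ℕ.* (J ℕ.* (X ℕ.* (β ℕ.^ m ℕ.* Z))) ℕ.* (2 ℕ.* (τ ℕ.* suc U))
          ≡⟨ lem₂ I J X (β ℕ.^ m) Z (τ ℕ.* suc U) ⟩
        2 ℕ.* (I ℕ.* (J ℕ.* Z)) ℕ.* (τ ℕ.* suc U) ℕ.* (X ℕ.* β ℕ.^ m)
          ≤⟨ ℕ.*-monoˡ-≤ (X ℕ.* β ℕ.^ m) H₂ ⟩
        ρ ℕ.^ n′ ℕ.* (X ℕ.* β ℕ.^ m)
          ≡⟨ trans (sym (ℕ.*-assoc (ρ ℕ.^ n′) X (β ℕ.^ m))) (cong (ℕ._* β ℕ.^ m) (sym (ℕ.^-distribˡ-+-* ρ n′ n))) ⟩
        ρ ℕ.^ (n′ ℕ.+ n) ℕ.* β ℕ.^ m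
          ∎)))
        where
        open ℕ.≤-Reasoning
        g = G m m<N
        k = K m m<N
        nz = ℕ.m*n≢0 (C U m) (ρ ℕ.^ m) {{CU m m<N}} {{ℕ.m^n≢0 ρ m}}
        lem₁ = ring3
        lem₂ = ring4
        lem₃ = ring5
        lem₄ = ring6
        width-bound : ρ ℕ.^ (n′ ℕ.+ n) ℕ.* β ℕ.^ m < ρ ℕ.^ e ℕ.* suc g ℕ.* (τ ℕ.* suc U ℕ.* C U m ℕ.* ρ ℕ.^ m)
        width-bound = begin-strict
          ρ ℕ.^ (n′ ℕ.+ n) ℕ.* β ℕ.^ m
            <⟨ ℕ.*-monoʳ-< (ρ ℕ.^ (n′ ℕ.+ n)) {{ℕ.m^n≢0 ρ (n′ ℕ.+ n)}} (n<[1+n/o]*o (β ℕ.^ m) (τ ℕ.* suc U ℕ.* C U m) {{ℕ.m*n≢0 _ _ {{ℕ.m*n≢0 τ (suc U)}} {{CU m m<N}}}}) ⟩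
          ρ ℕ.^ (n′ ℕ.+ n) ℕ.* (suc g ℕ.* (τ ℕ.* suc U ℕ.* C U m))
            ≡⟨ cong (ℕ._* (suc g ℕ.* (τ ℕ.* suc U ℕ.* C U m))) (trans (cong (ρ ℕ.^_) (sym em≡)) (ℕ.^-distribˡ-+-* ρ e m)) ⟩
          ρ ℕ.^ e ℕ.* ρ ℕ.^ m ℕ.* (suc g ℕ.* (τ ℕ.* suc U ℕ.* C U m))
            ≡⟨ sym (lem₄ (ρ ℕ.^ e) (suc g) (τ ℕ.* suc U ℕ.* C U m) (ρ ℕ.^ m)) ⟩
          ρ ℕ.^ e ℕ.* suc g ℕ.* (τ ℕ.* suc U ℕ.* C U m ℕ.* ρ ℕ.^ m) ∎

      -- Constraint number e concerns the Newton coefficient of index N − 1 − e.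
      index : ℕ → ℕ → ℕ
      index c e with suc (n′ ℕ.+ n ∸ e) ℕ.≤? N
      ... | yes lt = box c (n′ ℕ.+ n ∸ e) lt
      ... | no  _  = 0

      N≡′ : N ≡ suc (n′ ℕ.+ n)
      N≡′ = trans N≡ (cong (n ℕ.+_) (ℕ.+-identityʳ n))

      index-bound : ∀ c e → e < N → index c e < ρ ℕ.^ e
      index-bound c e e<N with suc (n′ ℕ.+ n ∸ e) ℕ.≤? N
      ... | yes lt = box-bound c (n′ ℕ.+ n ∸ e) e lt (ℕ.m+[n∸m]≡n (ℕ.≤-pred (subst (e <_) N≡′ e<N)))
      ... | no  _  = ℕ.m^n>0 ρ e

    abstract
      collision : ∃[ c ] ∃[ d ] (c < d × d < X ℕ.^ N × (∀ e → e < N → index c e ≡ index d e))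
      collision = pigeonhole-family N (X ℕ.^ N) (ρ ℕ.^_) index
        (subst (λ z → ∏ z (ρ ℕ.^_) < X ℕ.^ z) (sym N≡) (∏-powers-< ρ n 1<ρ (s≤s z≤n))) index-bound


    private
      c₁ = proj₁ collision
      c₂ = proj₁ (proj₂ collision)

    p : ℕ → ℕ → ℤ
    p i j = digits c₁ i j - digits c₂ i j

    ∣p∣≤X : ∀ i j → ∣ p i j ∣ ≤ ρ ℕ.^ suc n′
    ∣p∣≤X i j = subst (λ z → ∣ z ∣ ≤ X) (sym (ℤ.m-n≡m⊖n x y)) (ℕ.≤-trans (ℤ.∣m⊝n∣≤m⊔n x y) (ℕ.⊔-lub (digits≤X c₁ i j) (digits≤X c₂ i j)))
      where
      x = digit X (i ℕ.* J ℕ.+ j) c₁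
      y = digit X (i ℕ.* J ℕ.+ j) c₂

    p≢0 : ∃[ i ] ∃[ j ] (i < I × j < J × p i j ≢ 0ℤ)
    p≢0 with digits-differ X N c₁ c₂ (ℕ.<-trans c₁<c₂ c₂<) c₂< (ℕ.<⇒≢ c₁<c₂)
      where
      c₁<c₂ = proj₁ (proj₂ (proj₂ collision))
      c₂< = proj₁ (proj₂ (proj₂ (proj₂ collision)))
    ... | e , e<N , differ = e ℕ./ J , e ℕ.% J , ℕ.m<n*o⇒m/o<n e<N , ℕ.m%n<n e J ,
        λ eq → differ (ℤ.+-injective (trans (cong (λ z → + digit X z c₁) e≡) (trans (ℤ.i-j≡0⇒i≡j (digits c₁ (e ℕ./ J) (e ℕ.% J)) (digits c₂ (e ℕ./ J) (e ℕ.% J)) eq) (cong (λ z → + digit X z c₂) (sym e≡)))))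
      where
      instance
        J≢0 : NonZero J
        J≢0 = ℕ.≢-nonZero (λ { refl → ℕ.n≮0 (subst (e <_) (ℕ.*-zeroʳ I) e<N) })
      e≡ : e ≡ e ℕ./ J ℕ.* J ℕ.+ e ℕ.% J
      e≡ = trans (ℕ.m≡m%n+[m/n]*n e J) (ℕ.+-comm (e ℕ.% J) _)

    private
      Γ-difference : ∀ m → Γ p m ≡ Γ (digits c₁) m - Γ (digits c₂) m
      Γ-difference m = trans (∑-cong I (λ i _ → trans (∑-cong J (λ j _ → lem (digits c₁ i j) (digits c₂ i j) (coeff i j m))) (∑-- J (λ j → digits c₁ i j * coeff i j m) (λ j → digits c₂ i j * coeff i j m)))) (∑-- I (λ i → ∑ J (λ j → digits c₁ i j * coeff i j m)) (λ i → ∑ J (λ j → digits c₂ i j * coeff i j m)))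
        where lem = ring7

      ∣⊖∣ : ∀ m n → ∣ m ℤ.⊖ n ∣ ≡ ℕ.∣ m - n ∣
      ∣⊖∣ zero    zero    = refl
      ∣⊖∣ zero    (suc n) = refl
      ∣⊖∣ (suc m) zero    = refl
      ∣⊖∣ (suc m) (suc n) = trans (cong ∣_∣ (ℤ.[1+m]⊖[1+n]≡m⊖n m n)) (∣⊖∣ m n)

      same-boxes : ∀ m (m<N : m < N) → box c₁ m m<N ≡ box c₂ m m<N
      same-boxes m m<N = trans (sym (unfold c₁)) (trans (proj₂ (proj₂ (proj₂ (proj₂ collision))) e e<N) (unfold c₂))
        where
        e = n′ ℕ.+ n ∸ m
        e<N : e < N
        e<N = subst (e <_) (sym N≡′) (s≤s (ℕ.m∸n≤m (n′ ℕ.+ n) m))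
        m≡ : n′ ℕ.+ n ∸ e ≡ m
        m≡ = ℕ.m∸[m∸n]≡n (ℕ.≤-pred (subst (m <_) N≡′ m<N))
        unfold : ∀ c → index c e ≡ box c m m<N
        unfold c with suc (n′ ℕ.+ n ∸ e) ℕ.≤? N
        ... | yes lt = go lt m≡
          where go : ∀ {m′} (lt : m′ < N) → m′ ≡ m → box c m′ lt ≡ box c m m<N
                go lt refl = cong (box c m) (ℕ.≤-irrelevant lt m<N)
        ... | no  ¬lt = contradiction (subst (_< N) (sym m≡) m<N) ¬lt

      Γp≤G : ∀ m (m<N : m < N) → ∣ Γ p m ∣ ≤ G m m<N
      Γp≤G m m<N = ℕ.≤-pred (subst (_< suc (G m m<N)) eq (same-box (suc (G m m<N)) (shifted c₁ m m<N) (shifted c₂ m m<N) (same-boxes m m<N)))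
        where
        s₁ = shifted c₁ m m<N
        s₂ = shifted c₂ m m<N
        lem = ring8
        eq : ℕ.∣ s₁ - s₂ ∣ ≡ ∣ Γ p m ∣
        eq = trans (sym (∣⊖∣ s₁ s₂)) (cong ∣_∣ (trans (sym (ℤ.m-n≡m⊖n s₁ s₂)) (trans (cong₂ _-_ (shifted≡ c₁ m m<N) (shifted≡ c₂ m m<N))
          (trans (lem (Γ (digits c₁) m) (Γ (digits c₂) m) (+ K m m<N)) (sym (Γ-difference m))))))

      -- For m < N this is the width of a box. For m ≥ N it holds for all coefficients up to X,
      -- because the decay ρ^(-m) then suffices to apply `H₂` directly.
      Γp-bound : ∀ m u → u ≤ U → ∣ Γ p m ∣ ℕ.* (C u m ℕ.* (τ ℕ.* suc U)) ≤ β ℕ.^ m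
      Γp-bound m u u≤U with suc m ℕ.≤? N
      ... | yes m<N = begin
        ∣ Γ p m ∣ ℕ.* (C u m ℕ.* (τ ℕ.* suc U))   ≤⟨ ℕ.*-mono-≤ (Γp≤G m m<N) (ℕ.*-monoˡ-≤ (τ ℕ.* suc U) (C-mono m u≤U)) ⟩
        G m m<N ℕ.* (C U m ℕ.* (τ ℕ.* suc U))     ≡⟨ cong (G m m<N ℕ.*_) (ℕ.*-comm (C U m) (τ ℕ.* suc U)) ⟩
        G m m<N ℕ.* (τ ℕ.* suc U ℕ.* C U m)       ≤⟨ ℕ.m/n*n≤m (β ℕ.^ m) (τ ℕ.* suc U ℕ.* C U m) {{ℕ.m*n≢0 _ _ {{ℕ.m*n≢0 τ (suc U)}} {{CU m m<N}}}} ⟩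
        β ℕ.^ m                                   ∎
        where open ℕ.≤-Reasoning
      ... | no m≮N = ℕ.*-cancelʳ-≤ _ _ (ρ ℕ.^ m) {{ℕ.m^n≢0 ρ m}} (begin
        ∣ Γ p m ∣ ℕ.* (C u m ℕ.* (τ ℕ.* suc U)) ℕ.* ρ ℕ.^ m        ≡⟨ lem₁ ∣ Γ p m ∣ (C u m) (τ ℕ.* suc U) (ρ ℕ.^ m) ⟩
        ∣ Γ p m ∣ ℕ.* (C u m ℕ.* ρ ℕ.^ m) ℕ.* (τ ℕ.* suc U)        ≤⟨ ℕ.*-monoˡ-≤ (τ ℕ.* suc U) (Γ-bound p m u u≤U ∣p∣≤X) ⟩
        I ℕ.* (J ℕ.* (X ℕ.* (β ℕ.^ m ℕ.* Z))) ℕ.* (τ ℕ.* suc U)    ≤⟨ ℕ.m≤m+n _ _ ⟩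
        2 ℕ.* (I ℕ.* (J ℕ.* (X ℕ.* (β ℕ.^ m ℕ.* Z))) ℕ.* (τ ℕ.* suc U)) ≡⟨ lem₂ I J X (β ℕ.^ m) Z (τ ℕ.* suc U) ⟩
        2 ℕ.* (I ℕ.* (J ℕ.* Z)) ℕ.* (τ ℕ.* suc U) ℕ.* (X ℕ.* β ℕ.^ m) ≤⟨ ℕ.*-monoˡ-≤ (X ℕ.* β ℕ.^ m) H₂ ⟩
        ρ ℕ.^ n′ ℕ.* (X ℕ.* β ℕ.^ m)                               ≡⟨ trans (sym (ℕ.*-assoc (ρ ℕ.^ n′) X (β ℕ.^ m))) (cong (ℕ._* β ℕ.^ m) (sym (ℕ.^-distribˡ-+-* ρ n′ n))) ⟩
        ρ ℕ.^ (n′ ℕ.+ n) ℕ.* β ℕ.^ m                               ≤⟨ ℕ.*-monoˡ-≤ (β ℕ.^ m) (ℕ.^-monoʳ-≤ ρ (ℕ.≤-trans (ℕ.n≤1+n _) (subst (_≤ m) N≡′ (ℕ.≮⇒≥ m≮N)))) ⟩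
        ρ ℕ.^ m ℕ.* β ℕ.^ m                                        ≡⟨ ℕ.*-comm (ρ ℕ.^ m) (β ℕ.^ m) ⟩
        β ℕ.^ m ℕ.* ρ ℕ.^ m                                        ∎)
        where
        open ℕ.≤-Reasoning
        lem₁ = ring9
        lem₂ = ring10

    -- Each of the at most U + 1 terms of the Newton expansion is at most β^u/(τ(U + 1)).
    Φ-small : ∀ u → u ≤ U → ∣ Φ p u ∣ ℕ.* τ ≤ β ℕ.^ u
    Φ-small u u≤U = ℕ.*-cancelʳ-≤ _ _ (suc U) (begin
      ∣ Φ p u ∣ ℕ.* τ ℕ.* suc U     ≡⟨ ℕ.*-assoc ∣ Φ p u ∣ τ (suc U) ⟩
      ∣ Φ p u ∣ ℕ.* (τ ℕ.* suc U)   ≡⟨ cong (λ z → ∣ z ∣ ℕ.* (τ ℕ.* suc U)) (newton p u) ⟩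
      ∣ ∑ (suc u) (λ m → P (+ β) u m * Γ p m) ∣ ℕ.* (τ ℕ.* suc U) ≤⟨ ∣∑∣≤ (suc u) (λ m m<1+u → term m (ℕ.≤-pred m<1+u)) ⟩
      suc u ℕ.* β ℕ.^ u             ≤⟨ ℕ.*-monoˡ-≤ (β ℕ.^ u) (s≤s u≤U) ⟩
      suc U ℕ.* β ℕ.^ u             ≡⟨ ℕ.*-comm (suc U) (β ℕ.^ u) ⟩
      β ℕ.^ u ℕ.* suc U             ∎)
      where
      open ℕ.≤-Reasoning
      lem = ring11
      term : ∀ m → m ≤ u → ∣ P (+ β) u m * Γ p m ∣ ℕ.* (τ ℕ.* suc U) ≤ β ℕ.^ u
      term m m≤u = begin
        ∣ P (+ β) u m * Γ p m ∣ ℕ.* (τ ℕ.* suc U)                  ≡⟨ cong (ℕ._* (τ ℕ.* suc U)) (ℤ.abs-* (P (+ β) u m) (Γ p m)) ⟩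
        ∣ P (+ β) u m ∣ ℕ.* ∣ Γ p m ∣ ℕ.* (τ ℕ.* suc U)            ≡⟨ cong (λ z → z ℕ.* ∣ Γ p m ∣ ℕ.* (τ ℕ.* suc U)) ∣Pβ∣ ⟩
        C u m ℕ.* β ℕ.^ (u ∸ m) ℕ.* ∣ Γ p m ∣ ℕ.* (τ ℕ.* suc U)    ≡⟨ lem (C u m) (β ℕ.^ (u ∸ m)) ∣ Γ p m ∣ (τ ℕ.* suc U) ⟩
        β ℕ.^ (u ∸ m) ℕ.* (∣ Γ p m ∣ ℕ.* (C u m ℕ.* (τ ℕ.* suc U))) ≤⟨ ℕ.*-monoʳ-≤ (β ℕ.^ (u ∸ m)) (Γp-bound m u u≤U) ⟩
        β ℕ.^ (u ∸ m) ℕ.* β ℕ.^ m                                  ≡⟨ sym (ℕ.^-distribˡ-+-* β (u ∸ m) m) ⟩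
        β ℕ.^ (u ∸ m ℕ.+ m)                                        ≡⟨ cong (β ℕ.^_) (ℕ.m∸n+n≡m m≤u) ⟩
        β ℕ.^ u                                                    ∎
        where
        ∣Pβ∣ : ∣ P (+ β) u m ∣ ≡ C u m ℕ.* β ℕ.^ (u ∸ m)
        ∣Pβ∣ = trans (cong (λ z → ∣ P (+ β) z m ∣) (sym (ℕ.m+[n∸m]≡n m≤u))) (trans (∣P∣ (+ β) m (u ∸ m)) (cong (λ z → C z m ℕ.* β ℕ.^ (u ∸ m)) (ℕ.m+[n∸m]≡n m≤u)))

-- Determinants, leading coefficients and the Vandermonde determinant

module Determinants where

  open import Data.Nat as ℕ using (ℕ; zero; suc; _<_; z≤n; s≤s)
  import Data.Nat.Properties as ℕ
  open import Data.Nat.Divisibility using (_∣_)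
  open import Data.Integer as ℤ using (ℤ; +_; 0ℤ; 1ℤ; ∣_∣; _+_; _*_; -_; _-_; _^_)
  import Data.Integer.Properties as ℤ
  open import Data.Integer.Tactic.RingSolver using (solve-∀)
  open import Data.List using (List; []; _∷_; map; length; downFrom)
  open import Data.Nat.ListAction using (sum)
  open import Data.List.Relation.Unary.All as All using (All; []; _∷_)
  open import Data.List.Relation.Unary.AllPairs using ([]; _∷_)
  open import Data.List.Relation.Unary.Unique.Propositional using (Unique)
  open import Data.List.Membership.Propositional using (_∈_)
  open import Data.List.Relation.Unary.Any using (here; there)
  open import Data.Product using (_×_; _,_; ∃-syntax)
  open import Data.Sum using (inj₁; inj₂)
  open import Relation.Nullary using (contradiction)
  open import Relation.Binary.PropositionalEquality
  open Sums

  -- Expansion of a determinant along the column c; f gives the complementary minors.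
  op : (ℕ → ℤ) → (List ℕ → ℤ) → List ℕ → ℤ
  op c f []       = 0ℤ
  op c f (e ∷ es) = c e * f es - op c (λ es → f (e ∷ es)) es

  op-cong : ∀ c {f g} → (∀ es → f es ≡ g es) → ∀ es → op c f es ≡ op c g es
  op-cong c eq []       = refl
  op-cong c eq (e ∷ es) = cong₂ (λ a b → c e * a - b) (eq es) (op-cong c (λ es → eq (e ∷ es)) es)

  op-congᶜ : ∀ {c d} f es → (∀ e → c e ≡ d e) → op c f es ≡ op d f es
  op-congᶜ f []       eq = refl
  op-congᶜ f (e ∷ es) eq = cong₂ (λ a b → a * f es - b) (eq e) (op-congᶜ _ es eq)

  op-combine : ∀ c x f g es → op c (λ es → x * f es - g es) es ≡ x * op c f es - op c g es
  op-combine c x f g []       = sym (lem x)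
    where lem : ∀ x → x * 0ℤ - 0ℤ ≡ 0ℤ
          lem = solve-∀
  op-combine c x f g (e ∷ es) = trans (cong (_-_ (c e * (x * f es - g es))) (op-combine c x _ _ es)) (lem (c e) x (f es) (g es) _ _)
    where lem : ∀ c x a b s t → c * (x * a - b) - (x * s - t) ≡ x * (c * a - s) - (c * b - t)
          lem = solve-∀

  op-vanish : ∀ c f es → All (λ e → c e ≡ 0ℤ) es → op c f es ≡ 0ℤ
  op-vanish c f []       []       = refl
  op-vanish c f (e ∷ es) (z ∷ zs) = cong₂ (λ a b → a * f es - b) z (op-vanish c _ es zs)

  op-zero : ∀ c es → op c (λ _ → 0ℤ) es ≡ 0ℤ
  op-zero c []       = refl
  op-zero c (e ∷ es) = cong₂ _-_ (ℤ.*-zeroʳ (c e)) (op-zero c es)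

  op-linear : ∀ x c d f es → op (λ e → x * c e + d e) f es ≡ x * op c f es + op d f es
  op-linear x c d f []       = sym (lem x)
    where lem : ∀ x → x * 0ℤ + 0ℤ ≡ 0ℤ
          lem = solve-∀
  op-linear x c d f (e ∷ es) = trans (cong (_-_ ((x * c e + d e) * f es)) (op-linear x c d _ es)) (lem x (c e) (d e) (f es) _ _)
    where lem : ∀ x c d a s t → (x * c + d) * a - (x * s + t) ≡ x * (c * a - s) + (d * a - t)
          lem = solve-∀

  -- Choosing the rows for two columns in either order gives opposite signs. This is the alternating
  -- property: for c = d it yields x + x = 0.
  op-anticommute : ∀ c d f es → op c (op d f) es + op d (op c f) es ≡ 0ℤ
  op-anticommute c d f []       = refl
  op-anticommute c d f (e ∷ es) = begin
    (c e * op d f es - op c (λ es → d e * f es - op d fe es) es) + (d e * op c f es - op d (λ es → c e * f es - op c fe es) es)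
      ≡⟨ cong₂ (λ a b → (c e * op d f es - a) + (d e * op c f es - b)) (op-combine c (d e) f (op d fe) es) (op-combine d (c e) f (op c fe) es) ⟩
    (c e * op d f es - (d e * op c f es - op c (op d fe) es)) + (d e * op c f es - (c e * op d f es - op d (op c fe) es))
      ≡⟨ lem (c e * op d f es) (d e * op c f es) _ _ ⟩
    op c (op d fe) es + op d (op c fe) es
      ≡⟨ op-anticommute c d fe es ⟩
    0ℤ ∎
    where
    open ≡-Reasoning
    fe = λ es → f (e ∷ es)
    lem : ∀ a b s t → (a - (b - s)) + (b - (a - t)) ≡ s + t
    lem = solve-∀

  det : List (ℕ → ℤ) → List ℕ → ℤ
  det []       []      = 1ℤ
  det []       (_ ∷ _) = 0ℤ
  det (c ∷ cs) es      = op c (det cs) es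

  x+x≡0⇒x≡0 : ∀ {x} → x + x ≡ 0ℤ → x ≡ 0ℤ
  x+x≡0⇒x≡0 {x} eq with ℤ.i*j≡0⇒i≡0∨j≡0 (+ 2) {x} (trans (lem x) eq)
    where lem : ∀ x → + 2 * x ≡ x + x
          lem = solve-∀
  ... | inj₂ x≡0 = x≡0

  det-repeated : ∀ d {cs} → d ∈ cs → ∀ es → op d (det cs) es ≡ 0ℤ
  det-repeated d {.d ∷ cs} (here refl) es = x+x≡0⇒x≡0 (op-anticommute d d (det cs) es)
  det-repeated d {c ∷ cs} (there d∈cs) es = begin
    op d (op c (det cs)) es                          ≡⟨ lem _ _ (op-anticommute d c (det cs) es) ⟩
    - op c (op d (det cs)) es                        ≡⟨ cong -_ (trans (op-cong c (det-repeated d d∈cs) es) (op-zero c es)) ⟩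
    0ℤ                                               ∎
    where
    open ≡-Reasoning
    lem : ∀ x y → x + y ≡ 0ℤ → x ≡ - y
    lem x y eq = trans (lem′ x y) (trans (cong (_- y) eq) (ℤ.+-identityˡ (- y)))
      where lem′ : ∀ x y → x ≡ x + y - y
            lem′ = solve-∀

  ∑ˡ : List ℕ → (ℕ → ℤ) → ℤ
  ∑ˡ []       f = 0ℤ
  ∑ˡ (i ∷ is) f = f i + ∑ˡ is f

  module _ (c : ℕ → ℕ → ℤ) (z : ℕ → ℤ) where
    open import Data.List.Membership.Propositional.Properties using (∈-map⁺)

    op-combination : ∀ is js es → (∀ i → i ∈ is → i ∈ js) → op (λ e → ∑ˡ is (λ i → z i * c i e)) (det (map c js)) es ≡ 0ℤ
    op-combination []       js es _   = op-vanish _ _ es (All.universal (λ _ → refl) es)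
    op-combination (i ∷ is) js es inc = begin
      op (λ e → z i * c i e + ∑ˡ is (λ i → z i * c i e)) (det (map c js)) es
        ≡⟨ op-linear (z i) (c i) _ (det (map c js)) es ⟩
      z i * op (c i) (det (map c js)) es + op (λ e → ∑ˡ is (λ i → z i * c i e)) (det (map c js)) es
        ≡⟨ cong₂ (λ a b → z i * a + b) (det-repeated (c i) (∈-map⁺ c (inc i (here refl))) es) (op-combination is js es (λ i i∈ → inc i (there i∈))) ⟩
      z i * 0ℤ + 0ℤ ≡⟨ cong (_+ 0ℤ) (ℤ.*-zeroʳ (z i)) ⟩
      0ℤ ∎
      where open ≡-Reasoning

    -- Cramer's rule: the multiples of the other columns can be added without effect, and the
    -- combined first column vanishes on the rows es.
    det-kernel : ∀ i is es → All (λ e → ∑ˡ (i ∷ is) (λ i → z i * c i e) ≡ 0ℤ) es → z i * det (map c (i ∷ is)) es ≡ 0ℤ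
    det-kernel i is es rel = begin
      z i * op (c i) (det (map c is)) es
        ≡⟨ ℤ.+-identityʳ _ ⟨
      z i * op (c i) (det (map c is)) es + 0ℤ
        ≡⟨ cong (_+_ (z i * op (c i) (det (map c is)) es)) (op-combination is is es (λ _ i∈ → i∈)) ⟨
      z i * op (c i) (det (map c is)) es + op (λ e → ∑ˡ is (λ i → z i * c i e)) (det (map c is)) es
        ≡⟨ op-linear (z i) (c i) _ (det (map c is)) es ⟨
      op (λ e → ∑ˡ (i ∷ is) (λ i → z i * c i e)) (det (map c is)) es
        ≡⟨ op-vanish _ _ es rel ⟩
      0ℤ ∎
      where open ≡-Reasoning

  -- Top d c f: f is the polynomial c u^d + (lower terms), in Horner form.
  Top : ℕ → ℤ → (ℕ → ℤ) → Set
  Top zero    c f = ∀ u → f u ≡ c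
  Top (suc d) c f = ∃[ c₀ ] ∃[ g ] (Top d c g × (∀ u → f u ≡ c₀ + + u * g u))

  Top-cong : ∀ d {c c′ f g} → c ≡ c′ → (∀ u → f u ≡ g u) → Top d c f → Top d c′ g
  Top-cong zero    refl eq t              = λ u → trans (sym (eq u)) (t u)
  Top-cong (suc d) refl eq (c₀ , g , t , f≡) = c₀ , g , t , λ u → trans (sym (eq u)) (f≡ u)

  Top-raise : ∀ d {c f} → Top d c f → Top (suc d) 0ℤ f
  Top-raise zero    {c} t = c , (λ _ → 0ℤ) , (λ _ → refl) , λ u → trans (t u) (lem c (+ u))
    where lem : ∀ c u → c ≡ c + u * 0ℤ
          lem = solve-∀
  Top-raise (suc d) (c₀ , g , t , f≡) = c₀ , g , Top-raise d t , f≡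

  Top-raises : ∀ {d e c f} → d < e → Top d c f → Top e 0ℤ f
  Top-raises {d} {suc e} (s≤s d≤e) t with ℕ.m≤n⇒m<n∨m≡n d≤e
  ... | inj₁ d<e  = Top-raise e (Top-raises d<e t)
  ... | inj₂ refl = Top-raise e t

  Top-+ : ∀ d {c c′ f g} → Top d c f → Top d c′ g → Top d (c + c′) (λ u → f u + g u)
  Top-+ zero    t t′ = λ u → cong₂ _+_ (t u) (t′ u)
  Top-+ (suc d) (c₀ , g , t , f≡) (c₀′ , g′ , t′ , f≡′) = c₀ + c₀′ , (λ u → g u + g′ u) , Top-+ d t t′ ,
    λ u → trans (cong₂ _+_ (f≡ u) (f≡′ u)) (lem c₀ c₀′ (+ u) (g u) (g′ u))
    where lem : ∀ a b u g h → (a + u * g) + (b + u * h) ≡ (a + b) + u * (g + h)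
          lem = solve-∀

  Top-scale : ∀ d x {c f} → Top d c f → Top d (x * c) (λ u → x * f u)
  Top-scale zero    x t = λ u → cong (x *_) (t u)
  Top-scale (suc d) x (c₀ , g , t , f≡) = x * c₀ , (λ u → x * g u) , Top-scale d x t , λ u → trans (cong (x *_) (f≡ u)) (lem x c₀ (+ u) (g u))
    where lem : ∀ x a u g → x * (a + u * g) ≡ x * a + u * (x * g)
          lem = solve-∀

  Top-u* : ∀ d {c f} → Top d c f → Top (suc d) c (λ u → + u * f u)
  Top-u* d {f = f} t = 0ℤ , f , t , λ u → sym (ℤ.+-identityˡ (+ u * f u))

  Top-0 : ∀ d → Top d 0ℤ (λ _ → 0ℤ)
  Top-0 zero    = λ _ → refl
  Top-0 (suc d) = 0ℤ , (λ _ → 0ℤ) , Top-0 d , λ u → sym (trans (ℤ.+-identityˡ _) (ℤ.*-zeroʳ (+ u)))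

  Top-* : ∀ d d′ {c c′ f g} → Top d c f → Top d′ c′ g → Top (d ℕ.+ d′) (c * c′) (λ u → f u * g u)
  Top-* zero    d′ {c} {g = g} t t′ = Top-cong d′ refl (λ u → cong (_* g u) (sym (t u))) (Top-scale d′ c t′)
  Top-* (suc d) d′ {c} {c′} {f} {g} (c₀ , h , t , f≡) t′ = Top-cong (suc (d ℕ.+ d′)) (ℤ.+-identityˡ (c * c′))
    (λ u → trans (lem c₀ (+ u) (h u) (g u)) (cong (_* g u) (sym (f≡ u))))
    (Top-+ (suc (d ℕ.+ d′)) (Top-raises (s≤s (ℕ.m≤n+m d′ d)) (Top-scale d′ c₀ t′)) (Top-u* (d ℕ.+ d′) (Top-* d d′ t t′)))
    where lem : ∀ a u h g → a * g + u * (h * g) ≡ (a + u * h) * g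
          lem = solve-∀

  Top-shift : ∀ d k {c f} → Top d c f → Top d c (λ u → f (u ℕ.+ k))
  Top-shift zero    k t = λ u → t (u ℕ.+ k)
  Top-shift (suc d) k {c} {f} (c₀ , g , t , f≡) = Top-cong (suc d) (lem₀ c)
    (λ u → trans (lem c₀ (+ u) (+ k) (g (u ℕ.+ k))) (sym (f≡ (u ℕ.+ k))))
    (Top-+ (suc d) (Top-raises {0} {suc d} {c₀} {λ _ → c₀} (s≤s z≤n) (λ u → refl)) (Top-+ (suc d) (Top-raise d (Top-scale d (+ k) (Top-shift d k t))) (Top-u* d (Top-shift d k t))))
    where
    lem₀ : ∀ c → 0ℤ + (0ℤ + c) ≡ c
    lem₀ = solve-∀
    lem : ∀ a u k g → a + (k * g + u * g) ≡ a + (u + k) * g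
    lem = solve-∀

  Top-divide : ∀ d r {c f} → Top (suc d) c f → ∃[ g ] (Top d c g × (∀ u → f u ≡ (+ u - + r) * g u + f r))
  Top-divide zero r {c} (c₀ , g , t , f≡) = (λ _ → c) , (λ _ → refl) ,
    λ u → trans (trans (f≡ u) (cong (λ z → c₀ + + u * z) (t u))) (trans (lem c₀ (+ u) (+ r) c) (cong (_+_ ((+ u - + r) * c)) (sym (trans (f≡ r) (cong (λ z → c₀ + + r * z) (t r))))))
    where lem : ∀ a u r c → a + u * c ≡ (u - r) * c + (a + r * c)
          lem = solve-∀
  Top-divide (suc d) r {c} {f} (c₀ , g , t , f≡) with Top-divide d r t
  ... | h , th , g≡ = (λ u → g r + + u * h u) , (g r , h , th , λ _ → refl) ,
    λ u → trans (f≡ u) (trans (cong (λ z → c₀ + + u * z) (g≡ u)) (trans (lem c₀ (+ u) (+ r) (h u) (g r)) (cong (_+_ ((+ u - + r) * (g r + + u * h u))) (sym (f≡ r)))))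
    where lem : ∀ a u r h g → a + u * ((u - r) * h + g) ≡ (u - r) * (g + u * h) + (a + r * g)
          lem = solve-∀

  -- Division by u - x lowers the formal degree, keeps the top coefficient and preserves the
  -- remaining roots.
  Top-roots : ∀ d {c f} xs → Unique xs → d < length xs → All (λ x → f x ≡ 0ℤ) xs → Top d c f → c ≡ 0ℤ
  Top-roots zero    (x ∷ xs) _ _ (fx ∷ _) t = trans (sym (t x)) fx
  Top-roots (suc d) {c} {f} (x ∷ xs) (x∉ ∷ uniq) (s≤s d<) (fx ∷ fxs) t with Top-divide d x t
  ... | g , tg , f≡ = Top-roots d xs uniq d< (All.zipWith root (x∉ , fxs)) tg
    where
    root : ∀ {y} → (x ≢ y) × (f y ≡ 0ℤ) → g y ≡ 0ℤ
    root {y} (x≢y , fy) with ℤ.i*j≡0⇒i≡0∨j≡0 (+ y - + x) {g y} (trans (sym (ℤ.+-identityʳ _)) (trans (cong (_+_ ((+ y - + x) * g y)) (sym fx)) (trans (sym (f≡ y)) fy)))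
    ... | inj₁ eq = contradiction (sym (ℤ.+-injective (ℤ.i-j≡0⇒i≡j (+ y) (+ x) eq))) x≢y
    ... | inj₂ eq = eq

  Top-op : ∀ d D {C : ℕ → ℤ} {c : ℕ → ℕ → ℤ} {F : List ℕ → ℤ} {f : ℕ → List ℕ → ℤ} →
    (∀ e → Top d (C e) (λ u → c u e)) → (∀ es → Top D (F es) (λ u → f u es)) →
    ∀ es → Top (d ℕ.+ D) (op C F es) (λ u → op (c u) (f u) es)
  Top-op d D tc tf []       = Top-0 (d ℕ.+ D)
  Top-op d D {C} {c} {F} {f} tc tf (e ∷ es) = Top-cong (d ℕ.+ D) (lem (C e * F es) _) (λ u → lem (c u e * f u es) _)
    (Top-+ (d ℕ.+ D) (Top-* d D (tc e) (tf es)) (Top-scale (d ℕ.+ D) (- 1ℤ) (Top-op d D tc (λ es → tf (e ∷ es)) es)))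
    where lem : ∀ a b → a + - 1ℤ * b ≡ a - b
          lem = solve-∀

  Top-det : ∀ (deg : ℕ → ℕ) (C : ℕ → ℕ → ℤ) (c : ℕ → ℕ → ℕ → ℤ) is → (∀ i → i ∈ is → ∀ e → Top (deg i) (C i e) (λ u → c u i e)) →
    ∀ es → Top (sum (map deg is)) (det (map C is) es) (λ u → det (map (c u) is) es)
  Top-det deg C c []       t []      = λ _ → refl
  Top-det deg C c []       t (_ ∷ _) = λ _ → refl
  Top-det deg C c (i ∷ is) t es      = Top-op (deg i) (sum (map deg is)) (t i (here refl)) (Top-det deg C c is (λ i i∈ → t i (there i∈))) es

  power : ℕ → ℕ → ℤ
  power x e = (+ x) ^ e

  Top-power : ∀ d → Top d 1ℤ (λ u → power u d)
  Top-power zero    = λ _ → refl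
  Top-power (suc d) = Top-u* d (Top-power d)

  -- In a Vandermonde determinant only the row with the highest exponent contributes to the top
  -- coefficient; this disposes of the other rows.
  Top-op-power-low : ∀ d (f : List ℕ → ℤ) es → All (_< d) es → Top d 0ℤ (λ u → op (power u) f es)
  Top-op-power-low d f []       []        = Top-0 d
  Top-op-power-low d f (e ∷ es) (e<d ∷ lt) = Top-cong d refl (λ u → lem (power u e) (f es) _)
    (Top-+ d (Top-scale-0 (Top-scale d (f es) (Top-raises e<d (Top-power e)))) (Top-scale d (- 1ℤ) (Top-op-power-low d (λ es → f (e ∷ es)) es lt)))
    where
    lem : ∀ a b c → b * a + - 1ℤ * c ≡ a * b - c
    lem = solve-∀
    Top-scale-0 : ∀ {g} → Top d (f es * 0ℤ) g → Top d 0ℤ g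
    Top-scale-0 = Top-cong d (ℤ.*-zeroʳ (f es)) (λ _ → refl)

  downFrom-< : ∀ n → All (_< n) (downFrom n)
  downFrom-< zero    = []
  downFrom-< (suc n) = ℕ.≤-refl ∷ All.map ℕ.m<n⇒m<1+n (downFrom-< n)

  -- As a polynomial in its first node, the Vandermonde determinant has the remaining nodes as roots.
  vandermonde≢0 : ∀ xs → Unique xs → det (map power xs) (downFrom (length xs)) ≢ 0ℤ
  vandermonde≢0 []       _           ()
  vandermonde≢0 (x ∷ xs) (x∉ ∷ uniq) eq = vandermonde≢0 xs uniq (Top-roots n {D} {V} (x ∷ xs) (x∉ ∷ uniq) ℕ.≤-refl (eq ∷ All.tabulate (λ y∈ → det-repeated (power _) (∈-map⁺ power y∈) (downFrom (suc n)))) top)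
    where
    open import Data.List.Membership.Propositional.Properties using (∈-map⁺)
    n = length xs
    D = det (map power xs) (downFrom n)
    V : ℕ → ℤ
    V u = op (power u) (det (map power xs)) (downFrom (suc n))
    lem : ∀ a b c → b * a + - 1ℤ * c ≡ a * b - c
    lem = solve-∀
    lem′ : ∀ a → a * 1ℤ + - 1ℤ * 0ℤ ≡ a
    lem′ = solve-∀
    top : Top n D V
    top = Top-cong n (lem′ D) (λ u → lem (power u n) D _)
      (Top-+ n (Top-scale n D (Top-power n)) (Top-scale n (- 1ℤ) (Top-op-power-low n (λ es → det (map power xs) (n ∷ es)) (downFrom n) (downFrom-< n))))

-- Zero estimate for exponential polynomials

module ZeroEstimate where

  open import Data.Nat as ℕ using (ℕ; zero; suc; _≤_; _<_; z≤n; s≤s; _∸_; _!)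
  import Data.Nat.Properties as ℕ
  open import Data.Nat.Divisibility using (_∣_; m≤n⇒m!∣n!; quotient)
  open import Data.Nat.ListAction using (sum)
  open import Data.Integer as ℤ using (ℤ; +_; 0ℤ; 1ℤ; ∣_∣; _+_; _*_; -_; _-_; _^_)
  import Data.Integer.Properties as ℤ
  open import Data.Integer.Tactic.RingSolver using (solve-∀)
  open import Data.List using (List; []; _∷_; map; length; downFrom)
  open import Data.List.Properties using (length-map; map-∘)
  open import Data.List.Relation.Unary.All as All using (All; []; _∷_)
  open import Data.List.Relation.Unary.AllPairs using ([]; _∷_)
  open import Data.List.Relation.Unary.Unique.Propositional using (Unique)
  open import Data.List.Relation.Unary.Unique.Propositional.Properties using (map⁺)
  open import Data.List.Membership.Propositional using (_∈_)
  open import Data.List.Relation.Unary.Any using (here; there)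
  open import Data.Product using (Σ; _×_; _,_; ∃-syntax; proj₁; proj₂)
  open import Data.Sum using (_⊎_; inj₁; inj₂)
  open import Relation.Binary.Definitions using (tri<; tri≈; tri>)
  open import Relation.Nullary using (yes; no; contradiction)
  open import Relation.Binary.PropositionalEquality
  open Sums
  open Determinants

  -- Stated in ℤ because u - d is negative for u < d, where both sides vanish.
  C-absorb : ∀ u d → + C u (suc d) * + suc d ≡ + C u d * (+ u - + d)
  C-absorb zero    zero    = refl
  C-absorb zero    (suc d) = refl
  C-absorb (suc u) zero    = trans (lem₁ (+ C u 1) (+ C u 0)) (trans (cong (_+ + C u 0) (C-absorb u zero)) (lem₂ (+ C u 0) (+ u)))
    where
    lem₁ : ∀ a b → (a + b) * 1ℤ ≡ a * 1ℤ + b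
    lem₁ = solve-∀
    lem₂ : ∀ c u → c * (u - 0ℤ) + c ≡ c * (1ℤ + u - 0ℤ)
    lem₂ = solve-∀
  C-absorb (suc u) (suc d) = begin
    (+ C u (suc (suc d)) + + C u (suc d)) * + suc (suc d)
      ≡⟨ lem₁ (+ C u (suc (suc d))) (+ C u (suc d)) (+ suc (suc d)) ⟩
    + C u (suc (suc d)) * + suc (suc d) + + C u (suc d) * + suc (suc d)
      ≡⟨ cong (_+ + C u (suc d) * + suc (suc d)) (C-absorb u (suc d)) ⟩
    + C u (suc d) * (+ u - + suc d) + + C u (suc d) * + suc (suc d)
      ≡⟨ lem₂ (+ C u (suc d)) (+ u) (+ d) ⟩
    + C u (suc d) * (+ u - + d) + + C u (suc d) * + suc d
      ≡⟨ cong (_+_ (+ C u (suc d) * (+ u - + d))) (C-absorb u d) ⟩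
    + C u (suc d) * (+ u - + d) + + C u d * (+ u - + d)
      ≡⟨ lem₃ (+ C u (suc d)) (+ C u d) (+ u) (+ d) ⟩
    (+ C u (suc d) + + C u d) * (+ suc u - + suc d) ∎
    where
    open ≡-Reasoning
    lem₁ : ∀ a b c → (a + b) * c ≡ a * c + b * c
    lem₁ = solve-∀
    lem₂ : ∀ c u d → c * (u - (1ℤ + d)) + c * (1ℤ + (1ℤ + d)) ≡ c * (u - d) + c * (1ℤ + d)
    lem₂ = solve-∀
    lem₃ : ∀ a b u d → a * (u - d) + b * (u - d) ≡ (a + b) * (1ℤ + u - (1ℤ + d))
    lem₃ = solve-∀

  Top-C : ∀ d → Top d 1ℤ (λ u → + (d !) * + C u d)
  Top-C zero    = λ u → cong (λ z → 1ℤ * + z) (C0 u)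
    where C0 : ∀ u → C u 0 ≡ 1
          C0 zero    = refl
          C0 (suc u) = C0 u
  Top-C (suc d) = Top-cong (suc d) refl (λ u → sym (trans (cong (_* + C u (suc d)) (ℤ.pos-* (suc d) (d !))) (trans (lem₁ (+ suc d) (+ (d !)) (+ C u (suc d)))
      (trans (cong (+ (d !) *_) (C-absorb u d)) (lem₂ (+ (d !)) (+ C u d) (+ u) (+ d))))))
    (Top-* 1 d {c = 1ℤ} {f = λ u → + u - + d} (- + d , (λ _ → 1ℤ) , (λ _ → refl) , λ u → lem₃ (+ u) (+ d)) (Top-C d))
    where
    lem₁ : ∀ s f c → s * f * c ≡ f * (c * s)
    lem₁ = solve-∀
    lem₂ : ∀ f c u d → f * (c * (u - d)) ≡ (u - d) * (f * c)
    lem₂ = solve-∀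
    lem₃ : ∀ u d → u - d ≡ - d + u * 1ℤ
    lem₃ = solve-∀

  product≢0 : ∀ {a b} → a ≢ 0ℤ → b ≢ 0ℤ → a * b ≢ 0ℤ
  product≢0 {a} {b} a≢0 b≢0 eq with ℤ.i*j≡0⇒i≡0∨j≡0 a {b} eq
  ... | inj₁ z = a≢0 z
  ... | inj₂ z = b≢0 z

  -- The leading coefficient of a combination of binomial coefficients, after clearing denominators.
  leading : ∀ J (p : ℕ → ℤ) n → n ≤ J →
    (∀ j → j < n → p j ≡ 0ℤ) ⊎ (∃[ d ] ∃[ t ] (d < n × t ≢ 0ℤ × Top d t (λ u → + (J !) * ∑ n (λ j → p j * + C u j))))
  leading J p zero    _   = inj₁ λ j ()
  leading J p (suc n) n<J with p n ℤ.≟ 0ℤ | leading J p n (ℕ.<⇒≤ n<J)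
  ... | yes pn≡0 | inj₁ zeros = inj₁ λ j j<1+n → case j (ℕ.m≤n⇒m<n∨m≡n (ℕ.≤-pred j<1+n))
    where case : ∀ j → j < n ⊎ j ≡ n → p j ≡ 0ℤ
          case j (inj₁ j<n)  = zeros j j<n
          case j (inj₂ refl) = pn≡0
  ... | yes pn≡0 | inj₂ (d , t , d<n , t≢0 , top) = inj₂ (d , t , ℕ.m<n⇒m<1+n d<n , t≢0 ,
    Top-cong d refl (λ u → cong (+ (J !) *_) (sym (trans (cong (λ z → ∑ n (λ j → p j * + C u j) + z * + C u n) pn≡0) (ℤ.+-identityʳ _)))) top)
  ... | no pn≢0 | prev = inj₂ (n , q * p n , ℕ.≤-refl , product≢0 q≢0 pn≢0 , Top-cong n (lem₀ (q * p n)) (λ u → eq u) (Top-+ n (lower prev) new))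
    where
    n!∣J! = m≤n⇒m!∣n! (ℕ.<⇒≤ n<J)
    q = + quotient n!∣J!
    J!≡ : + (J !) ≡ q * + (n !)
    J!≡ = trans (cong +_ (_∣_.equality n!∣J!)) (ℤ.pos-* (quotient n!∣J!) (n !))
    q≢0 : q ≢ 0ℤ
    q≢0 q≡0 = ℕ.m<n⇒n≢0 (ℕ.1≤n! J) (ℤ.+-injective (trans J!≡ (cong (_* + (n !)) q≡0)))
    lem₀ : ∀ a → 0ℤ + a * 1ℤ ≡ a
    lem₀ = solve-∀
    lem : ∀ J s p c → J * s + J * (p * c) ≡ J * (s + p * c)
    lem = solve-∀
    lem′ : ∀ q p f c → q * p * (f * c) ≡ q * f * (p * c)
    lem′ = solve-∀
    new : Top n (q * p n * 1ℤ) (λ u → q * p n * (+ (n !) * + C u n))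
    new = Top-scale n (q * p n) (Top-C n)
    lower : (∀ j → j < n → p j ≡ 0ℤ) ⊎ (∃[ d ] ∃[ t ] (d < n × t ≢ 0ℤ × Top d t (λ u → + (J !) * ∑ n (λ j → p j * + C u j)))) →
            Top n 0ℤ (λ u → + (J !) * ∑ n (λ j → p j * + C u j))
    lower (inj₁ zeros) = Top-cong n refl (λ u → sym (trans (cong (+ (J !) *_) (trans (∑-cong n (λ j j<n → cong (_* + C u j) (zeros j j<n))) (∑-zero n))) (ℤ.*-zeroʳ (+ (J !))))) (Top-0 n)
    lower (inj₂ (d , t , d<n , _ , top)) = Top-raises d<n top
    eq : ∀ u → + (J !) * ∑ n (λ j → p j * + C u j) + q * p n * (+ (n !) * + C u n) ≡ + (J !) * ∑ (suc n) (λ j → p j * + C u j)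
    eq u = trans (cong (_+_ (+ (J !) * ∑ n (λ j → p j * + C u j))) (trans (lem′ q (p n) (+ (n !)) (+ C u n)) (cong (_* (p n * + C u n)) (sym J!≡)))) (lem (+ (J !)) _ (p n) (+ C u n))

  op-scaleᶠ : ∀ c x f es → op c (λ es → x * f es) es ≡ x * op c f es
  op-scaleᶠ c x f es = trans (op-cong c (λ es → sym (ℤ.+-identityʳ (x * f es))) es)
    (trans (op-combine c x f (λ _ → 0ℤ) es) (trans (cong (_-_ (x * op c f es)) (op-zero c es)) (ℤ.+-identityʳ _)))

  ∏ˡ : List ℕ → (ℕ → ℤ) → ℤ
  ∏ˡ []       t = 1ℤ
  ∏ˡ (i ∷ is) t = t i * ∏ˡ is t

  det-scale : ∀ (t : ℕ → ℤ) (c : ℕ → ℕ → ℤ) is es → det (map (λ i e → t i * c i e) is) es ≡ ∏ˡ is t * det (map c is) es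
  det-scale t c []       es = sym (ℤ.*-identityˡ _)
  det-scale t c (i ∷ is) es = begin
    op (λ e → t i * c i e) (det (map (λ i e → t i * c i e) is)) es
      ≡⟨ op-cong _ (det-scale t c is) es ⟩
    op (λ e → t i * c i e) (λ es → ∏ˡ is t * det (map c is) es) es
      ≡⟨ op-scaleᶠ _ (∏ˡ is t) (det (map c is)) es ⟩
    ∏ˡ is t * op (λ e → t i * c i e) (det (map c is)) es
      ≡⟨ cong (∏ˡ is t *_) (trans (op-congᶜ _ es (λ e → sym (ℤ.+-identityʳ (t i * c i e)))) (trans (op-linear (t i) (c i) (λ _ → 0ℤ) _ es) (trans (cong (_+_ (t i * op (c i) (det (map c is)) es)) (op-vanish _ _ es (All.universal (λ _ → refl) es))) (ℤ.+-identityʳ _)))) ⟩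
    ∏ˡ is t * (t i * op (c i) (det (map c is)) es)
      ≡⟨ lem (∏ˡ is t) (t i) _ ⟩
    t i * ∏ˡ is t * op (c i) (det (map c is)) es ∎
    where
    open ≡-Reasoning
    lem : ∀ a b c → a * (b * c) ≡ b * a * c
    lem = solve-∀

  ∏ˡ≢0 : ∀ is t → (∀ i → i ∈ is → t i ≢ 0ℤ) → ∏ˡ is t ≢ 0ℤ
  ∏ˡ≢0 []       t _  ()
  ∏ˡ≢0 (i ∷ is) t nz = product≢0 (nz i (here refl)) (∏ˡ≢0 is t (λ i i∈ → nz i (there i∈)))

  det-dependent : ∀ c z is es {i} → i ∈ is → (∀ i → z i ≢ 0ℤ) → All (λ e → ∑ˡ is (λ i → z i * c i e) ≡ 0ℤ) es → det (map c is) es ≡ 0ℤ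
  det-dependent c z (i ∷ is) es _ z≢0 rows with ℤ.i*j≡0⇒i≡0∨j≡0 (z i) (det-kernel c z i is es rows)
  ... | inj₁ z≡0 = contradiction z≡0 (z≢0 i)
  ... | inj₂ w≡0 = w≡0

  module _ (I J k : ℕ) (p : ℕ → ℕ → ℤ) where

    Q : ℕ → ℕ → ℤ
    Q i u = ∑ J (λ j → p i j * + C u j)

    Vanishes Leads : ℕ → Set
    Vanishes i = ∀ j → j < J → p i j ≡ 0ℤ
    Leads i = ∃[ d ] ∃[ t ] (d < J × t ≢ 0ℤ × Top d t (λ u → + (J !) * Q i u))

    classify : ∀ i → Vanishes i ⊎ Leads i
    classify i = leading J (p i) J ℕ.≤-refl

    deg : ℕ → ℕ
    deg i with classify i
    ... | inj₁ _ = 0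
    ... | inj₂ (d , _) = d

    lc : ℕ → ℤ
    lc i with classify i
    ... | inj₁ _ = 0ℤ
    ... | inj₂ (_ , t , _) = t

    Regular : ℕ → Set
    Regular i = deg i < J × lc i ≢ 0ℤ × Top (deg i) (lc i) (λ u → + (J !) * Q i u)

    regular : ∀ i → Vanishes i ⊎ Regular i
    regular i with classify i
    ... | inj₁ z = inj₁ z
    ... | inj₂ (d , t , d<J , t≢0 , top) = inj₂ (d<J , t≢0 , top)

    -- Collects the indices i < n of nonzero polynomials Q i. Only these may form columns of the
    -- determinant, since a zero polynomial would make its top coefficient vanish.
    record Support (n : ℕ) : Set where
      field
        is      : List ℕ
        unique  : Unique is
        small   : All (_< n) is
        reg     : All Regular is
        short   : length is ≤ n
        total   : ∀ f → (∀ i → Vanishes i → f i ≡ 0ℤ) → ∑ n f ≡ ∑ˡ is f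
        covers  : ∀ i → i < n → Vanishes i ⊎ i ∈ is

    support : ∀ n → Support n
    support zero = record { is = [] ; unique = [] ; small = [] ; reg = [] ; short = z≤n ; total = λ _ _ → refl ; covers = λ _ () }
    support (suc n) with support n | regular n
    ... | s | inj₁ z = record { is = is ; unique = unique ; small = All.map ℕ.m<n⇒m<1+n small ; reg = reg ; short = ℕ.m≤n⇒m≤1+n short
        ; total = λ f f0 → trans (cong (_+_ (∑ n f)) (f0 n z)) (trans (ℤ.+-identityʳ _) (total f f0))
        ; covers = λ i i<1+n → case i (ℕ.m≤n⇒m<n∨m≡n (ℕ.≤-pred i<1+n)) }
      where
      open Support s
      case : ∀ i → i < n ⊎ i ≡ n → Vanishes i ⊎ i ∈ is
      case i (inj₁ i<n)  = covers i i<n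
      case i (inj₂ refl) = inj₁ z
    ... | s | inj₂ r = record { is = n ∷ is ; unique = All.map (λ i<n n≡i → ℕ.<-irrefl (sym n≡i) i<n) small ∷ unique
        ; small = ℕ.≤-refl ∷ All.map ℕ.m<n⇒m<1+n small ; reg = r ∷ reg ; short = s≤s short
        ; total = λ f f0 → trans (cong (_+ f n) (total f f0)) (ℤ.+-comm (∑ˡ is f) (f n))
        ; covers = λ i i<1+n → case i (ℕ.m≤n⇒m<n∨m≡n (ℕ.≤-pred i<1+n)) }
      where
      open Support s
      case : ∀ i → i < n ⊎ i ≡ n → Vanishes i ⊎ i ∈ (n ∷ is)
      case i (inj₁ i<n) with covers i i<n
      ... | inj₁ z  = inj₁ z
      ... | inj₂ i∈ = inj₂ (there i∈)
      case i (inj₂ refl) = inj₂ (here refl)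

    -- The points at which P(u, Y) = Σ Q_i(u) Y^i vanishes for some Y together with its I − 1 shifts by (k, 3).
    Zeros : ℕ → Set
    Zeros u = Σ (ℕ → ℤ) λ z → ((∀ i → z i ≢ 0ℤ) × (∀ e → e < I → ∑ I (λ i → z i * (Q i (u ℕ.+ k ℕ.* e) * power (3 ℕ.^ i) e)) ≡ 0ℤ))

    -- At every given point the weights make the columns of the matrix of the Q_i(u + ke) · 3^(ie)
    -- dependent, so its determinant vanishes there. As a polynomial in u the determinant has degree
    -- at most I(J - 1). Shifting u does not change leading coefficients, so its top coefficient is
    -- the product of those of the Q_i and the Vandermonde determinant of the distinct numbers 3^i.
    zero-estimate : ∀ us → Unique us → I ℕ.* (J ∸ 1) < length us → All Zeros us → ∀ i → i < I → Vanishes i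
    zero-estimate us uniq long zeros i i<I with Support.covers (support I) i i<I
    ... | inj₁ z   = z
    ... | inj₂ i∈₀ = contradiction (Top-roots (sum (map deg is)) us uniq (ℕ.≤-<-trans degree-bound long) (All.map (λ {u} → W-root {u}) zeros) W-top) top≢0
      where
      open Support (support I)
      -- As many rows as there are columns left; `short` guarantees that the relations cover these
      -- rows.
      L = downFrom (length is)
      c : ℕ → ℕ → ℕ → ℤ
      c u i e = + (J !) * Q i (u ℕ.+ k ℕ.* e) * power (3 ℕ.^ i) e
      Cₜ : ℕ → ℕ → ℤ
      Cₜ i e = lc i * power (3 ℕ.^ i) e
      W : ℕ → ℤ
      W u = det (map (c u) is) L
      W-top : Top (sum (map deg is)) (det (map Cₜ is) L) W
      W-top = Top-det deg Cₜ c is (λ i i∈ e → Top-cong (deg i) (ℤ.*-comm (power (3 ℕ.^ i) e) (lc i)) (λ u → ℤ.*-comm (power (3 ℕ.^ i) e) _)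
        (Top-scale (deg i) (power (3 ℕ.^ i) e) (Top-shift (deg i) (k ℕ.* e) (proj₂ (proj₂ (All.lookup reg i∈)))))) L
      3^-injective : ∀ {i j} → 3 ℕ.^ i ≡ 3 ℕ.^ j → i ≡ j
      3^-injective {i} {j} eq with ℕ.<-cmp i j
      ... | tri< lt _ _ = contradiction eq (ℕ.<⇒≢ (ℕ.^-monoʳ-< 3 (s≤s (s≤s z≤n)) lt))
      ... | tri≈ _ e _  = e
      ... | tri> _ _ gt = contradiction (sym eq) (ℕ.<⇒≢ (ℕ.^-monoʳ-< 3 (s≤s (s≤s z≤n)) gt))
      top≢0 : det (map Cₜ is) L ≢ 0ℤ
      top≢0 eq = product≢0 (∏ˡ≢0 is lc (λ i i∈ → proj₁ (proj₂ (All.lookup reg i∈))))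
        (λ eq′ → vandermonde≢0 (map (3 ℕ.^_) is) (map⁺ 3^-injective unique)
           (trans (cong₂ det (sym (map-∘ is)) (cong downFrom (length-map (3 ℕ.^_) is))) eq′))
        (trans (sym (det-scale lc (λ i → power (3 ℕ.^ i)) is L)) eq)
      degree-bound : sum (map deg is) ≤ I ℕ.* (J ∸ 1)
      degree-bound = ℕ.≤-trans (go is reg) (ℕ.*-monoˡ-≤ (J ∸ 1) short)
        where
        go : ∀ is → All Regular is → sum (map deg is) ≤ length is ℕ.* (J ∸ 1)
        go []       []       = z≤n
        go (i ∷ is) (r ∷ rs) = ℕ.+-mono-≤ (ℕ.<⇒≤pred (proj₁ r)) (go is rs)
      W-root : ∀ {u} → Zeros u → W u ≡ 0ℤ
      W-root {u} (z , z≢0 , rel) = det-dependent (c u) z is L i∈₀ z≢0 (All.map (λ e< → rows _ (ℕ.<-≤-trans e< short)) (downFrom-< (length is)))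
        where
        lem : ∀ z J q x → z * (J * q * x) ≡ J * (z * (q * x))
        lem = solve-∀
        rows : ∀ e → e < I → ∑ˡ is (λ i → z i * c u i e) ≡ 0ℤ
        rows e e<I = trans (sym (total _ vanishing)) (trans (∑-cong I (λ i _ → lem (z i) (+ (J !)) (Q i (u ℕ.+ k ℕ.* e)) (power (3 ℕ.^ i) e)))
          (trans (∑-*ˡ I (+ (J !)) _) (trans (cong (+ (J !) *_) (rel e e<I)) (ℤ.*-zeroʳ (+ (J !))))))
          where
          vanishing : ∀ i → Vanishes i → z i * c u i e ≡ 0ℤ
          vanishing i v = trans (cong (λ q → z i * (+ (J !) * q * power (3 ℕ.^ i) e)) (trans (∑-cong J (λ j j<J → cong (_* + C (u ℕ.+ k ℕ.* e) j) (v j j<J))) (∑-zero J))) (lem₀ (z i) (+ (J !)) (power (3 ℕ.^ i) e))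
            where lem₀ : ∀ z J x → z * (J * 0ℤ * x) ≡ 0ℤ
                  lem₀ = solve-∀

-- Gelfond's method: vanishing near the multiples of k

module Gelfond where

  open import Data.Nat as ℕ using (ℕ; zero; suc; _≤_; _<_; z≤n; s≤s; NonZero; _∸_; _!)
  import Data.Nat.Properties as ℕ
  import Data.Nat.DivMod as ℕ
  open import Data.Integer as ℤ using (ℤ; +_; 0ℤ; ∣_∣; _+_; _*_; -_; _-_; _^_)
  import Data.Integer.Properties as ℤ
  open import Data.Integer.Tactic.RingSolver using (solve-∀)
  import Data.Nat.Tactic.RingSolver as ℕS
  open import Data.List using (List; []; _∷_; applyUpTo)
  open import Data.List.Properties using (length-applyUpTo)
  open import Data.List.Relation.Unary.All as All using (All; []; _∷_)
  import Data.List.Relation.Unary.All.Properties as All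
  open import Data.List.Relation.Unary.Unique.Propositional using (Unique)
  import Data.List.Relation.Unary.Unique.Propositional.Properties as Unique
  open import Data.Product using (Σ; _×_; _,_; ∃-syntax)
  open import Data.Sum using (_⊎_; inj₁; inj₂)
  open import Data.Empty using (⊥)
  open import Relation.Nullary using (contradiction)
  open import Relation.Binary.PropositionalEquality
  open Arithmetic using (^-distribʳ-*)
  open Sums
  open Bounds
  open Determinants
  open ZeroEstimate
  open AuxiliaryFunction using (module Auxiliary)

  pos-^ : ∀ x n → (+ x) ^ n ≡ + (x ℕ.^ n)
  pos-^ x zero    = refl
  pos-^ x (suc n) = trans (cong (+ x *_) (pos-^ x n)) (sym (ℤ.pos-* x (x ℕ.^ n)))

  -- The estimate |x^n - y^n| ≤ nE M^(n-1), multiplied by M to avoid n - 1 in the exponent.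
  power-difference : ∀ x y E M n → x ≤ M → y ≤ M → ∣ + x - + y ∣ ≤ E → ∣ + (x ℕ.^ n) - + (y ℕ.^ n) ∣ ℕ.* M ≤ n ℕ.* E ℕ.* M ℕ.^ n
  power-difference x y E M zero    _   _   _  = z≤n
  power-difference x y E M (suc n) x≤M y≤M dE = begin
    ∣ + (x ℕ.* x ℕ.^ n) - + (y ℕ.* y ℕ.^ n) ∣ ℕ.* M
      ≡⟨ cong (λ z → ∣ z ∣ ℕ.* M) (trans (cong₂ _-_ (ℤ.pos-* x (x ℕ.^ n)) (ℤ.pos-* y (y ℕ.^ n))) (lem (+ x) (+ y) (+ (x ℕ.^ n)) (+ (y ℕ.^ n)))) ⟩
    ∣ + x * (+ (x ℕ.^ n) - + (y ℕ.^ n)) + (+ x - + y) * + (y ℕ.^ n) ∣ ℕ.* M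
      ≤⟨ ℕ.*-monoˡ-≤ M (ℤ.∣i+j∣≤∣i∣+∣j∣ (+ x * (+ (x ℕ.^ n) - + (y ℕ.^ n))) _) ⟩
    (∣ + x * (+ (x ℕ.^ n) - + (y ℕ.^ n)) ∣ ℕ.+ ∣ (+ x - + y) * + (y ℕ.^ n) ∣) ℕ.* M
      ≡⟨ cong (ℕ._* M) (cong₂ ℕ._+_ (ℤ.abs-* (+ x) _) (ℤ.abs-* (+ x - + y) _)) ⟩
    (x ℕ.* d ℕ.+ ∣ + x - + y ∣ ℕ.* y ℕ.^ n) ℕ.* M
      ≤⟨ ℕ.*-monoˡ-≤ M (ℕ.+-mono-≤ (ℕ.*-monoˡ-≤ d x≤M) (ℕ.*-mono-≤ dE (ℕ.^-monoˡ-≤ n y≤M))) ⟩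
    (M ℕ.* d ℕ.+ E ℕ.* M ℕ.^ n) ℕ.* M
      ≡⟨ lem₁ M d E (M ℕ.^ n) ⟩
    M ℕ.* (d ℕ.* M) ℕ.+ E ℕ.* (M ℕ.* M ℕ.^ n)
      ≤⟨ ℕ.+-monoˡ-≤ _ (ℕ.*-monoʳ-≤ M (power-difference x y E M n x≤M y≤M dE)) ⟩
    M ℕ.* (n ℕ.* E ℕ.* M ℕ.^ n) ℕ.+ E ℕ.* (M ℕ.* M ℕ.^ n)
      ≡⟨ lem₂ M n E (M ℕ.^ n) ⟩
    suc n ℕ.* E ℕ.* (M ℕ.* M ℕ.^ n) ∎
    where
    open ℕ.≤-Reasoning
    d = ∣ + (x ℕ.^ n) - + (y ℕ.^ n) ∣
    lem : ∀ x y a b → x * a - y * b ≡ x * (a - b) + (x - y) * b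
    lem = solve-∀
    lem₁ : ∀ M d E m → (M ℕ.* d ℕ.+ E ℕ.* m) ℕ.* M ≡ M ℕ.* (d ℕ.* M) ℕ.+ E ℕ.* (M ℕ.* m)
    lem₁ = ℕS.solve-∀
    lem₂ : ∀ M n E m → M ℕ.* (n ℕ.* E ℕ.* m) ℕ.+ E ℕ.* (M ℕ.* m) ≡ suc n ℕ.* E ℕ.* (M ℕ.* m)
    lem₂ = ℕS.solve-∀

  -- As a/b ≥ 1, its power j is at most its power kS, hence at most 4^S.
  ratio-power : ∀ {a b k S} j → b ≤ a → 0 < b → a ℕ.^ k ≤ 4 ℕ.* b ℕ.^ k → j ≤ k ℕ.* S → a ℕ.^ j ≤ 4 ℕ.^ S ℕ.* b ℕ.^ j
  ratio-power {a} {b} {k} {S} j b≤a 0<b ak≤ j≤kS = ℕ.*-cancelʳ-≤ _ _ (b ℕ.^ r) {{ℕ.m^n≢0 b r {{ℕ.>-nonZero 0<b}}}} (begin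
    a ℕ.^ j ℕ.* b ℕ.^ r           ≤⟨ ℕ.*-monoʳ-≤ (a ℕ.^ j) (ℕ.^-monoˡ-≤ r b≤a) ⟩
    a ℕ.^ j ℕ.* a ℕ.^ r           ≡⟨ sym (ℕ.^-distribˡ-+-* a j r) ⟩
    a ℕ.^ (j ℕ.+ r)               ≡⟨ cong (a ℕ.^_) j+r≡ ⟩
    a ℕ.^ (k ℕ.* S)               ≡⟨ sym (ℕ.^-*-assoc a k S) ⟩
    (a ℕ.^ k) ℕ.^ S               ≤⟨ ℕ.^-monoˡ-≤ S ak≤ ⟩
    (4 ℕ.* b ℕ.^ k) ℕ.^ S         ≡⟨ ^-distribʳ-* 4 (b ℕ.^ k) S ⟩
    4 ℕ.^ S ℕ.* (b ℕ.^ k) ℕ.^ S   ≡⟨ cong (4 ℕ.^ S ℕ.*_) (ℕ.^-*-assoc b k S) ⟩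
    4 ℕ.^ S ℕ.* b ℕ.^ (k ℕ.* S)   ≡⟨ cong (λ z → 4 ℕ.^ S ℕ.* b ℕ.^ z) (sym j+r≡) ⟩
    4 ℕ.^ S ℕ.* b ℕ.^ (j ℕ.+ r)   ≡⟨ cong (4 ℕ.^ S ℕ.*_) (ℕ.^-distribˡ-+-* b j r) ⟩
    4 ℕ.^ S ℕ.* (b ℕ.^ j ℕ.* b ℕ.^ r) ≡⟨ sym (ℕ.*-assoc (4 ℕ.^ S) (b ℕ.^ j) (b ℕ.^ r)) ⟩
    4 ℕ.^ S ℕ.* b ℕ.^ j ℕ.* b ℕ.^ r ∎)
    where
    open ℕ.≤-Reasoning
    r = k ℕ.* S ∸ j
    j+r≡ : j ℕ.+ r ≡ k ℕ.* S
    j+r≡ = ℕ.m+[n∸m]≡n j≤kS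

  ∑-difference : ∀ n {f g} {c B} → (∀ i → i < n → ∣ f i - g i ∣ ℕ.* c ≤ B) → ∣ ∑ n f - ∑ n g ∣ ℕ.* c ≤ n ℕ.* B
  ∑-difference n {f} {g} {c} {B} bd = subst (λ z → ∣ z ∣ ℕ.* c ≤ n ℕ.* B) (∑-- n f g) (∣∑∣≤ n bd)

  private
    -- M|y| ≤ |x| + |x - My| ≤ M/2, so the integer y is 0.
    half : ∀ {x y M} → 4 ℕ.* ∣ x ∣ ≤ M → 4 ℕ.* ∣ x - + M * y ∣ ≤ M → 0 < M → y ≡ 0ℤ
    half {x} {y} {M} hx hd 0<M = go ∣ y ∣ refl
     where
     open ℕ.≤-Reasoning
     lem : ∀ x m → m ≡ x - (x - m)
     lem = solve-∀
     lem′ : ∀ M → M ℕ.+ M ≡ 2 ℕ.* M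
     lem′ = ℕS.solve-∀
     go : ∀ m → ∣ y ∣ ≡ m → y ≡ 0ℤ
     go zero    eq = ℤ.∣i∣≡0⇒i≡0 eq
     go (suc m) eq = contradiction (begin
      4 ℕ.* M                                       ≤⟨ ℕ.*-monoʳ-≤ 4 (ℕ.m≤m*n M (suc m)) ⟩
      4 ℕ.* (M ℕ.* suc m)                           ≡⟨ cong (λ z → 4 ℕ.* (M ℕ.* z)) (sym eq) ⟩
      4 ℕ.* (M ℕ.* ∣ y ∣)                           ≡⟨ cong (4 ℕ.*_) (sym (ℤ.abs-* (+ M) y)) ⟩
      4 ℕ.* ∣ + M * y ∣                             ≡⟨ cong (λ z → 4 ℕ.* ∣ z ∣) (lem x (+ M * y)) ⟩
      4 ℕ.* ∣ x - (x - + M * y) ∣                   ≤⟨ ℕ.*-monoʳ-≤ 4 (ℤ.∣i-j∣≤∣i∣+∣j∣ x (x - + M * y)) ⟩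
      4 ℕ.* (∣ x ∣ ℕ.+ ∣ x - + M * y ∣)             ≡⟨ ℕ.*-distribˡ-+ 4 ∣ x ∣ _ ⟩
      4 ℕ.* ∣ x ∣ ℕ.+ 4 ℕ.* ∣ x - + M * y ∣         ≤⟨ ℕ.+-mono-≤ hx hd ⟩
      M ℕ.+ M                                       ≡⟨ lem′ M ⟩
      2 ℕ.* M                                       ∎) (ℕ.<⇒≱ (ℕ.*-monoˡ-< M {{ℕ.>-nonZero 0<M}} {2} {4} (s≤s (s≤s (s≤s z≤n)))))

  -- Comparison of Σ Qᵢ W Aᵢ^u with Σ Qᵢ ξᵢ 3^{is}; here x = a^k and y = b^k.
  module Compare (I : ℕ) (Qv : ℕ → ℤ) (ξ : ℕ → ℕ) (WA : ℕ → ℕ) (x y s S′ E Ξ QB : ℕ)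
    (x≤4y : x ≤ 4 ℕ.* y) (xE : ∣ + x - + (3 ℕ.* y) ∣ ≤ E) (0<y : 0 < y) (s≤S′ : s ≤ S′)
    (WA≡ : ∀ i → i < suc I → WA i ≡ ξ i ℕ.* (x ℕ.^ (i ℕ.* s) ℕ.* y ℕ.^ ((I ∸ i) ℕ.* s)))
    (ξ≤ : ∀ i → i < suc I → ξ i ≤ Ξ) (Q≤ : ∀ i → i < suc I → ∣ Qv i ∣ ≤ QB)
    (small : suc I ℕ.* (QB ℕ.* (Ξ ℕ.* (I ℕ.* S′ ℕ.* E ℕ.* 4 ℕ.^ (I ℕ.* S′)))) ≤ y)
    (near : 4 ℕ.* ∣ ∑ (suc I) (λ i → Qv i * + WA i) ∣ ≤ y ℕ.^ (I ℕ.* s))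
    where

    private
      Y = y ℕ.^ (I ℕ.* s)
      ψ : ℕ → ℤ
      ψ i = + ξ i * (Qv i * power (3 ℕ.^ i) s)

      split : ∀ i → i < suc I → Y ≡ y ℕ.^ (i ℕ.* s) ℕ.* y ℕ.^ ((I ∸ i) ℕ.* s)
      split i i<I = trans (cong (y ℕ.^_) (trans (cong (ℕ._* s) (sym (ℕ.m+[n∸m]≡n (ℕ.≤-pred i<I)))) (ℕ.*-distribʳ-+ s i (I ∸ i)))) (ℕ.^-distribˡ-+-* y (i ℕ.* s) ((I ∸ i) ℕ.* s))

      term : ∀ i → i < suc I → ∣ Qv i * + WA i - + Y * ψ i ∣ ℕ.* (4 ℕ.* y) ≤ QB ℕ.* (Ξ ℕ.* (I ℕ.* S′ ℕ.* E ℕ.* 4 ℕ.^ (I ℕ.* S′))) ℕ.* Y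
      term i i<I = begin
        ∣ Qv i * + WA i - + Y * ψ i ∣ ℕ.* (4 ℕ.* y)
          ≡⟨ cong (λ z → ∣ z ∣ ℕ.* (4 ℕ.* y)) factor ⟩
        ∣ Qv i * (+ ξ i * (+ r * (+ (x ℕ.^ e) - + ((3 ℕ.* y) ℕ.^ e)))) ∣ ℕ.* (4 ℕ.* y)
          ≡⟨ cong (ℕ._* (4 ℕ.* y)) (trans (ℤ.abs-* (Qv i) _) (cong (∣ Qv i ∣ ℕ.*_) (trans (ℤ.abs-* (+ ξ i) _) (cong (ξ i ℕ.*_) (ℤ.abs-* (+ r) _))))) ⟩
        ∣ Qv i ∣ ℕ.* (ξ i ℕ.* (r ℕ.* d)) ℕ.* (4 ℕ.* y)
          ≡⟨ lem₁ ∣ Qv i ∣ (ξ i) r d (4 ℕ.* y) ⟩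
        ∣ Qv i ∣ ℕ.* (ξ i ℕ.* (r ℕ.* (d ℕ.* (4 ℕ.* y))))
          ≤⟨ ℕ.*-mono-≤ (Q≤ i i<I) (ℕ.*-mono-≤ (ξ≤ i i<I) (ℕ.*-monoʳ-≤ r (power-difference x (3 ℕ.* y) E (4 ℕ.* y) e x≤4y (ℕ.*-monoˡ-≤ y {3} {4} (s≤s (s≤s (s≤s z≤n)))) xE))) ⟩
        QB ℕ.* (Ξ ℕ.* (r ℕ.* (e ℕ.* E ℕ.* (4 ℕ.* y) ℕ.^ e)))
          ≡⟨ cong (λ z → QB ℕ.* (Ξ ℕ.* (r ℕ.* (e ℕ.* E ℕ.* z)))) (^-distribʳ-* 4 y e) ⟩
        QB ℕ.* (Ξ ℕ.* (r ℕ.* (e ℕ.* E ℕ.* (4 ℕ.^ e ℕ.* y ℕ.^ e))))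
          ≡⟨ lem₂ QB Ξ r e E (4 ℕ.^ e) (y ℕ.^ e) ⟩
        QB ℕ.* (Ξ ℕ.* (e ℕ.* E ℕ.* 4 ℕ.^ e)) ℕ.* (y ℕ.^ e ℕ.* r)
          ≡⟨ cong (QB ℕ.* (Ξ ℕ.* (e ℕ.* E ℕ.* 4 ℕ.^ e)) ℕ.*_) (sym (split i i<I)) ⟩
        QB ℕ.* (Ξ ℕ.* (e ℕ.* E ℕ.* 4 ℕ.^ e)) ℕ.* Y
          ≤⟨ ℕ.*-monoˡ-≤ Y (ℕ.*-monoʳ-≤ QB (ℕ.*-monoʳ-≤ Ξ (ℕ.*-mono-≤ (ℕ.*-monoˡ-≤ E e≤) (ℕ.^-monoʳ-≤ 4 e≤)))) ⟩
        QB ℕ.* (Ξ ℕ.* (I ℕ.* S′ ℕ.* E ℕ.* 4 ℕ.^ (I ℕ.* S′))) ℕ.* Y ∎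
        where
        open ℕ.≤-Reasoning
        e = i ℕ.* s
        r = y ℕ.^ ((I ∸ i) ℕ.* s)
        d = ∣ + (x ℕ.^ e) - + ((3 ℕ.* y) ℕ.^ e) ∣
        e≤ : e ≤ I ℕ.* S′
        e≤ = ℕ.*-mono-≤ (ℕ.≤-pred i<I) s≤S′
        lem₁ : ∀ a b c d e → a ℕ.* (b ℕ.* (c ℕ.* d)) ℕ.* e ≡ a ℕ.* (b ℕ.* (c ℕ.* (d ℕ.* e)))
        lem₁ = ℕS.solve-∀
        lem₂ : ∀ q X r e E f g → q ℕ.* (X ℕ.* (r ℕ.* (e ℕ.* E ℕ.* (f ℕ.* g)))) ≡ q ℕ.* (X ℕ.* (e ℕ.* E ℕ.* f)) ℕ.* (g ℕ.* r)
        lem₂ = ℕS.solve-∀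
        lem₃ : ∀ q ξ x r y t → q * (ξ * (x * r)) - (y * r) * (ξ * (q * t)) ≡ q * (ξ * (r * (x - t * y)))
        lem₃ = solve-∀
        3y^e : + ((3 ℕ.* y) ℕ.^ e) ≡ power (3 ℕ.^ i) s * + (y ℕ.^ e)
        3y^e = trans (cong +_ (trans (^-distribʳ-* 3 y e) (cong (ℕ._* y ℕ.^ e) (sym (ℕ.^-*-assoc 3 i s)))))
          (trans (ℤ.pos-* ((3 ℕ.^ i) ℕ.^ s) (y ℕ.^ e)) (cong (_* + (y ℕ.^ e)) (sym (pos-^ (3 ℕ.^ i) s))))
        factor : Qv i * + WA i - + Y * ψ i ≡ Qv i * (+ ξ i * (+ r * (+ (x ℕ.^ e) - + ((3 ℕ.* y) ℕ.^ e))))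
        factor = trans (cong₂ (λ a b → Qv i * a - b * ψ i)
            (trans (cong +_ (WA≡ i i<I)) (trans (ℤ.pos-* (ξ i) _) (cong (+ ξ i *_) (ℤ.pos-* (x ℕ.^ e) r))))
            (trans (cong +_ (split i i<I)) (ℤ.pos-* (y ℕ.^ e) r)))
          (trans (lem₃ (Qv i) (+ ξ i) (+ (x ℕ.^ e)) (+ r) (+ (y ℕ.^ e)) (power (3 ℕ.^ i) s))
            (cong (λ z → Qv i * (+ ξ i * (+ r * (+ (x ℕ.^ e) - z)))) (sym 3y^e)))

    vanishes : ∑ (suc I) ψ ≡ 0ℤ
    vanishes = half {∑ (suc I) (λ i → Qv i * + WA i)} {∑ (suc I) ψ} {Y} near
      (ℕ.*-cancelʳ-≤ _ _ y {{ℕ.>-nonZero 0<y}} (begin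
        4 ℕ.* ∣ ∑ (suc I) (λ i → Qv i * + WA i) - + Y * ∑ (suc I) ψ ∣ ℕ.* y
          ≡⟨ cong (λ z → 4 ℕ.* ∣ ∑ (suc I) (λ i → Qv i * + WA i) - z ∣ ℕ.* y) (sym (∑-*ˡ (suc I) (+ Y) ψ)) ⟩
        4 ℕ.* ∣ ∑ (suc I) (λ i → Qv i * + WA i) - ∑ (suc I) (λ i → + Y * ψ i) ∣ ℕ.* y
          ≡⟨ lem ∣ ∑ (suc I) (λ i → Qv i * + WA i) - ∑ (suc I) (λ i → + Y * ψ i) ∣ y ⟩
        ∣ ∑ (suc I) (λ i → Qv i * + WA i) - ∑ (suc I) (λ i → + Y * ψ i) ∣ ℕ.* (4 ℕ.* y)
          ≤⟨ ∑-difference (suc I) {λ i → Qv i * + WA i} {λ i → + Y * ψ i} term ⟩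
        suc I ℕ.* (QB ℕ.* (Ξ ℕ.* (I ℕ.* S′ ℕ.* E ℕ.* 4 ℕ.^ (I ℕ.* S′))) ℕ.* Y)
          ≡⟨ sym (ℕ.*-assoc (suc I) (QB ℕ.* (Ξ ℕ.* (I ℕ.* S′ ℕ.* E ℕ.* 4 ℕ.^ (I ℕ.* S′)))) Y) ⟩
        suc I ℕ.* (QB ℕ.* (Ξ ℕ.* (I ℕ.* S′ ℕ.* E ℕ.* 4 ℕ.^ (I ℕ.* S′)))) ℕ.* Y
          ≤⟨ ℕ.*-monoˡ-≤ Y small ⟩
        y ℕ.* Y ≡⟨ ℕ.*-comm y Y ⟩
        Y ℕ.* y ∎))
      (ℕ.m^n>0 y {{ℕ.>-nonZero 0<y}} (I ℕ.* s))
      where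
      open ℕ.≤-Reasoning
      lem : ∀ d y → 4 ℕ.* d ℕ.* y ≡ d ℕ.* (4 ℕ.* y)
      lem = ℕS.solve-∀

  private
    4*-cancel : ∀ x y w t → x ℕ.* (4 ℕ.* t) ≤ w → w ≤ t ℕ.* y → 0 < t → 4 ℕ.* x ≤ y
    4*-cancel x y w t h₁ h₂ 0<t = ℕ.*-cancelʳ-≤ _ _ t {{ℕ.>-nonZero 0<t}} (ℕ.≤-trans (ℕ.≤-reflexive (lem x t)) (ℕ.≤-trans h₁ (ℕ.≤-trans h₂ (ℕ.≤-reflexive (ℕ.*-comm t y)))))
      where lem : ∀ x t → 4 ℕ.* x ℕ.* t ≡ x ℕ.* (4 ℕ.* t)
            lem = ℕS.solve-∀

  -- The bases are a^i b^(2h-i) for 0 ≤ i ≤ 2h; expanding around the middle one keeps all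
  -- differences below a^h(a^h - b^h). The points are the integers within R of k, 2k, ..., Sk. `hB`
  -- and `hfall` bound the Newton coefficients, `C₁` is the condition `H₂` of the construction, and
  -- `C₂` allows a^k to be replaced by 3b^k at the points.
  module Contradiction (h a b k ρ n′ J S R B : ℕ)
    (0<b : 0 < b) (b≤a : b ≤ a) (1<ρ : 1 < ρ) (0<J : 0 < J) (0<k : 0 < k)
    (ak≤4bk : a ℕ.^ k ≤ 4 ℕ.* b ℕ.^ k)
    (close : ∣ + (a ℕ.^ k) - + (3 ℕ.* b ℕ.^ k) ∣ ≤ 3 ℕ.* k)
    (hB : k ℕ.* (S ℕ.+ suc (h ℕ.+ h)) ℕ.* (a ℕ.^ h ∸ b ℕ.^ h) ≤ B ℕ.* b ℕ.^ h)
    (hJ≤kS : h ℕ.* J ≤ k ℕ.* S)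
    (IJ≡ : (suc (h ℕ.+ h)) ℕ.* J ≡ 2 ℕ.* suc n′)
    (IJ≤U : (suc (h ℕ.+ h)) ℕ.* J ≤ k ℕ.* (S ℕ.+ suc (h ℕ.+ h)))
    (hfall : 3 ℕ.* (k ℕ.* (S ℕ.+ suc (h ℕ.+ h)) ℕ.* ρ) ≤ 2 ℕ.* k ℕ.* J)
    (2R<k : 2 ℕ.* R < k)
    (points : (suc (h ℕ.+ h)) ℕ.* (J ∸ 1) < suc (2 ℕ.* R) ℕ.* S)
    (C₁ : 2 ℕ.* ((suc (h ℕ.+ h)) ℕ.* (J ℕ.* (4 ℕ.^ S ℕ.* 3 ℕ.^ (B ℕ.* ρ) ℕ.* (2 ℕ.* k) ℕ.^ J))) ℕ.* (4 ℕ.* (4 ℕ.^ (h ℕ.* (S ℕ.+ (h ℕ.+ h))) ℕ.* a ℕ.^ ((h ℕ.+ h) ℕ.* R)) ℕ.* suc (k ℕ.* (S ℕ.+ suc (h ℕ.+ h)))) ≤ ρ ℕ.^ n′)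
    (C₂ : (suc (h ℕ.+ h)) ℕ.* (J ℕ.* (ρ ℕ.^ suc n′ ℕ.* (2 ℕ.* k) ℕ.^ J) ℕ.* (a ℕ.^ ((h ℕ.+ h) ℕ.* R) ℕ.* ((h ℕ.+ h) ℕ.* (S ℕ.+ (h ℕ.+ h)) ℕ.* (3 ℕ.* k) ℕ.* 4 ℕ.^ ((h ℕ.+ h) ℕ.* (S ℕ.+ (h ℕ.+ h)))))) ≤ b ℕ.^ k)
    where

    private
      U S′ Ξ τ β Y Z : ℕ
      U = k ℕ.* (S ℕ.+ suc (h ℕ.+ h))
      S′ = S ℕ.+ (h ℕ.+ h)
      Ξ = a ℕ.^ ((h ℕ.+ h) ℕ.* R)
      -- The factor behind 4 is the loss in `βks≤`, the comparison of the size of Φ with b^(2hks);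
      -- the 4 itself leaves the quarter that `half` asks for.
      τ = 4 ℕ.* (4 ℕ.^ (h ℕ.* S′) ℕ.* Ξ)
      β = a ℕ.^ h ℕ.* b ℕ.^ h
      Y = (2 ℕ.* k) ℕ.^ J
      Z = 4 ℕ.^ S ℕ.* 3 ℕ.^ (B ℕ.* ρ) ℕ.* Y

      A : ℕ → ℕ
      A i = a ℕ.^ i ℕ.* b ℕ.^ ((h ℕ.+ h) ∸ i)
      D : ℕ → ℤ
      D i = + A i - + β

      0<a : 0 < a
      0<a = ℕ.<-≤-trans 0<b b≤a
      instance
        a≢0 : NonZero a
        a≢0 = ℕ.>-nonZero 0<a
        b≢0 : NonZero b
        b≢0 = ℕ.>-nonZero 0<b
        J≢0 : NonZero J
        J≢0 = ℕ.>-nonZero 0<J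

      0<Ξ : 0 < Ξ
      0<Ξ = ℕ.m^n>0 a ((h ℕ.+ h) ℕ.* R)
      0<t : 0 < 4 ℕ.^ (h ℕ.* S′) ℕ.* Ξ
      0<t = ℕ.*-mono-≤ (ℕ.m^n>0 4 (h ℕ.* S′)) 0<Ξ
      0<τ : 0 < τ
      0<τ = ℕ.*-mono-≤ {1} {4} (s≤s z≤n) 0<t
      0<β : 0 < β
      0<β = ℕ.*-mono-≤ (ℕ.m^n>0 a h) (ℕ.m^n>0 b h)

      A≤ : ∀ i → i < (suc (h ℕ.+ h)) → A i ≤ a ℕ.^ (h ℕ.+ h)
      A≤ i i<I = begin
        a ℕ.^ i ℕ.* b ℕ.^ ((h ℕ.+ h) ∸ i)   ≤⟨ ℕ.*-monoʳ-≤ (a ℕ.^ i) (ℕ.^-monoˡ-≤ ((h ℕ.+ h) ∸ i) b≤a) ⟩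
        a ℕ.^ i ℕ.* a ℕ.^ ((h ℕ.+ h) ∸ i)   ≡⟨ sym (ℕ.^-distribˡ-+-* a i ((h ℕ.+ h) ∸ i)) ⟩
        a ℕ.^ (i ℕ.+ ((h ℕ.+ h) ∸ i))       ≡⟨ cong (a ℕ.^_) (ℕ.m+[n∸m]≡n (ℕ.≤-pred i<I)) ⟩
        a ℕ.^ (h ℕ.+ h)                     ∎
        where open ℕ.≤-Reasoning

      A≥ : ∀ i → i < (suc (h ℕ.+ h)) → b ℕ.^ (h ℕ.+ h) ≤ A i
      A≥ i i<I = begin
        b ℕ.^ (h ℕ.+ h)                     ≡⟨ cong (b ℕ.^_) (sym (ℕ.m+[n∸m]≡n (ℕ.≤-pred i<I))) ⟩
        b ℕ.^ (i ℕ.+ ((h ℕ.+ h) ∸ i))       ≡⟨ ℕ.^-distribˡ-+-* b i ((h ℕ.+ h) ∸ i) ⟩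
        b ℕ.^ i ℕ.* b ℕ.^ ((h ℕ.+ h) ∸ i)   ≤⟨ ℕ.*-monoˡ-≤ (b ℕ.^ ((h ℕ.+ h) ∸ i)) (ℕ.^-monoˡ-≤ i b≤a) ⟩
        a ℕ.^ i ℕ.* b ℕ.^ ((h ℕ.+ h) ∸ i)   ∎
        where open ℕ.≤-Reasoning

      bʰ≤aʰ : b ℕ.^ h ≤ a ℕ.^ h
      bʰ≤aʰ = ℕ.^-monoˡ-≤ h b≤a

      D≤ : ∀ i → i < (suc (h ℕ.+ h)) → ∣ D i ∣ ≤ a ℕ.^ h ℕ.* (a ℕ.^ h ∸ b ℕ.^ h)
      D≤ i i<I = subst (λ z → ∣ z ∣ ≤ a ℕ.^ h ℕ.* (a ℕ.^ h ∸ b ℕ.^ h)) (sym (ℤ.m-n≡m⊖n (A i) β)) (case (ℕ.≤-total β (A i)))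
        where
        open ℕ.≤-Reasoning
        case : β ≤ A i ⊎ A i ≤ β → ∣ A i ℤ.⊖ β ∣ ≤ a ℕ.^ h ℕ.* (a ℕ.^ h ∸ b ℕ.^ h)
        case (inj₁ β≤A) = begin
          ∣ A i ℤ.⊖ β ∣                       ≡⟨ trans (ℤ.∣m⊖n∣≡∣n⊖m∣ (A i) β) (ℤ.∣⊖∣-≤ β≤A) ⟩
          A i ∸ β                             ≤⟨ ℕ.∸-monoˡ-≤ β (A≤ i i<I) ⟩
          a ℕ.^ (h ℕ.+ h) ∸ β                        ≡⟨ cong (_∸ β) (ℕ.^-distribˡ-+-* a h h) ⟩
          a ℕ.^ h ℕ.* a ℕ.^ h ∸ β             ≡⟨ sym (ℕ.*-distribˡ-∸ (a ℕ.^ h) (a ℕ.^ h) (b ℕ.^ h)) ⟩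
          a ℕ.^ h ℕ.* (a ℕ.^ h ∸ b ℕ.^ h)     ∎
        case (inj₂ A≤β) = begin
          ∣ A i ℤ.⊖ β ∣                       ≡⟨ ℤ.∣⊖∣-≤ A≤β ⟩
          β ∸ A i                             ≤⟨ ℕ.∸-monoʳ-≤ β (A≥ i i<I) ⟩
          β ∸ b ℕ.^ (h ℕ.+ h)                        ≡⟨ cong (β ∸_) (ℕ.^-distribˡ-+-* b h h) ⟩
          β ∸ b ℕ.^ h ℕ.* b ℕ.^ h             ≡⟨ sym (ℕ.*-distribʳ-∸ (b ℕ.^ h) (a ℕ.^ h) (b ℕ.^ h)) ⟩
          (a ℕ.^ h ∸ b ℕ.^ h) ℕ.* b ℕ.^ h     ≤⟨ ℕ.*-monoʳ-≤ (a ℕ.^ h ∸ b ℕ.^ h) bʰ≤aʰ ⟩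
          (a ℕ.^ h ∸ b ℕ.^ h) ℕ.* a ℕ.^ h     ≡⟨ ℕ.*-comm _ (a ℕ.^ h) ⟩
          a ℕ.^ h ℕ.* (a ℕ.^ h ∸ b ℕ.^ h)     ∎

      UD≤ : ∀ i → i < (suc (h ℕ.+ h)) → U ℕ.* ∣ D i ∣ ≤ B ℕ.* β
      UD≤ i i<I = begin
        U ℕ.* ∣ D i ∣                                 ≤⟨ ℕ.*-monoʳ-≤ U (D≤ i i<I) ⟩
        U ℕ.* (a ℕ.^ h ℕ.* (a ℕ.^ h ∸ b ℕ.^ h))       ≡⟨ reorder U (a ℕ.^ h) (a ℕ.^ h ∸ b ℕ.^ h) ⟩
        a ℕ.^ h ℕ.* (U ℕ.* (a ℕ.^ h ∸ b ℕ.^ h))       ≤⟨ ℕ.*-monoʳ-≤ (a ℕ.^ h) hB ⟩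
        a ℕ.^ h ℕ.* (B ℕ.* b ℕ.^ h)                   ≡⟨ reorder (a ℕ.^ h) B (b ℕ.^ h) ⟩
        B ℕ.* β                                       ∎
        where
        open ℕ.≤-Reasoning
        reorder : ∀ x y z → x ℕ.* (y ℕ.* z) ≡ y ℕ.* (x ℕ.* z)
        reorder x y z = trans (sym (ℕ.*-assoc x y z)) (trans (cong (ℕ._* z) (ℕ.*-comm x y)) (ℕ.*-assoc y x z))

      A^≤ : ∀ i j → i < (suc (h ℕ.+ h)) → j < J → A i ℕ.^ j ≤ 4 ℕ.^ S ℕ.* β ℕ.^ j
      A^≤ i j i<I j<J = ℕ.*-cancelʳ-≤ _ _ (b ℕ.^ (h ℕ.* j)) {{ℕ.m^n≢0 b (h ℕ.* j)}} (begin
        A i ℕ.^ j ℕ.* b ℕ.^ (h ℕ.* j)                                 ≤⟨ ℕ.*-monoˡ-≤ (b ℕ.^ (h ℕ.* j)) (ℕ.^-monoˡ-≤ j (A≤ i i<I)) ⟩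
        (a ℕ.^ (h ℕ.+ h)) ℕ.^ j ℕ.* b ℕ.^ (h ℕ.* j)                          ≡⟨ cong (λ z → z ℕ.^ j ℕ.* b ℕ.^ (h ℕ.* j)) (ℕ.^-distribˡ-+-* a h h) ⟩
        (a ℕ.^ h ℕ.* a ℕ.^ h) ℕ.^ j ℕ.* b ℕ.^ (h ℕ.* j)               ≡⟨ cong₂ ℕ._*_ (^-distribʳ-* (a ℕ.^ h) (a ℕ.^ h) j) (sym (ℕ.^-*-assoc b h j)) ⟩
        (a ℕ.^ h) ℕ.^ j ℕ.* (a ℕ.^ h) ℕ.^ j ℕ.* (b ℕ.^ h) ℕ.^ j       ≡⟨ reorder ((a ℕ.^ h) ℕ.^ j) ((a ℕ.^ h) ℕ.^ j) ((b ℕ.^ h) ℕ.^ j) ⟩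
        (a ℕ.^ h) ℕ.^ j ℕ.* (b ℕ.^ h) ℕ.^ j ℕ.* (a ℕ.^ h) ℕ.^ j       ≡⟨ cong₂ ℕ._*_ (sym (^-distribʳ-* (a ℕ.^ h) (b ℕ.^ h) j)) (ℕ.^-*-assoc a h j) ⟩
        β ℕ.^ j ℕ.* a ℕ.^ (h ℕ.* j)                                   ≤⟨ ℕ.*-monoʳ-≤ (β ℕ.^ j) (ratio-power {a} {b} {k} {S} (h ℕ.* j) b≤a 0<b ak≤4bk (ℕ.≤-trans (ℕ.*-monoʳ-≤ h (ℕ.<⇒≤ j<J)) hJ≤kS)) ⟩
        β ℕ.^ j ℕ.* (4 ℕ.^ S ℕ.* b ℕ.^ (h ℕ.* j))                     ≡⟨ trans (sym (ℕ.*-assoc (β ℕ.^ j) (4 ℕ.^ S) _)) (cong (ℕ._* b ℕ.^ (h ℕ.* j)) (ℕ.*-comm (β ℕ.^ j) (4 ℕ.^ S))) ⟩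
        4 ℕ.^ S ℕ.* β ℕ.^ j ℕ.* b ℕ.^ (h ℕ.* j)                       ∎)
        where
        open ℕ.≤-Reasoning
        reorder : ∀ x y z → x ℕ.* y ℕ.* z ≡ x ℕ.* z ℕ.* y
        reorder x y z = trans (ℕ.*-assoc x y z) (trans (cong (x ℕ.*_) (ℕ.*-comm y z)) (sym (ℕ.*-assoc x z y)))

      fall : ∀ j → j < J → (U ℕ.* ρ) ℕ.^ j ≤ j ! ℕ.* Y
      fall j j<J = falling-bound (U ℕ.* ρ) j J (2 ℕ.* k) (ℕ.<⇒≤ j<J) J≤Uρ hfall
        where J≤Uρ : J ≤ U ℕ.* ρ
              J≤Uρ = ℕ.≤-trans (ℕ.m≤n*m J (suc (h ℕ.+ h))) (ℕ.≤-trans IJ≤U (ℕ.m≤m*n U ρ {{ℕ.>-nonZero (ℕ.<-trans (s≤s z≤n) 1<ρ)}}))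

      Φ : (ℕ → ℕ → ℤ) → ℕ → ℤ
      Φ p u = ∑ (suc (h ℕ.+ h)) (λ i → ∑ J (λ j → p i j * ((+ A i) ^ j * P (+ A i) u j)))

    abstract
      auxiliary : Σ (ℕ → ℕ → ℤ) λ p → (∀ i j → ∣ p i j ∣ ≤ ρ ℕ.^ suc n′) ×
        (∃[ i ] ∃[ j ] (i < suc (h ℕ.+ h) × j < J × p i j ≢ 0ℤ)) × (∀ u → u ≤ U → ∣ Φ p u ∣ ℕ.* τ ≤ β ℕ.^ u)
      auxiliary = K.p , K.∣p∣≤X , K.p≢0 , K.Φ-small
        where
        module K = Auxiliary (suc (h ℕ.+ h)) J n′ ρ U τ β Z A D (λ i _ → sym (trans (ℤ.+-assoc (+ A i) (- + β) (+ β)) (trans (cong (_+_ (+ A i)) (ℤ.+-inverseˡ (+ β))) (ℤ.+-identityʳ (+ A i)))))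
          1<ρ 0<β 0<τ IJ≡ IJ≤U
          (λ i j l u i<I j<J u≤U → newton-bound {j} {l} {u} {U} {A i} {∣ D i ∣} {β} {ρ} {B} {4 ℕ.^ S} {Y} u≤U (UD≤ i i<I) (A^≤ i j i<I j<J) (fall j j<J)) C₁

    private
     module WithP (p : ℕ → ℕ → ℤ) (∣p∣≤X : ∀ i j → ∣ p i j ∣ ≤ ρ ℕ.^ suc n′) (Φ-small : ∀ u → u ≤ U → ∣ Φ p u ∣ ℕ.* τ ≤ β ℕ.^ u) where
        q : ℕ → ℕ → ℤ
        q = Q (suc (h ℕ.+ h)) J k p

        QB : ℕ
        QB = J ℕ.* (ρ ℕ.^ suc n′ ℕ.* Y)

        q-bound : ∀ i u → u ≤ U → ∣ q i u ∣ ≤ QB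
        q-bound i u u≤U = subst (_≤ QB) (ℕ.*-identityʳ _) (∣∑∣≤ J {c = 1} λ j j<J → begin
          ∣ p i j * + C u j ∣ ℕ.* 1   ≡⟨ ℕ.*-identityʳ _ ⟩
          ∣ p i j * + C u j ∣         ≡⟨ ℤ.abs-* (p i j) (+ C u j) ⟩
          ∣ p i j ∣ ℕ.* C u j         ≤⟨ ℕ.*-mono-≤ (∣p∣≤X i j) (C≤Y j j<J) ⟩
          ρ ℕ.^ suc n′ ℕ.* Y            ∎)
          where
          open ℕ.≤-Reasoning
          C≤Y : ∀ j → j < J → C u j ≤ Y
          C≤Y j j<J = ℕ.*-cancelʳ-≤ _ _ (j !) {{ℕ.>-nonZero (ℕ.1≤n! j)}} (begin
            C u j ℕ.* j !         ≤⟨ C-pow u j ⟩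
            u ℕ.^ j               ≤⟨ ℕ.^-monoˡ-≤ j (ℕ.≤-trans u≤U (ℕ.m≤m*n U ρ {{ℕ.>-nonZero (ℕ.<-trans (s≤s z≤n) 1<ρ)}})) ⟩
            (U ℕ.* ρ) ℕ.^ j       ≤⟨ fall j j<J ⟩
            j ! ℕ.* Y             ≡⟨ ℕ.*-comm (j !) Y ⟩
            Y ℕ.* j !             ∎)

        Φ≡ : ∀ u → Φ p u ≡ ∑ (suc (h ℕ.+ h)) (λ i → q i u * + (A i ℕ.^ u))
        Φ≡ u = ∑-cong (suc (h ℕ.+ h)) (λ i _ → trans (∑-cong J (λ j _ → inner i j)) (∑-*ʳ J (+ (A i ℕ.^ u)) (λ j → p i j * + C u j)))
          where
          inner : ∀ i j → p i j * ((+ A i) ^ j * P (+ A i) u j) ≡ p i j * + C u j * + (A i ℕ.^ u)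
          inner i j = trans (cong (p i j *_) (trans (ℤ.*-comm ((+ A i) ^ j) _) (trans (P-homogeneous (+ A i) u j) (cong (+ C u j *_) (pos-^ (A i) u))))) (sym (ℤ.*-assoc (p i j) _ _))

        -- W · Φ(u) differs little from b^(2hks) times the integer sum on the right, and both it and
        -- the difference are at most a quarter of b^(2hks). The multiplier W turns A_i^u into an
        -- exact power A_i^(ks) times an integer ξ i.
        vanishing : ∀ u s W ξ → u ≤ U → s ≤ S′ →
          (∀ i → i < (suc (h ℕ.+ h)) → W ℕ.* A i ℕ.^ u ≡ ξ i ℕ.* ((a ℕ.^ k) ℕ.^ (i ℕ.* s) ℕ.* (b ℕ.^ k) ℕ.^ (((h ℕ.+ h) ∸ i) ℕ.* s))) →
          (∀ i → i < (suc (h ℕ.+ h)) → ξ i ≤ Ξ) → W ℕ.* β ℕ.^ u ≤ 4 ℕ.^ (h ℕ.* S′) ℕ.* Ξ ℕ.* (b ℕ.^ k) ℕ.^ ((h ℕ.+ h) ℕ.* s) →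
          ∑ (suc (h ℕ.+ h)) (λ i → + ξ i * (q i u * power (3 ℕ.^ i) s)) ≡ 0ℤ
        vanishing u s W ξ u≤U s≤S′ WA≡ ξ≤ Wβ≤ = Compare.vanishes (h ℕ.+ h) (λ i → q i u) ξ (λ i → W ℕ.* A i ℕ.^ u) (a ℕ.^ k) (b ℕ.^ k) s S′ (3 ℕ.* k) Ξ QB
            ak≤4bk close (ℕ.m^n>0 b k) s≤S′ WA≡ ξ≤ (λ i _ → q-bound i u u≤U) C₂ near
          where
          open ℕ.≤-Reasoning
          lem : ∀ q w a → q * (w * a) ≡ w * (q * a)
          lem q w a = trans (sym (ℤ.*-assoc q w a)) (trans (cong (_* a) (ℤ.*-comm q w)) (ℤ.*-assoc w q a))
          sum≡ : ∑ (suc (h ℕ.+ h)) (λ i → q i u * + (W ℕ.* A i ℕ.^ u)) ≡ + W * Φ p u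
          sum≡ = trans (∑-cong (suc (h ℕ.+ h)) (λ i _ → trans (cong (q i u *_) (ℤ.pos-* W (A i ℕ.^ u))) (lem (q i u) (+ W) (+ (A i ℕ.^ u))))) (trans (∑-*ˡ (suc (h ℕ.+ h)) (+ W) (λ i → q i u * + (A i ℕ.^ u))) (cong (+ W *_) (sym (Φ≡ u))))
          near : 4 ℕ.* ∣ ∑ (suc (h ℕ.+ h)) (λ i → q i u * + (W ℕ.* A i ℕ.^ u)) ∣ ≤ (b ℕ.^ k) ℕ.^ ((h ℕ.+ h) ℕ.* s)
          near = 4*-cancel (∣ ∑ (suc (h ℕ.+ h)) (λ i → q i u * + (W ℕ.* A i ℕ.^ u)) ∣) ((b ℕ.^ k) ℕ.^ ((h ℕ.+ h) ℕ.* s)) (W ℕ.* β ℕ.^ u) (4 ℕ.^ (h ℕ.* S′) ℕ.* Ξ) (begin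
            ∣ ∑ (suc (h ℕ.+ h)) (λ i → q i u * + (W ℕ.* A i ℕ.^ u)) ∣ ℕ.* τ   ≡⟨ cong (λ z → ∣ z ∣ ℕ.* τ) sum≡ ⟩
            ∣ + W * Φ p u ∣ ℕ.* τ                            ≡⟨ cong (ℕ._* τ) (ℤ.abs-* (+ W) (Φ p u)) ⟩
            W ℕ.* ∣ Φ p u ∣ ℕ.* τ                            ≡⟨ ℕ.*-assoc W _ τ ⟩
            W ℕ.* (∣ Φ p u ∣ ℕ.* τ)                          ≤⟨ ℕ.*-monoʳ-≤ W (Φ-small u u≤U) ⟩
            W ℕ.* β ℕ.^ u                                        ∎) Wβ≤ 0<t

        A^ks : ∀ i s → A i ℕ.^ (k ℕ.* s) ≡ (a ℕ.^ k) ℕ.^ (i ℕ.* s) ℕ.* (b ℕ.^ k) ℕ.^ (((h ℕ.+ h) ∸ i) ℕ.* s)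
        A^ks i s = trans (^-distribʳ-* (a ℕ.^ i) (b ℕ.^ ((h ℕ.+ h) ∸ i)) (k ℕ.* s)) (cong₂ ℕ._*_ (swap a i) (swap b ((h ℕ.+ h) ∸ i)))
          where
          swap : ∀ c i → (c ℕ.^ i) ℕ.^ (k ℕ.* s) ≡ (c ℕ.^ k) ℕ.^ (i ℕ.* s)
          swap c i = trans (ℕ.^-*-assoc c i (k ℕ.* s)) (trans (cong (c ℕ.^_) (trans (sym (ℕ.*-assoc i k s)) (trans (cong (ℕ._* s) (ℕ.*-comm i k)) (ℕ.*-assoc k i s)))) (sym (ℕ.^-*-assoc c k (i ℕ.* s))))

        A^r≤ : ∀ i r → i < (suc (h ℕ.+ h)) → r ≤ R → A i ℕ.^ r ≤ Ξ
        A^r≤ i r i<I r≤R = ℕ.≤-trans (ℕ.^-monoˡ-≤ r (A≤ i i<I)) (ℕ.≤-trans (ℕ.≤-reflexive (ℕ.^-*-assoc a (h ℕ.+ h) r)) (ℕ.^-monoʳ-≤ a (ℕ.*-monoʳ-≤ (h ℕ.+ h) r≤R)))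

        βks≤ : ∀ s r → s ≤ S′ → r ≤ R → β ℕ.^ (k ℕ.* s) ℕ.* β ℕ.^ r ≤ 4 ℕ.^ (h ℕ.* S′) ℕ.* Ξ ℕ.* (b ℕ.^ k) ℕ.^ ((h ℕ.+ h) ℕ.* s)
        βks≤ s r s≤S′ r≤R = begin
          β ℕ.^ (k ℕ.* s) ℕ.* β ℕ.^ r
            ≤⟨ ℕ.*-monoʳ-≤ (β ℕ.^ (k ℕ.* s)) β^r≤ ⟩
          β ℕ.^ (k ℕ.* s) ℕ.* Ξ
            ≡⟨ cong (ℕ._* Ξ) (trans (cong (ℕ._^ (k ℕ.* s)) (sym A-mid)) (trans (A^ks h s) (cong (λ z → (a ℕ.^ k) ℕ.^ (h ℕ.* s) ℕ.* (b ℕ.^ k) ℕ.^ (z ℕ.* s)) (ℕ.m+n∸m≡n h h)))) ⟩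
          (a ℕ.^ k) ℕ.^ (h ℕ.* s) ℕ.* (b ℕ.^ k) ℕ.^ (h ℕ.* s) ℕ.* Ξ
            ≤⟨ ℕ.*-monoˡ-≤ Ξ (ℕ.*-monoˡ-≤ ((b ℕ.^ k) ℕ.^ (h ℕ.* s)) (ℕ.≤-trans (ℕ.^-monoˡ-≤ (h ℕ.* s) ak≤4bk) (ℕ.≤-reflexive (^-distribʳ-* 4 (b ℕ.^ k) (h ℕ.* s))))) ⟩
          4 ℕ.^ (h ℕ.* s) ℕ.* (b ℕ.^ k) ℕ.^ (h ℕ.* s) ℕ.* (b ℕ.^ k) ℕ.^ (h ℕ.* s) ℕ.* Ξ
            ≡⟨ cong (ℕ._* Ξ) (trans (ℕ.*-assoc (4 ℕ.^ (h ℕ.* s)) _ _) (cong (4 ℕ.^ (h ℕ.* s) ℕ.*_) (trans (sym (ℕ.^-distribˡ-+-* (b ℕ.^ k) (h ℕ.* s) (h ℕ.* s))) (cong ((b ℕ.^ k) ℕ.^_) (sym (ℕ.*-distribʳ-+ s h h)))))) ⟩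
          4 ℕ.^ (h ℕ.* s) ℕ.* (b ℕ.^ k) ℕ.^ ((h ℕ.+ h) ℕ.* s) ℕ.* Ξ
            ≡⟨ trans (ℕ.*-assoc (4 ℕ.^ (h ℕ.* s)) _ Ξ) (trans (cong (4 ℕ.^ (h ℕ.* s) ℕ.*_) (ℕ.*-comm _ Ξ)) (sym (ℕ.*-assoc (4 ℕ.^ (h ℕ.* s)) Ξ _))) ⟩
          4 ℕ.^ (h ℕ.* s) ℕ.* Ξ ℕ.* (b ℕ.^ k) ℕ.^ ((h ℕ.+ h) ℕ.* s)
            ≤⟨ ℕ.*-monoˡ-≤ ((b ℕ.^ k) ℕ.^ ((h ℕ.+ h) ℕ.* s)) (ℕ.*-monoˡ-≤ Ξ (ℕ.^-monoʳ-≤ 4 (ℕ.*-monoʳ-≤ h s≤S′))) ⟩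
          4 ℕ.^ (h ℕ.* S′) ℕ.* Ξ ℕ.* (b ℕ.^ k) ℕ.^ ((h ℕ.+ h) ℕ.* s) ∎
          where
          open ℕ.≤-Reasoning
          A-mid : A h ≡ β
          A-mid = cong (λ z → a ℕ.^ h ℕ.* b ℕ.^ z) (ℕ.m+n∸m≡n h h)
          β^r≤ : β ℕ.^ r ≤ Ξ
          β^r≤ = subst (λ z → z ℕ.^ r ≤ Ξ) A-mid (A^r≤ h r (s≤s (ℕ.m≤m+n h h)) r≤R)

        vanishing⁺ : ∀ s r u → s ≤ S′ → r ≤ R → u ≤ U → u ≡ k ℕ.* s ℕ.+ r → ∑ (suc (h ℕ.+ h)) (λ i → + (A i ℕ.^ r) * (q i u * power (3 ℕ.^ i) s)) ≡ 0ℤ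
        vanishing⁺ s r u s≤ r≤ u≤ u≡ = vanishing u s 1 (λ i → A i ℕ.^ r) u≤ s≤
          (λ i i<I → trans (ℕ.*-identityˡ _) (trans (cong (A i ℕ.^_) u≡) (trans (ℕ.^-distribˡ-+-* (A i) (k ℕ.* s) r) (trans (ℕ.*-comm _ (A i ℕ.^ r)) (cong (A i ℕ.^ r ℕ.*_) (A^ks i s))))))
          (λ i i<I → A^r≤ i r i<I r≤)
          (ℕ.≤-trans (ℕ.≤-reflexive (trans (ℕ.*-identityˡ _) (trans (cong (β ℕ.^_) u≡) (ℕ.^-distribˡ-+-* β (k ℕ.* s) r)))) (βks≤ s r s≤ r≤))

        -- Up to the constant β², the reflection i ↦ 2h - i inverts A i. This is what opens the
        -- points to the left of a multiple of k.
        A-dual : ∀ i → i < (suc (h ℕ.+ h)) → A i ℕ.* A ((h ℕ.+ h) ∸ i) ≡ β ℕ.* β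
        A-dual i i<I = begin
          a ℕ.^ i ℕ.* b ℕ.^ ((h ℕ.+ h) ∸ i) ℕ.* (a ℕ.^ ((h ℕ.+ h) ∸ i) ℕ.* b ℕ.^ ((h ℕ.+ h) ∸ ((h ℕ.+ h) ∸ i)))
            ≡⟨ cong (λ z → a ℕ.^ i ℕ.* b ℕ.^ ((h ℕ.+ h) ∸ i) ℕ.* (a ℕ.^ ((h ℕ.+ h) ∸ i) ℕ.* b ℕ.^ z)) (ℕ.m∸[m∸n]≡n i≤I) ⟩
          a ℕ.^ i ℕ.* b ℕ.^ ((h ℕ.+ h) ∸ i) ℕ.* (a ℕ.^ ((h ℕ.+ h) ∸ i) ℕ.* b ℕ.^ i)
            ≡⟨ interchange (a ℕ.^ i) (b ℕ.^ ((h ℕ.+ h) ∸ i)) (a ℕ.^ ((h ℕ.+ h) ∸ i)) (b ℕ.^ i) ⟩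
          a ℕ.^ i ℕ.* a ℕ.^ ((h ℕ.+ h) ∸ i) ℕ.* (b ℕ.^ i ℕ.* b ℕ.^ ((h ℕ.+ h) ∸ i))
            ≡⟨ cong₂ ℕ._*_ (join a) (join b) ⟩
          a ℕ.^ h ℕ.* a ℕ.^ h ℕ.* (b ℕ.^ h ℕ.* b ℕ.^ h)
            ≡⟨ interchange′ (a ℕ.^ h) (a ℕ.^ h) (b ℕ.^ h) (b ℕ.^ h) ⟩
          β ℕ.* β ∎
          where
          open ≡-Reasoning
          i≤I = ℕ.≤-pred i<I
          interchange : ∀ x y z w → x ℕ.* y ℕ.* (z ℕ.* w) ≡ x ℕ.* z ℕ.* (w ℕ.* y)
          interchange x y z w = trans (ℕ.*-assoc x y (z ℕ.* w)) (trans (cong (x ℕ.*_) (trans (ℕ.*-comm y (z ℕ.* w)) (ℕ.*-assoc z w y))) (sym (ℕ.*-assoc x z (w ℕ.* y))))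
          interchange′ : ∀ x y z w → x ℕ.* y ℕ.* (z ℕ.* w) ≡ x ℕ.* z ℕ.* (y ℕ.* w)
          interchange′ x y z w = trans (interchange x y z w) (cong (x ℕ.* z ℕ.*_) (ℕ.*-comm w y))
          join : ∀ c → c ℕ.^ i ℕ.* c ℕ.^ ((h ℕ.+ h) ∸ i) ≡ c ℕ.^ h ℕ.* c ℕ.^ h
          join c = trans (sym (ℕ.^-distribˡ-+-* c i ((h ℕ.+ h) ∸ i))) (trans (cong (c ℕ.^_) (ℕ.m+[n∸m]≡n i≤I)) (ℕ.^-distribˡ-+-* c h h))

        -- Here u = ks - r. Multiplication by β^(2r) replaces the missing factor A_i^(-r) by the
        -- integer A_(2h-i)^r.
        vanishing⁻ : ∀ s r u → s ≤ S′ → r ≤ R → u ≤ U → u ℕ.+ r ≡ k ℕ.* s → ∑ (suc (h ℕ.+ h)) (λ i → + (A ((h ℕ.+ h) ∸ i) ℕ.^ r) * (q i u * power (3 ℕ.^ i) s)) ≡ 0ℤ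
        vanishing⁻ s r u s≤ r≤ u≤ u≡ = vanishing u s (β ℕ.^ r ℕ.* β ℕ.^ r) (λ i → A ((h ℕ.+ h) ∸ i) ℕ.^ r) u≤ s≤
          (λ i i<I → begin
            β ℕ.^ r ℕ.* β ℕ.^ r ℕ.* A i ℕ.^ u          ≡⟨ cong (ℕ._* A i ℕ.^ u) (trans (sym (^-distribʳ-* β β r)) (trans (cong (ℕ._^ r) (sym (A-dual i i<I))) (^-distribʳ-* (A i) (A ((h ℕ.+ h) ∸ i)) r))) ⟩
            A i ℕ.^ r ℕ.* A ((h ℕ.+ h) ∸ i) ℕ.^ r ℕ.* A i ℕ.^ u ≡⟨ trans (cong (ℕ._* A i ℕ.^ u) (ℕ.*-comm (A i ℕ.^ r) _)) (ℕ.*-assoc (A ((h ℕ.+ h) ∸ i) ℕ.^ r) _ _) ⟩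
            A ((h ℕ.+ h) ∸ i) ℕ.^ r ℕ.* (A i ℕ.^ r ℕ.* A i ℕ.^ u) ≡⟨ cong (A ((h ℕ.+ h) ∸ i) ℕ.^ r ℕ.*_) (trans (sym (ℕ.^-distribˡ-+-* (A i) r u)) (trans (cong (A i ℕ.^_) (trans (ℕ.+-comm r u) u≡)) (A^ks i s))) ⟩
            A ((h ℕ.+ h) ∸ i) ℕ.^ r ℕ.* ((a ℕ.^ k) ℕ.^ (i ℕ.* s) ℕ.* (b ℕ.^ k) ℕ.^ (((h ℕ.+ h) ∸ i) ℕ.* s)) ∎)
          (λ i i<I → A^r≤ ((h ℕ.+ h) ∸ i) r (s≤s (ℕ.m∸n≤m (h ℕ.+ h) i)) r≤)
          (ℕ.≤-trans (ℕ.≤-reflexive (trans (ℕ.*-assoc (β ℕ.^ r) _ _) (trans (cong (β ℕ.^ r ℕ.*_) (trans (sym (ℕ.^-distribˡ-+-* β r u)) (cong (β ℕ.^_) (trans (ℕ.+-comm r u) u≡)))) (ℕ.*-comm (β ℕ.^ r) _)))) (βks≤ s r s≤ r≤))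
          where open ≡-Reasoning

        module Points where
          M = suc (2 ℕ.* R)

          -- The residue of e modulo M = 2R + 1, lowered by R, is the offset from the multiple of k
          -- numbered by the quotient. Different e give different points because 2R < k.
          pt : ℕ → ℕ
          pt e = k ℕ.* suc (e ℕ./ M) ℕ.+ e ℕ.% M ∸ R

          R≤kt : ∀ t → R ≤ k ℕ.* suc t
          R≤kt t = ℕ.≤-trans (ℕ.≤-trans (ℕ.m≤m+n R (R ℕ.+ 0)) (ℕ.<⇒≤ 2R<k)) (ℕ.m≤m*n k (suc t))

          pt+R : ∀ e → pt e ℕ.+ R ≡ e ℕ.% M ℕ.+ suc (e ℕ./ M) ℕ.* k
          pt+R e = trans (ℕ.m∸n+n≡m (ℕ.≤-trans (R≤kt (e ℕ./ M)) (ℕ.m≤m+n _ (e ℕ.% M)))) (trans (ℕ.+-comm _ (e ℕ.% M)) (cong (e ℕ.% M ℕ.+_) (ℕ.*-comm k _)))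

          %<k : ∀ e → e ℕ.% M < k
          %<k e = ℕ.<-≤-trans (ℕ.m%n<n e M) 2R<k

          pt-injective : ∀ {i j} → pt i ≡ pt j → i ≡ j
          pt-injective {i} {j} eq with Pigeonhole.remainder-unique {k} {i ℕ.% M} {j ℕ.% M} {suc (i ℕ./ M)} {suc (j ℕ./ M)} (%<k i) (%<k j)
                                        (trans (sym (pt+R i)) (trans (cong (ℕ._+ R) eq) (pt+R j)))
          ... | r≡ , q≡ = trans (ℕ.m≡m%n+[m/n]*n i M) (trans (cong₂ (λ x y → x ℕ.+ y ℕ.* M) r≡ (ℕ.suc-injective q≡)) (sym (ℕ.m≡m%n+[m/n]*n j M)))

          weights : (ℕ → ℕ) → ℕ → ℕ → ℤ
          weights ξ t i = + ξ i * power (3 ℕ.^ i) t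

          weights≢0 : ∀ ξ t → (∀ i → 0 < ξ i) → ∀ i → weights ξ t i ≢ 0ℤ
          weights≢0 ξ t pos i = product≢0 (λ eq → ℕ.m<n⇒n≢0 (pos i) (ℤ.+-injective eq))
            (λ eq → ℕ.m<n⇒n≢0 (ℕ.m^n>0 (3 ℕ.^ i) {{ℕ.m^n≢0 3 i}} t) (ℤ.+-injective (trans (sym (pos-^ (3 ℕ.^ i) t)) eq)))

          collect : ∀ ξ t e u → ∑ (suc (h ℕ.+ h)) (λ i → + ξ i * (q i u * power (3 ℕ.^ i) (t ℕ.+ e))) ≡ 0ℤ →
                    ∑ (suc (h ℕ.+ h)) (λ i → weights ξ t i * (q i u * power (3 ℕ.^ i) e)) ≡ 0ℤ
          collect ξ t e u eq = trans (∑-cong (suc (h ℕ.+ h)) (λ i _ → trans (lem (+ ξ i) (power (3 ℕ.^ i) t) (q i u) (power (3 ℕ.^ i) e)) (cong (λ z → + ξ i * (q i u * z)) (sym (ℤ.^-distribˡ-+-* (+ (3 ℕ.^ i)) t e))))) eq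
            where lem : ∀ x p q r → x * p * (q * r) ≡ x * (q * (p * r))
                  lem x p q r = trans (ℤ.*-assoc x p (q * r)) (cong (x *_) (trans (sym (ℤ.*-assoc p q r)) (trans (cong (_* r) (ℤ.*-comm p q)) (ℤ.*-assoc q p r))))

          A-pos : ∀ i → 0 < A i
          A-pos i = ℕ.*-mono-≤ (ℕ.m^n>0 a i) (ℕ.m^n>0 b ((h ℕ.+ h) ∸ i))

          -- The shifts by k e′ keep the offset and move the multiple of k from t to t + e′. Only
          -- the factor 3^(ie′) changes, so the same weights serve all e′.
          zeros : ∀ e → e < M ℕ.* S → Zeros (suc (h ℕ.+ h)) J k p (pt e)
          zeros e e< = case (ℕ.≤-total R (e ℕ.% M))
            where
            t = suc (e ℕ./ M)
            t≤S : t ≤ S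
            t≤S = ℕ.m<n*o⇒m/o<n (subst (e <_) (ℕ.*-comm M S) e<)
            te≤ : ∀ e′ → e′ < (suc (h ℕ.+ h)) → t ℕ.+ e′ ≤ S′
            te≤ e′ e′<I = ℕ.+-mono-≤ t≤S (ℕ.≤-pred e′<I)
            bound : ∀ e′ → e′ < (suc (h ℕ.+ h)) → k ℕ.* (t ℕ.+ e′) ℕ.+ R ≤ U
            bound e′ e′<I = begin
              k ℕ.* (t ℕ.+ e′) ℕ.+ R   ≤⟨ ℕ.+-mono-≤ (ℕ.*-monoʳ-≤ k (te≤ e′ e′<I)) (ℕ.≤-trans (ℕ.m≤m+n R (R ℕ.+ 0)) (ℕ.<⇒≤ 2R<k)) ⟩
              k ℕ.* S′ ℕ.+ k           ≡⟨ trans (ℕ.+-comm (k ℕ.* S′) k) (sym (ℕ.*-suc k S′)) ⟩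
              k ℕ.* suc S′             ≡⟨ cong (k ℕ.*_) (sym (ℕ.+-suc S (h ℕ.+ h))) ⟩
              U                        ∎
              where open ℕ.≤-Reasoning
            shift : ∀ e′ → pt e ℕ.+ k ℕ.* e′ ℕ.+ R ≡ e ℕ.% M ℕ.+ k ℕ.* (t ℕ.+ e′)
            shift e′ = trans (ℕ.+-assoc (pt e) _ R) (trans (cong (pt e ℕ.+_) (ℕ.+-comm (k ℕ.* e′) R)) (trans (sym (ℕ.+-assoc (pt e) R _)) (trans (cong (ℕ._+ k ℕ.* e′) (pt+R e))
              (trans (ℕ.+-assoc (e ℕ.% M) _ _) (cong (e ℕ.% M ℕ.+_) (trans (cong (ℕ._+ k ℕ.* e′) (ℕ.*-comm t k)) (sym (ℕ.*-distribˡ-+ k t e′))))))))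
            case : R ≤ e ℕ.% M ⊎ e ℕ.% M ≤ R → Zeros (suc (h ℕ.+ h)) J k p (pt e)
            case (inj₁ R≤) = weights (λ i → A i ℕ.^ r) t , weights≢0 _ t (λ i → ℕ.m^n>0 (A i) {{ℕ.>-nonZero (A-pos i)}} r) ,
                λ e′ e′<I → collect (λ i → A i ℕ.^ r) t e′ (pt e ℕ.+ k ℕ.* e′) (vanishing⁺ (t ℕ.+ e′) r (pt e ℕ.+ k ℕ.* e′) (te≤ e′ e′<I) r≤R (u≤ e′ e′<I) (u≡ e′))
              where
              r = e ℕ.% M ∸ R
              r≤R : r ≤ R
              r≤R = ℕ.≤-trans (ℕ.∸-monoˡ-≤ R (ℕ.≤-pred (ℕ.m%n<n e M))) (ℕ.≤-reflexive (trans (cong (λ z → R ℕ.+ z ∸ R) (ℕ.+-identityʳ R)) (ℕ.m+n∸n≡m R R)))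
              u≡ : ∀ e′ → pt e ℕ.+ k ℕ.* e′ ≡ k ℕ.* (t ℕ.+ e′) ℕ.+ r
              u≡ e′ = ℕ.+-cancelʳ-≡ R _ _ (trans (shift e′) (trans (ℕ.+-comm (e ℕ.% M) _) (trans (cong (k ℕ.* (t ℕ.+ e′) ℕ.+_) (sym (ℕ.m∸n+n≡m R≤))) (sym (ℕ.+-assoc (k ℕ.* (t ℕ.+ e′)) r R)))))
              u≤ : ∀ e′ → e′ < (suc (h ℕ.+ h)) → pt e ℕ.+ k ℕ.* e′ ≤ U
              u≤ e′ e′<I = ℕ.≤-trans (ℕ.≤-reflexive (u≡ e′)) (ℕ.≤-trans (ℕ.+-monoʳ-≤ _ r≤R) (bound e′ e′<I))
            case (inj₂ ≤R) = weights (λ i → A ((h ℕ.+ h) ∸ i) ℕ.^ r) t , weights≢0 _ t (λ i → ℕ.m^n>0 (A ((h ℕ.+ h) ∸ i)) {{ℕ.>-nonZero (A-pos ((h ℕ.+ h) ∸ i))}} r) ,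
                λ e′ e′<I → collect (λ i → A ((h ℕ.+ h) ∸ i) ℕ.^ r) t e′ (pt e ℕ.+ k ℕ.* e′) (vanishing⁻ (t ℕ.+ e′) r (pt e ℕ.+ k ℕ.* e′) (te≤ e′ e′<I) (ℕ.m∸n≤m R (e ℕ.% M)) (u≤ e′ e′<I) (u≡ e′))
              where
              r = R ∸ e ℕ.% M
              u≡ : ∀ e′ → pt e ℕ.+ k ℕ.* e′ ℕ.+ r ≡ k ℕ.* (t ℕ.+ e′)
              u≡ e′ = ℕ.+-cancelʳ-≡ (e ℕ.% M) _ _ (trans (ℕ.+-assoc (pt e ℕ.+ k ℕ.* e′) r _) (trans (cong (pt e ℕ.+ k ℕ.* e′ ℕ.+_) (ℕ.m∸n+n≡m ≤R)) (trans (shift e′) (ℕ.+-comm (e ℕ.% M) _))))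
              u≤ : ∀ e′ → e′ < (suc (h ℕ.+ h)) → pt e ℕ.+ k ℕ.* e′ ≤ U
              u≤ e′ e′<I = ℕ.≤-trans (ℕ.m≤m+n _ r) (ℕ.≤-trans (ℕ.≤-reflexive (u≡ e′)) (ℕ.≤-trans (ℕ.m≤m+n _ R) (bound e′ e′<I)))

    contradictory : ⊥
    contradictory = go auxiliary
      where
      go : (Σ (ℕ → ℕ → ℤ) λ p → (∀ i j → ∣ p i j ∣ ≤ ρ ℕ.^ suc n′) ×
        (∃[ i ] ∃[ j ] (i < suc (h ℕ.+ h) × j < J × p i j ≢ 0ℤ)) × (∀ u → u ≤ U → ∣ Φ p u ∣ ℕ.* τ ≤ β ℕ.^ u)) → ⊥
      go (p , ∣p∣≤X , (i , j , i<I , j<J , pij≢0) , Φ-small) = pij≢0 (zero-estimate (suc (h ℕ.+ h)) J k p (applyUpTo pt (M ℕ.* S))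
          (Unique.applyUpTo⁺₁ pt (M ℕ.* S) (λ i<j _ eq → ℕ.<⇒≢ i<j (pt-injective eq)))
          (subst ((suc (h ℕ.+ h)) ℕ.* (J ∸ 1) <_) (sym (length-applyUpTo pt (M ℕ.* S))) points)
          (All.applyUpTo⁺₁ pt (M ℕ.* S) (λ {e} e< → zeros e e<)) i i<I j j<J)
        where open WithP p ∣p∣≤X Φ-small
              open Points

-- Choice of the parameters for k ≥ 41370

module LargeExponents where

  open import Data.Nat
  open import Data.Nat.Properties
  open import Data.Nat.DivMod
  open import Data.Nat.Tactic.RingSolver using (solve-∀)
  open import Data.Integer as ℤ using (+_; ∣_∣)
  import Data.Integer.Properties as ℤ
  open import Data.Product using (_×_; _,_; ∃-syntax)
  open import Data.Empty using (⊥)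
  open import Data.Unit using (tt)
  open import Relation.Nullary using (¬_; yes; no; contradiction)
  open import Relation.Nullary.Decidable using (toWitness; from-no)
  open import Relation.Binary.PropositionalEquality hiding (J)
  open Arithmetic using (^-distribʳ-*)
  open Bounds using (bernoulli)
  open Gelfond using (ratio-power; module Contradiction)

  private
    ring-1 : ∀ x y → 5 + ((30 + x) + (52 + y)) + (52 + y) + 6 * ((52 + y) + 12) + suc ((7 + (30 + x)) + ((52 + y) + 13)) + (30 + x) + (904 + 49 * x + 21 * y + x * y) ≡ (30 + x) * (52 + y)
    ring-1 = solve-∀

    ring-2 : ∀ x y → 5 + ((30 + x) + (52 + y)) + ((52 + y) + 12) + (7 + (30 + x)) + 12 * ((52 + y) + 12) + (604 + 50 * x + 16 * y + x * y) ≡ (30 + x) * (52 + y)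
    ring-2 = solve-∀

    ring-4 : ∀ x d → 1 * (x + 1 * d) ≡ (x + d) * 1
    ring-4 = solve-∀

    ring-5 : ∀ x y m d → x * y * (x + suc (suc m) * d) ≡ x * (y * (x + suc m * d)) + d * (x * y)
    ring-5 = solve-∀

    ring-6 : ∀ Q → 6 * (Q * 32) ≡ Q * 192
    ring-6 = solve-∀

    ring-7 : ∀ x → 1036 * x * 41472 + 12008 * x ≡ 1000 * 41472 * x + 1000 * (215 * (7 * x))
    ring-7 = solve-∀

    ring-8 : ∀ x Q d → 1000 * 41472 * x + 1000 * (215 * (suc Q * 192 * d)) ≡ 1000 * 41472 * x + 1000 * ((215 * Q + 215) * 192 * d)
    ring-8 = solve-∀

    ring-9 : ∀ x Q d → 1000 * 41472 * x + 1000 * ((215 * Q + Q) * 192 * d) ≡ 1000 * (x + Q * d) * 41472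
    ring-9 = solve-∀

    ring-10 : ∀ ρ → 3 * (ρ * 459) ≡ ρ * 1377
    ring-10 = solve-∀

    ring-11 : ∀ x ρ → 4 * x * ((2850 * ρ) * ((2850 * ρ) * 1)) ≡ 4 * 2850 * (2850 * x) * (ρ * ρ)
    ring-11 = solve-∀

    ring-12 : ∀ ρ → 2 * (suc ρ * 1379) ≡ ρ * 2758 + 2758
    ring-12 = solve-∀

    ring-13 : ∀ ρ → ρ * 2758 + ρ * 92 ≡ 2850 * ρ
    ring-13 = solve-∀

    ring-14 : ∀ S ρ → 9 * S * ρ ≡ 9 * (ρ * S)
    ring-14 = solve-∀

    ring-15 : ∀ ρ → 12 * (13 * ρ) ≡ 52 * (3 * ρ)
    ring-15 = solve-∀

    ring-16 : ∀ S ρ → S * (3 * ρ) ≡ 3 * (ρ * S)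
    ring-16 = solve-∀

    ring-17 : ∀ T → 104 * (2 * T) ≡ 208 * T
    ring-17 = solve-∀

    ring-18 : ∀ J x₁ x₂ x₃ x₄ x₅ x₆ ρ → 2 * (13 * (J * (x₁ * x₂ * x₃))) * (4 * (x₄ * x₅) * x₆) * ρ ≡ 104 * J * x₁ * x₄ * x₆ * ρ * (x₂ * x₃) * x₅
    ring-18 = solve-∀

    ring-19 : ∀ ρ S → 26 * (ρ * S) ≡ S * (26 * ρ)
    ring-19 = solve-∀

    ring-20 : ∀ ρ → 52 * (26 * ρ) ≡ ρ * 1352
    ring-20 = solve-∀

    ring-21 : ∀ ρ → 26 * ρ + (ρ + ρ * 1352) ≡ ρ * 1379
    ring-21 = solve-∀

    ring-22 : ∀ T r x a s k f → 13 * (2 * T * (r * x) * (a * (12 * s * (3 * k) * f))) ≡ 936 * T * s * k * f * x * (r * a)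
    ring-22 = solve-∀

    ring-23 : ∀ T → 10 * T + (13 * T + 3 * T) ≡ 26 * T
    ring-23 = solve-∀

    ring-24 : ∀ k S ρ → 3 * (k * (S + 13) * ρ) ≡ k * ρ * (3 * S + 39)
    ring-24 = solve-∀

    ring-25 : ∀ k S ρ → k * ρ * (3 * S + S) ≡ 2 * k * (2 * (ρ * S))
    ring-25 = solve-∀

    ring-26 : ∀ k s d → k * s * d ≡ s * (k * d)
    ring-26 = solve-∀

    ring-27 : ∀ S x → (S + 13) * (7 * x) ≡ (7 * S + 91) * x
    ring-27 = solve-∀

    ring-28 : ∀ ρ S → 6 * (2 * (ρ * S)) ≡ 12 * ρ * S
    ring-28 = solve-∀

    ring-29 : ∀ T → 13 * (2 * T) ≡ 2 * (13 * T)
    ring-29 = solve-∀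

    ring-30 : ∀ ρ S → 13 * (2 * (ρ * S)) ≡ 26 * ρ * S
    ring-30 = solve-∀

    ring-31 : ∀ ρ → 26 * ρ ≡ 2 * (13 * ρ)
    ring-31 = solve-∀

    ring-32 : ∀ ρ S → 13 * (2 * (ρ * S)) ≡ 2 * (13 * ρ) * S
    ring-32 = solve-∀

    ring-33 : ∀ x k → 100 * (3 * x + 3 * k) ≡ 300 * x + 300 * k
    ring-33 = solve-∀


  n<4^n : ∀ n → n < 4 ^ n
  n<4^n zero    = s≤s z≤n
  n<4^n (suc n) = begin-strict
    suc n             ≤⟨ n<4^n n ⟩
    4 ^ n             <⟨ m<m+n (4 ^ n) (<-≤-trans (m^n>0 4 n) (m≤m+n (4 ^ n) _)) ⟩
    4 ^ n + (4 ^ n + (4 ^ n + (4 ^ n + 0))) ∎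
    where open ≤-Reasoning

  ≤4^-* : ∀ {x y} m n → x ≤ 4 ^ m → y ≤ 4 ^ n → x * y ≤ 4 ^ (m + n)
  ≤4^-* m n hx hy = ≤-trans (*-mono-≤ hx hy) (≤-reflexive (sym (^-distribˡ-+-* 4 m n)))

  ≤4^-suc : ∀ {x} m → x ≤ 4 ^ m → suc x ≤ 4 ^ suc m
  ≤4^-suc {x} m hx = begin
    suc x             ≤⟨ s≤s hx ⟩
    suc (4 ^ m)       ≤⟨ +-monoˡ-≤ (4 ^ m) (m^n>0 4 m) ⟩
    4 ^ m + 4 ^ m     ≤⟨ +-monoʳ-≤ (4 ^ m) (m≤m+n (4 ^ m) _) ⟩
    4 ^ suc m         ∎
    where open ≤-Reasoning

  -- An integer substitute for log x / log ρ; the exponent n only bounds the search.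
  logarithm : ∀ ρ n {x} → 1 < x → x ≤ ρ ^ n → ∃[ m ] (ρ ^ m < x × x ≤ ρ ^ suc m)
  logarithm ρ zero    1<x x≤ = contradiction x≤ (<⇒≱ 1<x)
  logarithm ρ (suc n) {x} 1<x x≤ with x ≤? ρ ^ n
  ... | yes x≤′ = logarithm ρ n 1<x x≤′
  ... | no  x≰  = n , ≰⇒> x≰ , x≤

  -- The left side collects the powers of 4 that bound the minor factors in `small₁`. They are
  -- linear in ρ and S and lose against ρS once ρ ≥ 30 and S ≥ 52.
  exponents₁ : ∀ ρ S → 30 ≤ ρ → 52 ≤ S → 5 + (ρ + S) + S + 6 * (S + 12) + suc ((7 + ρ) + (S + 13)) + ρ ≤ ρ * S
  exponents₁ ρ S 30≤ρ 52≤S = subst₂ (λ ρ S → 5 + (ρ + S) + S + 6 * (S + 12) + suc ((7 + ρ) + (S + 13)) + ρ ≤ ρ * S)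
      (m+[n∸m]≡n 30≤ρ) (m+[n∸m]≡n 52≤S) (≤-trans (m≤m+n _ _) (≤-reflexive (lem (ρ ∸ 30) (S ∸ 52))))
    where lem = ring-1

  exponents₂ : ∀ ρ S → 30 ≤ ρ → 52 ≤ S → 5 + (ρ + S) + (S + 12) + (7 + ρ) + 12 * (S + 12) ≤ ρ * S
  exponents₂ ρ S 30≤ρ 52≤S = subst₂ (λ ρ S → 5 + (ρ + S) + (S + 12) + (7 + ρ) + 12 * (S + 12) ≤ ρ * S)
      (m+[n∸m]≡n 30≤ρ) (m+[n∸m]≡n 52≤S) (≤-trans (m≤m+n _ _) (≤-reflexive (lem (ρ ∸ 30) (S ∸ 52))))
    where lem = ring-2

  -- The inequality that fixes the threshold: 30 is the least ρ for which it holds. Here 19683 = 3⁹,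
  -- and 2850 bounds 2k/ρ.
  ρ^8-large : ∀ ρ → 30 ≤ ρ → 4 * 2850 * (2850 * 19683) ≤ ρ ^ 8
  ρ^8-large ρ 30≤ρ = ≤-trans (toWitness {a? = 4 * 2850 * (2850 * 19683) ≤? 30 ^ 8} tt) (^-monoˡ-≤ 8 30≤ρ)

  n<2^n : ∀ n → n < 2 ^ n
  n<2^n zero    = s≤s z≤n
  n<2^n (suc n) = begin-strict
    suc n             ≤⟨ n<2^n n ⟩
    2 ^ n             <⟨ m<m+n (2 ^ n) (<-≤-trans (m^n>0 2 n) (m≤m+n (2 ^ n) 0)) ⟩
    2 ^ n + (2 ^ n + 0) ∎
    where open ≤-Reasoning

  300n≤2^n : ∀ n → 20 ≤ n → 300 * n ≤ 2 ^ n
  300n≤2^n n 20≤n = subst (λ n → 300 * n ≤ 2 ^ n) (m∸n+n≡m 20≤n) (go (n ∸ 20))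
    where
    double : ∀ N → 0 < N → 300 * N ≤ 2 ^ N → 300 * suc N ≤ 2 ^ suc N
    double N 0<N le = begin
      300 * suc N           ≡⟨ *-suc 300 N ⟩
      300 + 300 * N         ≤⟨ +-mono-≤ (≤-trans (m≤m*n 300 N {{>-nonZero 0<N}}) le) (≤-trans le (≤-reflexive (sym (+-identityʳ (2 ^ N))))) ⟩
      2 ^ suc N             ∎
      where open ≤-Reasoning
    go : ∀ m → 300 * (m + 20) ≤ 2 ^ (m + 20)
    go zero    = toWitness {a? = 300 * 20 ≤? 2 ^ 20} tt
    go (suc m) = double (m + 20) (≤-trans (s≤s z≤n) (m≤n+m 20 m)) (go m)

  general-bernoulli : ∀ x d m → x ^ m * (x + suc m * d) ≤ (x + d) ^ suc m
  general-bernoulli x d zero    = ≤-reflexive (lem x d)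
    where lem = ring-4
  general-bernoulli x d (suc m) = begin
    x * x ^ m * (x + suc (suc m) * d)                    ≡⟨ lem x (x ^ m) m d ⟩
    x * (x ^ m * (x + suc m * d)) + d * (x * x ^ m)      ≤⟨ +-mono-≤ (*-monoʳ-≤ x (general-bernoulli x d m)) (*-monoʳ-≤ d (^-monoˡ-≤ (suc m) (m≤m+n x d))) ⟩
    x * (x + d) ^ suc m + d * (x + d) ^ suc m            ≡⟨ sym (*-distribʳ-+ ((x + d) ^ suc m) x d) ⟩
    (x + d) * (x + d) ^ suc m                            ∎
    where
    open ≤-Reasoning
    lem = ring-5

  lower-power : ∀ {a b k c e} j → b ≤ a → 0 < b → c * a ^ k ≤ e * b ^ k → j ≤ k → c * a ^ j ≤ e * b ^ j
  lower-power {a} {b} {k} {c} {e} j b≤a 0<b hk j≤k = *-cancelʳ-≤ _ _ (b ^ (k ∸ j)) {{m^n≢0 b (k ∸ j) {{>-nonZero 0<b}}}} (begin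
    c * a ^ j * b ^ (k ∸ j)         ≤⟨ *-monoʳ-≤ (c * a ^ j) (^-monoˡ-≤ (k ∸ j) b≤a) ⟩
    c * a ^ j * a ^ (k ∸ j)         ≡⟨ join c a ⟩
    c * a ^ k                       ≤⟨ hk ⟩
    e * b ^ k                       ≡⟨ sym (join e b) ⟩
    e * b ^ j * b ^ (k ∸ j)         ∎)
    where
    open ≤-Reasoning
    join : ∀ c a → c * a ^ j * a ^ (k ∸ j) ≡ c * a ^ k
    join c a = trans (*-assoc c (a ^ j) _) (cong (c *_) (trans (sym (^-distribˡ-+-* a j (k ∸ j))) (cong (a ^_) (m+[n∸m]≡n j≤k))))

  1036-power : ∀ e x y → 0 < x → 100 * (x + y) ^ e ≤ 301 * x ^ e → 1036 * x ≤ 1000 * (x + y) → 100 * 1036 ^ e ≤ 301 * 1000 ^ e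
  1036-power e x y 0<x h₁ h₂ = *-cancelʳ-≤ _ _ (x ^ e) {{m^n≢0 x e {{>-nonZero 0<x}}}} (begin
    100 * 1036 ^ e * x ^ e          ≡⟨ trans (*-assoc 100 (1036 ^ e) (x ^ e)) (cong (100 *_) (sym (^-distribʳ-* 1036 x e))) ⟩
    100 * (1036 * x) ^ e            ≤⟨ *-monoʳ-≤ 100 (^-monoˡ-≤ e h₂) ⟩
    100 * (1000 * (x + y)) ^ e      ≡⟨ cong (100 *_) (^-distribʳ-* 1000 (x + y) e) ⟩
    100 * (1000 ^ e * (x + y) ^ e)  ≡⟨ swap 100 (1000 ^ e) ((x + y) ^ e) ⟩
    1000 ^ e * (100 * (x + y) ^ e)  ≤⟨ *-monoʳ-≤ (1000 ^ e) h₁ ⟩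
    1000 ^ e * (301 * x ^ e)        ≡⟨ trans (swap (1000 ^ e) 301 (x ^ e)) (sym (*-assoc 301 (1000 ^ e) (x ^ e))) ⟩
    301 * 1000 ^ e * x ^ e          ∎)
    where
    open ≤-Reasoning
    swap : ∀ a b c → a * (b * c) ≡ b * (a * c)
    swap a b c = trans (sym (*-assoc a b c)) (trans (cong (_* c) (*-comm a b)) (*-assoc b a c))

  delta-power : ∀ A B e h x d Q b k a → x ≡ b ^ h → x + d ≡ a ^ h → b ≤ a → 0 < b → h * (suc Q * e) ≤ k → A * a ^ k ≤ B * b ^ k → A * (x + suc Q * d) ^ e ≤ B * x ^ e
  delta-power A B e h x d Q b k a x≡ xd≡ b≤a 0<b j≤k hk = *-cancelˡ-≤ ((x ^ Q) ^ e) {{m^n≢0 (x ^ Q) e {{m^n≢0 x Q {{x≢0}}}}}} (begin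
    (x ^ Q) ^ e * (A * (x + suc Q * d) ^ e)     ≡⟨ swap ((x ^ Q) ^ e) A _ ⟩
    A * ((x ^ Q) ^ e * (x + suc Q * d) ^ e)     ≡⟨ cong (A *_) (sym (^-distribʳ-* (x ^ Q) (x + suc Q * d) e)) ⟩
    A * (x ^ Q * (x + suc Q * d)) ^ e           ≤⟨ *-monoʳ-≤ A (^-monoˡ-≤ e (general-bernoulli x d Q)) ⟩
    A * ((x + d) ^ suc Q) ^ e                   ≡⟨ cong (λ z → A * (z ^ suc Q) ^ e) xd≡ ⟩
    A * ((a ^ h) ^ suc Q) ^ e                   ≡⟨ cong (A *_) (flat a) ⟩
    A * a ^ (h * (suc Q * e))                   ≤⟨ lower-power {a} {b} {k} {A} {B} (h * (suc Q * e)) b≤a 0<b hk j≤k ⟩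
    B * b ^ (h * (suc Q * e))                   ≡⟨ cong (B *_) (sym (flat b)) ⟩
    B * ((b ^ h) ^ suc Q) ^ e                   ≡⟨ cong (λ z → B * (z ^ suc Q) ^ e) (sym x≡) ⟩
    B * (x * x ^ Q) ^ e                         ≡⟨ cong (B *_) (trans (^-distribʳ-* x (x ^ Q) e) (*-comm (x ^ e) _)) ⟩
    B * ((x ^ Q) ^ e * x ^ e)                   ≡⟨ swap B ((x ^ Q) ^ e) (x ^ e) ⟩
    (x ^ Q) ^ e * (B * x ^ e)                   ∎)
    where
    open ≤-Reasoning
    x≢0 : NonZero x
    x≢0 = subst NonZero (sym x≡) (m^n≢0 b h {{>-nonZero 0<b}})
    swap : ∀ a b c → a * (b * c) ≡ b * (a * c)
    swap a b c = trans (sym (*-assoc a b c)) (trans (cong (_* c) (*-comm a b)) (*-assoc b a c))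
    flat : ∀ a → ((a ^ h) ^ suc Q) ^ e ≡ a ^ (h * (suc Q * e))
    flat a = trans (^-*-assoc (a ^ h) (suc Q) e) (^-*-assoc a h (suc Q * e))

  -- With Q ≈ k/192, 1.036 < 3.01^(1/32) fails, so (a/b)^6 − 1 is at most 7/k.
  delta : ∀ {a b k} → b ≤ a → 0 < b → 41370 ≤ k → 100 * a ^ k ≤ 301 * b ^ k → k * (a ^ 6 ∸ b ^ 6) ≤ 7 * b ^ 6
  delta {a} {b} {k} b≤a 0<b hk up = ≮⇒≥ λ lt → numeric (1036-power 32 x (Q * d) 0<x (powers Q 1≤Q Q*192≤k) (large lt))
    where
    x = b ^ 6
    d = a ^ 6 ∸ b ^ 6
    Q = k / 192
    0<x : 0 < x
    0<x = m^n>0 b {{>-nonZero 0<b}} 6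
    xd≡ : x + d ≡ a ^ 6
    xd≡ = m+[n∸m]≡n (^-monoˡ-≤ 6 b≤a)
    215≤Q : 215 ≤ Q
    215≤Q = /-monoˡ-≤ {41370} {k} 192 hk
    1≤Q : 1 ≤ Q
    1≤Q = ≤-trans (s≤s z≤n) 215≤Q
    Q*192≤k : Q * 192 ≤ k
    Q*192≤k = m/n*n≤m k 192
    numeric : ¬ (100 * 1036 ^ 32 ≤ 301 * 1000 ^ 32)
    numeric = from-no (100 * 1036 ^ 32 ≤? 301 * 1000 ^ 32)
    powers : ∀ Q → 1 ≤ Q → Q * 192 ≤ k → 100 * (x + Q * d) ^ 32 ≤ 301 * x ^ 32
    powers (suc Q) _ le = delta-power 100 301 32 6 x d Q b k a refl xd≡ b≤a 0<b (≤-trans (≤-reflexive (lem (suc Q))) le) up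
      where lem = ring-6
    k< : k < suc Q * 192
    k< = subst (_< suc Q * 192) (sym (m≡m%n+[m/n]*n k 192)) (+-monoˡ-< (Q * 192) (m%n<n k 192))
    -- Here 41472 = 192 · 216. From k < 192(Q + 1) and Q ≥ 215 follows Q/k > 215/41472, and 7 ·
    -- 215/41472 exceeds 0.036.
    large : 7 * x < k * d → 1036 * x ≤ 1000 * (x + Q * d)
    large lt = *-cancelʳ-≤ _ _ 41472 (begin
      1036 * x * 41472                                    ≤⟨ m≤m+n _ (12008 * x) ⟩
      1036 * x * 41472 + 12008 * x                        ≡⟨ lem₁ x ⟩
      1000 * 41472 * x + 1000 * (215 * (7 * x))           ≤⟨ +-monoʳ-≤ (1000 * 41472 * x) (*-monoʳ-≤ 1000 (*-monoʳ-≤ 215 (≤-trans (<⇒≤ lt) (*-monoˡ-≤ d (<⇒≤ k<))))) ⟩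
      1000 * 41472 * x + 1000 * (215 * (suc Q * 192 * d)) ≡⟨ lem₂ x Q d ⟩
      1000 * 41472 * x + 1000 * ((215 * Q + 215) * 192 * d) ≤⟨ +-monoʳ-≤ (1000 * 41472 * x) (*-monoʳ-≤ 1000 (*-monoˡ-≤ d (*-monoˡ-≤ 192 (+-monoʳ-≤ (215 * Q) 215≤Q)))) ⟩
      1000 * 41472 * x + 1000 * ((215 * Q + Q) * 192 * d) ≡⟨ lem₃ x Q d ⟩
      1000 * (x + Q * d) * 41472                          ∎)
      where
      open ≤-Reasoning
      lem₁ = ring-7
      lem₂ = ring-8
      lem₃ = ring-9

  tenth-power : ∀ c k ρ → 2 * k ≤ 2850 * ρ → 4 * 2850 * (2850 * c) ≤ ρ ^ 8 → 4 * c * (2 * k) ^ 2 ≤ ρ ^ 10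
  tenth-power c k ρ 2k≤ large = begin
    4 * c * (2 * k) ^ 2                    ≤⟨ *-monoʳ-≤ (4 * c) (^-monoˡ-≤ 2 2k≤) ⟩
    4 * c * (2850 * ρ) ^ 2                 ≡⟨ ring-11 c ρ ⟩
    4 * 2850 * (2850 * c) * (ρ * ρ)        ≤⟨ *-monoˡ-≤ (ρ * ρ) large ⟩
    ρ ^ 8 * (ρ * ρ)                        ≡⟨ cong (λ z → ρ ^ 8 * (ρ * z)) (sym (*-identityʳ ρ)) ⟩
    ρ ^ 8 * ρ ^ 2                          ≡⟨ sym (^-distribˡ-+-* ρ 8 2) ⟩
    ρ ^ 10                                 ∎
    where open ≤-Reasoning

  -- S is chosen so that ρ^S agrees with a^52 up to a factor ρ. The exponent 52 makes a^(12 · 13ρ) =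
  -- (a^52)^(3ρ) ≤ ρ^(3T). Of the 13T powers of ρ available in `C₁` this takes 3T, and `main-factor`
  -- takes the other 10T.
  module Parameters (a b k ρ m : ℕ) (0<b : 0 < b) (b≤a : b ≤ a) (k≤3b : k ≤ 3 * b)
    (30≤ρ : 30 ≤ ρ) (ρ≤k : ρ * 1379 ≤ k) (k<ρ : k < suc ρ * 1379)
    (ak≤4bk : a ^ k ≤ 4 * b ^ k) (lo : ρ ^ m < a ^ 52) (hi : a ^ 52 ≤ ρ ^ suc m) where

    S T J : ℕ
    S = suc m
    T = ρ * S
    J = 2 * T

    instance
      ρ≢0 : NonZero ρ
      ρ≢0 = >-nonZero (≤-trans (s≤s z≤n) 30≤ρ)
      b≢0 : NonZero b
      b≢0 = >-nonZero 0<b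
      a≢0 : NonZero a
      a≢0 = >-nonZero (<-≤-trans 0<b b≤a)

    459ρ≤b : ρ * 459 ≤ b
    459ρ≤b = *-cancelˡ-≤ 3 (begin
      3 * (ρ * 459)   ≡⟨ lem ρ ⟩
      ρ * 1377        ≤⟨ *-monoʳ-≤ ρ (m≤m+n 1377 2) ⟩
      ρ * 1379        ≤⟨ ρ≤k ⟩
      k               ≤⟨ k≤3b ⟩
      3 * b           ∎)
      where
      open ≤-Reasoning
      lem = ring-10

    ρ≤b : ρ ≤ b
    ρ≤b = ≤-trans (m≤m*n ρ 459) 459ρ≤b

    ρ<a : ρ < a
    ρ<a = <-≤-trans (<-≤-trans (m<m*n ρ 459 (s≤s (s≤s z≤n))) 459ρ≤b) b≤a

    52≤S : 52 ≤ S
    52≤S = ≮⇒≥ λ S<52 → <⇒≱ (^-monoˡ-< 52 ρ<a) (≤-trans hi (^-monoʳ-≤ ρ (<⇒≤ S<52)))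

    k≤4^ : k ≤ 4 ^ (7 + ρ)
    k≤4^ = begin
      k               ≤⟨ <⇒≤ k<ρ ⟩
      suc ρ * 1379    ≤⟨ *-mono-≤ (n<4^n ρ) (toWitness {a? = 1379 ≤? 4 ^ 7} tt) ⟩
      4 ^ ρ * 4 ^ 7   ≡⟨ *-comm (4 ^ ρ) (4 ^ 7) ⟩
      4 ^ 7 * 4 ^ ρ   ≡⟨ sym (^-distribˡ-+-* 4 7 ρ) ⟩
      4 ^ (7 + ρ)     ∎
      where open ≤-Reasoning

    T≤4^ : T ≤ 4 ^ (ρ + S)
    T≤4^ = ≤4^-* ρ S (<⇒≤ (n<4^n ρ)) (<⇒≤ (n<4^n S))

    base : 4 * 3 ^ 9 * (2 * k) ^ 2 ≤ ρ ^ 10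
    base = tenth-power (3 ^ 9) k ρ 2k≤ (ρ^8-large ρ 30≤ρ)
      where
      lem₁ = ring-12
      lem₂ = ring-13
      2k≤ : 2 * k ≤ 2850 * ρ
      2k≤ = begin
        2 * k                 ≤⟨ *-monoʳ-≤ 2 (<⇒≤ k<ρ) ⟩
        2 * (suc ρ * 1379)    ≡⟨ lem₁ ρ ⟩
        ρ * 2758 + 2758       ≤⟨ +-monoʳ-≤ (ρ * 2758) (≤-trans (toWitness {a? = 2758 ≤? 30 * 92} tt) (*-monoˡ-≤ 92 30≤ρ)) ⟩
        ρ * 2758 + ρ * 92     ≡⟨ lem₂ ρ ⟩
        2850 * ρ              ∎
        where open ≤-Reasoning

    -- All three factors are T-th powers, so this is the inequality `base` raised to the power T.
    -- The 4^T is room for the polynomial and linear-exponential terms of `small₁` and `small₂`.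
    main-factor : 4 ^ T * (3 ^ (9 * S * ρ) * (2 * k) ^ J) ≤ ρ ^ (10 * T)
    main-factor = begin
      4 ^ T * (3 ^ (9 * S * ρ) * (2 * k) ^ J)        ≡⟨ cong₂ (λ x y → 4 ^ T * (x * y)) (trans (cong (3 ^_) (lem S ρ)) (sym (^-*-assoc 3 9 T))) (sym (^-*-assoc (2 * k) 2 T)) ⟩
      4 ^ T * ((3 ^ 9) ^ T * ((2 * k) ^ 2) ^ T)      ≡⟨ sym (*-assoc (4 ^ T) ((3 ^ 9) ^ T) _) ⟩
      4 ^ T * (3 ^ 9) ^ T * ((2 * k) ^ 2) ^ T        ≡⟨ cong (_* ((2 * k) ^ 2) ^ T) (sym (^-distribʳ-* 4 (3 ^ 9) T)) ⟩
      (4 * 3 ^ 9) ^ T * ((2 * k) ^ 2) ^ T            ≡⟨ sym (^-distribʳ-* (4 * 3 ^ 9) ((2 * k) ^ 2) T) ⟩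
      (4 * 3 ^ 9 * (2 * k) ^ 2) ^ T                  ≤⟨ ^-monoˡ-≤ T base ⟩
      (ρ ^ 10) ^ T                                   ≡⟨ ^-*-assoc ρ 10 T ⟩
      ρ ^ (10 * T)                                   ∎
      where
      open ≤-Reasoning
      lem = ring-14

    a-power : a ^ (12 * (13 * ρ)) ≤ ρ ^ (3 * T)
    a-power = begin
      a ^ (12 * (13 * ρ))      ≡⟨ cong (a ^_) (lem₁ ρ) ⟩
      a ^ (52 * (3 * ρ))       ≡⟨ sym (^-*-assoc a 52 (3 * ρ)) ⟩
      (a ^ 52) ^ (3 * ρ)       ≤⟨ ^-monoˡ-≤ (3 * ρ) hi ⟩
      (ρ ^ S) ^ (3 * ρ)        ≡⟨ ^-*-assoc ρ S (3 * ρ) ⟩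
      ρ ^ (S * (3 * ρ))        ≡⟨ cong (ρ ^_) (lem₂ S ρ) ⟩
      ρ ^ (3 * T)              ∎
      where
      open ≤-Reasoning
      lem₁ = ring-15
      lem₂ = ring-16

    instance
      13T≢0 : NonZero (13 * T)
      13T≢0 = m*n≢0 13 T {{_}} {{m*n≢0 ρ S}}

    n′ : ℕ
    n′ = pred (13 * T)

    n≡ : suc n′ ≡ 13 * T
    n≡ = suc-pred (13 * T)

    small₁ : 104 * J * 4 ^ S * 4 ^ (6 * (S + 12)) * suc (k * (S + 13)) * ρ ≤ 4 ^ T
    small₁ = ≤-trans (≤4^-* (5 + (ρ + S) + S + 6 * (S + 12) + suc ((7 + ρ) + (S + 13))) ρ
        (≤4^-* (5 + (ρ + S) + S + 6 * (S + 12)) (suc ((7 + ρ) + (S + 13)))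
          (≤4^-* (5 + (ρ + S) + S) (6 * (S + 12)) (≤4^-* (5 + (ρ + S)) S J≤ ≤-refl) ≤-refl)
          (≤4^-suc ((7 + ρ) + (S + 13)) (≤4^-* (7 + ρ) (S + 13) k≤4^ (<⇒≤ (n<4^n (S + 13))))))
        (<⇒≤ (n<4^n ρ)))
      (^-monoʳ-≤ 4 (exponents₁ ρ S 30≤ρ 52≤S))
      where
      J≤ : 104 * J ≤ 4 ^ (5 + (ρ + S))
      J≤ = ≤-trans (≤-reflexive (lem T)) (≤4^-* 5 (ρ + S) (toWitness {a? = 208 ≤? 4 ^ 5} tt) T≤4^)
        where lem = ring-17

    C₁ : 2 * (13 * (J * (4 ^ S * 3 ^ (9 * S * ρ) * (2 * k) ^ J))) * (4 * (4 ^ (6 * (S + 12)) * a ^ (12 * (13 * ρ))) * suc (k * (S + 13))) ≤ ρ ^ n′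
    C₁ = *-cancelʳ-≤ _ _ ρ (begin
      2 * (13 * (J * (4 ^ S * 3 ^ (9 * S * ρ) * (2 * k) ^ J))) * (4 * (4 ^ (6 * (S + 12)) * a ^ (12 * (13 * ρ))) * suc (k * (S + 13))) * ρ
        ≡⟨ lem J (4 ^ S) (3 ^ (9 * S * ρ)) ((2 * k) ^ J) (4 ^ (6 * (S + 12))) (a ^ (12 * (13 * ρ))) (suc (k * (S + 13))) ρ ⟩
      104 * J * 4 ^ S * 4 ^ (6 * (S + 12)) * suc (k * (S + 13)) * ρ * (3 ^ (9 * S * ρ) * (2 * k) ^ J) * a ^ (12 * (13 * ρ))
        ≤⟨ *-mono-≤ (*-monoˡ-≤ (3 ^ (9 * S * ρ) * (2 * k) ^ J) small₁) a-power ⟩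
      4 ^ T * (3 ^ (9 * S * ρ) * (2 * k) ^ J) * ρ ^ (3 * T)
        ≤⟨ *-monoˡ-≤ (ρ ^ (3 * T)) main-factor ⟩
      ρ ^ (10 * T) * ρ ^ (3 * T)
        ≡⟨ trans (sym (^-distribˡ-+-* ρ (10 * T) (3 * T))) (cong (ρ ^_) (trans (sym (*-distribʳ-+ T 10 3)) (sym n≡))) ⟩
      ρ * ρ ^ n′
        ≡⟨ *-comm ρ (ρ ^ n′) ⟩
      ρ ^ n′ * ρ ∎)
      where
      open ≤-Reasoning
      lem = ring-18

    small₂ : 936 * T * (S + 12) * k * 4 ^ (12 * (S + 12)) ≤ 4 ^ T
    small₂ = ≤-trans (≤4^-* (5 + (ρ + S) + (S + 12) + (7 + ρ)) (12 * (S + 12))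
        (≤4^-* (5 + (ρ + S) + (S + 12)) (7 + ρ) (≤4^-* (5 + (ρ + S)) (S + 12) (≤4^-* 5 (ρ + S) (toWitness {a? = 936 ≤? 4 ^ 5} tt) T≤4^) (<⇒≤ (n<4^n (S + 12)))) k≤4^) ≤-refl)
      (^-monoʳ-≤ 4 (exponents₂ ρ S 30≤ρ 52≤S))

    -- The origin of 1379: replacing ρ^S by ρ · a^52 costs 26ρ + 26 · 52ρ in the exponent, and one
    -- more ρ absorbs the 4 from comparing a with b. The sum is 1379ρ ≤ k.
    ρ-power : ρ ^ (26 * T) ≤ b ^ k
    ρ-power = begin
      ρ ^ (26 * T)                                    ≡⟨ cong (ρ ^_) (lem₁ ρ S) ⟩
      ρ ^ (S * (26 * ρ))                              ≡⟨ sym (^-*-assoc ρ S (26 * ρ)) ⟩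
      (ρ * ρ ^ m) ^ (26 * ρ)                          ≤⟨ ^-monoˡ-≤ (26 * ρ) (*-monoʳ-≤ ρ (<⇒≤ lo)) ⟩
      (ρ * a ^ 52) ^ (26 * ρ)                         ≡⟨ ^-distribʳ-* ρ (a ^ 52) (26 * ρ) ⟩
      ρ ^ (26 * ρ) * (a ^ 52) ^ (26 * ρ)              ≡⟨ cong (ρ ^ (26 * ρ) *_) (trans (^-*-assoc a 52 (26 * ρ)) (cong (a ^_) (lem₂ ρ))) ⟩
      ρ ^ (26 * ρ) * a ^ (ρ * 1352)                   ≤⟨ *-mono-≤ (^-monoˡ-≤ (26 * ρ) ρ≤b) (ratio-power {a} {b} {k} {1} (ρ * 1352) b≤a 0<b ak≤4bk (≤-trans (*-monoʳ-≤ ρ (m≤m+n 1352 27)) (≤-trans ρ≤k (≤-reflexive (sym (*-identityʳ k)))))) ⟩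
      b ^ (26 * ρ) * (4 ^ 1 * b ^ (ρ * 1352))         ≤⟨ *-monoʳ-≤ (b ^ (26 * ρ)) (*-monoˡ-≤ (b ^ (ρ * 1352)) 4≤b^ρ) ⟩
      b ^ (26 * ρ) * (b ^ ρ * b ^ (ρ * 1352))         ≡⟨ trans (cong (b ^ (26 * ρ) *_) (sym (^-distribˡ-+-* b ρ (ρ * 1352)))) (sym (^-distribˡ-+-* b (26 * ρ) (ρ + ρ * 1352))) ⟩
      b ^ (26 * ρ + (ρ + ρ * 1352))                   ≤⟨ ^-monoʳ-≤ b (≤-trans (≤-reflexive (lem₃ ρ)) ρ≤k) ⟩
      b ^ k                                           ∎
      where
      open ≤-Reasoning
      lem₁ = ring-19
      lem₂ = ring-20
      lem₃ = ring-21
      4≤b^ρ : 4 ^ 1 ≤ b ^ ρ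
      4≤b^ρ = ≤-trans (≤-trans (≤-trans (m≤m+n 4 26) 30≤ρ) ρ≤b) (≤-trans (≤-reflexive (sym (*-identityʳ b))) (^-monoʳ-≤ b {1} {ρ} (≤-trans (s≤s z≤n) 30≤ρ)))

    C₂ : 13 * (J * (ρ ^ suc n′ * (2 * k) ^ J) * (a ^ (12 * (13 * ρ)) * (12 * (S + 12) * (3 * k) * 4 ^ (12 * (S + 12))))) ≤ b ^ k
    C₂ = begin
      13 * (J * (ρ ^ suc n′ * (2 * k) ^ J) * (a ^ (12 * (13 * ρ)) * (12 * (S + 12) * (3 * k) * 4 ^ (12 * (S + 12)))))
        ≡⟨ lem T (ρ ^ suc n′) ((2 * k) ^ J) (a ^ (12 * (13 * ρ))) (S + 12) k (4 ^ (12 * (S + 12))) ⟩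
      936 * T * (S + 12) * k * 4 ^ (12 * (S + 12)) * (2 * k) ^ J * (ρ ^ suc n′ * a ^ (12 * (13 * ρ)))
        ≤⟨ *-mono-≤ (*-mono-≤ small₂ (m≤n*m ((2 * k) ^ J) (3 ^ (9 * S * ρ)) {{m^n≢0 3 (9 * S * ρ)}})) (*-monoʳ-≤ (ρ ^ suc n′) a-power) ⟩
      4 ^ T * (3 ^ (9 * S * ρ) * (2 * k) ^ J) * (ρ ^ suc n′ * ρ ^ (3 * T))
        ≤⟨ *-mono-≤ main-factor (≤-reflexive (cong (λ z → ρ ^ z * ρ ^ (3 * T)) n≡)) ⟩
      ρ ^ (10 * T) * (ρ ^ (13 * T) * ρ ^ (3 * T))
        ≡⟨ trans (cong (ρ ^ (10 * T) *_) (sym (^-distribˡ-+-* ρ (13 * T) (3 * T)))) (trans (sym (^-distribˡ-+-* ρ (10 * T) (13 * T + 3 * T))) (cong (ρ ^_) (lem′ T))) ⟩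
      ρ ^ (26 * T)
        ≤⟨ ρ-power ⟩
      b ^ k ∎
      where
      open ≤-Reasoning
      lem = ring-22
      lem′ = ring-23

    hfall : 3 * (k * (S + 13) * ρ) ≤ 2 * k * J
    hfall = begin
      3 * (k * (S + 13) * ρ)    ≡⟨ lem₁ k S ρ ⟩
      k * ρ * (3 * S + 39)      ≤⟨ *-monoʳ-≤ (k * ρ) (+-monoʳ-≤ (3 * S) (≤-trans (m≤m+n 39 13) 52≤S)) ⟩
      k * ρ * (3 * S + S)       ≡⟨ lem₂ k S ρ ⟩
      2 * k * (2 * (ρ * S))     ∎
      where
      open ≤-Reasoning
      lem₁ = ring-24
      lem₂ = ring-25

    hB : k * (a ^ 6 ∸ b ^ 6) ≤ 7 * b ^ 6 → k * (S + 13) * (a ^ 6 ∸ b ^ 6) ≤ 9 * S * b ^ 6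
    hB δ = begin
      k * (S + 13) * (a ^ 6 ∸ b ^ 6)     ≡⟨ lem₁ k (S + 13) (a ^ 6 ∸ b ^ 6) ⟩
      (S + 13) * (k * (a ^ 6 ∸ b ^ 6))   ≤⟨ *-monoʳ-≤ (S + 13) δ ⟩
      (S + 13) * (7 * b ^ 6)             ≡⟨ lem₂ S (b ^ 6) ⟩
      (7 * S + 91) * b ^ 6               ≤⟨ *-monoˡ-≤ (b ^ 6) (+-monoʳ-≤ (7 * S) (≤-trans (m≤m+n 91 13) (*-monoʳ-≤ 2 52≤S))) ⟩
      (7 * S + 2 * S) * b ^ 6            ≡⟨ cong (_* b ^ 6) (sym (*-distribʳ-+ S 7 2)) ⟩
      9 * S * b ^ 6                      ∎
      where
      open ≤-Reasoning
      lem₁ = ring-26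
      lem₂ = ring-27

    rest : ∀ c → c ≤ 1379 → c * ρ ≤ k
    rest c c≤ = ≤-trans (*-monoˡ-≤ ρ c≤) (≤-trans (≤-reflexive (*-comm 1379 ρ)) ρ≤k)

    impossible : ∣ + (a ^ k) ℤ.- + (3 * b ^ k) ∣ ≤ 3 * k → k * (a ^ 6 ∸ b ^ 6) ≤ 7 * b ^ 6 → ⊥
    -- The choice is h = 6 and R = 13ρ. Then (26ρ + 1)S points face a determinant of degree at most
    -- 13(2ρS - 1), so hardly any point is wasted.
    impossible close δ = Contradiction.contradictory 6 a b k ρ n′ J S (13 * ρ) (9 * S) 0<b b≤a
      (≤-trans (s≤s (s≤s z≤n)) 30≤ρ) 0<J 0<k ak≤4bk close (hB δ)
      (≤-trans (≤-reflexive (l₁ ρ S)) (*-monoˡ-≤ S (rest 12 (m≤m+n 12 1367))))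
      (trans (l₂ T) (cong (2 *_) (sym n≡)))
      (≤-trans (≤-reflexive (l₃ ρ S)) (*-mono-≤ (rest 26 (m≤m+n 26 1353)) (m≤m+n S 13)))
      hfall
      (<-≤-trans (<-≤-trans (subst (_< 27 * ρ) (l₄ ρ) (*-monoˡ-< ρ {26} {27} ≤-refl)) (rest 27 (m≤m+n 27 1352))) ≤-refl)
      pts C₁ C₂
      where
      0<T : 0 < T
      0<T = *-mono-≤ {1} {ρ} (≤-trans (s≤s z≤n) 30≤ρ) (s≤s z≤n)
      0<J : 0 < J
      0<J = *-mono-≤ {1} {2} (s≤s z≤n) 0<T
      0<k : 0 < k
      0<k = ≤-trans (≤-trans (s≤s z≤n) 30≤ρ) (≤-trans (≤-reflexive (sym (*-identityˡ ρ))) (rest 1 (s≤s z≤n)))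
      l₁ = ring-28
      l₂ = ring-29
      l₃ = ring-30
      l₄ = ring-31
      l₅ = ring-32
      pts : 13 * (J ∸ 1) < suc (2 * (13 * ρ)) * S
      pts = begin-strict
        13 * (J ∸ 1)                 ≤⟨ *-monoʳ-≤ 13 (m∸n≤m J 1) ⟩
        13 * J                       ≡⟨ l₅ ρ S ⟩
        2 * (13 * ρ) * S             <⟨ m<n+m (2 * (13 * ρ) * S) {S} (s≤s z≤n) ⟩
        S + 2 * (13 * ρ) * S         ∎
        where open ≤-Reasoning

  no-large-solution : ∀ {a b k} → 41370 ≤ k → 0 < b → b < a → ∣ + (a ^ k) ℤ.- + (3 * b ^ k) ∣ ≤ 3 * k → a ^ k ≤ 3 * b ^ k + 3 * k → ⊥
  no-large-solution {a} {b} {k} hk 0<b b<a close up = found (logarithm ρ (a ^ 52) 1<a52 a52≤)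
    where
    open ≤-Reasoning
    ρ = k / 1379
    30≤ρ : 30 ≤ ρ
    30≤ρ = /-monoˡ-≤ {41370} {k} 1379 hk
    300k≤2^k : 300 * k ≤ 2 ^ k
    300k≤2^k = 300n≤2^n k (≤-trans (m≤m+n 20 41350) hk)
    k≤300k : ∀ c → c ≤ 300 → c * k ≤ 300 * k
    k≤300k c c≤ = *-monoˡ-≤ k c≤
    2≤b : 2 ≤ b
    -- For b = 1 the inequality would give 2^k ≤ 3 + 3k.
    2≤b = ≰⇒> λ b≤1 → <⇒≱ (begin-strict
        3 * 1 ^ k + 3 * k    ≡⟨ cong (λ z → 3 * z + 3 * k) (^-zeroˡ k) ⟩
        3 + 3 * k            <⟨ +-monoˡ-< (3 * k) (*-monoʳ-< 3 {1} {k} (≤-trans (s≤s (s≤s z≤n)) hk)) ⟩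
        3 * k + 3 * k        ≡⟨ sym (*-distribʳ-+ k 3 3) ⟩
        6 * k                ≤⟨ k≤300k 6 (m≤m+n 6 294) ⟩
        300 * k              ≤⟨ 300k≤2^k ⟩
        2 ^ k                ≤⟨ ^-monoˡ-≤ k (≤-trans (s≤s 0<b) b<a) ⟩
        a ^ k                ∎) (≤-trans up (+-monoˡ-≤ (3 * k) (*-monoʳ-≤ 3 (^-monoˡ-≤ k b≤1))))
    300k≤bk : 300 * k ≤ b ^ k
    300k≤bk = ≤-trans 300k≤2^k (^-monoˡ-≤ k 2≤b)
    301bk : 100 * a ^ k ≤ 301 * b ^ k
    301bk = begin
      100 * a ^ k                    ≤⟨ *-monoʳ-≤ 100 up ⟩
      100 * (3 * b ^ k + 3 * k)      ≡⟨ lem (b ^ k) k ⟩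
      300 * b ^ k + 300 * k          ≤⟨ +-monoʳ-≤ (300 * b ^ k) 300k≤bk ⟩
      300 * b ^ k + b ^ k            ≡⟨ +-comm (300 * b ^ k) (b ^ k) ⟩
      301 * b ^ k                    ∎
      where lem = ring-33
    ak≤4bk : a ^ k ≤ 4 * b ^ k
    ak≤4bk = ≤-trans up (≤-trans (+-monoʳ-≤ (3 * b ^ k) (≤-trans (k≤300k 3 (m≤m+n 3 297)) 300k≤bk)) (≤-reflexive (+-comm (3 * b ^ k) (b ^ k))))
    -- (b + 1)^k ≤ a^k ≤ 4b^k, while (b + 1)^k ≥ b^(k-1)(b + k). Hence a solution has large b, which
    -- bounds ρ by b.
    k≤3b : k ≤ 3 * b
    k≤3b = go k refl
      where
      go : ∀ k′ → k ≡ k′ → k′ ≤ 3 * b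
      go zero     _    = z≤n
      go (suc k′) refl = +-cancelˡ-≤ b (suc k′) (3 * b) (*-cancelʳ-≤ _ _ (b ^ k′) {{m^n≢0 b k′ {{>-nonZero 0<b}}}} (begin
        (b + suc k′) * b ^ k′          ≡⟨ *-distribʳ-+ (b ^ k′) b (suc k′) ⟩
        b ^ suc k′ + suc k′ * b ^ k′   ≤⟨ bernoulli b k′ ⟩
        suc b ^ suc k′                 ≤⟨ ^-monoˡ-≤ (suc k′) b<a ⟩
        a ^ suc k′                     ≤⟨ ak≤4bk ⟩
        4 * b ^ suc k′                 ≡⟨ sym (*-assoc 4 b (b ^ k′)) ⟩
        4 * b * b ^ k′                 ∎))
    ρ≤k : ρ * 1379 ≤ k
    ρ≤k = m/n*n≤m k 1379
    k<ρ : k < suc ρ * 1379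
    k<ρ = subst (_< suc ρ * 1379) (sym (m≡m%n+[m/n]*n k 1379)) (+-monoˡ-< (ρ * 1379) (m%n<n k 1379))
    a52≤ : a ^ 52 ≤ ρ ^ (a ^ 52)
    a52≤ = ≤-trans (<⇒≤ (n<2^n (a ^ 52))) (^-monoˡ-≤ (a ^ 52) (≤-trans (s≤s (s≤s z≤n)) 30≤ρ))
    1<a52 : 1 < a ^ 52
    1<a52 = <-≤-trans (≤-trans (s≤s 0<b) b<a) (≤-trans (≤-reflexive (sym (*-identityʳ a))) (^-monoʳ-≤ a {{>-nonZero (<-trans 0<b b<a)}} {1} {52} (s≤s z≤n)))
    found : ∃[ m ] (ρ ^ m < a ^ 52 × a ^ 52 ≤ ρ ^ suc m) → ⊥
    found (m , lo , hi) = Parameters.impossible a b k ρ m 0<b (<⇒≤ b<a) k≤3b 30≤ρ ρ≤k k<ρ ak≤4bk lo hi close (delta (<⇒≤ b<a) 0<b hk 301bk)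

-- Fermat's little theorem and roots of polynomials modulo a prime

module Fermat where

  open import Data.Nat as ℕ using (ℕ; zero; suc; _<_; z≤n; s≤s; NonZero; _!)
  import Data.Nat.Properties as ℕ
  import Data.Nat.Divisibility as ℕ
  open import Data.Nat.Primality using (Prime; euclidsLemma; prime⇒nonZero; prime⇒nonTrivial)
  open import Data.Integer as ℤ using (ℤ; +_; 0ℤ; 1ℤ; _+_; _*_; -_; _-_; _^_)
  import Data.Integer.Properties as ℤ
  open import Data.Integer.Divisibility.Signed using (_∣_; divides; ∣ᵤ⇒∣; ∣⇒∣ᵤ; ∣m∣n⇒∣m+n; ∣m⇒∣-m; ∣m⇒∣m*n)
  open import Data.Integer.Tactic.RingSolver using (solve-∀)
  open import Data.List using (List; []; _∷_; length)
  open import Data.List.Relation.Unary.All as All using (All; []; _∷_)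
  open import Data.List.Relation.Unary.AllPairs using (AllPairs; []; _∷_)
  open import Data.Product using (_×_; _,_)
  open import Data.Sum using (_⊎_; inj₁; inj₂)
  open import Relation.Nullary using (¬_; contradiction)
  open import Relation.Binary.PropositionalEquality
  open Sums
  open Bounds using (C-factorial)
  open Determinants using (Top; Top-divide; Top-power; Top-cong; Top-raises; Top-+; power)
  open Gelfond using (pos-^)

  private variable ℓ : ℕ

  ∣0 : ∀ {x} → x ∣ 0ℤ
  ∣0 = divides 0ℤ refl

  euclid : Prime ℓ → ∀ {x y} → + ℓ ∣ x * y → + ℓ ∣ x ⊎ + ℓ ∣ y
  euclid {ℓ} pr {x} {y} d with euclidsLemma ℤ.∣ x ∣ ℤ.∣ y ∣ pr (subst (ℓ ℕ.∣_) (ℤ.abs-* x y) (∣⇒∣ᵤ d))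
  ... | inj₁ e = inj₁ (∣ᵤ⇒∣ e)
  ... | inj₂ e = inj₂ (∣ᵤ⇒∣ e)

  prime∤! : Prime ℓ → ∀ n → n < ℓ → ¬ (ℓ ℕ.∣ n !)
  prime∤! pr zero    _   d = contradiction (ℕ.∣1⇒≡1 d) (λ e → ℕ.nonTrivial⇒≢1 {{prime⇒nonTrivial pr}} e)
  prime∤! pr (suc n) n<ℓ d with euclidsLemma (suc n) (n !) pr d
  ... | inj₁ e = ℕ.<⇒≱ n<ℓ (ℕ.∣⇒≤ e)
  ... | inj₂ e = prime∤! pr n (ℕ.<-trans ℕ.≤-refl n<ℓ) e

  prime∣C : Prime ℓ → ∀ j l → 0 < j → 0 < l → j ℕ.+ l ≡ ℓ → ℓ ℕ.∣ C ℓ j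
  prime∣C {ℓ} pr j l 0<j 0<l refl with euclidsLemma (C ℓ j) (j ! ℕ.* l !) pr (subst (ℓ ℕ.∣_) (sym (C-factorial j l)) (ℓ∣ℓ! ℓ (ℕ.<-≤-trans 0<j (ℕ.m≤m+n j l))))
    where ℓ∣ℓ! : ∀ n → 0 < n → n ℕ.∣ n !
          ℓ∣ℓ! (suc n) _ = ℕ.m∣m*n (n !)
  ... | inj₁ d = d
  ... | inj₂ d with euclidsLemma (j !) (l !) pr d
  ...   | inj₁ e = contradiction e (prime∤! pr j (ℕ.m<m+n j 0<l))
  ...   | inj₂ e = contradiction e (prime∤! pr l (ℕ.m<n+m l 0<j))

  ∣∑ : ∀ n f → (∀ i → i < n → + ℓ ∣ f i) → + ℓ ∣ ∑ n f
  ∣∑ zero    f d = ∣0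
  ∣∑ (suc n) f d = ∣m∣n⇒∣m+n (∣∑ n f (λ i i<n → d i (ℕ.m<n⇒m<1+n i<n))) (d n ℕ.≤-refl)

  P-0 : ∀ x u → P x u 0 ≡ x ^ u
  P-0 x zero    = refl
  P-0 x (suc u) = cong (x *_) (P-0 x u)

  P-diagonal : ∀ x u → P x u u ≡ 1ℤ
  P-diagonal x zero    = refl
  P-diagonal x (suc u) = trans (cong₂ (λ a b → x * a + b) (P-vanish x u (suc u) ℕ.≤-refl) (P-diagonal x u)) (cong (_+ 1ℤ) (ℤ.*-zeroʳ x))

  -- The constant term of `P-compose` is the binomial theorem for (x + 1)^ℓ, whose inner
  -- coefficients are multiples of ℓ.
  frobenius : Prime ℓ → ∀ x → + ℓ ∣ (x + 1ℤ) ^ ℓ - (x ^ ℓ + 1ℤ)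
  frobenius {zero}  pr x = contradiction refl (ℕ.≢-nonZero⁻¹ 0 {{prime⇒nonZero pr}})
  frobenius {suc n} pr x = subst (+ suc n ∣_) (sym eq) (∣∑ n (λ i → P 1ℤ (suc n) (suc i) * x ^ suc i) middle)
    where
    middle : ∀ i → i < n → + suc n ∣ P 1ℤ (suc n) (suc i) * x ^ suc i
    middle i i<n = ∣m⇒∣m*n (x ^ suc i) (subst (+ suc n ∣_) (sym P≡C) (∣ᵤ⇒∣ (prime∣C pr (suc i) (n ℕ.∸ i) (s≤s z≤n) (ℕ.m<n⇒0<n∸m i<n) (cong suc (ℕ.m+[n∸m]≡n (ℕ.<⇒≤ i<n))))))
      where
      1^ : ∀ l → 1ℤ ^ l ≡ 1ℤ
      1^ zero    = refl
      1^ (suc l) = trans (ℤ.*-identityˡ _) (1^ l)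
      P≡C : P 1ℤ (suc n) (suc i) ≡ + C (suc n) (suc i)
      P≡C = subst (λ z → P 1ℤ z (suc i) ≡ + C z (suc i)) (cong suc (ℕ.m+[n∸m]≡n (ℕ.<⇒≤ i<n)))
        (trans (P-explicit 1ℤ (suc i) (n ℕ.∸ i)) (trans (cong (+ C (suc i ℕ.+ (n ℕ.∸ i)) (suc i) *_) (1^ (n ℕ.∸ i))) (ℤ.*-identityʳ _)))
    eq : (x + 1ℤ) ^ suc n - (x ^ suc n + 1ℤ) ≡ ∑ n (λ i → P 1ℤ (suc n) (suc i) * x ^ suc i)
    eq = trans (cong (_- (x ^ suc n + 1ℤ)) expand) (lem (∑ n (λ i → P 1ℤ (suc n) (suc i) * x ^ suc i)) (x ^ suc n))
      where
      lem : ∀ s y → (1ℤ * 1ℤ + (s + 1ℤ * y)) - (y + 1ℤ) ≡ s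
      lem = solve-∀
      1^ : ∀ u → P 1ℤ u 0 ≡ 1ℤ
      1^ zero    = refl
      1^ (suc u) = trans (ℤ.*-identityˡ _) (1^ u)
      expand : (x + 1ℤ) ^ suc n ≡ 1ℤ * 1ℤ + (∑ n (λ i → P 1ℤ (suc n) (suc i) * x ^ suc i) + 1ℤ * x ^ suc n)
      expand = trans (sym (P-0 (x + 1ℤ) (suc n))) (trans (P-compose x 1ℤ (suc n) 0) (trans (∑-suc (suc n) _)
        (cong₂ _+_ (cong (_* 1ℤ) (1^ (suc n))) (cong₂ _+_ (∑-cong n (λ i _ → cong (P 1ℤ (suc n) (suc i) *_) (P-0 x (suc i)))) (cong₂ _*_ (P-diagonal 1ℤ (suc n)) (P-0 x (suc n)))))))

  fermat : Prime ℓ → ∀ a → + ℓ ∣ (+ a) ^ ℓ - + a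
  fermat {ℓ} pr zero    = subst (λ z → + ℓ ∣ z - 0ℤ) (sym (0^ ℓ {{prime⇒nonZero pr}})) ∣0
    where 0^ : ∀ n .{{_ : NonZero n}} → 0ℤ ^ n ≡ 0ℤ
          0^ (suc n) = refl
  fermat {ℓ} pr (suc a) = subst (+ ℓ ∣_) eq (∣m∣n⇒∣m+n (frobenius pr (+ a)) (fermat pr a))
    where
    eq : ((+ a + 1ℤ) ^ ℓ - ((+ a) ^ ℓ + 1ℤ)) + ((+ a) ^ ℓ - + a) ≡ (+ suc a) ^ ℓ - + suc a
    eq = trans (lem ((+ a + 1ℤ) ^ ℓ) ((+ a) ^ ℓ) (+ a)) (cong (λ z → (+ z) ^ ℓ - + z) (ℕ.+-comm a 1))
      where lem : ∀ x y a → (x - (y + 1ℤ)) + (y - a) ≡ x - (a + 1ℤ)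
            lem = solve-∀

  -- For ℓ = jk + 1 a k-th power is thus 0 or a j-th root of unity modulo ℓ. With j small, only j +
  -- 1 residues have to be examined.
  fermat-power : ∀ j k → Prime (suc (j ℕ.* k)) → ∀ a → let ℓ = suc (j ℕ.* k) ; x = + (a ℕ.^ k) in + ℓ ∣ x ⊎ + ℓ ∣ x ^ j - 1ℤ
  fermat-power j k pr a with euclid pr {+ a} {(+ a) ^ (j ℕ.* k) - 1ℤ} (subst (+ suc (j ℕ.* k) ∣_) (lem (+ a) ((+ a) ^ (j ℕ.* k))) (fermat pr a))
    where lem : ∀ a x → a * x - a ≡ a * (x - 1ℤ)
          lem = solve-∀
  ... | inj₂ d = inj₂ (subst (λ z → + suc (j ℕ.* k) ∣ z - 1ℤ) eq d)
    where eq : (+ a) ^ (j ℕ.* k) ≡ (+ (a ℕ.^ k)) ^ j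
          eq = trans (pos-^ a (j ℕ.* k)) (trans (cong +_ (trans (cong (a ℕ.^_) (ℕ.*-comm j k)) (sym (ℕ.^-*-assoc a k j)))) (sym (pos-^ (a ℕ.^ k) j)))
  ... | inj₁ d with k
  ...   | zero  = inj₂ (subst (+ suc (j ℕ.* 0) ∣_) (sym (cong (_- 1ℤ) (1^ j))) ∣0)
    where 1^ : ∀ j → 1ℤ ^ j ≡ 1ℤ
          1^ zero    = refl
          1^ (suc j) = trans (ℤ.*-identityˡ _) (1^ j)
  ...   | suc k′ = inj₁ (subst (+ suc (j ℕ.* suc k′) ∣_) (sym (ℤ.pos-* a (a ℕ.^ k′))) (∣m⇒∣m*n (+ (a ℕ.^ k′)) d))

  -- The argument of `Top-roots`, with Euclid's lemma in place of the absence of zero divisors in ℤ.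
  Top-roots-mod : Prime ℓ → ∀ d {c f} xs → AllPairs (λ x y → ¬ (+ ℓ ∣ + y - + x)) xs → d < length xs → All (λ x → + ℓ ∣ f x) xs → Top d c f → + ℓ ∣ c
  Top-roots-mod {ℓ} pr zero    (x ∷ xs) _ _ (fx ∷ _) t = subst (+ ℓ ∣_) (t x) fx
  Top-roots-mod {ℓ} pr (suc d) {c} {f} (x ∷ xs) (x∉ ∷ uniq) (s≤s d<) (fx ∷ fxs) t with Top-divide d x t
  ... | g , tg , f≡ = Top-roots-mod pr d xs uniq d< (All.zipWith root (x∉ , fxs)) tg
    where
    root : ∀ {y} → (¬ (+ ℓ ∣ + y - + x)) × (+ ℓ ∣ f y) → + ℓ ∣ g y
    root {y} (x≢y , fy) with euclid pr {+ y - + x} {g y} (subst (+ ℓ ∣_) (lem _ _ _ (f≡ y)) (∣m∣n⇒∣m+n fy (∣m⇒∣-m fx)))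
      where lem : ∀ a p b → a ≡ p + b → a + - b ≡ p
            lem a p b refl = lem′ p b
              where lem′ : ∀ p b → p + b + - b ≡ p
                    lem′ = solve-∀
    ... | inj₁ e = contradiction e x≢y
    ... | inj₂ e = e

  Top-cyclotomic : ∀ j → 0 < j → Top j 1ℤ (λ u → power u j - 1ℤ)
  Top-cyclotomic (suc j) _ = Top-cong (suc j) refl (λ _ → refl) (Top-+ (suc j) (Top-power (suc j)) (Top-raises {0} {suc j} { - 1ℤ} {λ _ → - 1ℤ} (s≤s z≤n) (λ _ → refl)))

-- Sieve by primes jk + 1: the computation

module SieveTests where

  open import Data.Nat
  open import Data.Nat.DivMod
  open import Data.Bool using (Bool; true; false; _∧_; _∨_; not; if_then_else_)
  open import Data.List using (List; []; _∷_)

  -- All residues are taken modulo the prime suc n = jk + 1.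
  pw : ℕ → ℕ → ℕ → ℕ
  pw n x zero    = 1
  pw n x (suc e) = (x * pw n x e) % suc n

  distinct₂ : ℕ → ℕ → Bool
  distinct₂ t v = not (v ≡ᵇ 0) ∧ not (v ≡ᵇ t)

  -- With t = 3^j: if w is three times a k-th power, then w^j is 0 or t. The test excludes both.
  test : ℕ → ℕ → ℕ → ℕ → Bool
  test n j t w = distinct₂ t (pw n (w % suc n) j)

  -- For a residue r of a^k, the two values are those of a^k - c and a^k + c; the complement of c
  -- avoids a negative number.
  testBoth : ℕ → ℕ → ℕ → ℕ → ℕ → Bool
  testBoth n j t c r = test n j t (r + (suc n ∸ c % suc n)) ∧ test n j t (r + c)

  module _ (n j t c h : ℕ) where
    mutual
      -- The run over 1, h, h², ... tests each residue and at the same time confirms that h has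
      -- order exactly j: the value 1 must return after j steps and, by `step`, not earlier.
      walk : ℕ → ℕ → Bool
      walk zero    x = x ≡ᵇ 1
      walk (suc r) x = testBoth n j t c x ∧ step r ((x * h) % suc n)

      step : ℕ → ℕ → Bool
      step zero    x = x ≡ᵇ 1
      step (suc r) x = not (x ≡ᵇ 1) ∧ walk (suc r) x

  coprimeTest : ℕ → ℕ → ℕ → Bool
  coprimeTest zero    a b       = false
  coprimeTest (suc f) a zero    = a ≡ᵇ 1
  coprimeTest (suc f) a (suc b) = coprimeTest f (suc b) (a % suc b)

  -- Only used to propose an element of order j; its value is never trusted.
  fastPower : ℕ → ℕ → ℕ → ℕ → ℕ
  fastPower zero    n x e = 1
  fastPower (suc f) n x zero = 1
  fastPower (suc f) n x e@(suc _) with e % 2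
  ... | zero  = fastPower f n ((x * x) % suc n) (e / 2)
  ... | suc _ = (x * fastPower f n ((x * x) % suc n) (e / 2)) % suc n

  bases : List ℕ
  bases = 2 ∷ 3 ∷ 5 ∷ 7 ∷ 11 ∷ 6 ∷ 13 ∷ 10 ∷ 17 ∷ 14 ∷ 19 ∷ 23 ∷ 29 ∷ 22 ∷ 26 ∷ 15 ∷ 12 ∷ 21 ∷ []

  -- The power g^k has an order dividing j, and equal to j whenever g is a primitive root; trying
  -- several g makes a failure on this account unlikely.
  anyBase : ℕ → ℕ → ℕ → ℕ → ℕ → List ℕ → Bool
  anyBase n j k t c []       = false
  anyBase n j k t c (g ∷ gs) = walk n j t c (fastPower 32 n g k) j 1 ∨ anyBase n j k t c gs

  -- suc n is coprime to N ! for some N with N < suc n < (N + 1)²; the argument F stands for 2000 !.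
  primeTest : ℕ → ℕ → Bool
  primeTest F n = if n <ᵇ 120 then coprimeTest 60 (suc n) (10 ! % suc n) else
                 (if n <ᵇ 2499 then coprimeTest 60 (suc n) (49 ! % suc n) else
                  (n <ᵇ 4000000) ∧ coprimeTest 60 (suc n) (F % suc n))

  check : ℕ → ℕ → ℕ → ℕ → Bool
  check F k c j = (0 <ᵇ j) ∧ (primeTest F n ∧ (testBoth n j (pw n 3 j) c 0 ∧ anyBase n j k (pw n 3 j) c bases))
    where n = j * k

  search : ℕ → ℕ → ℕ → ℕ → ℕ → Bool
  search F k c zero    j = false
  search F k c (suc f) j = check F k c j ∨ search F k c f (suc j)

  skip : ℕ → Bool
  skip k = (k % 3 ≡ᵇ 0) ∨ (k % 4 ≡ᵇ 0)

  exceptional : ℕ → Bool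
  exceptional k = (k ≡ᵇ 5) ∨ (k ≡ᵇ 7)

  -- The two searches belong to the two alternatives of `ThueSol`: c = k if the factor 3 stands with
  -- b^k in q, and c = 3k if it stands with p.
  good : ℕ → ℕ → Bool
  good F k = skip k ∨ (search F k k 150 1 ∧ (exceptional k ∨ search F k (3 * k) 150 1))

  checkRange : ℕ → ℕ → ℕ → Bool
  checkRange F zero    k = true
  checkRange F (suc f) k = good F k ∧ checkRange F f (suc k)

-- Sieve by primes jk + 1: soundness

module SieveSoundness where

  open import Data.Nat as ℕ using (ℕ; zero; suc; _≤_; _<_; z≤n; s≤s; NonZero; _%_; _∸_; _≡ᵇ_; _<ᵇ_)
  import Data.Nat.Properties as ℕ
  import Data.Nat.DivMod as ℕ
  import Data.Nat.Divisibility as ℕ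
  open import Data.Nat.Primality using (Prime; prime⇒nonTrivial)
  open import Data.Integer as ℤ using (ℤ; +_; 0ℤ; 1ℤ; _+_; _*_; -_; _-_; _^_)
  import Data.Integer.Properties as ℤ
  open import Data.Integer.Divisibility.Signed using (_∣_; divides; ∣⇒∣ᵤ; ∣-refl; ∣m∣n⇒∣m+n; ∣m⇒∣-m; ∣m⇒∣m*n; ∣n⇒∣m*n; _∣?_)
  open import Data.Integer.Tactic.RingSolver using (solve-∀)
  open import Data.Bool using (true; false; _∧_; _∨_; not; T)
  open import Data.List using (List; []; _∷_; applyUpTo)
  open import Data.List.Properties using (length-applyUpTo)
  open import Data.List.Relation.Unary.All as All using (All; []; _∷_)
  import Data.List.Relation.Unary.All.Properties as All
  open import Data.List.Relation.Unary.AllPairs using (AllPairs; []; _∷_)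
  import Data.List.Relation.Unary.AllPairs.Properties as AllPairs
  open import Data.Product using (_×_; _,_; ∃-syntax; proj₁; proj₂)
  open import Data.Sum using (_⊎_; inj₁; inj₂; [_,_]′)
  open import Data.Unit using (tt)
  open import Data.Empty using (⊥)
  open import Relation.Nullary using (¬_; yes; no; contradiction)
  open import Relation.Binary.PropositionalEquality
  open Fermat
  open Gelfond using (pos-^)
  open Arithmetic using (^-distribʳ-*)
  open Determinants using (power)
  open SieveTests

  private
    ring-1 : ∀ x y → - (x - y) ≡ y - x
    ring-1 = solve-∀

    ring-2 : ∀ x y z → (x - y) + (y - z) ≡ x - z
    ring-2 = solve-∀

    ring-3 : ∀ x y x′ y′ → (x - y) * x′ + y * (x′ - y′) ≡ x * x′ - y * y′
    ring-3 = solve-∀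

    ring-4 : ∀ x y x′ y′ → (x - y) + (x′ - y′) ≡ (x + x′) - (y + y′)
    ring-4 = solve-∀

    ring-5 : ∀ r q → r + q - r ≡ q
    ring-5 = solve-∀

    ring-6 : ∀ y c → y + c - c ≡ y
    ring-6 = solve-∀

    ring-7 : ∀ a b c → (a + b) + (c - b) ≡ a - - c
    ring-7 = solve-∀

    ring-8 : ∀ x y → x * y - x ≡ x * (y - 1ℤ)
    ring-8 = solve-∀


  ∧-true : ∀ {a b} → a ∧ b ≡ true → a ≡ true × b ≡ true
  ∧-true {true} {true} _ = refl , refl

  ∨-true : ∀ {a b} → a ∨ b ≡ true → a ≡ true ⊎ b ≡ true
  ∨-true {true}  _ = inj₁ refl
  ∨-true {false} e = inj₂ e

  not-≡ᵇ : ∀ m n → not (m ≡ᵇ n) ≡ true → m ≢ n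
  not-≡ᵇ m n e m≡n with m ≡ᵇ n | ℕ.≡⇒≡ᵇ m n m≡n
  not-≡ᵇ m n () m≡n | true | _

  ≡ᵇ-true : ∀ m n → (m ≡ᵇ n) ≡ true → m ≡ n
  ≡ᵇ-true m n e = ℕ.≡ᵇ⇒≡ m n (subst T (sym e) tt)

  <ᵇ-true : ∀ m n → (m <ᵇ n) ≡ true → m < n
  <ᵇ-true m n e = ℕ.<ᵇ⇒< m n (subst T (sym e) tt)

  module Modular (n : ℕ) where
    ℓ = suc n

    infix 4 _≈_
    _≈_ : ℤ → ℤ → Set
    x ≈ y = + ℓ ∣ x - y

    ≈-refl : ∀ {x} → x ≈ x
    ≈-refl {x} = subst (+ ℓ ∣_) (sym (ℤ.+-inverseʳ x)) ∣0

    ≈-sym : ∀ {x y} → x ≈ y → y ≈ x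
    ≈-sym {x} {y} d = subst (+ ℓ ∣_) (lem x y) (∣m⇒∣-m d)
      where lem = ring-1

    ≈-trans : ∀ {x y z} → x ≈ y → y ≈ z → x ≈ z
    ≈-trans {x} {y} {z} d e = subst (+ ℓ ∣_) (lem x y z) (∣m∣n⇒∣m+n d e)
      where lem = ring-2

    ≈-* : ∀ {x y x′ y′} → x ≈ y → x′ ≈ y′ → x * x′ ≈ y * y′
    ≈-* {x} {y} {x′} {y′} d e = subst (+ ℓ ∣_) (lem x y x′ y′) (∣m∣n⇒∣m+n (∣m⇒∣m*n x′ d) (∣n⇒∣m*n y e))
      where lem = ring-3

    ≈-+ : ∀ {x y x′ y′} → x ≈ y → x′ ≈ y′ → x + x′ ≈ y + y′
    ≈-+ {x} {y} {x′} {y′} d e = subst (+ ℓ ∣_) (lem x y x′ y′) (∣m∣n⇒∣m+n d e)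
      where lem = ring-4

    ≈-^ : ∀ {x y} e → x ≈ y → x ^ e ≈ y ^ e
    ≈-^ zero    d = ≈-refl {1ℤ}
    ≈-^ {x} {y} (suc e) d = ≈-* {x} {y} {x ^ e} {y ^ e} d (≈-^ e d)

    %-≈ : ∀ m → + (m % ℓ) ≈ + m
    %-≈ m = ∣m⇒∣-m′ (divides (+ (m ℕ./ ℓ)) (trans (cong (λ z → z - + (m % ℓ)) (trans (cong +_ (ℕ.m≡m%n+[m/n]*n m ℓ)) (trans (ℤ.pos-+ (m % ℓ) _) (cong (_+_ (+ (m % ℓ))) (ℤ.pos-* (m ℕ./ ℓ) ℓ))))) (lem (+ (m % ℓ)) (+ (m ℕ./ ℓ) * + ℓ))))
      where
      lem = ring-5
      ∣m⇒∣-m′ : + ℓ ∣ + m - + (m % ℓ) → + ℓ ∣ + (m % ℓ) - + m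
      ∣m⇒∣-m′ = ≈-sym {+ m} {+ (m % ℓ)}

    ≈⇒≡ : ∀ {u v} → u < ℓ → v < ℓ → + u ≈ + v → u ≡ v
    ≈⇒≡ {u} {v} u<ℓ v<ℓ d = ℤ.+-injective (ℤ.i-j≡0⇒i≡j (+ u) (+ v) (zero-or-large (ℤ.∣ + u - + v ∣) refl))
      where
      bound : ℤ.∣ + u - + v ∣ < ℓ
      bound = subst (λ z → ℤ.∣ z ∣ < ℓ) (sym (ℤ.m-n≡m⊖n u v)) (ℕ.≤-<-trans (ℤ.∣m⊝n∣≤m⊔n u v) (ℕ.⊔-lub u<ℓ v<ℓ))
      zero-or-large : ∀ m → ℤ.∣ + u - + v ∣ ≡ m → + u - + v ≡ 0ℤ
      zero-or-large zero    e = ℤ.∣i∣≡0⇒i≡0 e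
      zero-or-large (suc m) e = contradiction (ℕ.∣⇒≤ {{subst NonZero (sym e) _}} (∣⇒∣ᵤ d)) (ℕ.<⇒≱ bound)

    pw-≈ : ∀ x e → + pw n x e ≈ (+ x) ^ e
    pw-≈ x zero    = ≈-refl {1ℤ}
    pw-≈ x (suc e) = ≈-trans {+ ((x ℕ.* pw n x e) % ℓ)} {+ (x ℕ.* pw n x e)} {(+ x) ^ suc e} (%-≈ (x ℕ.* pw n x e))
      (subst (λ z → z ≈ (+ x) ^ suc e) (sym (ℤ.pos-* x (pw n x e))) (≈-* {+ x} {+ x} {+ pw n x e} {(+ x) ^ e} (≈-refl {+ x}) (pw-≈ x e)))

    pw< : ∀ x e → 0 < e → pw n x e < ℓ
    pw< x (suc e) _ = ℕ.m%n<n (x ℕ.* pw n x e) ℓ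

    test-sound : ∀ j w → 0 < j → test n j (pw n 3 j) w ≡ true → ¬ (+ w) ^ j ≈ 0ℤ × ¬ (+ w) ^ j ≈ (+ 3) ^ j
    test-sound j w 0<j e with ∧-true e
    ... | v≢0 , v≢t = (λ d → not-≡ᵇ v 0 v≢0 (≈⇒≡ v< (s≤s z≤n) (≈-trans {+ v} {(+ w) ^ j} {0ℤ} v≈ d)))
                    , (λ d → not-≡ᵇ v (pw n 3 j) v≢t (≈⇒≡ v< (pw< 3 j 0<j) (≈-trans {+ v} {(+ w) ^ j} {+ pw n 3 j} v≈ (≈-trans {(+ w) ^ j} {(+ 3) ^ j} {+ pw n 3 j} d (≈-sym {+ pw n 3 j} {(+ 3) ^ j} (pw-≈ 3 j))))))
      where
      v = pw n (w % ℓ) j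
      v< : v < ℓ
      v< = pw< (w % ℓ) j 0<j
      v≈ : + v ≈ (+ w) ^ j
      v≈ = ≈-trans {+ v} {(+ (w % ℓ)) ^ j} {(+ w) ^ j} (pw-≈ (w % ℓ) j) (≈-^ {+ (w % ℓ)} {+ w} j (%-≈ w))

    module _ (pr : Prime ℓ) (j k c h : ℕ) (n≡ : n ≡ j ℕ.* k) (0<j : 0 < j) where
      t = pw n 3 j

      fermat′ : ∀ a → + (a ℕ.^ k) ≈ 0ℤ ⊎ (+ (a ℕ.^ k)) ^ j ≈ 1ℤ
      fermat′ a = [ (λ d → inj₁ (subst (λ z → + suc z ∣ + (a ℕ.^ k) - 0ℤ) (sym n≡) (subst (+ suc (j ℕ.* k) ∣_) (sym (ℤ.+-identityʳ _)) d)))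
                  , (λ d → inj₂ (subst (λ z → + suc z ∣ (+ (a ℕ.^ k)) ^ j - 1ℤ) (sym n≡) d)) ]′ (fermat-power j k (subst (λ z → Prime (suc z)) n≡ pr) a)

      -- By `fermat′` the j-th power of b^k is 0 or 1, which leaves 0 and 3^j for w.
      thrice : ∀ w b → + w ≈ + (3 ℕ.* b ℕ.^ k) → (+ w) ^ j ≈ 0ℤ ⊎ (+ w) ^ j ≈ (+ 3) ^ j
      thrice w b d = [ zero-case , unit-case ]′ (fermat′ b)
        where
        0^ : ∀ j → 0 < j → 0ℤ ^ j ≡ 0ℤ
        0^ (suc j) _ = refl
        zero-case : + (b ℕ.^ k) ≈ 0ℤ → (+ w) ^ j ≈ 0ℤ ⊎ (+ w) ^ j ≈ (+ 3) ^ j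
        zero-case y≈0 = inj₁ (≈-trans {(+ w) ^ j} {0ℤ ^ j} {0ℤ} (≈-^ {+ w} {0ℤ} j (≈-trans {+ w} {+ (3 ℕ.* b ℕ.^ k)} {0ℤ} d (subst (_≈ 0ℤ) (sym (ℤ.pos-* 3 (b ℕ.^ k))) (≈-* {+ 3} {+ 3} {+ (b ℕ.^ k)} {0ℤ} (≈-refl {+ 3}) y≈0)))) (subst (λ z → z ≈ 0ℤ) (sym (0^ j 0<j)) (≈-refl {0ℤ})))
        eq : (+ (3 ℕ.* b ℕ.^ k)) ^ j ≡ (+ 3) ^ j * (+ (b ℕ.^ k)) ^ j
        eq = trans (pos-^ _ j) (trans (cong +_ (^-distribʳ-* 3 (b ℕ.^ k) j)) (trans (ℤ.pos-* (3 ℕ.^ j) _) (cong₂ _*_ (sym (pos-^ 3 j)) (sym (pos-^ (b ℕ.^ k) j)))))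
        unit-case : (+ (b ℕ.^ k)) ^ j ≈ 1ℤ → (+ w) ^ j ≈ 0ℤ ⊎ (+ w) ^ j ≈ (+ 3) ^ j
        unit-case y^j≈1 = inj₂ (≈-trans {(+ w) ^ j} {(+ (3 ℕ.* b ℕ.^ k)) ^ j} {(+ 3) ^ j} (≈-^ {+ w} {+ (3 ℕ.* b ℕ.^ k)} j d)
          (subst₂ _≈_ (sym eq) (ℤ.*-identityʳ ((+ 3) ^ j)) (≈-* {(+ 3) ^ j} {(+ 3) ^ j} {(+ (b ℕ.^ k)) ^ j} {1ℤ} (≈-refl {(+ 3) ^ j}) y^j≈1)))

      test-excludes : ∀ r x b → + r ≈ + x → testBoth n j t c r ≡ true → ¬ (x ≡ 3 ℕ.* b ℕ.^ k ℕ.+ c) × ¬ (x ℕ.+ c ≡ 3 ℕ.* b ℕ.^ k)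
      test-excludes r x b r≈x e with ∧-true e
      ... | e₁ , e₂ = (λ x≡ → exclude (r ℕ.+ (ℓ ∸ c % ℓ)) e₁ (minus x≡)) , (λ x≡ → exclude (r ℕ.+ c) e₂ (plus x≡))
        where
        exclude : ∀ w → test n j t w ≡ true → ¬ (+ w ≈ + (3 ℕ.* b ℕ.^ k))
        exclude w e d = [ proj₁ (test-sound j w 0<j e) , proj₂ (test-sound j w 0<j e) ]′ (thrice w b d)
        plus : x ℕ.+ c ≡ 3 ℕ.* b ℕ.^ k → + (r ℕ.+ c) ≈ + (3 ℕ.* b ℕ.^ k)
        plus x≡ = subst₂ _≈_ (sym (ℤ.pos-+ r c)) (trans (sym (ℤ.pos-+ x c)) (cong +_ x≡)) (≈-+ {+ r} {+ x} {+ c} {+ c} r≈x (≈-refl {+ c}))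
        minus : x ≡ 3 ℕ.* b ℕ.^ k ℕ.+ c → + (r ℕ.+ (ℓ ∸ c % ℓ)) ≈ + (3 ℕ.* b ℕ.^ k)
        minus x≡ = subst₂ _≈_ (sym (ℤ.pos-+ r (ℓ ∸ c % ℓ))) (trans (cong (λ z → + z - + c) x≡) (trans (cong (_- + c) (ℤ.pos-+ (3 ℕ.* b ℕ.^ k) c)) (lem (+ (3 ℕ.* b ℕ.^ k)) (+ c))))
            (≈-+ {+ r} {+ x} {+ (ℓ ∸ c % ℓ)} { - + c} r≈x neg)
          where
          lem = ring-6
          neg : + (ℓ ∸ c % ℓ) ≈ - + c
          neg = subst (+ ℓ ∣_) (trans (cong (λ z → z + (+ c - + (c % ℓ))) (cong +_ (sym (ℕ.m∸n+n≡m (ℕ.<⇒≤ (ℕ.m%n<n c ℓ)))))) (trans (cong (_+ (+ c - + (c % ℓ))) (ℤ.pos-+ (ℓ ∸ c % ℓ) (c % ℓ))) (lem′ (+ (ℓ ∸ c % ℓ)) (+ (c % ℓ)) (+ c))))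
              (∣m∣n⇒∣m+n (∣-refl {+ ℓ}) (≈-sym {+ (c % ℓ)} {+ c} (%-≈ c)))
            where lem′ = ring-7

      r : ℕ → ℕ
      r zero    = 1
      r (suc i) = (r i ℕ.* h) % ℓ

      r-≈ : ∀ i → + r i ≈ (+ h) ^ i
      r-≈ zero    = ≈-refl {1ℤ}
      r-≈ (suc i) = ≈-trans {+ r (suc i)} {+ (r i ℕ.* h)} {(+ h) ^ suc i} (%-≈ (r i ℕ.* h))
        (subst₂ _≈_ (sym (ℤ.pos-* (r i) h)) (ℤ.*-comm ((+ h) ^ i) (+ h)) (≈-* {+ r i} {(+ h) ^ i} {+ h} {+ h} (r-≈ i) (≈-refl {+ h})))

      walk-sound : ∀ m i → walk n j t c h (suc m) (r i) ≡ true →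
        (∀ e → e < suc m → testBoth n j t c (r (i ℕ.+ e)) ≡ true) × (∀ e → e < m → r (suc (i ℕ.+ e)) ≢ 1) × r (i ℕ.+ suc m) ≡ 1
      walk-sound zero i e with ∧-true e
      ... | e₁ , e₂ = (λ { zero _ → subst (λ z → testBoth n j t c (r z) ≡ true) (sym (ℕ.+-identityʳ i)) e₁ ; (suc _) (s≤s ()) }) , (λ _ ()) , trans (cong r (ℕ.+-comm i 1)) (≡ᵇ-true _ 1 e₂)
      walk-sound (suc m) i e with ∧-true e
      ... | e₁ , e₂ with ∧-true e₂
      ...   | e₃ , e₄ with walk-sound m (suc i) e₄
      ...     | tests , proper , close =
        (λ { zero _ → subst (λ z → testBoth n j t c (r z) ≡ true) (sym (ℕ.+-identityʳ i)) e₁ ; (suc e) (s≤s e<) → subst (λ z → testBoth n j t c (r z) ≡ true) (sym (ℕ.+-suc i e)) (tests e e<) })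
        , (λ { zero _ → subst (λ z → r (suc z) ≢ 1) (sym (ℕ.+-identityʳ i)) (not-≡ᵇ _ 1 e₃) ; (suc e) (s≤s e<) → subst (λ z → r (suc z) ≢ 1) (sym (ℕ.+-suc i e)) (proper e e<) })
        , trans (cong r (ℕ.+-suc i (suc m))) close

      -- The distinct powers 1, h, ..., h^(j-1) are j roots of X^j - 1, hence all of them: one more
      -- root would contradict `Top-roots-mod`. So a^k is one of the residues tested by `walk`, or
      -- 0, which is tested separately.
      excludes : walk n j t c h j 1 ≡ true → testBoth n j t c 0 ≡ true → ∀ a b → ¬ (a ℕ.^ k ≡ 3 ℕ.* b ℕ.^ k ℕ.+ c) × ¬ (a ℕ.^ k ℕ.+ c ≡ 3 ℕ.* b ℕ.^ k)
      excludes e e₀ a b = [ (λ x≈0 → test-excludes 0 (a ℕ.^ k) b (≈-sym {+ (a ℕ.^ k)} {0ℤ} x≈0) e₀) , located (find j ℕ.≤-refl) ]′ (fermat′ a)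
        where
        x = a ℕ.^ k
        1<ℓ : 1 < ℓ
        1<ℓ = ℕ.nonTrivial⇒n>1 ℓ {{prime⇒nonTrivial pr}}
        facts : (∀ e → e < j → testBoth n j t c (r e) ≡ true) × (∀ e → 0 < e → e < j → r e ≢ 1) × r j ≡ 1
        facts = go j refl e
          where
          go : ∀ j′ → j ≡ j′ → walk n j t c h j′ 1 ≡ true → (∀ e → e < j → testBoth n j t c (r e) ≡ true) × (∀ e → 0 < e → e < j → r e ≢ 1) × r j ≡ 1
          go zero j≡0 _ = contradiction (subst (0 <_) j≡0 0<j) ℕ.n≮0
          go (suc m) j≡ e with walk-sound m 0 e
          ... | tests , proper , close = (λ e e<j → tests e (subst (e <_) j≡ e<j)) , (λ { (suc e) _ e<j → proper e (ℕ.≤-pred (subst (suc e <_) j≡ e<j)) }) , trans (cong r j≡) close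
        h^j≈1 : (+ h) ^ j ≈ 1ℤ
        h^j≈1 = ≈-trans {(+ h) ^ j} {+ r j} {1ℤ} (≈-sym {+ r j} {(+ h) ^ j} (r-≈ j)) (subst (λ z → + z ≈ 1ℤ) (sym (proj₂ (proj₂ facts))) (≈-refl {1ℤ}))
        ¬1≈0 : ¬ (1ℤ ≈ 0ℤ)
        ¬1≈0 d = ℕ.1+n≢0 (≈⇒≡ {1} {0} 1<ℓ (s≤s z≤n) d)
        h≉0 : ∀ i → ¬ ((+ h) ^ i ≈ 0ℤ)
        h≉0 zero    d = ¬1≈0 d
        h≉0 (suc i) d with euclid pr {+ h} {(+ h) ^ i} (subst (+ ℓ ∣_) (ℤ.+-identityʳ _) d)
        ... | inj₂ d′ = h≉0 i (subst (+ ℓ ∣_) (sym (ℤ.+-identityʳ _)) d′)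
        ... | inj₁ d′ = ¬1≈0 (≈-trans {1ℤ} {(+ h) ^ j} {0ℤ} (≈-sym {(+ h) ^ j} {1ℤ} h^j≈1) (power0 j 0<j))
          where power0 : ∀ j → 0 < j → (+ h) ^ j ≈ 0ℤ
                power0 (suc j) _ = subst (+ ℓ ∣_) (sym (ℤ.+-identityʳ _)) (∣m⇒∣m*n ((+ h) ^ j) d′)
        distinct : ∀ {i i′} → i < i′ → i′ < j → ¬ (+ r i′ ≈ + r i)
        distinct {i} {i′} i<i′ i′<j d = [ (λ d′ → h≉0 i (subst (+ ℓ ∣_) (sym (ℤ.+-identityʳ _)) d′)) , proper ]′
            (euclid pr {(+ h) ^ i} {(+ h) ^ δ - 1ℤ} (subst (+ ℓ ∣_) eq (≈-trans {(+ h) ^ i′} {+ r i′} {(+ h) ^ i} (≈-sym {+ r i′} {(+ h) ^ i′} (r-≈ i′)) (≈-trans {+ r i′} {+ r i} {(+ h) ^ i} d (r-≈ i)))))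
          where
          δ = i′ ∸ i
          lem = ring-8
          eq : (+ h) ^ i′ - (+ h) ^ i ≡ (+ h) ^ i * ((+ h) ^ δ - 1ℤ)
          eq = trans (cong (λ z → (+ h) ^ z - (+ h) ^ i) (sym (ℕ.m+[n∸m]≡n (ℕ.<⇒≤ i<i′)))) (trans (cong (_- (+ h) ^ i) (ℤ.^-distribˡ-+-* (+ h) i δ)) (lem ((+ h) ^ i) ((+ h) ^ δ)))
          r< : ∀ i → r i < ℓ
          r< zero    = 1<ℓ
          r< (suc i) = ℕ.m%n<n (r i ℕ.* h) ℓ
          proper : (+ h) ^ δ ≈ 1ℤ → ⊥
          proper d′ = proj₁ (proj₂ facts) δ (ℕ.m<n⇒0<n∸m i<i′) (ℕ.≤-<-trans (ℕ.m∸n≤m i′ i) i′<j) (≈⇒≡ (r< δ) 1<ℓ (≈-trans {+ r δ} {(+ h) ^ δ} {1ℤ} (r-≈ δ) d′))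
        find : ∀ m → m ≤ j → (∃[ i ] (i < j × + r i ≈ + x)) ⊎ (∀ i → i < m → ¬ (+ r i ≈ + x))
        find zero    _   = inj₂ λ _ ()
        find (suc m) m<j with (+ ℓ) ∣? (+ r m - + x) | find m (ℕ.<⇒≤ m<j)
        ... | yes d | _ = inj₁ (m , m<j , d)
        ... | no _  | inj₁ found = inj₁ found
        ... | no ¬d | inj₂ none = inj₂ λ i i<1+m → case i (ℕ.m≤n⇒m<n∨m≡n (ℕ.≤-pred i<1+m))
          where case : ∀ i → i < m ⊎ i ≡ m → ¬ (+ r i ≈ + x)
                case i (inj₁ i<m)  = none i i<m
                case i (inj₂ refl) = ¬d
        located : (∃[ i ] (i < j × + r i ≈ + x)) ⊎ (∀ i → i < j → ¬ (+ r i ≈ + x)) → (+ x) ^ j ≈ 1ℤ → ¬ (x ≡ 3 ℕ.* b ℕ.^ k ℕ.+ c) × ¬ (x ℕ.+ c ≡ 3 ℕ.* b ℕ.^ k)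
        located (inj₁ (i , i<j , d)) _ = test-excludes (r i) x b d (proj₁ facts i i<j)
        located (inj₂ none) x^j≈1 = contradiction (subst (+ ℓ ∣_) (sym (ℤ.+-identityʳ 1ℤ)) (Top-roots-mod pr j {1ℤ} {λ u → power u j - 1ℤ} (x ∷ applyUpTo r j)
            (All.applyUpTo⁺₁ r j (λ {i} i<j → none i i<j) ∷ AllPairs.applyUpTo⁺₁ r j (λ i<i′ i′<j → distinct i<i′ i′<j))
            (ℕ.≤-reflexive (cong suc (sym (length-applyUpTo r j))))
            (x^j≈1 ∷ All.applyUpTo⁺₁ r j (λ {i} _ → root i)) (Top-cyclotomic j 0<j))) ¬1≈0
          where
          root : ∀ i → (+ r i) ^ j ≈ 1ℤ
          root i = ≈-trans {(+ r i) ^ j} {((+ h) ^ i) ^ j} {1ℤ} (≈-^ {+ r i} {(+ h) ^ i} j (r-≈ i))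
            (subst (_≈ 1ℤ) (trans (ℤ.^-*-assoc (+ h) j i) (trans (cong ((+ h) ^_) (ℕ.*-comm j i)) (sym (ℤ.^-*-assoc (+ h) i j))))
              (subst (λ z → ((+ h) ^ j) ^ i ≈ z) (1^ i) (≈-^ {(+ h) ^ j} {1ℤ} i h^j≈1)))
            where 1^ : ∀ i → 1ℤ ^ i ≡ 1ℤ
                  1^ zero    = refl
                  1^ (suc i) = trans (ℤ.*-identityˡ _) (1^ i)

-- The exponents 3 ≤ k < 41370

module SmallExponents where

  open import Data.Nat
  open import Data.Nat.Properties
  open import Data.Nat.DivMod
  open import Data.Nat.Divisibility
  open import Data.Nat.Primality using (Prime; prime)
  open import Data.Bool using (true; false; _∧_; _∨_)
  open import Data.List using (_∷_)
  open import Data.Product using (_×_; _,_; proj₁; proj₂)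
  open import Data.Sum using (_⊎_; inj₁; inj₂; [_,_]′)
  open import Data.Unit using (tt)
  open import Relation.Nullary using (¬_; yes; no)
  open import Relation.Nullary.Decidable using (toWitness)
  open import Relation.Binary.PropositionalEquality
  open SieveTests
  open SieveSoundness

  coprimeTest-sound : ∀ f a b {d} → coprimeTest f a b ≡ true → d ∣ a → d ∣ b → d ≡ 1
  coprimeTest-sound (suc f) a zero    e d∣a _   = ∣1⇒≡1 (subst (_ ∣_) (≡ᵇ-true a 1 e) d∣a)
  coprimeTest-sound (suc f) a (suc b) e d∣a d∣b = coprimeTest-sound f (suc b) (a % suc b) e d∣b (%-presˡ-∣ d∣a d∣b)

  d∣N! : ∀ {d N} → 0 < d → d ≤ N → d ∣ N !
  d∣N! {suc d} _ d≤N = ∣-trans (m∣m*n (d !)) (m≤n⇒m!∣n! d≤N)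

  -- Of two complementary divisors of a number below (N + 1)², one is at most N and so divides F;
  -- coprimality makes it 1.
  coprime-factorial⇒prime : ∀ N F ℓ → (∀ {d} → 0 < d → d ≤ N → d ∣ F) → 1 < ℓ → ℓ < suc N * suc N → (∀ {d} → d ∣ ℓ → d ∣ F → d ≡ 1) → Prime ℓ
  coprime-factorial⇒prime N F ℓ factors 1<ℓ ℓ< cop = prime {{n>1⇒nonTrivial 1<ℓ}} notComposite
    where
    notComposite : ¬ (ℓ HasNonTrivialDivisorLessThan ℓ)
    notComposite (hasNonTrivialDivisor {d} {{nt}} d<ℓ d∣ℓ@(divides q ℓ≡)) with d ≤? N
    ... | yes d≤N = nonTrivial⇒≢1 {{nt}} (cop d∣ℓ (factors (<-trans (s≤s z≤n) (nonTrivial⇒n>1 d {{nt}})) d≤N))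
    ... | no  d≰N = <⇒≢ d<ℓ (sym (trans ℓ≡ (trans (cong (_* d) q≡1) (*-identityˡ d))))
      where
      q≤N : q ≤ N
      q≤N = ≤-pred (≰⇒> λ N<q → <⇒≱ ℓ< (≤-trans (*-mono-≤ N<q (≰⇒> d≰N)) (≤-reflexive (sym ℓ≡))))
      0<q : 0 < q
      0<q = n≢0⇒n>0 λ { refl → <⇒≢ (<-trans (s≤s z≤n) 1<ℓ) (sym ℓ≡) }
      q≡1 : q ≡ 1
      q≡1 = cop (divides d (trans ℓ≡ (*-comm q d))) (factors 0<q q≤N)

  module _ (F : ℕ) (factors : ∀ {d} → 0 < d → d ≤ 2000 → d ∣ F) where

    coprime-% : ∀ F n {d} → coprimeTest 60 (suc n) (F % suc n) ≡ true → d ∣ suc n → d ∣ F → d ≡ 1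
    coprime-% F n e d∣ℓ d∣F = coprimeTest-sound 60 (suc n) (F % suc n) e d∣ℓ (%-presˡ-∣ d∣F d∣ℓ)

    primeTest-sound : ∀ n → 0 < n → primeTest F n ≡ true → Prime (suc n)
    primeTest-sound n 0<n e with n <ᵇ 120 in e₁ | n <ᵇ 2499 in e₂
    ... | true  | _     = coprime-factorial⇒prime 10 (10 !) (suc n) d∣N! (s≤s 0<n) (s≤s (<ᵇ-true n 120 e₁)) (coprime-% (10 !) n e)
    ... | false | true  = coprime-factorial⇒prime 49 (49 !) (suc n) d∣N! (s≤s 0<n) (s≤s (<ᵇ-true n 2499 e₂)) (coprime-% (49 !) n e)
    ... | false | false with ∧-true {n <ᵇ 4000000} e
    ...   | e₃ , e₄ = coprime-factorial⇒prime 2000 F (suc n) factors (s≤s 0<n) (<-trans (s≤s (<ᵇ-true n 4000000 e₃)) (toWitness {a? = 4000001 <? 2001 * 2001} tt)) (coprime-% F n e₄)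

    Excluded : ℕ → ℕ → Set
    Excluded k c = ∀ a b → ¬ (a ^ k ≡ 3 * b ^ k + c) × ¬ (a ^ k + c ≡ 3 * b ^ k)

    check-sound : ∀ k c j → 0 < k → check F k c j ≡ true → Excluded k c
    check-sound k c j 0<k e with ∧-true {0 <ᵇ j} e
    ... | e₁ , e₂ with ∧-true {primeTest F (j * k)} e₂
    ...   | e₃ , e₄ with ∧-true {testBoth (j * k) j (pw (j * k) 3 j) c 0} e₄
    ...     | e₅ , e₆ = bases-sound bases e₆
      where
      0<j : 0 < j
      0<j = <ᵇ-true 0 j e₁
      pr : Prime (suc (j * k))
      pr = primeTest-sound (j * k) (*-mono-≤ 0<j 0<k) e₃
      bases-sound : ∀ gs → anyBase (j * k) j k (pw (j * k) 3 j) c gs ≡ true → Excluded k c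
      bases-sound (g ∷ gs) e with ∨-true {walk (j * k) j (pw (j * k) 3 j) c (fastPower 32 (j * k) g k) j 1} e
      ... | inj₁ e = Modular.excludes (j * k) pr j k c (fastPower 32 (j * k) g k) refl 0<j e e₅
      ... | inj₂ e = bases-sound gs e

    search-sound : ∀ k c f j → 0 < k → search F k c f j ≡ true → Excluded k c
    search-sound k c (suc f) j 0<k e with ∨-true {check F k c j} e
    ... | inj₁ e = check-sound k c j 0<k e
    ... | inj₂ e = search-sound k c f (suc j) 0<k e

    Good : ℕ → Set
    Good k = (k % 3 ≡ 0 ⊎ k % 4 ≡ 0) ⊎ (Excluded k k × ((k ≡ 5 ⊎ k ≡ 7) ⊎ Excluded k (3 * k)))

    good-sound : ∀ k → 0 < k → good F k ≡ true → Good k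
    good-sound k 0<k e = [ (λ s → inj₁ ([ (λ s → inj₁ (≡ᵇ-true (k % 3) 0 s)) , (λ s → inj₂ (≡ᵇ-true (k % 4) 0 s)) ]′ (∨-true {k % 3 ≡ᵇ 0} s))) , searched ]′ (∨-true {skip k} e)
      where
      special : exceptional k ≡ true → k ≡ 5 ⊎ k ≡ 7
      special s = [ (λ s → inj₁ (≡ᵇ-true k 5 s)) , (λ s → inj₂ (≡ᵇ-true k 7 s)) ]′ (∨-true {k ≡ᵇ 5} s)
      searched : search F k k 150 1 ∧ (exceptional k ∨ search F k (3 * k) 150 1) ≡ true → Good k
      searched s = inj₂ (search-sound k k 150 1 0<k (proj₁ (∧-true s)) ,
        [ (λ s → inj₁ (special s)) , (λ s → inj₂ (search-sound k (3 * k) 150 1 0<k s)) ]′ (∨-true {exceptional k} (proj₂ (∧-true {search F k k 150 1} s))))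

    range-sound : ∀ f k → 0 < k → checkRange F f k ≡ true → ∀ i → i < f → Good (k + i)
    range-sound (suc f) k 0<k e zero    _         = subst Good (sym (+-identityʳ k)) (good-sound k 0<k (proj₁ (∧-true {good F k} e)))
    range-sound (suc f) k 0<k e (suc i) (s≤s i<f) = subst Good (sym (+-suc k i)) (range-sound f (suc k) (s≤s z≤n) (proj₂ (∧-true {good F k} e)) i i<f)

  abstract
    sieve : ∀ k → 3 ≤ k → k < 41370 → Good (2000 !) d∣N! k
    -- The range has 41370 - 3 = 41367 exponents; `refl` is the whole computation.
    sieve k 3≤k k< = subst (Good (2000 !) d∣N!) (m+[n∸m]≡n 3≤k) (range-sound (2000 !) d∣N! 41367 3 (s≤s z≤n) refl (k ∸ 3) (∸-monoˡ-< k< 3≤k))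

-- Exponents divisible by 3 or by 4

module ExponentDivisibility where

  open import Data.Nat
  open import Data.Nat.Properties
  open import Data.Nat.DivMod
  open import Data.Nat.Divisibility
  open import Data.Nat.Primality using (Prime; euclidsLemma; prime?)
  open import Data.Nat.Coprimality using (Coprime)
  open import Data.Product using (_×_; _,_)
  open import Data.Sum using (_⊎_; inj₁; inj₂; swap)
  open import Data.Unit using (tt)
  open import Data.Empty using (⊥)
  open import Relation.Nullary using (¬_; contradiction)
  open import Relation.Nullary.Decidable using (toWitness)
  open import Relation.Binary.PropositionalEquality
  open ToThue using (ThueSol)

  ∣m+n∣n⇒∣m : ∀ {d} m {n} → d ∣ m + n → d ∣ n → d ∣ m
  ∣m+n∣n⇒∣m {d} m {n} e f = ∣m+n∣m⇒∣n (subst (d ∣_) (+-comm m n) e) f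

  prime-3 : Prime 3
  prime-3 = toWitness {a? = prime? 3} tt

  prime∣^ : ∀ {p} → Prime p → ∀ a k → p ∣ a ^ k → p ∣ a
  prime∣^ pr a zero    d = ∣-trans d (divides a (sym (*-identityʳ a)))
  prime∣^ pr a (suc k) d with euclidsLemma a (a ^ k) pr d
  ... | inj₁ e = e
  ... | inj₂ e = prime∣^ pr a k e

  3∤coprime : ∀ {p q} → Coprime p q → 3 ∣ p → ¬ 3 ∣ q
  3∤coprime c d e with c (d , e)
  ... | ()

  transfer : ∀ {d p q k} → p ≡ q + k ⊎ q ≡ p + k → d ∣ k → d ∣ q → d ∣ p
  transfer {d} (inj₁ p≡q+k) d∣k d∣q = subst (d ∣_) (sym p≡q+k) (∣m∣n⇒∣m+n d∣q d∣k)
  transfer {d} (inj₂ q≡p+k) d∣k d∣q = ∣m+n∣n⇒∣m _ (subst (d ∣_) q≡p+k d∣q) d∣k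

  -- As 3 divides k, it divides p and q together. It does divide one: q in the second alternative;
  -- in the first, p, since 3p = a^k is then divisible by 9, k being at least 2.
  no-3∣k : ∀ {k p q a b} → 2 ≤ k → 3 ∣ k → Coprime p q → ¬ ThueSol k p q a b
  no-3∣k {k} {p} {q} {a} {b} 2≤k 3∣k c (diff , inj₂ (p≡ , q≡)) = 3∤coprime c 3∣p 3∣q
    where
    3∣q : 3 ∣ q
    3∣q = divides (b ^ k) (trans q≡ (*-comm 3 (b ^ k)))
    3∣p : 3 ∣ p
    3∣p = transfer diff 3∣k 3∣q
  no-3∣k {suc (suc k)} {p} {q} {a} {b} 2≤k 3∣k c (diff , inj₁ (3p≡ , q≡)) = 3∤coprime c 3∣p 3∣q
    where
    3∣a : 3 ∣ a
    3∣a = prime∣^ prime-3 a (suc (suc k)) (divides p (trans (sym 3p≡) (*-comm 3 p)))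
    3∣p : 3 ∣ p
    3∣p = *-cancelˡ-∣ 3 (subst (9 ∣_) (sym 3p≡) (∣-trans (*-pres-∣ 3∣a 3∣a) (divides (a ^ k) (trans (sym (*-assoc a a (a ^ k))) (*-comm (a * a) (a ^ k))))))
    3∣q : 3 ∣ q
    3∣q = transfer (swap diff) 3∣k 3∣p
  no-3∣k {suc zero} (s≤s ()) _ _ _

  odd : ℕ → Set
  odd n = n % 2 ≡ 1

  -- Already the squares of odd numbers are 1 modulo 8; the table goes through the odd residues.
  odd-fourth : ∀ a m → odd a → (a ^ (m * 4)) % 8 ≡ 1
  odd-fourth a m odd-a = trans (cong (_% 8) (trans (cong (a ^_) (*-comm m 4)) (sym (^-*-assoc a 4 m)))) (go m)
    where
    r = a % 8
    r-odd : odd r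
    r-odd = trans (m%n%n′ a) odd-a
      where m%n%n′ : ∀ a → (a % 8) % 2 ≡ a % 2
            m%n%n′ a = m∣n⇒o%n%m≡o%m 2 8 a (divides 4 refl)
    table : ∀ r → r < 8 → odd r → ((r * (r * (r * (r * 1))))) % 8 ≡ 1
    table 0 _ ()
    table 1 _ _ = refl
    table 2 _ ()
    table 3 _ _ = refl
    table 4 _ ()
    table 5 _ _ = refl
    table 6 _ ()
    table 7 _ _ = refl
    table (suc (suc (suc (suc (suc (suc (suc (suc _)))))))) (s≤s (s≤s (s≤s (s≤s (s≤s (s≤s (s≤s (s≤s ())))))))) _
    ^-% : ∀ x e → (x ^ e) % 8 ≡ ((x % 8) ^ e) % 8
    ^-% x zero    = refl
    ^-% x (suc e) = trans (%-distribˡ-* x (x ^ e) 8) (trans (cong (λ z → (x % 8 * z) % 8) (^-% x e)) (trans (cong (λ z → (z * ((x % 8) ^ e % 8)) % 8) (sym (m%n%n≡m%n x 8))) (sym (%-distribˡ-* (x % 8) ((x % 8) ^ e) 8))))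
    a4 : (a ^ 4) % 8 ≡ 1
    a4 = trans (^-% a 4) (table r (m%n<n a 8) r-odd)
    go : ∀ m → ((a ^ 4) ^ m) % 8 ≡ 1
    go m = trans (^-% (a ^ 4) m) (trans (cong (λ z → (z ^ m) % 8) a4) (cong (_% 8) (^-zeroˡ m)))

  odd-factor : ∀ a k → odd (a ^ suc k) → odd a
  odd-factor a k o with a % 2 in e
  ... | 1 = refl
  ... | 0 = contradiction (trans (sym o) (trans (%-distribˡ-* a (a ^ k) 2) (cong (λ z → (z * (a ^ k % 2)) % 2) e))) λ ()
  ... | suc (suc r) = contradiction (subst (_< 2) e (m%n<n a 2)) λ { (s≤s (s≤s ())) }

  ≡0mod4⇒≢2mod8 : ∀ m → (m * 4) % 8 ≡ 0 ⊎ (m * 4) % 8 ≡ 4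
  ≡0mod4⇒≢2mod8 zero          = inj₁ refl
  ≡0mod4⇒≢2mod8 (suc zero)    = inj₂ refl
  ≡0mod4⇒≢2mod8 (suc (suc m)) with ≡0mod4⇒≢2mod8 m
  ... | inj₁ e = inj₁ (trans (trans (cong (_% 8) (+-comm 8 (m * 4))) ([m+n]%n≡m%n (m * 4) 8)) e)
  ... | inj₂ e = inj₂ (trans (trans (cong (_% 8) (+-comm 8 (m * 4))) ([m+n]%n≡m%n (m * 4) 8)) e)

  -- Both p and q are odd, so one is 1 and the other 3 modulo 8, and their difference is 2 modulo 4.
  no-4∣k : ∀ {k p q a b} → 0 < k → 4 ∣ k → Coprime p q → ¬ ThueSol k p q a b
  no-4∣k {k} {p} {q} {a} {b} 0<k (divides zero    k≡) c sol = contradiction k≡ (>⇒≢ 0<k)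
  no-4∣k {k} {p} {q} {a} {b} 0<k (divides (suc m) refl) c (diff , kind) = finish kind diff
    where
    4m = suc m * 4
    even-k : 2 ∣ k
    even-k = divides (suc m * 2) (sym (*-assoc (suc m) 2 2))
    even-or-odd : ∀ n → n % 2 ≡ 0 ⊎ odd n
    even-or-odd n with n % 2 | m%n<n n 2
    ... | 0 | _ = inj₁ refl
    ... | 1 | _ = inj₂ refl
    ... | suc (suc _) | s≤s (s≤s ())
    odd-p : odd p
    odd-p with even-or-odd p
    ... | inj₂ o = o
    ... | inj₁ e = contradiction (c (m%n≡0⇒n∣m p 2 e , transfer (swap diff) even-k (m%n≡0⇒n∣m p 2 e))) λ ()
    odd-q : odd q
    odd-q with even-or-odd q
    ... | inj₂ o = o
    ... | inj₁ e = contradiction (c (transfer diff even-k (m%n≡0⇒n∣m q 2 e) , m%n≡0⇒n∣m q 2 e)) λ ()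
    sum-mod : ∀ x r → x % 8 ≡ r → (x + k) % 8 ≡ (r + 0) % 8 ⊎ (x + k) % 8 ≡ (r + 4) % 8
    sum-mod x r e with ≡0mod4⇒≢2mod8 (suc m)
    ... | inj₁ z = inj₁ (trans (%-distribˡ-+ x k 8) (cong₂ (λ u v → (u + v) % 8) e z))
    ... | inj₂ z = inj₂ (trans (%-distribˡ-+ x k 8) (cong₂ (λ u v → (u + v) % 8) e z))
    clash : p % 8 ≡ 1 → q % 8 ≡ 3 → p ≡ q + k ⊎ q ≡ p + k → ⊥
    clash p1 q3 (inj₁ p≡) with sum-mod q 3 q3
    ... | inj₁ z = contradiction (trans (sym p1) (trans (cong (_% 8) p≡) z)) λ ()
    ... | inj₂ z = contradiction (trans (sym p1) (trans (cong (_% 8) p≡) z)) λ ()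
    clash p1 q3 (inj₂ q≡) with sum-mod p 1 p1
    ... | inj₁ z = contradiction (trans (sym q3) (trans (cong (_% 8) q≡) z)) λ ()
    ... | inj₂ z = contradiction (trans (sym q3) (trans (cong (_% 8) q≡) z)) λ ()
    clash′ : p % 8 ≡ 3 → q % 8 ≡ 1 → p ≡ q + k ⊎ q ≡ p + k → ⊥
    clash′ p3 q1 (inj₁ p≡) with sum-mod q 1 q1
    ... | inj₁ z = contradiction (trans (sym p3) (trans (cong (_% 8) p≡) z)) λ ()
    ... | inj₂ z = contradiction (trans (sym p3) (trans (cong (_% 8) p≡) z)) λ ()
    clash′ p3 q1 (inj₂ q≡) with sum-mod p 3 p3
    ... | inj₁ z = contradiction (trans (sym q1) (trans (cong (_% 8) q≡) z)) λ ()
    ... | inj₂ z = contradiction (trans (sym q1) (trans (cong (_% 8) q≡) z)) λ ()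
    odd-thrice : ∀ x → odd (3 * x) → odd x
    odd-thrice x o with even-or-odd x
    ... | inj₂ o′ = o′
    ... | inj₁ e = contradiction (trans (sym o) (trans (%-distribˡ-* 3 x 2) (cong (λ z → (1 * z) % 2) e))) λ ()
    thrice-mod : ∀ x → (3 * x) % 8 ≡ 1 → x % 8 ≡ 3
    thrice-mod x e = trans (sym ([m+kn]%n≡m%n x x 8)) (trans (cong (_% 8) (lem x)) (trans (%-distribˡ-* 3 (3 * x) 8) (cong (λ z → (3 * z) % 8) e)))
      where lem : ∀ x → x + x * 8 ≡ 3 * (3 * x)
            lem x = trans (cong (x +_) (*-comm x 8)) (*-assoc 3 3 x)
    finish : (3 * p ≡ a ^ k × q ≡ b ^ k) ⊎ (p ≡ a ^ k × q ≡ 3 * b ^ k) → p ≡ q + k ⊎ q ≡ p + k → ⊥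
    finish (inj₂ (p≡ , q≡)) = clash (trans (cong (_% 8) p≡) (odd-fourth a (suc m) (odd-factor a (3 + m * 4) (trans (cong (_% 2) (sym p≡)) odd-p))))
      (trans (cong (_% 8) q≡) (trans (%-distribˡ-* 3 (b ^ k) 8) (cong (λ z → (3 * z) % 8) (odd-fourth b (suc m) (odd-factor b (3 + m * 4) (odd-thrice (b ^ k) (trans (cong (_% 2) (sym q≡)) odd-q)))))))
    finish (inj₁ (3p≡ , q≡)) = clash′ (thrice-mod p (trans (cong (_% 8) 3p≡) (odd-fourth a (suc m) (odd-factor a (3 + m * 4) (trans (cong (_% 2) (sym 3p≡)) (trans (%-distribˡ-* 3 p 2) (cong (λ z → (1 * z) % 2) odd-p)))))))
      (trans (cong (_% 8) q≡) (odd-fourth b (suc m) (odd-factor b (3 + m * 4) (trans (cong (_% 2) (sym q≡)) odd-q))))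

-- The ring ℤ[η] with η^k = 3

module Order where

  open import Data.Nat as ℕ using (ℕ; zero; suc; _≤_; _<_; z≤n; s≤s)
  import Data.Nat.Properties as ℕ
  open import Data.Integer as ℤ using (ℤ; +_; 0ℤ; 1ℤ; _+_; _*_)
  import Data.Integer.Properties as ℤ
  open import Data.Integer.Tactic.RingSolver using (solve-∀)
  open import Data.Vec using (Vec; []; _∷_)
  open import Data.Product using (_×_; _,_; proj₁; proj₂)
  open import Relation.Binary.PropositionalEquality

  infixl 6 _⊕_
  infixl 7 _⊙_

  _⊕_ : ∀ {n} → Vec ℤ n → Vec ℤ n → Vec ℤ n
  []      ⊕ []      = []
  (a ∷ v) ⊕ (b ∷ w) = (a + b) ∷ (v ⊕ w)

  _⊙_ : ∀ {n} → ℤ → Vec ℤ n → Vec ℤ n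
  a ⊙ []      = []
  a ⊙ (b ∷ v) = (a * b) ∷ (a ⊙ v)

  zeros : ∀ n → Vec ℤ n
  zeros zero    = []
  zeros (suc n) = 0ℤ ∷ zeros n

  dot : ∀ {n} → Vec ℤ n → Vec ℤ n → ℤ
  dot []      []      = 0ℤ
  dot (a ∷ v) (b ∷ w) = a * b + dot v w

  ⊕-assoc : ∀ {n} (u v w : Vec ℤ n) → (u ⊕ v) ⊕ w ≡ u ⊕ (v ⊕ w)
  ⊕-assoc []      []      []      = refl
  ⊕-assoc (a ∷ u) (b ∷ v) (c ∷ w) = cong₂ _∷_ (ℤ.+-assoc a b c) (⊕-assoc u v w)

  ⊕-comm : ∀ {n} (u v : Vec ℤ n) → u ⊕ v ≡ v ⊕ u
  ⊕-comm []      []      = refl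
  ⊕-comm (a ∷ u) (b ∷ v) = cong₂ _∷_ (ℤ.+-comm a b) (⊕-comm u v)

  ⊕-identityʳ : ∀ {n} (u : Vec ℤ n) → u ⊕ zeros n ≡ u
  ⊕-identityʳ []      = refl
  ⊕-identityʳ (a ∷ u) = cong₂ _∷_ (ℤ.+-identityʳ a) (⊕-identityʳ u)

  ⊙-⊕ : ∀ {n} a (u v : Vec ℤ n) → a ⊙ (u ⊕ v) ≡ a ⊙ u ⊕ a ⊙ v
  ⊙-⊕ a []      []      = refl
  ⊙-⊕ a (b ∷ u) (c ∷ v) = cong₂ _∷_ (ℤ.*-distribˡ-+ a b c) (⊙-⊕ a u v)

  ⊙-⊙ : ∀ {n} a b (u : Vec ℤ n) → a ⊙ (b ⊙ u) ≡ (a * b) ⊙ u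
  ⊙-⊙ a b []      = refl
  ⊙-⊙ a b (c ∷ u) = cong₂ _∷_ (sym (ℤ.*-assoc a b c)) (⊙-⊙ a b u)

  +-⊙ : ∀ {n} a b (u : Vec ℤ n) → (a + b) ⊙ u ≡ a ⊙ u ⊕ b ⊙ u
  +-⊙ a b []      = refl
  +-⊙ a b (c ∷ u) = cong₂ _∷_ (ℤ.*-distribʳ-+ c a b) (+-⊙ a b u)

  1-⊙ : ∀ {n} (u : Vec ℤ n) → 1ℤ ⊙ u ≡ u
  1-⊙ []      = refl
  1-⊙ (c ∷ u) = cong₂ _∷_ (ℤ.*-identityˡ c) (1-⊙ u)

  ⊙-zeros : ∀ n a → a ⊙ zeros n ≡ zeros n
  ⊙-zeros zero    a = refl
  ⊙-zeros (suc n) a = cong₂ _∷_ (ℤ.*-zeroʳ a) (⊙-zeros n a)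

  0-⊙ : ∀ {n} (u : Vec ℤ n) → 0ℤ ⊙ u ≡ zeros n
  0-⊙ []      = refl
  0-⊙ (c ∷ u) = cong (0ℤ ∷_) (0-⊙ u)

  ⊙-comm : ∀ {n} a b (u : Vec ℤ n) → a ⊙ (b ⊙ u) ≡ b ⊙ (a ⊙ u)
  ⊙-comm a b u = trans (⊙-⊙ a b u) (trans (cong (_⊙ u) (ℤ.*-comm a b)) (sym (⊙-⊙ b a u)))

  ⊙-cancel : ∀ {n} a → a ≢ 0ℤ → {u v : Vec ℤ n} → a ⊙ u ≡ a ⊙ v → u ≡ v
  ⊙-cancel a a≢0 {[]}    {[]}    eq = refl
  ⊙-cancel a a≢0 {b ∷ u} {c ∷ v} eq = cong₂ _∷_ (ℤ.*-cancelˡ-≡ a b c {{ℤ.≢-nonZero a≢0}} (cong head eq)) (⊙-cancel a a≢0 (cong tail eq))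
    where open import Data.Vec using (head; tail)

  ⊕-interchange : ∀ {n} (a b c d : Vec ℤ n) → (a ⊕ b) ⊕ (c ⊕ d) ≡ (a ⊕ c) ⊕ (b ⊕ d)
  ⊕-interchange []      []      []      []      = refl
  ⊕-interchange (a ∷ u) (b ∷ v) (c ∷ w) (d ∷ x) = cong₂ _∷_ (lem a b c d) (⊕-interchange u v w x)
    where lem : ∀ a b c d → (a + b) + (c + d) ≡ (a + c) + (b + d)
          lem = solve-∀

  dot-⊕ : ∀ {n} (ℓ u v : Vec ℤ n) → dot ℓ (u ⊕ v) ≡ dot ℓ u + dot ℓ v
  dot-⊕ []      []      []      = refl
  dot-⊕ (l ∷ ℓ) (a ∷ u) (b ∷ v) = trans (cong (_+_ (l * (a + b))) (dot-⊕ ℓ u v)) (lem l a b (dot ℓ u) (dot ℓ v))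
    where lem : ∀ l a b s t → l * (a + b) + (s + t) ≡ (l * a + s) + (l * b + t)
          lem = solve-∀

  dot-⊙ : ∀ {n} a (ℓ u : Vec ℤ n) → dot ℓ (a ⊙ u) ≡ a * dot ℓ u
  dot-⊙ a []      []      = sym (ℤ.*-zeroʳ a)
  dot-⊙ a (l ∷ ℓ) (b ∷ u) = trans (cong (_+_ (l * (a * b))) (dot-⊙ a ℓ u)) (lem a l b (dot ℓ u))
    where lem : ∀ a l b s → l * (a * b) + a * s ≡ a * (l * b + s)
          lem = solve-∀

  dot-zeros : ∀ {n} (ℓ : Vec ℤ n) → dot ℓ (zeros n) ≡ 0ℤ
  dot-zeros []      = refl
  dot-zeros (l ∷ ℓ) = trans (cong₂ _+_ (ℤ.*-zeroʳ l) (dot-zeros ℓ)) refl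

  -- Multiplication by η moves (a , v) one place up, to (into a v , out a v).
  out : ∀ {n} → ℤ → Vec ℤ n → ℤ
  out a []      = a
  out a (b ∷ v) = out b v

  into : ∀ {n} → ℤ → Vec ℤ n → Vec ℤ n
  into a []      = []
  into a (b ∷ v) = a ∷ into b v

  -- Multiplication by η in ℤ[η], η^n = 3, on coordinate vectors with respect to 1, η, η², …
  shift : ∀ {n} → Vec ℤ (suc n) → Vec ℤ (suc n)
  shift (a ∷ v) = + 3 * out a v ∷ into a v

  carry-⊕ : ∀ {n} a b (v w : Vec ℤ n) → out (a + b) (v ⊕ w) ≡ out a v + out b w × into (a + b) (v ⊕ w) ≡ into a v ⊕ into b w
  carry-⊕ a b []      []      = refl , refl
  carry-⊕ a b (c ∷ v) (d ∷ w) = proj₁ (carry-⊕ c d v w) , cong ((a + b) ∷_) (proj₂ (carry-⊕ c d v w))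

  carry-⊙ : ∀ {n} s a (v : Vec ℤ n) → out (s * a) (s ⊙ v) ≡ s * out a v × into (s * a) (s ⊙ v) ≡ s ⊙ into a v
  carry-⊙ s a []      = refl , refl
  carry-⊙ s a (c ∷ v) = proj₁ (carry-⊙ s c v) , cong ((s * a) ∷_) (proj₂ (carry-⊙ s c v))

  shift-⊕ : ∀ {n} (v w : Vec ℤ (suc n)) → shift (v ⊕ w) ≡ shift v ⊕ shift w
  shift-⊕ (a ∷ v) (b ∷ w) = cong₂ _∷_ (trans (cong (+ 3 *_) (proj₁ (carry-⊕ a b v w))) (ℤ.*-distribˡ-+ (+ 3) (out a v) (out b w))) (proj₂ (carry-⊕ a b v w))

  shift-⊙ : ∀ {n} s (v : Vec ℤ (suc n)) → shift (s ⊙ v) ≡ s ⊙ shift v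
  shift-⊙ s (a ∷ v) = cong₂ _∷_ (trans (cong (+ 3 *_) (proj₁ (carry-⊙ s a v))) (lem s (out a v))) (proj₂ (carry-⊙ s a v))
    where lem : ∀ s x → + 3 * (s * x) ≡ s * (+ 3 * x)
          lem = solve-∀

  shift-zeros : ∀ n → shift (zeros (suc n)) ≡ zeros (suc n)
  shift-zeros n = trans (cong shift (sym (⊙-zeros (suc n) 0ℤ))) (trans (shift-⊙ 0ℤ (zeros (suc n))) (0-⊙ (shift (zeros (suc n)))))

  at : ∀ {m} → Vec ℤ m → ℕ → ℤ
  at []      i       = 0ℤ
  at (a ∷ v) zero    = a
  at (a ∷ v) (suc i) = at v i

  at-ext : ∀ {m} (v w : Vec ℤ m) → (∀ i → i < m → at v i ≡ at w i) → v ≡ w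
  at-ext []      []      eq = refl
  at-ext (a ∷ v) (b ∷ w) eq = cong₂ _∷_ (eq 0 (s≤s z≤n)) (at-ext v w (λ i i<m → eq (suc i) (s≤s i<m)))

  at-⊕ : ∀ {m} (v w : Vec ℤ m) i → at (v ⊕ w) i ≡ at v i + at w i
  at-⊕ []      []      i       = refl
  at-⊕ (a ∷ v) (b ∷ w) zero    = refl
  at-⊕ (a ∷ v) (b ∷ w) (suc i) = at-⊕ v w i

  at-⊙ : ∀ {m} s (v : Vec ℤ m) i → at (s ⊙ v) i ≡ s * at v i
  at-⊙ s []      i       = sym (ℤ.*-zeroʳ s)
  at-⊙ s (a ∷ v) zero    = refl
  at-⊙ s (a ∷ v) (suc i) = at-⊙ s v i

  at-zeros : ∀ m i → at (zeros m) i ≡ 0ℤ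
  at-zeros zero    i       = refl
  at-zeros (suc m) zero    = refl
  at-zeros (suc m) (suc i) = at-zeros m i

  at-beyond : ∀ {m} (v : Vec ℤ m) i → m ≤ i → at v i ≡ 0ℤ
  at-beyond []      i       _        = refl
  at-beyond (a ∷ v) (suc i) (s≤s le) = at-beyond v i le

  carry-out : ∀ {m} a (v : Vec ℤ m) → out a v ≡ at (a ∷ v) m
  carry-out a []      = refl
  carry-out a (b ∷ v) = carry-out b v

  carry-at : ∀ {m} a (v : Vec ℤ m) i → i < m → at (into a v) i ≡ at (a ∷ v) i
  carry-at a (b ∷ v) zero    _         = refl
  carry-at a (b ∷ v) (suc i) (s≤s i<m) = carry-at b v i i<m

  module _ {n : ℕ} where

    O : Set
    O = Vec ℤ (suc n)

    -- Horner's rule: v is a polynomial in η, with any number m of coefficients, applied to w. The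
    -- free length is what permits induction on v.
    act : ∀ {m} → Vec ℤ m → O → O
    act []      w = zeros (suc n)
    act (a ∷ v) w = a ⊙ w ⊕ shift (act v w)

    infixl 8 _·_
    _·_ : O → O → O
    v · w = act v w

    𝟙 : O
    𝟙 = 1ℤ ∷ zeros n

    act-⊕ : ∀ {m} (v : Vec ℤ m) x y → act v (x ⊕ y) ≡ act v x ⊕ act v y
    act-⊕ []      x y = sym (⊕-identityʳ _)
    act-⊕ (a ∷ v) x y = trans (cong₂ _⊕_ (⊙-⊕ a x y) (trans (cong shift (act-⊕ v x y)) (shift-⊕ (act v x) (act v y)))) (⊕-interchange (a ⊙ x) (a ⊙ y) (shift (act v x)) (shift (act v y)))

    act-⊙ : ∀ {m} (v : Vec ℤ m) s x → act v (s ⊙ x) ≡ s ⊙ act v x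
    act-⊙ []      s x = sym (⊙-zeros (suc n) s)
    act-⊙ (a ∷ v) s x = trans (cong₂ _⊕_ (⊙-comm a s x) (trans (cong shift (act-⊙ v s x)) (shift-⊙ s (act v x)))) (sym (⊙-⊕ s (a ⊙ x) (shift (act v x))))

    act-shift : ∀ {m} (v : Vec ℤ m) x → act v (shift x) ≡ shift (act v x)
    act-shift []      x = sym (shift-zeros n)
    act-shift (a ∷ v) x = trans (cong₂ _⊕_ (sym (shift-⊙ a x)) (cong shift (act-shift v x))) (sym (shift-⊕ (a ⊙ x) (shift (act v x))))

    act-zeros : ∀ {m} (v : Vec ℤ m) → act v (zeros (suc n)) ≡ zeros (suc n)
    act-zeros v = trans (cong (act v) (sym (⊙-zeros (suc n) 0ℤ))) (trans (act-⊙ v 0ℤ (zeros (suc n))) (0-⊙ _))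

    -- Polynomials in the single operator `shift` commute. Together with the right identity this
    -- gives commutativity of the product, and then associativity.
    act-act : ∀ {l m} (v : Vec ℤ l) (w : Vec ℤ m) x → act v (act w x) ≡ act w (act v x)
    act-act []      w x = sym (act-zeros w)
    act-act (a ∷ v) w x = trans (cong₂ _⊕_ (sym (act-⊙ w a x)) (trans (cong shift (act-act v w x)) (sym (act-shift w (act v x))))) (sym (act-⊕ w (a ⊙ x) (shift (act v x))))

    -- A polynomial of at most n + 1 coefficients never reaches η^(n+1), so the overflow that would
    -- be multiplied by 3 is 0.
    act-𝟙-at : ∀ {m} (v : Vec ℤ m) → m ≤ suc n → ∀ i → i < suc n → at (act v 𝟙) i ≡ at v i
    act-𝟙-at []      _   i _ = at-zeros (suc n) i
    act-𝟙-at (a ∷ v) (s≤s m≤n) i i<k = trans (at-⊕ (a ⊙ 𝟙) (shift (act v 𝟙)) i) (go (act v 𝟙) refl i i<k)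
      where
      go : ∀ x → act v 𝟙 ≡ x → ∀ i → i < suc n → at (a ⊙ 𝟙) i + at (shift x) i ≡ at (a ∷ v) i
      go (c ∷ w) eq zero    _ = trans (cong (λ z → a * 1ℤ + + 3 * z) (trans (carry-out c w) (trans (cong (λ z → at z n) (sym eq)) (trans (act-𝟙-at v (ℕ.m≤n⇒m≤1+n m≤n) n ℕ.≤-refl) (at-beyond v n m≤n))))) (lem a)
        where lem : ∀ a → a * 1ℤ + + 3 * 0ℤ ≡ a
              lem = solve-∀
      go (c ∷ w) eq (suc i) (s≤s i<n) = trans (cong₂ _+_ (trans (at-⊙ a (zeros n) i) (trans (cong (a *_) (at-zeros n i)) (ℤ.*-zeroʳ a))) (trans (carry-at c w i i<n) (trans (cong (λ z → at z i) (sym eq)) (act-𝟙-at v (ℕ.m≤n⇒m≤1+n m≤n) i (ℕ.m<n⇒m<1+n i<n))))) (ℤ.+-identityˡ _)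

    ·-identityʳ : ∀ v → v · 𝟙 ≡ v
    ·-identityʳ v = at-ext (v · 𝟙) v (act-𝟙-at v ℕ.≤-refl)

    ·-comm : ∀ v w → v · w ≡ w · v
    ·-comm v w = trans (cong (act v) (sym (·-identityʳ w))) (trans (act-act v w 𝟙) (cong (act w) (·-identityʳ v)))

    ·-assoc : ∀ u v w → (u · v) · w ≡ u · (v · w)
    ·-assoc u v w = trans (·-comm (u · v) w) (trans (act-act w u v) (cong (act u) (·-comm w v)))

    ·-identityˡ : ∀ v → 𝟙 · v ≡ v
    ·-identityˡ v = trans (·-comm 𝟙 v) (·-identityʳ v)

    ·-⊕ : ∀ u v w → u · (v ⊕ w) ≡ u · v ⊕ u · w
    ·-⊕ = act-⊕

    ·-⊙ : ∀ u s v → u · (s ⊙ v) ≡ s ⊙ (u · v)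
    ·-⊙ = act-⊙

    ⊙-· : ∀ s u v → (s ⊙ u) · v ≡ s ⊙ (u · v)
    ⊙-· s u v = trans (·-comm (s ⊙ u) v) (trans (act-⊙ v s u) (cong (s ⊙_) (·-comm v u)))

    ⊕-· : ∀ u v w → (u ⊕ v) · w ≡ u · w ⊕ v · w
    ⊕-· u v w = trans (·-comm (u ⊕ v) w) (trans (act-⊕ w u v) (cong₂ _⊕_ (·-comm w u) (·-comm w v)))

-- Quadratic forms with integer matrices

module QuadraticForms where

  open import Data.Nat as ℕ using (ℕ; zero; suc; _≤_; z≤n)
  import Data.Nat.Properties as ℕ
  open import Data.Integer as ℤ using (ℤ; +_; -[1+_]; 0ℤ; ∣_∣; _+_; _*_; -_; _-_)
  import Data.Integer.Properties as ℤ
  open import Data.Integer.Tactic.RingSolver using (solve-∀)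
  import Data.Nat.Tactic.RingSolver as ℕS
  open import Data.Vec using (Vec; []; _∷_; map)
  open import Data.Sum using (inj₁; inj₂)
  open import Relation.Binary.PropositionalEquality
  open Order

  Mat : ℕ → ℕ → Set
  Mat m n = Vec (Vec ℤ n) m

  rows : ∀ {m n} → Mat m n → Vec ℤ n → Vec ℤ m
  rows M v = map (λ r → dot r v) M

  bil : ∀ {m n} → Mat m n → Vec ℤ m → Vec ℤ n → ℤ
  bil M u v = dot (rows M v) u

  infixl 6 _⊞_
  infixl 7 _⊡_

  _⊞_ : ∀ {m n} → Mat m n → Mat m n → Mat m n
  []      ⊞ []      = []
  (r ∷ M) ⊞ (s ∷ N) = (r ⊕ s) ∷ (M ⊞ N)

  _⊡_ : ∀ {m n} → ℤ → Mat m n → Mat m n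
  a ⊡ []      = []
  a ⊡ (r ∷ M) = (a ⊙ r) ∷ (a ⊡ M)

  outer : ∀ {m n} → Vec ℤ m → Vec ℤ n → Mat m n
  outer []      b = []
  outer (a ∷ u) b = (a ⊙ b) ∷ outer u b

  dot-comm : ∀ {n} (u v : Vec ℤ n) → dot u v ≡ dot v u
  dot-comm []      []      = refl
  dot-comm (a ∷ u) (b ∷ v) = cong₂ _+_ (ℤ.*-comm a b) (dot-comm u v)

  dot-⊕ˡ : ∀ {n} (u v w : Vec ℤ n) → dot (u ⊕ v) w ≡ dot u w + dot v w
  dot-⊕ˡ u v w = trans (dot-comm (u ⊕ v) w) (trans (dot-⊕ w u v) (cong₂ _+_ (dot-comm w u) (dot-comm w v)))

  dot-⊙ˡ : ∀ {n} a (u v : Vec ℤ n) → dot (a ⊙ u) v ≡ a * dot u v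
  dot-⊙ˡ a u v = trans (dot-comm (a ⊙ u) v) (trans (dot-⊙ a v u) (cong (a *_) (dot-comm v u)))

  bil-⊞ : ∀ {m n} (M N : Mat m n) u v → bil (M ⊞ N) u v ≡ bil M u v + bil N u v
  bil-⊞ []      []      []      v = refl
  bil-⊞ (r ∷ M) (s ∷ N) (a ∷ u) v = trans (cong₂ (λ x y → x * a + y) (dot-⊕ˡ r s v) (bil-⊞ M N u v)) (lem (dot r v) (dot s v) a (bil M u v) (bil N u v))
    where lem : ∀ x y a s t → (x + y) * a + (s + t) ≡ (x * a + s) + (y * a + t)
          lem = solve-∀

  bil-⊡ : ∀ {m n} c (M : Mat m n) u v → bil (c ⊡ M) u v ≡ c * bil M u v
  bil-⊡ c []      []      v = sym (ℤ.*-zeroʳ c)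
  bil-⊡ c (r ∷ M) (a ∷ u) v = trans (cong₂ (λ x y → x * a + y) (dot-⊙ˡ c r v) (bil-⊡ c M u v)) (lem c (dot r v) a (bil M u v))
    where lem : ∀ c x a s → c * x * a + c * s ≡ c * (x * a + s)
          lem = solve-∀

  bil-outer : ∀ {m n} (p : Vec ℤ m) (q : Vec ℤ n) u v → bil (outer p q) u v ≡ dot p u * dot q v
  bil-outer []      q []      v = refl
  bil-outer (a ∷ p) q (b ∷ u) v = trans (cong₂ (λ x y → x * b + y) (dot-⊙ˡ a q v) (bil-outer p q u v)) (lem a b (dot q v) (dot p u))
    where lem : ∀ a b x s → a * x * b + s * x ≡ (a * b + s) * x
          lem = solve-∀

  norm₁ : ∀ {n} → Vec ℤ n → ℕ
  norm₁ []      = 0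
  norm₁ (a ∷ v) = ∣ a ∣ ℕ.+ norm₁ v

  -- A crude matrix norm, applied only to matrices of rounding errors, where a constant factor does
  -- no harm.
  total : ∀ {m n} → Mat m n → ℕ
  total []      = 0
  total (r ∷ M) = norm₁ r ℕ.+ total M

  sup : ∀ {n} → Vec ℤ n → ℕ
  sup []      = 0
  sup (a ∷ v) = ∣ a ∣ ℕ.⊔ sup v

  S : ∀ {n} → Vec ℤ n → ℕ
  S []      = 0
  S (a ∷ v) = ∣ a ∣ ℕ.* ∣ a ∣ ℕ.+ S v

  sup²≤S : ∀ {n} (v : Vec ℤ n) → sup v ℕ.* sup v ≤ S v
  sup²≤S []      = z≤n
  sup²≤S (a ∷ v) with ℕ.≤-total ∣ a ∣ (sup v)
  ... | inj₁ a≤ = subst (λ z → z ℕ.* z ≤ ∣ a ∣ ℕ.* ∣ a ∣ ℕ.+ S v) (sym (ℕ.m≤n⇒m⊔n≡n a≤)) (ℕ.≤-trans (sup²≤S v) (ℕ.m≤n+m (S v) _))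
  ... | inj₂ ≤a = subst (λ z → z ℕ.* z ≤ ∣ a ∣ ℕ.* ∣ a ∣ ℕ.+ S v) (sym (ℕ.m≥n⇒m⊔n≡m ≤a)) (ℕ.m≤m+n _ (S v))

  ∣dot∣≤ : ∀ {n} (r v : Vec ℤ n) t → sup v ≤ t → ∣ dot r v ∣ ≤ norm₁ r ℕ.* t
  ∣dot∣≤ []      []      t _  = z≤n
  ∣dot∣≤ (a ∷ r) (b ∷ v) t le = begin
    ∣ a * b + dot r v ∣                  ≤⟨ ℤ.∣i+j∣≤∣i∣+∣j∣ (a * b) (dot r v) ⟩
    ∣ a * b ∣ ℕ.+ ∣ dot r v ∣            ≤⟨ ℕ.+-mono-≤ (ℕ.≤-reflexive (ℤ.abs-* a b)) (∣dot∣≤ r v t (ℕ.≤-trans (ℕ.m≤n⊔m ∣ b ∣ (sup v)) le)) ⟩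
    ∣ a ∣ ℕ.* ∣ b ∣ ℕ.+ norm₁ r ℕ.* t    ≤⟨ ℕ.+-monoˡ-≤ (norm₁ r ℕ.* t) (ℕ.*-monoʳ-≤ ∣ a ∣ (ℕ.≤-trans (ℕ.m≤m⊔n ∣ b ∣ (sup v)) le)) ⟩
    ∣ a ∣ ℕ.* t ℕ.+ norm₁ r ℕ.* t        ≡⟨ sym (ℕ.*-distribʳ-+ t ∣ a ∣ (norm₁ r)) ⟩
    (∣ a ∣ ℕ.+ norm₁ r) ℕ.* t            ∎
    where open ℕ.≤-Reasoning

  ∣bil∣≤ : ∀ {m n} (M : Mat m n) u v s t → sup u ≤ s → sup v ≤ t → ∣ bil M u v ∣ ≤ total M ℕ.* (s ℕ.* t)
  ∣bil∣≤ []      []      v s t _  _   = z≤n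
  ∣bil∣≤ (r ∷ M) (a ∷ u) v s t hs ht = begin
    ∣ dot r v * a + bil M u v ∣                             ≤⟨ ℤ.∣i+j∣≤∣i∣+∣j∣ (dot r v * a) (bil M u v) ⟩
    ∣ dot r v * a ∣ ℕ.+ ∣ bil M u v ∣                       ≤⟨ ℕ.+-mono-≤ (ℕ.≤-reflexive (ℤ.abs-* (dot r v) a)) (∣bil∣≤ M u v s t (ℕ.≤-trans (ℕ.m≤n⊔m ∣ a ∣ (sup u)) hs) ht) ⟩
    ∣ dot r v ∣ ℕ.* ∣ a ∣ ℕ.+ total M ℕ.* (s ℕ.* t)         ≤⟨ ℕ.+-monoˡ-≤ _ (ℕ.*-mono-≤ (∣dot∣≤ r v t ht) (ℕ.≤-trans (ℕ.m≤m⊔n ∣ a ∣ (sup u)) hs)) ⟩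
    norm₁ r ℕ.* t ℕ.* s ℕ.+ total M ℕ.* (s ℕ.* t)           ≡⟨ lem (norm₁ r) t s (total M) ⟩
    (norm₁ r ℕ.+ total M) ℕ.* (s ℕ.* t)                     ∎
    where
    open ℕ.≤-Reasoning
    lem : ∀ r t s m → r ℕ.* t ℕ.* s ℕ.+ m ℕ.* (s ℕ.* t) ≡ (r ℕ.+ m) ℕ.* (s ℕ.* t)
    lem = ℕS.solve-∀

  ∣form∣≤ : ∀ {n} (M : Mat n n) v → ∣ bil M v v ∣ ≤ total M ℕ.* S v
  ∣form∣≤ M v = ℕ.≤-trans (∣bil∣≤ M v v (sup v) (sup v) ℕ.≤-refl ℕ.≤-refl) (ℕ.*-monoʳ-≤ (total M) (sup²≤S v))

  diagonal : ∀ {n} → Vec ℕ n → Vec ℤ n → ℕ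
  diagonal []      []      = 0
  diagonal (g ∷ gs) (a ∷ v) = g ℕ.* (∣ a ∣ ℕ.* ∣ a ∣) ℕ.+ diagonal gs v

  diagMat : ∀ {n} → Vec ℕ n → Mat n n
  diagMat []       = []
  diagMat (g ∷ gs) = (+ g ∷ zeros _) ∷ map (0ℤ ∷_) (diagMat gs)

  ∣a∣² : ∀ a → + (∣ a ∣ ℕ.* ∣ a ∣) ≡ a * a
  ∣a∣² (+ n)    = ℤ.pos-* n n
  ∣a∣² -[1+ n ] = refl

  dot-zerosˡ : ∀ {n} (v : Vec ℤ n) → dot (zeros n) v ≡ 0ℤ
  dot-zerosˡ v = trans (dot-comm (zeros _) v) (dot-zeros v)

  bil-diag : ∀ {n} (g : Vec ℕ n) v → bil (diagMat g) v v ≡ + diagonal g v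
  bil-diag []       []      = refl
  bil-diag (g ∷ gs) (a ∷ v) = begin
    (+ g * a + dot (zeros _) v) * a + dot (rows (map (0ℤ ∷_) (diagMat gs)) (a ∷ v)) v
      ≡⟨ cong₂ (λ x y → (+ g * a + x) * a + y) (dot-zerosˡ v) (cong (λ z → dot z v) (drop (diagMat gs))) ⟩
    (+ g * a + 0ℤ) * a + bil (diagMat gs) v v
      ≡⟨ cong₂ _+_ (lem (+ g) a) (bil-diag gs v) ⟩
    + g * (a * a) + + diagonal gs v
      ≡⟨ cong (_+ + diagonal gs v) (trans (cong (+ g *_) (sym (∣a∣² a))) (sym (ℤ.pos-* g _))) ⟩
    + (g ℕ.* (∣ a ∣ ℕ.* ∣ a ∣)) + + diagonal gs v ∎
    where
    open ≡-Reasoning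
    lem : ∀ g a → (g * a + 0ℤ) * a ≡ g * (a * a)
    lem = solve-∀
    drop : ∀ {m} (M : Mat m _) → rows (map (0ℤ ∷_) M) (a ∷ v) ≡ rows M v
    drop []      = refl
    drop (r ∷ M) = cong₂ _∷_ (ℤ.+-identityˡ (dot r v)) (drop M)

  -- The linear form v ↦ ℓ(v · w).
  pull : ∀ {n} m → Vec ℤ (suc n) → Vec ℤ (suc n) → Vec ℤ m
  pull zero    ℓ w = []
  pull (suc m) ℓ w = dot ℓ w ∷ pull m ℓ (shift w)

  dot-act : ∀ {n m} (ℓ : Vec ℤ (suc n)) (v : Vec ℤ m) w → dot ℓ (act v w) ≡ dot (pull m ℓ w) v
  dot-act ℓ []      w = dot-zeros ℓ
  dot-act ℓ (a ∷ v) w = trans (dot-⊕ ℓ (a ⊙ w) (shift (act v w))) (cong₂ _+_ (trans (dot-⊙ a ℓ w) (ℤ.*-comm a (dot ℓ w))) (trans (cong (dot ℓ) (sym (act-shift v w))) (dot-act ℓ v (shift w))))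

  -- The matrix of the bilinear form (u, v) ↦ ℓ(u · v).
  pullMat : ∀ {n} m → Vec ℤ (suc n) → Vec ℤ (suc n) → Mat m (suc n)
  pullMat         zero    ℓ e = []
  pullMat {n} (suc m) ℓ e = pull (suc n) ℓ e ∷ pullMat m ℓ (shift e)

-- Archimedean places with rounded values

module Embeddings where

  open import Data.Nat as ℕ using (ℕ; zero; suc; _≤_; z≤n)
  import Data.Nat.Properties as ℕ
  open import Data.Integer as ℤ using (ℤ; +_; 1ℤ; ∣_∣; _+_; _*_; -_; _-_)
  import Data.Integer.Properties as ℤ
  open import Data.Integer.Tactic.RingSolver using (solve-∀)
  import Data.Nat.Tactic.RingSolver as ℕS
  open import Data.Vec as Vec using (Vec; []; _∷_)
  open import Data.Vec.Relation.Unary.All as VAll using ([]; _∷_)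
  open import Data.List using (List; []; _∷_)
  open import Data.List.Relation.Unary.All using (All; []; _∷_)
  open import Relation.Binary.PropositionalEquality
  open Order
  open QuadraticForms

  -- An archimedean place of ℚ(η): its multiplicity and the rounded real and imaginary parts of the images of 1, η, η², …
  record Place (n : ℕ) : Set where
    constructor place
    field
      mult  : ℕ
      re im : Vec ℤ n
  open Place public

  -- For places given at scale D this is D² times the squared absolute value of v, up to rounding.
  W : ∀ {n} → Place n → Vec ℤ n → ℕ
  W p v = ∣ dot (re p) v ∣ ℕ.* ∣ dot (re p) v ∣ ℕ.+ ∣ dot (im p) v ∣ ℕ.* ∣ dot (im p) v ∣

  ∑ₚ : ∀ {n} → List (Place n) → (Place n → ℕ) → ℕ
  ∑ₚ []       f = 0
  ∑ₚ (p ∷ ps) f = f p ℕ.+ ∑ₚ ps f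

  -- The size on which the descent runs. Complex places have multiplicity 2, so up to rounding it is
  -- D² times the sum over all embeddings.
  H : ∀ {n} → List (Place n) → Vec ℤ n → ℕ
  H ps v = ∑ₚ ps (λ p → mult p ℕ.* W p v)

  ∑ₚ-mono : ∀ {n} (ps : List (Place n)) {f g : Place n → ℕ} → All (λ p → f p ≤ g p) ps → ∑ₚ ps f ≤ ∑ₚ ps g
  ∑ₚ-mono []       []         = z≤n
  ∑ₚ-mono (p ∷ ps) (le ∷ les) = ℕ.+-mono-≤ le (∑ₚ-mono ps les)

  ∑ₚ-+ : ∀ {n} (ps : List (Place n)) (f g : Place n → ℕ) → ∑ₚ ps (λ p → f p ℕ.+ g p) ≡ ∑ₚ ps f ℕ.+ ∑ₚ ps g
  ∑ₚ-+ []       f g = refl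
  ∑ₚ-+ (p ∷ ps) f g = trans (cong ((f p ℕ.+ g p) ℕ.+_) (∑ₚ-+ ps f g)) (lem (f p) (g p) (∑ₚ ps f) (∑ₚ ps g))
    where lem : ∀ a b c d → (a ℕ.+ b) ℕ.+ (c ℕ.+ d) ≡ (a ℕ.+ c) ℕ.+ (b ℕ.+ d)
          lem = ℕS.solve-∀

  ∑ₚ-* : ∀ {n} (ps : List (Place n)) c (f : Place n → ℕ) → ∑ₚ ps (λ p → c ℕ.* f p) ≡ c ℕ.* ∑ₚ ps f
  ∑ₚ-* []       c f = sym (ℕ.*-zeroʳ c)
  ∑ₚ-* (p ∷ ps) c f = trans (cong (c ℕ.* f p ℕ.+_) (∑ₚ-* ps c f)) (sym (ℕ.*-distribˡ-+ c (f p) (∑ₚ ps f)))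

  ∑ₚ-cong : ∀ {n} (ps : List (Place n)) {f g : Place n → ℕ} → (∀ p → f p ≡ g p) → ∑ₚ ps f ≡ ∑ₚ ps g
  ∑ₚ-cong []       eq = refl
  ∑ₚ-cong (p ∷ ps) eq = cong₂ ℕ._+_ (eq p) (∑ₚ-cong ps eq)

  gram : ∀ {n} → List (Place n) → Mat n n
  gram {n} []       = diagMat (Vec.replicate n 0)
  gram     (p ∷ ps) = (+ mult p ⊡ (outer (re p) (re p) ⊞ outer (im p) (im p))) ⊞ gram ps

  diagonal-const : ∀ {n} c (v : Vec ℤ n) → diagonal (Vec.replicate n c) v ≡ c ℕ.* S v
  diagonal-const c []      = sym (ℕ.*-zeroʳ c)
  diagonal-const c (a ∷ v) = trans (cong (c ℕ.* (∣ a ∣ ℕ.* ∣ a ∣) ℕ.+_) (diagonal-const c v)) (sym (ℕ.*-distribˡ-+ c (∣ a ∣ ℕ.* ∣ a ∣) (S v)))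

  diagonal-+ : ∀ {n} c (g : Vec ℕ n) v → diagonal (Vec.map (c ℕ.+_) g) v ≡ c ℕ.* S v ℕ.+ diagonal g v
  diagonal-+ c []      []      = sym (trans (ℕ.+-identityʳ _) (ℕ.*-zeroʳ c))
  diagonal-+ c (x ∷ g) (a ∷ v) = trans (cong ((c ℕ.+ x) ℕ.* (∣ a ∣ ℕ.* ∣ a ∣) ℕ.+_) (diagonal-+ c g v)) (lem c x (∣ a ∣ ℕ.* ∣ a ∣) (S v) (diagonal g v))
    where lem : ∀ c x a s d → (c ℕ.+ x) ℕ.* a ℕ.+ (c ℕ.* s ℕ.+ d) ≡ c ℕ.* (a ℕ.+ s) ℕ.+ (x ℕ.* a ℕ.+ d)
          lem = ℕS.solve-∀

  diagonal-≥ : ∀ {n} c (g : Vec ℕ n) → VAll.All (c ≤_) g → ∀ v → c ℕ.* S v ≤ diagonal g v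
  diagonal-≥ c []      []         []      = ℕ.≤-reflexive (ℕ.*-zeroʳ c)
  diagonal-≥ c (x ∷ g) (le ∷ les) (a ∷ v) = ℕ.≤-trans (ℕ.≤-reflexive (ℕ.*-distribˡ-+ c (∣ a ∣ ℕ.* ∣ a ∣) (S v))) (ℕ.+-mono-≤ (ℕ.*-monoˡ-≤ (∣ a ∣ ℕ.* ∣ a ∣) le) (diagonal-≥ c g les v))

  bil-gram : ∀ {n} (ps : List (Place n)) v → bil (gram ps) v v ≡ + H ps v
  bil-gram {n} []   v = trans (bil-diag (Vec.replicate n 0) v) (cong +_ (diagonal-const 0 v))
  bil-gram (p ∷ ps) v = begin
    bil ((+ mult p ⊡ (outer (re p) (re p) ⊞ outer (im p) (im p))) ⊞ gram ps) v v
      ≡⟨ bil-⊞ (+ mult p ⊡ (outer (re p) (re p) ⊞ outer (im p) (im p))) (gram ps) v v ⟩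
    bil (+ mult p ⊡ (outer (re p) (re p) ⊞ outer (im p) (im p))) v v + bil (gram ps) v v
      ≡⟨ cong₂ _+_ (bil-⊡ (+ mult p) (outer (re p) (re p) ⊞ outer (im p) (im p)) v v) (bil-gram ps v) ⟩
    + mult p * bil (outer (re p) (re p) ⊞ outer (im p) (im p)) v v + + H ps v
      ≡⟨ cong (λ z → + mult p * z + + H ps v) (trans (bil-⊞ (outer (re p) (re p)) (outer (im p) (im p)) v v) (cong₂ _+_ (square (re p)) (square (im p)))) ⟩
    + mult p * + W p v + + H ps v
      ≡⟨ cong (_+ + H ps v) (sym (ℤ.pos-* (mult p) (W p v))) ⟩
    + (mult p ℕ.* W p v) + + H ps v ∎
    where
    open ≡-Reasoning
    square : ∀ r → bil (outer r r) v v ≡ + (∣ dot r v ∣ ℕ.* ∣ dot r v ∣)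
    square r = trans (bil-outer r r v v) (sym (∣a∣² (dot r v)))

  bil-pullMat : ∀ {n m} (ℓ : Vec ℤ (suc n)) e (u : Vec ℤ m) (v : Vec ℤ (suc n)) → bil (pullMat m ℓ e) u v ≡ dot ℓ (act u (v · e))
  bil-pullMat ℓ e []      v = sym (dot-zeros ℓ)
  bil-pullMat {n} ℓ e (a ∷ u) v = begin
    dot (pull (suc n) ℓ e) v * a + bil (pullMat _ ℓ (shift e)) u v
      ≡⟨ cong₂ (λ x y → x * a + y) (sym (dot-act ℓ v e)) (bil-pullMat ℓ (shift e) u v) ⟩
    dot ℓ (v · e) * a + dot ℓ (act u (v · shift e))
      ≡⟨ cong₂ _+_ (trans (ℤ.*-comm (dot ℓ (v · e)) a) (sym (dot-⊙ a ℓ (v · e)))) (cong (dot ℓ) (trans (cong (act u) (act-shift v e)) (act-shift u (v · e)))) ⟩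
    dot ℓ (a ⊙ (v · e)) + dot ℓ (shift (act u (v · e)))
      ≡⟨ sym (dot-⊕ ℓ (a ⊙ (v · e)) (shift (act u (v · e)))) ⟩
    dot ℓ (a ⊙ (v · e) ⊕ shift (act u (v · e))) ∎
    where open ≡-Reasoning

  -- The forms Re u Re v − Im u Im v − D Re(uv) and Re u Im v + Im u Re v − D Im(uv), which would vanish without rounding.
  reErr imErr : ∀ {n} → ℕ → Place (suc n) → Mat (suc n) (suc n)
  reErr D p = (outer (re p) (re p) ⊞ (- 1ℤ ⊡ outer (im p) (im p))) ⊞ (- + D ⊡ pullMat _ (re p) 𝟙)
  imErr D p = (outer (re p) (im p) ⊞ outer (im p) (re p)) ⊞ (- + D ⊡ pullMat _ (im p) 𝟙)

  2xy≤x²+y² : ∀ x y → 2 ℕ.* (x ℕ.* y) ≤ x ℕ.* x ℕ.+ y ℕ.* y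
  2xy≤x²+y² zero    y       = z≤n
  2xy≤x²+y² (suc x) zero    = ℕ.≤-trans (ℕ.≤-reflexive (cong (2 ℕ.*_) (ℕ.*-zeroʳ (suc x)))) z≤n
  2xy≤x²+y² (suc x) (suc y) = subst₂ _≤_ (lem₁ x y) (lem₂ x y) (ℕ.+-monoʳ-≤ (2 ℕ.+ 2 ℕ.* x ℕ.+ 2 ℕ.* y) (2xy≤x²+y² x y))
    where
    lem₁ : ∀ x y → 2 ℕ.+ 2 ℕ.* x ℕ.+ 2 ℕ.* y ℕ.+ 2 ℕ.* (x ℕ.* y) ≡ 2 ℕ.* (suc x ℕ.* suc y)
    lem₁ = ℕS.solve-∀
    lem₂ : ∀ x y → 2 ℕ.+ 2 ℕ.* x ℕ.+ 2 ℕ.* y ℕ.+ (x ℕ.* x ℕ.+ y ℕ.* y) ≡ suc x ℕ.* suc x ℕ.+ suc y ℕ.* suc y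
    lem₂ = ℕS.solve-∀

  -- |x| ≤ d + q, and the mixed term 2dq is at most q²/N + N d². A relative loss of 1/N thus makes
  -- the error quadratic in d.
  perturb : ∀ N x y q d → ∣ x - y ∣ ≤ d → ∣ y ∣ ≡ q → N ℕ.* (∣ x ∣ ℕ.* ∣ x ∣) ≤ suc N ℕ.* (q ℕ.* q) ℕ.+ N ℕ.* suc N ℕ.* (d ℕ.* d)
  perturb N x y q d close refl = begin
    N ℕ.* (∣ x ∣ ℕ.* ∣ x ∣)                    ≤⟨ ℕ.*-monoʳ-≤ N (ℕ.*-mono-≤ tri tri) ⟩
    N ℕ.* ((d ℕ.+ q) ℕ.* (d ℕ.+ q))            ≡⟨ lem₁ N d q ⟩
    N ℕ.* (q ℕ.* q) ℕ.+ N ℕ.* (d ℕ.* d) ℕ.+ 2 ℕ.* (q ℕ.* (N ℕ.* d))             ≤⟨ ℕ.+-monoʳ-≤ (N ℕ.* (q ℕ.* q) ℕ.+ N ℕ.* (d ℕ.* d)) (2xy≤x²+y² q (N ℕ.* d)) ⟩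
    N ℕ.* (q ℕ.* q) ℕ.+ N ℕ.* (d ℕ.* d) ℕ.+ (q ℕ.* q ℕ.+ N ℕ.* d ℕ.* (N ℕ.* d))  ≡⟨ lem₂ N d q ⟩
    suc N ℕ.* (q ℕ.* q) ℕ.+ N ℕ.* suc N ℕ.* (d ℕ.* d) ∎
    where
    open ℕ.≤-Reasoning
    tri : ∣ x ∣ ≤ d ℕ.+ q
    tri = begin
      ∣ x ∣                    ≡⟨ cong ∣_∣ (lem x y) ⟩
      ∣ x - y + y ∣            ≤⟨ ℤ.∣i+j∣≤∣i∣+∣j∣ (x - y) y ⟩
      ∣ x - y ∣ ℕ.+ ∣ y ∣      ≤⟨ ℕ.+-monoˡ-≤ ∣ y ∣ close ⟩
      d ℕ.+ q                  ∎
      where lem : ∀ x y → x ≡ x - y + y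
            lem = solve-∀
    lem₁ : ∀ N d q → N ℕ.* ((d ℕ.+ q) ℕ.* (d ℕ.+ q)) ≡ N ℕ.* (q ℕ.* q) ℕ.+ N ℕ.* (d ℕ.* d) ℕ.+ 2 ℕ.* (q ℕ.* (N ℕ.* d))
    lem₁ = ℕS.solve-∀
    lem₂ : ∀ N d q → N ℕ.* (q ℕ.* q) ℕ.+ N ℕ.* (d ℕ.* d) ℕ.+ (q ℕ.* q ℕ.+ N ℕ.* d ℕ.* (N ℕ.* d)) ≡ suc N ℕ.* (q ℕ.* q) ℕ.+ N ℕ.* suc N ℕ.* (d ℕ.* d)
    lem₂ = ℕS.solve-∀

  ∣∣²-injective : ∀ {m a b} → + m ≡ a * a + b * b → m ≡ ∣ a ∣ ℕ.* ∣ a ∣ ℕ.+ ∣ b ∣ ℕ.* ∣ b ∣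
  ∣∣²-injective {m} {a} {b} eq = ℤ.+-injective (trans eq (sym (cong₂ _+_ (∣a∣² a) (∣a∣² b))))

  brahmagupta : ∀ a b c d → (∣ a ∣ ℕ.* ∣ a ∣ ℕ.+ ∣ b ∣ ℕ.* ∣ b ∣) ℕ.* (∣ c ∣ ℕ.* ∣ c ∣ ℕ.+ ∣ d ∣ ℕ.* ∣ d ∣) ≡ ∣ a * c - b * d ∣ ℕ.* ∣ a * c - b * d ∣ ℕ.+ ∣ a * d + b * c ∣ ℕ.* ∣ a * d + b * c ∣
  brahmagupta a b c d = ∣∣²-injective {a = a * c - b * d} {b = a * d + b * c} (trans (ℤ.pos-* (∣ a ∣ ℕ.* ∣ a ∣ ℕ.+ ∣ b ∣ ℕ.* ∣ b ∣) (∣ c ∣ ℕ.* ∣ c ∣ ℕ.+ ∣ d ∣ ℕ.* ∣ d ∣)) (trans (cong₂ _*_ (cong₂ _+_ (∣a∣² a) (∣a∣² b)) (cong₂ _+_ (∣a∣² c) (∣a∣² d))) (lem a b c d)))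
    where lem : ∀ a b c d → (a * a + b * b) * (c * c + d * d) ≡ (a * c - b * d) * (a * c - b * d) + (a * d + b * c) * (a * d + b * c)
          lem = solve-∀

  -- Exact absolute values satisfy W(u)W(v) = D² W(uv). After rounding the two sides agree up to a
  -- factor 1 + 1/N and an error controlled by S(u)S(v), because the forms `reErr` and `imErr` have
  -- small entries.
  module Multiplicative {n} (D T N : ℕ) (p : Place (suc n)) (re≤ : total (reErr D p) ≤ T) (im≤ : total (imErr D p) ≤ T) (u v : Vec ℤ (suc n)) where

    private
      a = dot (re p) u
      b = dot (im p) u
      c = dot (re p) v
      d = dot (im p) v
      x = dot (re p) (u · v)
      y = dot (im p) (u · v)
      s = sup u ℕ.* sup v

      pulled : ∀ ℓ → bil (- + D ⊡ pullMat (suc n) ℓ 𝟙) u v ≡ - + D * dot ℓ (u · v)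
      pulled ℓ = trans (bil-⊡ (- + D) (pullMat _ ℓ 𝟙) u v) (cong (- + D *_) (trans (bil-pullMat ℓ 𝟙 u v) (cong (λ z → dot ℓ (act u z)) (·-identityʳ v))))

      ring₁ : ∀ a b c d D x → a * c + - 1ℤ * (b * d) + - D * x ≡ a * c - b * d - D * x
      ring₁ = solve-∀
      ring₂ : ∀ a b c d D x → a * d + b * c + - D * x ≡ a * d + b * c - D * x
      ring₂ = solve-∀

      re-form : bil (reErr D p) u v ≡ a * c - b * d - + D * x
      re-form = trans (bil-⊞ (outer (re p) (re p) ⊞ (- 1ℤ ⊡ outer (im p) (im p))) (- + D ⊡ pullMat _ (re p) 𝟙) u v) (trans (cong₂ _+_ (trans (bil-⊞ (outer (re p) (re p)) (- 1ℤ ⊡ outer (im p) (im p)) u v) (cong₂ _+_ (bil-outer (re p) (re p) u v) (trans (bil-⊡ (- 1ℤ) (outer (im p) (im p)) u v) (cong (- 1ℤ *_) (bil-outer (im p) (im p) u v))))) (pulled (re p))) (ring₁ a b c d (+ D) x))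

      im-form : bil (imErr D p) u v ≡ a * d + b * c - + D * y
      im-form = trans (bil-⊞ (outer (re p) (im p) ⊞ outer (im p) (re p)) (- + D ⊡ pullMat _ (im p) 𝟙) u v) (trans (cong₂ _+_ (trans (bil-⊞ (outer (re p) (im p)) (outer (im p) (re p)) u v) (cong₂ _+_ (bil-outer (re p) (im p) u v) (bil-outer (im p) (re p) u v))) (pulled (im p))) (ring₂ a b c d (+ D) y))

      bound : ∀ M → total M ≤ T → ∀ {z} → bil M u v ≡ z → ∣ z ∣ ≤ T ℕ.* s
      bound M le refl = ℕ.≤-trans (∣bil∣≤ M u v (sup u) (sup v) ℕ.≤-refl ℕ.≤-refl) (ℕ.*-monoˡ-≤ s le)

      flip : ∀ x y → ∣ x - y ∣ ≤ T ℕ.* s → ∣ y - x ∣ ≤ T ℕ.* s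
      flip x y = subst (_≤ T ℕ.* s) (ℤ.∣i-j∣≡∣j-i∣ x y)

      arrange : ∀ N S R e → (suc N ℕ.* S ℕ.+ N ℕ.* suc N ℕ.* (e ℕ.* e)) ℕ.+ (suc N ℕ.* R ℕ.+ N ℕ.* suc N ℕ.* (e ℕ.* e)) ≡ suc N ℕ.* (S ℕ.+ R) ℕ.+ N ℕ.* suc N ℕ.* (2 ℕ.* (e ℕ.* e))
      arrange = ℕS.solve-∀

      pull-D : ∀ D x y → D ℕ.* x ℕ.* (D ℕ.* x) ℕ.+ D ℕ.* y ℕ.* (D ℕ.* y) ≡ D ℕ.* D ℕ.* (x ℕ.* x ℕ.+ y ℕ.* y)
      pull-D = ℕS.solve-∀

      sup² : ∀ T s t → T ℕ.* (s ℕ.* t) ℕ.* (T ℕ.* (s ℕ.* t)) ≡ T ℕ.* T ℕ.* ((s ℕ.* s) ℕ.* (t ℕ.* t))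
      sup² = ℕS.solve-∀

      error≤ : N ℕ.* suc N ℕ.* (2 ℕ.* (T ℕ.* s ℕ.* (T ℕ.* s))) ≤ N ℕ.* suc N ℕ.* (2 ℕ.* (T ℕ.* T ℕ.* (S u ℕ.* S v)))
      error≤ = ℕ.*-monoʳ-≤ (N ℕ.* suc N) (ℕ.*-monoʳ-≤ 2 (ℕ.≤-trans (ℕ.≤-reflexive (sup² T (sup u) (sup v))) (ℕ.*-monoʳ-≤ (T ℕ.* T) (ℕ.*-mono-≤ (sup²≤S u) (sup²≤S v)))))

    product≤ : N ℕ.* (W p u ℕ.* W p v) ≤ suc N ℕ.* (D ℕ.* D ℕ.* W p (u · v)) ℕ.+ N ℕ.* suc N ℕ.* (2 ℕ.* (T ℕ.* T ℕ.* (S u ℕ.* S v)))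
    product≤ = begin
      N ℕ.* (W p u ℕ.* W p v)                       ≡⟨ cong (N ℕ.*_) (brahmagupta a b c d) ⟩
      N ℕ.* (∣ A ∣ ℕ.* ∣ A ∣ ℕ.+ ∣ B ∣ ℕ.* ∣ B ∣)   ≡⟨ ℕ.*-distribˡ-+ N (∣ A ∣ ℕ.* ∣ A ∣) (∣ B ∣ ℕ.* ∣ B ∣) ⟩
      N ℕ.* (∣ A ∣ ℕ.* ∣ A ∣) ℕ.+ N ℕ.* (∣ B ∣ ℕ.* ∣ B ∣)
        ≤⟨ ℕ.+-mono-≤ (perturb N A (+ D * x) (D ℕ.* ∣ x ∣) (T ℕ.* s) (bound (reErr D p) re≤ re-form) (ℤ.abs-* (+ D) x)) (perturb N B (+ D * y) (D ℕ.* ∣ y ∣) (T ℕ.* s) (bound (imErr D p) im≤ im-form) (ℤ.abs-* (+ D) y)) ⟩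
      _ ≡⟨ arrange N (D ℕ.* ∣ x ∣ ℕ.* (D ℕ.* ∣ x ∣)) (D ℕ.* ∣ y ∣ ℕ.* (D ℕ.* ∣ y ∣)) (T ℕ.* s) ⟩
      suc N ℕ.* (D ℕ.* ∣ x ∣ ℕ.* (D ℕ.* ∣ x ∣) ℕ.+ D ℕ.* ∣ y ∣ ℕ.* (D ℕ.* ∣ y ∣)) ℕ.+ N ℕ.* suc N ℕ.* (2 ℕ.* (T ℕ.* s ℕ.* (T ℕ.* s)))
        ≤⟨ ℕ.+-mono-≤ (ℕ.≤-reflexive (cong (suc N ℕ.*_) (pull-D D ∣ x ∣ ∣ y ∣))) error≤ ⟩
      suc N ℕ.* (D ℕ.* D ℕ.* W p (u · v)) ℕ.+ N ℕ.* suc N ℕ.* (2 ℕ.* (T ℕ.* T ℕ.* (S u ℕ.* S v))) ∎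
      where
      open ℕ.≤-Reasoning
      A = a * c - b * d
      B = a * d + b * c

    ≤product : N ℕ.* (D ℕ.* D ℕ.* W p (u · v)) ≤ suc N ℕ.* (W p u ℕ.* W p v) ℕ.+ N ℕ.* suc N ℕ.* (2 ℕ.* (T ℕ.* T ℕ.* (S u ℕ.* S v)))
    ≤product = begin
      N ℕ.* (D ℕ.* D ℕ.* W p (u · v))
        ≡⟨ trans (cong (N ℕ.*_) (sym (pull-D D ∣ x ∣ ∣ y ∣))) (ℕ.*-distribˡ-+ N (D ℕ.* ∣ x ∣ ℕ.* (D ℕ.* ∣ x ∣)) (D ℕ.* ∣ y ∣ ℕ.* (D ℕ.* ∣ y ∣))) ⟩
      N ℕ.* (D ℕ.* ∣ x ∣ ℕ.* (D ℕ.* ∣ x ∣)) ℕ.+ N ℕ.* (D ℕ.* ∣ y ∣ ℕ.* (D ℕ.* ∣ y ∣))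
        ≡⟨ cong₂ (λ X Y → N ℕ.* (X ℕ.* X) ℕ.+ N ℕ.* (Y ℕ.* Y)) (sym (ℤ.abs-* (+ D) x)) (sym (ℤ.abs-* (+ D) y)) ⟩
      N ℕ.* (∣ + D * x ∣ ℕ.* ∣ + D * x ∣) ℕ.+ N ℕ.* (∣ + D * y ∣ ℕ.* ∣ + D * y ∣)
        ≤⟨ ℕ.+-mono-≤ (perturb N (+ D * x) A ∣ A ∣ (T ℕ.* s) (flip A (+ D * x) (bound (reErr D p) re≤ re-form)) refl) (perturb N (+ D * y) B ∣ B ∣ (T ℕ.* s) (flip B (+ D * y) (bound (imErr D p) im≤ im-form)) refl) ⟩
      _ ≡⟨ arrange N (∣ A ∣ ℕ.* ∣ A ∣) (∣ B ∣ ℕ.* ∣ B ∣) (T ℕ.* s) ⟩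
      suc N ℕ.* (∣ A ∣ ℕ.* ∣ A ∣ ℕ.+ ∣ B ∣ ℕ.* ∣ B ∣) ℕ.+ N ℕ.* suc N ℕ.* (2 ℕ.* (T ℕ.* s ℕ.* (T ℕ.* s)))
        ≤⟨ ℕ.+-mono-≤ (ℕ.≤-reflexive (cong (suc N ℕ.*_) (sym (brahmagupta a b c d)))) error≤ ⟩
      suc N ℕ.* (W p u ℕ.* W p v) ℕ.+ N ℕ.* suc N ℕ.* (2 ℕ.* (T ℕ.* T ℕ.* (S u ℕ.* S v))) ∎
      where
      open ℕ.≤-Reasoning
      A = a * c - b * d
      B = a * d + b * c

  -- The conjugates of η differ by k-th roots of unity, so the powers of η are orthogonal for the
  -- sum over all embeddings. For the places used later the Gram matrix is therefore diagonal up to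
  -- rounding, and lowering the diagonal by `off` absorbs what is left.
  diagonal≤H : ∀ {n} (ps : List (Place n)) off (g : Vec ℕ n) → total (gram ps ⊞ (- 1ℤ ⊡ diagMat (Vec.map (off ℕ.+_) g))) ≤ off → ∀ v → diagonal g v ≤ H ps v
  diagonal≤H ps off g small v = ℕ.+-cancelˡ-≤ (off ℕ.* S v) (diagonal g v) (H ps v) (subst₂ _≤_ (diagonal-+ off g v) (ℕ.+-comm (H ps v) (off ℕ.* S v)) (≤-from-diff (H ps v) (diagonal (Vec.map (off ℕ.+_) g) v) (off ℕ.* S v) difference))
    where
    M = gram ps ⊞ (- 1ℤ ⊡ diagMat (Vec.map (off ℕ.+_) g))
    value : bil M v v ≡ + H ps v - + diagonal (Vec.map (off ℕ.+_) g) v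
    value = trans (bil-⊞ (gram ps) (- 1ℤ ⊡ diagMat (Vec.map (off ℕ.+_) g)) v v) (cong₂ _+_ (bil-gram ps v) (trans (bil-⊡ (- 1ℤ) (diagMat (Vec.map (off ℕ.+_) g)) v v) (trans (cong (- 1ℤ *_) (bil-diag (Vec.map (off ℕ.+_) g) v)) (ℤ.-1*i≡-i _))))
    difference : ∣ + H ps v - + diagonal (Vec.map (off ℕ.+_) g) v ∣ ≤ off ℕ.* S v
    difference = subst (λ z → ∣ z ∣ ≤ off ℕ.* S v) value (ℕ.≤-trans (∣form∣≤ M v) (ℕ.*-monoˡ-≤ (S v) small))
    ≤-from-diff : ∀ h d e → ∣ + h - + d ∣ ≤ e → d ≤ h ℕ.+ e
    ≤-from-diff h d e le = begin
      d                          ≡⟨ cong ∣_∣ (lem (+ h) (+ d)) ⟩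
      ∣ + h - (+ h - + d) ∣      ≤⟨ ℤ.∣i-j∣≤∣i∣+∣j∣ (+ h) (+ h - + d) ⟩
      h ℕ.+ ∣ + h - + d ∣        ≤⟨ ℕ.+-monoʳ-≤ h le ⟩
      h ℕ.+ e ∎
      where
      open ℕ.≤-Reasoning
      lem : ∀ h d → d ≡ h - (h - d)
      lem = solve-∀

-- Covering the possible proportions of absolute values by boxes

module Boxes where

  open import Data.Nat using (ℕ; zero; suc; _≤_; z≤n; _+_; _*_; _∸_; _/_; _<ᵇ_; _≤ᵇ_; NonZero)
  open import Data.Nat.Properties
  open import Data.Nat.DivMod using (m≡m%n+[m/n]*n; m%n<n)
  open import Data.Nat.Tactic.RingSolver using (solve-∀)
  open import Data.Integer using (ℤ)
  open import Data.Bool using (Bool; true; false; _∧_; _∨_; if_then_else_; T)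
  open import Data.Bool.ListAction using (any)
  open import Data.Bool.Properties using (T-∧; T-∨)
  open import Data.Vec using (Vec)
  open import Data.List using (List; []; _∷_; map)
  open import Data.List.Relation.Unary.All as All using (All; []; _∷_)
  open import Data.List.Relation.Unary.Any as Any using (Any; here; there)
  import Data.List.Relation.Unary.Any.Properties as Any
  import Data.List.Relation.Unary.All.Properties as All
  open import Data.Product using (_×_; _,_; proj₁; proj₂)
  open import Data.Sum using (_⊎_; inj₁; inj₂; [_,_]′)
  import Data.Sum as Sum
  open import Data.Unit using (⊤; tt)
  open import Data.Empty using (⊥; ⊥-elim)
  open import Function using (_∘_; Equivalence)
  open import Relation.Binary.PropositionalEquality
  open Order
  open QuadraticForms using (S)
  open Embeddings

  Box : Set
  Box = List (ℕ × ℕ)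

  zdot : List ℕ → List ℕ → ℕ
  zdot (a ∷ as) (b ∷ bs) = a * b + zdot as bs
  zdot _        _        = 0

  los his : Box → List ℕ
  los = map proj₁
  his = map proj₂

  capHi capLo : ℕ → ℕ → Box → Box
  capHi j       mid []              = []
  capHi zero    mid ((lo , hi) ∷ b) = (lo , mid) ∷ b
  capHi (suc j) mid (e ∷ b)         = e ∷ capHi j mid b
  capLo j       mid []              = []
  capLo zero    mid ((lo , hi) ∷ b) = (mid , hi) ∷ b
  capLo (suc j) mid (e ∷ b)         = e ∷ capLo j mid b

  -- The inverses of the sides matter as well as the sides. A side reaching far down in proportion
  -- is therefore cut near its lower end, at a quarter, and only otherwise halved.
  middle : ℕ × ℕ → ℕ
  middle (lo , hi) = if 16 * lo <ᵇ hi then hi / 4 else (lo + hi) / 2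

  -- Sides are compared by the ratio hi/(lo + 1), not by their length.
  widest : Box → ℕ × ℕ
  widest []      = 0 , 0
  widest (e ∷ b) = go 0 1 e b
    where
    go : ℕ → ℕ → ℕ × ℕ → Box → ℕ × ℕ
    go best i e []       = best , middle e
    go best i (lo , hi) ((lo′ , hi′) ∷ b) = if hi * suc lo′ <ᵇ hi′ * suc lo then go i (suc i) (lo′ , hi′) b else go best (suc i) (lo , hi) b

  -- An integer above Q/l: where W/H is at least l/Q, it bounds H/W.
  invert : ℕ → ℕ → ℕ
  invert Q zero    = 0
  invert Q (suc l) = suc (Q / suc l)

  positive : List ℕ → Bool
  positive []           = true
  positive (zero  ∷ ls) = false
  positive (suc l ∷ ls) = positive ls

  ≤-invert : ∀ Q l → Q ≤ suc l * invert Q (suc l)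
  ≤-invert Q l = subst (_≤ suc l * suc (Q / suc l)) (sym (m≡m%n+[m/n]*n Q (suc l))) (≤-trans (+-monoˡ-≤ _ (<⇒≤ (m%n<n Q (suc l)))) (≤-reflexive (lem (suc l) (Q / suc l))))
    where lem : ∀ l q → l + q * l ≡ l * suc q
          lem = solve-∀

  c+[t∸c] : ∀ c t → c + (t ∸ c) ≡ t + (c ∸ t)
  c+[t∸c] zero    t       = sym (trans (cong (t +_) (0∸n≡0 t)) (+-identityʳ t))
  c+[t∸c] (suc c) zero    = +-identityʳ (suc c)
  c+[t∸c] (suc c) (suc t) = cong suc (c+[t∸c] c t)

  -- W p v / H v lies in the side belonging to p, in units of 1/Q.
  InBox : ∀ {n} → ℕ → ℕ → Vec ℤ n → List (Place n) → Box → Set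
  InBox Q h v []       []               = ⊤
  InBox Q h v (p ∷ ps) ((lo , hi) ∷ b) = (lo * h ≤ W p v * Q × W p v * Q ≤ hi * h) × InBox Q h v ps b
  InBox Q h v _        _                = ⊥

  module _ {n} (Q h : ℕ) (v : Vec ℤ n) where

    split-box : ∀ ps b j mid → InBox Q h v ps b → InBox Q h v ps (capHi j mid b) ⊎ InBox Q h v ps (capLo j mid b)
    split-box []       []              j       mid tt = inj₁ tt
    split-box (p ∷ ps) ((lo , hi) ∷ b) zero    mid ((l , u) , ins) = Sum.map (λ le → (l , le) , ins) (λ le → (le , u) , ins) (≤-total (W p v * Q) (mid * h))
    split-box (p ∷ ps) ((lo , hi) ∷ b) (suc j) mid (e , ins) = Sum.map (e ,_) (e ,_) (split-box ps b j mid ins)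

    ∑≤his : ∀ ps b (f : Place n → ℕ) → InBox Q h v ps b → ∑ₚ ps (λ p → f p * W p v) * Q ≤ zdot (map f ps) (his b) * h
    ∑≤his []       []              f tt = z≤n
    ∑≤his (p ∷ ps) ((lo , hi) ∷ b) f ((l , u) , ins) = begin
      (f p * W p v + ∑ₚ ps (λ p → f p * W p v)) * Q         ≡⟨ lem₁ (f p) (W p v) _ Q ⟩
      f p * (W p v * Q) + ∑ₚ ps (λ p → f p * W p v) * Q     ≤⟨ +-mono-≤ (*-monoʳ-≤ (f p) u) (∑≤his ps b f ins) ⟩
      f p * (hi * h) + zdot (map f ps) (his b) * h          ≡⟨ lem₂ (f p) hi h _ ⟩
      (f p * hi + zdot (map f ps) (his b)) * h              ∎
      where
      open ≤-Reasoning
      lem₁ : ∀ f w s Q → (f * w + s) * Q ≡ f * (w * Q) + s * Q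
      lem₁ = solve-∀
      lem₂ : ∀ f l h z → f * (l * h) + z * h ≡ (f * l + z) * h
      lem₂ = solve-∀

    los≤∑ : ∀ ps b (f : Place n → ℕ) → InBox Q h v ps b → zdot (map f ps) (los b) * h ≤ ∑ₚ ps (λ p → f p * W p v) * Q
    los≤∑ []       []              f tt = z≤n
    los≤∑ (p ∷ ps) ((lo , hi) ∷ b) f ((l , u) , ins) = begin
      (f p * lo + zdot (map f ps) (los b)) * h              ≡⟨ lem₂ (f p) lo h _ ⟩
      f p * (lo * h) + zdot (map f ps) (los b) * h          ≤⟨ +-mono-≤ (*-monoʳ-≤ (f p) l) (los≤∑ ps b f ins) ⟩
      f p * (W p v * Q) + ∑ₚ ps (λ p → f p * W p v) * Q     ≡⟨ lem₁ (f p) (W p v) _ Q ⟩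
      (f p * W p v + ∑ₚ ps (λ p → f p * W p v)) * Q         ∎
      where
      open ≤-Reasoning
      lem₁ : ∀ f w s Q → f * (w * Q) + s * Q ≡ (f * w + s) * Q
      lem₁ = solve-∀
      lem₂ : ∀ f l h z → (f * l + z) * h ≡ f * (l * h) + z * h
      lem₂ = solve-∀

    Covers : List (Place n) → List ℕ → Set
    Covers []       []       = ⊤
    Covers (p ∷ ps) (L ∷ Ls) = h ≤ L * W p v × Covers ps Ls
    Covers _        _        = ⊥

    covers : .{{_ : NonZero Q}} → ∀ ps b → InBox Q h v ps b → T (positive (los b)) → Covers ps (map (invert Q) (los b))
    covers []       []                  tt              _   = tt
    covers (p ∷ ps) ((suc l , hi) ∷ b) ((lo≤ , _) , ins) pos = *-cancelˡ-≤ Q bound , covers ps b ins pos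
      where
      open ≤-Reasoning
      L = invert Q (suc l)
      lem₁ : ∀ l L h → l * L * h ≡ L * (l * h)
      lem₁ = solve-∀
      lem₂ : ∀ L w Q → L * (w * Q) ≡ Q * (L * w)
      lem₂ = solve-∀
      bound : Q * h ≤ Q * (L * W p v)
      bound = begin
        Q * h              ≤⟨ *-monoˡ-≤ h (≤-invert Q l) ⟩
        suc l * L * h      ≡⟨ lem₁ (suc l) L h ⟩
        L * (suc l * h)    ≤⟨ *-monoʳ-≤ L lo≤ ⟩
        L * (W p v * Q)    ≡⟨ lem₂ L (W p v) Q ⟩
        Q * (L * W p v)    ∎

  module Check (Q N D τ κ C : ℕ) where

    -- The lists are the positive and negative parts of the coefficients in a bound for H(ve) -
    -- H(v). If the inequality holds at the worst corner, e decreases H on the whole box.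
    shrinks : Box → List ℕ × List ℕ → Bool
    shrinks b (pos , neg) = zdot pos (his b) <ᵇ zdot neg (los b)

    -- One per cent of the bound is reserved for the rounding error, which `inverted` controls.
    balanced : List ℕ → List ℕ → Bool
    balanced Ls tab = 100 * (suc N * (D * D) * zdot Ls tab) ≤ᵇ 99 * (N * (C * C))

    inverted : List ℕ → List (List ℕ) → List ℕ → Bool
    inverted ms xT Ls = (100 * (suc N * (2 * (τ * τ)) * zdot Ls ms) ≤ᵇ κ * κ) ∧ any (balanced Ls) xT

    -- The multiples of the W add up to H, so a box where the weighted sum misses Q contains no
    -- nonzero vector. Near the faces of the region some unit decreases H; in the interior all
    -- absolute values are comparable and a bound for x/v is available.
    check : List ℕ → List (List ℕ × List ℕ) → List (List ℕ) → ℕ → Box → Bool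
    divide : List ℕ → List (List ℕ × List ℕ) → List (List ℕ) → ℕ → Box → ℕ × ℕ → Bool
    check ms eT xT zero    b = false
    check ms eT xT (suc f) b = (zdot ms (his b) <ᵇ Q) ∨ (Q <ᵇ zdot ms (los b)) ∨ any (shrinks b) eT
      ∨ (positive (los b) ∧ inverted ms xT (map (invert Q) (los b)))
      ∨ divide ms eT xT f b (widest b)
    divide ms eT xT f b (j , mid) = check ms eT xT f (capHi j mid b) ∧ check ms eT xT f (capLo j mid b)

  <ᵇ-irrefl : ∀ a b {c d} → T (a <ᵇ b) → b * c ≤ d → d ≤ a * c → c ≡ 0
  <ᵇ-irrefl a b {zero}  _ _ _ = refl
  <ᵇ-irrefl a b {suc c} a<b bc≤d d≤ac = ⊥-elim (<⇒≱ (*-monoˡ-< (suc c) (<ᵇ⇒< a b a<b)) (≤-trans bc≤d d≤ac))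

  module Reduction {n} (ps : List (Place (suc n))) (Q N D τ κ C K : ℕ) .{{_ : NonZero Q}} .{{_ : NonZero N}} .{{_ : NonZero κ}}
    (errors : All (λ p → QuadraticForms.total (reErr D p) ≤ τ × QuadraticForms.total (imErr D p) ≤ τ) ps)
    (lower : ∀ v → κ * S v ≤ H ps v)
    (slack : N * suc N * (2 * (τ * τ)) * ∑ₚ ps mult ≤ K * κ)
    (es xs : List (Vec ℤ (suc n))) where

    open Check Q N D τ κ C public

    Θ : ℕ
    Θ = N * (D * D)

    coef : Vec ℤ (suc n) → Place (suc n) → ℕ
    coef e p = suc N * W p e + K * S e

    shrink-table : Vec ℤ (suc n) → List ℕ × List ℕ
    shrink-table e = map (λ p → mult p * (coef e p ∸ Θ)) ps , map (λ p → mult p * (Θ ∸ coef e p)) ps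

    inverse-table : Vec ℤ (suc n) → List ℕ
    inverse-table x = map (λ p → mult p * W p x) ps

    Reduced : Vec ℤ (suc n) → Set
    Reduced v = All (λ e → H ps v ≤ H ps (v · e)) es

    private
      R : Vec ℤ (suc n) → Vec ℤ (suc n) → ℕ
      R u v = N * suc N * (2 * (τ * τ * (S u * S v)))

      lem₁ : ∀ N D m w → N * D * (m * w) ≡ m * (N * (D * w))
      lem₁ = solve-∀
      lem₂ : ∀ m N w e r → m * (N * (w * e) + r) ≡ m * (N * e) * w + r * m
      lem₂ = solve-∀
      lem₃ : ∀ N t s e μ → N * suc N * (2 * (t * t * (s * e))) * μ ≡ N * suc N * (2 * (t * t)) * μ * (s * e)
      lem₃ = solve-∀
      lem₄ : ∀ K κ s e → K * κ * (s * e) ≡ K * e * (κ * s)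
      lem₄ = solve-∀
      lem₅ : ∀ m c w K → m * c * w + K * (m * w) ≡ m * (c + K) * w
      lem₅ = solve-∀

    -- By `slack` and `lower` the rounding error is at most K · S(e) · H(v). As a multiple of H(v) =
    -- Σ mult · W it can be distributed over the places, which explains the second term of `coef`.
    H-product : ∀ v e → Θ * H ps (v · e) ≤ ∑ₚ ps (λ p → mult p * coef e p * W p v)
    H-product v e = begin
      Θ * H ps (v · e)                                                      ≡⟨ sym (∑ₚ-* ps Θ (λ p → mult p * W p (v · e))) ⟩
      ∑ₚ ps (λ p → Θ * (mult p * W p (v · e)))                              ≤⟨ ∑ₚ-mono ps (All.map (λ {p} er → pointwise p er) errors) ⟩
      ∑ₚ ps (λ p → mult p * (suc N * W p e) * W p v + R v e * mult p)       ≡⟨ trans (∑ₚ-+ ps _ _) (cong (X +_) (∑ₚ-* ps (R v e) mult)) ⟩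
      X + R v e * ∑ₚ ps mult                                                ≡⟨ cong (X +_) (lem₃ N τ (S v) (S e) (∑ₚ ps mult)) ⟩
      X + N * suc N * (2 * (τ * τ)) * ∑ₚ ps mult * (S v * S e)              ≤⟨ +-monoʳ-≤ X (*-monoˡ-≤ (S v * S e) slack) ⟩
      X + K * κ * (S v * S e)                                               ≡⟨ cong (X +_) (lem₄ K κ (S v) (S e)) ⟩
      X + K * S e * (κ * S v)                                               ≤⟨ +-monoʳ-≤ X (*-monoʳ-≤ (K * S e) (lower v)) ⟩
      X + K * S e * H ps v                                                  ≡⟨ cong (X +_) (sym (∑ₚ-* ps (K * S e) (λ p → mult p * W p v))) ⟩
      X + ∑ₚ ps (λ p → K * S e * (mult p * W p v))                          ≡⟨ sym (∑ₚ-+ ps _ _) ⟩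
      ∑ₚ ps (λ p → mult p * (suc N * W p e) * W p v + K * S e * (mult p * W p v))  ≡⟨ ∑ₚ-cong ps (λ p → lem₅ (mult p) (suc N * W p e) (W p v) (K * S e)) ⟩
      ∑ₚ ps (λ p → mult p * coef e p * W p v) ∎
      where
      open ≤-Reasoning
      X = ∑ₚ ps (λ p → mult p * (suc N * W p e) * W p v)
      pointwise : ∀ p → QuadraticForms.total (reErr D p) ≤ τ × QuadraticForms.total (imErr D p) ≤ τ → Θ * (mult p * W p (v · e)) ≤ mult p * (suc N * W p e) * W p v + R v e * mult p
      pointwise p (r , i) = subst₂ _≤_ (sym (lem₁ N (D * D) (mult p) (W p (v · e)))) (lem₂ (mult p) (suc N) (W p v) (W p e) (R v e)) (*-monoʳ-≤ (mult p) (Multiplicative.≤product D τ N p r i v e))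

    -- For a reduced v the bound `H-product` is at least Θ · H(v). Truncated subtraction splits coef
    -- - Θ into two nonnegative parts, to which the upper and lower sides of the box apply.
    shrink-sound : ∀ v e b → InBox Q (H ps v) v ps b → H ps v ≤ H ps (v · e) → T (shrinks b (shrink-table e)) → H ps v ≡ 0
    shrink-sound v e b ins red t = <ᵇ-irrefl (zdot (map pos ps) (his b)) (zdot (map neg ps) (los b)) t (los≤∑ Q (H ps v) v ps b neg ins) (≤-trans (*-monoˡ-≤ Q neg≤pos) (∑≤his Q (H ps v) v ps b pos ins))
      where
      open ≤-Reasoning
      pos neg : Place (suc n) → ℕ
      pos p = mult p * (coef e p ∸ Θ)
      neg p = mult p * (Θ ∸ coef e p)
      lem : ∀ m c w d → m * c * w + m * d * w ≡ m * (c + d) * w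
      lem = solve-∀
      lem′ : ∀ m c w d → m * (c + d) * w ≡ c * (m * w) + m * d * w
      lem′ = solve-∀
      equal : ∑ₚ ps (λ p → mult p * coef e p * W p v) + ∑ₚ ps (λ p → neg p * W p v) ≡ Θ * H ps v + ∑ₚ ps (λ p → pos p * W p v)
      equal = trans (sym (∑ₚ-+ ps _ _)) (trans (∑ₚ-cong ps (λ p → trans (lem (mult p) (coef e p) (W p v) (Θ ∸ coef e p)) (trans (cong (λ z → mult p * z * W p v) (c+[t∸c] (coef e p) Θ)) (lem′ (mult p) Θ (W p v) (coef e p ∸ Θ))))) (trans (∑ₚ-+ ps _ _) (cong (_+ ∑ₚ ps (λ p → pos p * W p v)) (∑ₚ-* ps Θ (λ p → mult p * W p v)))))
      neg≤pos : ∑ₚ ps (λ p → neg p * W p v) ≤ ∑ₚ ps (λ p → pos p * W p v)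
      neg≤pos = +-cancelˡ-≤ (Θ * H ps v) _ _ (begin
        Θ * H ps v + ∑ₚ ps (λ p → neg p * W p v)   ≤⟨ +-monoˡ-≤ _ (≤-trans (*-monoʳ-≤ Θ red) (H-product v e)) ⟩
        ∑ₚ ps (λ p → mult p * coef e p * W p v) + ∑ₚ ps (λ p → neg p * W p v)   ≡⟨ equal ⟩
        Θ * H ps v + ∑ₚ ps (λ p → pos p * W p v) ∎)

    -- Placewise H(v)W(z) ≤ L · W(v)W(z), and W(v)W(z) is about D² W(vz), which is known because vz
    -- = x.
    product-covers : ∀ v z qs Ls → All (λ p → QuadraticForms.total (reErr D p) ≤ τ × QuadraticForms.total (imErr D p) ≤ τ) qs → Covers Q (H ps v) v qs Ls →
      N * (H ps v * H qs z) ≤ suc N * (D * D) * zdot Ls (map (λ p → mult p * W p (v · z)) qs) + R v z * zdot Ls (map mult qs)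
    product-covers v z []       []       _                  _          = ≤-trans (≤-reflexive (trans (cong (N *_) (*-zeroʳ (H ps v))) (*-zeroʳ N))) z≤n
    product-covers v z (p ∷ qs) (L ∷ Ls) ((re≤ , im≤) ∷ er) (h≤ , cov) = begin
      N * (h * (m * W p z + H qs z))                     ≡⟨ r₁ N h m (W p z) (H qs z) ⟩
      m * W p z * N * h + N * (h * H qs z)               ≤⟨ +-mono-≤ (*-monoʳ-≤ (m * W p z * N) h≤) (product-covers v z qs Ls er cov) ⟩
      m * W p z * N * (L * W p v) + (E * A + r * M)      ≡⟨ cong (_+ (E * A + r * M)) (r₂ m (W p z) N L (W p v)) ⟩
      L * m * (N * (W p v * W p z)) + (E * A + r * M)    ≤⟨ +-monoˡ-≤ (E * A + r * M) (*-monoʳ-≤ (L * m) (Multiplicative.product≤ D τ N p re≤ im≤ v z)) ⟩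
      L * m * (suc N * (D * D * W p (v · z)) + r) + (E * A + r * M)    ≡⟨ r₃ L m (suc N) (D * D) (W p (v · z)) r A M ⟩
      E * (L * (m * W p (v · z)) + A) + r * (L * m + M)  ∎
      where
      open ≤-Reasoning
      h = H ps v
      m = mult p
      r = R v z
      E = suc N * (D * D)
      A = zdot Ls (map (λ p → mult p * W p (v · z)) qs)
      M = zdot Ls (map mult qs)
      r₁ : ∀ N h m w s → N * (h * (m * w + s)) ≡ m * w * N * h + N * (h * s)
      r₁ = solve-∀
      r₂ : ∀ m z N L v → m * z * N * (L * v) ≡ L * m * (N * (v * z))
      r₂ = solve-∀
      r₃ : ∀ L m N D w r A M → L * m * (N * (D * w) + r) + (N * D * A + r * M) ≡ N * D * (L * (m * w) + A) + r * (L * m + M)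
      r₃ = solve-∀

    inverse-sound : ∀ v z x Ls → v · z ≡ x → Covers Q (H ps v) v ps Ls → T (100 * (suc N * (2 * (τ * τ)) * zdot Ls (map mult ps)) ≤ᵇ κ * κ) → T (balanced Ls (inverse-table x)) → H ps v * H ps z ≤ C * C
    inverse-sound v z x Ls refl cov t₁ t₂ = *-cancelˡ-≤ N (*-cancelˡ-≤ 99 (+-cancelˡ-≤ (N * G) _ _ (begin
      N * G + 99 * (N * G)                    ≡⟨⟩
      100 * (N * G)                           ≤⟨ *-monoʳ-≤ 100 (product-covers v z ps Ls errors cov) ⟩
      100 * (suc N * (D * D) * A + R v z * M)        ≡⟨ *-distribˡ-+ 100 (suc N * (D * D) * A) (R v z * M) ⟩
      100 * (suc N * (D * D) * A) + 100 * (R v z * M)   ≤⟨ +-mono-≤ (≤ᵇ⇒≤ (100 * (suc N * (D * D) * A)) (99 * (N * (C * C))) t₂) error ⟩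
      99 * (N * (C * C)) + N * G              ≡⟨ +-comm _ (N * G) ⟩
      N * G + 99 * (N * (C * C)) ∎)))
      where
      open ≤-Reasoning
      G = H ps v * H ps z
      A = zdot Ls (inverse-table (v · z))
      M = zdot Ls (map mult ps)
      r₁ : ∀ k N t s z M → k * k * (100 * (N * suc N * (2 * (t * t * (s * z))) * M)) ≡ N * (100 * (suc N * (2 * (t * t)) * M)) * ((k * s) * (k * z))
      r₁ = solve-∀
      r₂ : ∀ N k g → N * (k * k) * g ≡ k * k * (N * g)
      r₂ = solve-∀
      error : 100 * (R v z * M) ≤ N * G
      error = *-cancelˡ-≤ (κ * κ) {{m*n≢0 κ κ}} (begin
        κ * κ * (100 * (R v z * M))         ≡⟨ r₁ κ N τ (S v) (S z) M ⟩
        N * (100 * (suc N * (2 * (τ * τ)) * M)) * ((κ * S v) * (κ * S z))   ≤⟨ *-mono-≤ (*-monoʳ-≤ N (≤ᵇ⇒≤ (100 * (suc N * (2 * (τ * τ)) * M)) (κ * κ) t₁)) (*-mono-≤ (lower v) (lower z)) ⟩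
        N * (κ * κ) * G                     ≡⟨ r₂ N κ G ⟩
        κ * κ * (N * G) ∎)

    Inverse-small : Vec ℤ (suc n) → Set
    Inverse-small v = Any (λ x → ∀ z → v · z ≡ x → H ps v * H ps z ≤ C * C) xs

    private
      shrinks-somewhere : ∀ v b → InBox Q (H ps v) v ps b → ∀ fs → All (λ e → H ps v ≤ H ps (v · e)) fs → Any (λ e → T (shrinks b (shrink-table e))) fs → H ps v ≡ 0
      shrinks-somewhere v b ins (e ∷ fs) (r ∷ rs) (here t)  = shrink-sound v e b ins r t
      shrinks-somewhere v b ins (e ∷ fs) (r ∷ rs) (there t) = shrinks-somewhere v b ins fs rs t

      T∨ : ∀ x {y} → T (x ∨ y) → T x ⊎ T y
      T∨ x = Equivalence.to T-∨
      T∧ : ∀ x {y} → T (x ∧ y) → T x × T y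
      T∧ x = Equivalence.to T-∧

    check-sound : ∀ f b v → Reduced v → InBox Q (H ps v) v ps b → T (check (map mult ps) (map shrink-table es) (map inverse-table xs) f b) → H ps v ≡ 0 ⊎ Inverse-small v
    check-sound (suc f) b v red ins t =
      [ (λ u → inj₁ (<ᵇ-irrefl (zdot ms (his b)) Q u (≤-reflexive (*-comm Q (H ps v))) (∑≤his Q (H ps v) v ps b mult ins)))
      , [ (λ u → inj₁ (<ᵇ-irrefl Q (zdot ms (los b)) u (los≤∑ Q (H ps v) v ps b mult ins) (≤-reflexive (*-comm (H ps v) Q))))
        , [ (λ u → inj₁ (shrinks-somewhere v b ins es red (Any.map⁻ (Any.any⁻ (shrinks b) eT u))))
          , [ (λ u → inj₂ (invertible (T∧ (positive (los b)) u)))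
            , (λ u → divided (widest b) (T∧ (check ms eT xT f (capHi (proj₁ (widest b)) (proj₂ (widest b)) b)) u))
            ]′ ∘ T∨ (positive (los b) ∧ inverted ms xT Ls)
          ]′ ∘ T∨ (any (shrinks b) eT)
        ]′ ∘ T∨ (Q <ᵇ zdot ms (los b))
      ]′ (T∨ (zdot ms (his b) <ᵇ Q) t)
      where
      ms = map mult ps
      eT = map shrink-table es
      xT = map inverse-table xs
      Ls = map (invert Q) (los b)
      within = 100 * (suc N * (2 * (τ * τ)) * zdot Ls ms) ≤ᵇ κ * κ
      invertible : T (positive (los b)) × T (inverted ms xT Ls) → Inverse-small v
      invertible (pos , u) = Any.map (λ {x} bal z eq → inverse-sound v z x Ls eq (covers Q (H ps v) v ps b ins pos) (proj₁ (T∧ within u)) bal) (Any.map⁻ (Any.any⁻ (balanced Ls) xT (proj₂ (T∧ within u))))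
      divided : ∀ jm → T (check ms eT xT f (capHi (proj₁ jm) (proj₂ jm) b)) × T (check ms eT xT f (capLo (proj₁ jm) (proj₂ jm) b)) → H ps v ≡ 0 ⊎ Inverse-small v
      divided (j , mid) (t₁ , t₂) = [ (λ i → check-sound f (capHi j mid b) v red i t₁) , (λ i → check-sound f (capLo j mid b) v red i t₂) ]′ (split-box Q (H ps v) v ps b j mid ins)

    whole : List (Place (suc n)) → Box
    whole = map (λ _ → 0 , Q)

    in-whole : All (λ p → 1 ≤ mult p) ps → ∀ v → InBox Q (H ps v) v ps (whole ps)
    in-whole pos v = go ps pos ≤-refl
      where
      go : ∀ qs → All (λ p → 1 ≤ mult p) qs → H qs v ≤ H ps v → InBox Q (H ps v) v qs (whole qs)
      go []       []         _  = tt
      go (p ∷ qs) (m≥1 ∷ ms) le = (z≤n , ≤-trans (≤-reflexive (*-comm (W p v) Q)) (*-monoʳ-≤ Q (≤-trans (≤-trans (≤-reflexive (sym (*-identityˡ (W p v)))) (*-monoˡ-≤ (W p v) m≥1)) (≤-trans (m≤m+n (mult p * W p v) (H qs v)) le)))) , go qs ms (≤-trans (m≤n+m (H qs v) (mult p * W p v)) le)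

-- Enumeration of small units and small cofactors

module SmallUnits where

  open import Data.Nat as ℕ using (ℕ; zero; suc; _≤_; _<_; z≤n; s≤s; _≤ᵇ_; _<ᵇ_; _≡ᵇ_)
  import Data.Nat.Properties as ℕ
  open import Data.Nat.DivMod using (m*n%n≡0)
  open import Data.Nat.Induction using (<-wellFounded)
  open import Induction.WellFounded using (Acc; acc)
  open import Data.Integer as ℤ using (ℤ; +_; -[1+_]; 0ℤ; 1ℤ; ∣_∣; -_; _/ℕ_)
  import Data.Integer.Properties as ℤ
  open import Data.Bool using (Bool; true; false; _∧_; _∨_; not; if_then_else_; T)
  open import Data.Bool.ListAction using (any; all)
  open import Data.Bool.Properties using (T-∧; T-∨)
  open import Data.Vec as Vec using (Vec; []; _∷_)
  open import Data.Vec.Properties using (≡-dec)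
  open import Data.List using (List; []; _∷_)
  open import Data.List.Relation.Unary.All as All using (All; []; _∷_)
  open import Data.List.Relation.Unary.Any as Any using (Any; here; there)
  import Data.List.Relation.Unary.Any.Properties as Any
  import Data.List.Relation.Unary.All.Properties as All
  open import Data.Product using (_×_; _,_; proj₁; proj₂; ∃-syntax)
  open import Data.Sum using (_⊎_; inj₁; inj₂; [_,_]′)
  open import Data.Unit using (⊤; tt)
  open import Data.Empty using (⊥; ⊥-elim)
  open import Function using (_∘_; Equivalence)
  open import Relation.Nullary using (¬_)
  open import Relation.Nullary.Decidable using (⌊_⌋; toWitness; fromWitness)
  open import Relation.Binary.PropositionalEquality
  open Order
  open QuadraticForms using (diagonal)
  open Embeddings

  T∨ : ∀ x {y} → T (x ∨ y) → T x ⊎ T y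
  T∨ x = Equivalence.to T-∨

  T∧ : ∀ x {y} → T (x ∧ y) → T x × T y
  T∧ x = Equivalence.to T-∧

  T-not : ∀ {x} → T (not x) → ¬ T x
  T-not {false} _ ()

  infix 4 _==_
  _==_ : ∀ {n} → Vec ℤ n → Vec ℤ n → Bool
  u == v = ⌊ ≡-dec ℤ._≟_ u v ⌋

  ==⇒≡ : ∀ {n} (u v : Vec ℤ n) → T (u == v) → u ≡ v
  ==⇒≡ u v = toWitness

  both only⁺ : ℕ → (ℤ → Bool) → Bool
  both zero    f = f 0ℤ
  both (suc a) f = f (+ suc a) ∧ f -[1+ a ]
  only⁺ a f = f (+ a)

  both-sound : ∀ b f → T (both ∣ b ∣ f) → T (f b)
  both-sound (+ zero)  f t = t
  both-sound (+ suc a) f t = proj₁ (T∧ (f (+ suc a)) t)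
  both-sound -[1+ a ]  f t = proj₂ (T∧ (f (+ suc a)) t)

  -- Test f on all integer vectors v with Σ g_i v_i² ≤ c; the scan of one coordinate fails if it needs more than 10 steps.
  small : ∀ {m} → Vec ℕ m → ℕ → (Vec ℤ m → Bool) → Bool
  scan  : ∀ {m} → (ℕ → (ℤ → Bool) → Bool) → ℕ → Vec ℕ m → ℕ → (Vec ℤ (suc m) → Bool) → ℕ → ℕ → Bool
  small []       c f = f []
  small (g ∷ gs) c f = scan both g gs c f 10 0
  scan pick g gs c f zero    a = false
  scan pick g gs c f (suc r) a = if g ℕ.* (a ℕ.* a) ≤ᵇ c
    then pick a (λ b → small gs (c ℕ.∸ g ℕ.* (a ℕ.* a)) (λ v → f (b ∷ v))) ∧ scan pick g gs c f r (suc a)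
    else true

  T-if : ∀ x y → T (if x then y else true) → T x → T y
  T-if true y t _ = t

  small-sound : ∀ {m} (g : Vec ℕ m) c f → T (small g c f) → ∀ v → diagonal g v ≤ c → T (f v)
  scan-sound  : ∀ {m} pick g (gs : Vec ℕ m) c f r a → T (scan pick g gs c f r a) → ∀ b v → (∀ h → T (pick ∣ b ∣ h) → T (h b)) → a ≤ ∣ b ∣ → g ℕ.* (∣ b ∣ ℕ.* ∣ b ∣) ℕ.+ diagonal gs v ≤ c → T (f (b ∷ v))
  small-sound []       c f t []      _  = t
  small-sound (g ∷ gs) c f t (b ∷ v) le = scan-sound both g gs c f 10 0 t b v (both-sound b) z≤n le
  scan-sound pick g gs c f (suc r) a t b v picked a≤ le = [ (λ a<b → scan-sound pick g gs c f r (suc a) (proj₂ branch) b v picked a<b le) , equal ]′ (ℕ.m≤n⇒m<n∨m≡n a≤)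
    where
    here? : ℤ → Bool
    here? b = small gs (c ℕ.∸ g ℕ.* (a ℕ.* a)) (λ v → f (b ∷ v))
    branch = T∧ (pick a here?) (T-if (g ℕ.* (a ℕ.* a) ≤ᵇ c) _ t (ℕ.≤⇒≤ᵇ (ℕ.≤-trans (ℕ.*-monoʳ-≤ g (ℕ.*-mono-≤ a≤ a≤)) (ℕ.≤-trans (ℕ.m≤m+n _ (diagonal gs v)) le))))
    equal : a ≡ ∣ b ∣ → T (f (b ∷ v))
    equal refl = small-sound gs (c ℕ.∸ g ℕ.* (a ℕ.* a)) (λ v → f (b ∷ v)) (picked here? (proj₁ branch)) v (ℕ.≤-trans (ℕ.≤-reflexive (sym (ℕ.m+n∸m≡n (g ℕ.* (a ℕ.* a)) (diagonal gs v)))) (ℕ.∸-monoˡ-≤ (g ℕ.* (a ℕ.* a)) le))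

  -- Singles out one of v and -v, which have the same H and are units together; this halves the
  -- enumeration. The zero vector counts as well.
  Leading⁺ : ∀ {m} → Vec ℤ m → Set
  Leading⁺ []              = ⊤
  Leading⁺ (+ zero   ∷ v)  = Leading⁺ v
  Leading⁺ (+ suc a  ∷ v)  = ⊤
  Leading⁺ (-[1+ a ] ∷ v)  = ⊥

  leading± : ∀ {m} (v : Vec ℤ m) → Leading⁺ v ⊎ Leading⁺ (- 1ℤ ⊙ v)
  leading± []             = inj₁ tt
  leading± (+ zero   ∷ v) = leading± v
  leading± (+ suc a  ∷ v) = inj₁ tt
  leading± (-[1+ a ] ∷ v) = inj₂ tt

  small⁺ : ∀ {m} → Vec ℕ m → ℕ → (Vec ℤ m → Bool) → Bool
  small⁺ []       c f = f []
  small⁺ (g ∷ gs) c f = small⁺ gs c (λ v → f (0ℤ ∷ v)) ∧ scan only⁺ g gs c f 10 1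

  small⁺-sound : ∀ {m} (g : Vec ℕ m) c f → T (small⁺ g c f) → ∀ v → Leading⁺ v → diagonal g v ≤ c → T (f v)
  small⁺-sound []       c f t []            _  _  = t
  small⁺-sound (g ∷ gs) c f t (+ zero ∷ v)  l  le = small⁺-sound gs c (λ v → f (0ℤ ∷ v)) (proj₁ (T∧ (small⁺ gs c (λ v → f (0ℤ ∷ v))) t)) v l (ℕ.≤-trans (ℕ.m≤n+m (diagonal gs v) _) le)
  small⁺-sound (g ∷ gs) c f t (+ suc a ∷ v) _  le = scan-sound only⁺ g gs c f 10 1 (proj₂ (T∧ (small⁺ gs c (λ v → f (0ℤ ∷ v))) t)) (+ suc a) v (λ h t → t) (s≤s z≤n) le

  ∣-1*∣ : ∀ a → ∣ - 1ℤ ℤ.* a ∣ ≡ ∣ a ∣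
  ∣-1*∣ a = trans (ℤ.abs-* (- 1ℤ) a) (ℕ.*-identityˡ ∣ a ∣)

  W-neg : ∀ {m} (p : Place m) v → W p (- 1ℤ ⊙ v) ≡ W p v
  W-neg p v = cong₂ (λ x y → x ℕ.* x ℕ.+ y ℕ.* y) (abs-neg (re p)) (abs-neg (im p))
    where
    abs-neg : ∀ r → ∣ dot r (- 1ℤ ⊙ v) ∣ ≡ ∣ dot r v ∣
    abs-neg r = trans (cong ∣_∣ (dot-⊙ (- 1ℤ) r v)) (∣-1*∣ (dot r v))

  H-neg : ∀ {m} (ps : List (Place m)) v → H ps (- 1ℤ ⊙ v) ≡ H ps v
  H-neg ps v = ∑ₚ-cong ps (λ p → cong (mult p ℕ.*_) (W-neg p v))

  -- Some entry is not a multiple of d (false for d = 0).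
  nonmultiple : ∀ {m} → ℤ → Vec ℤ m → Bool
  nonmultiple′ : ∀ {m} → ℕ → Vec ℤ m → Bool
  nonmultiple d v = nonmultiple′ ∣ d ∣ v
  nonmultiple′ zero    v       = false
  nonmultiple′ (suc d) []      = false
  nonmultiple′ (suc d) (a ∷ v) = not (∣ a ∣ ℕ.% suc d ≡ᵇ 0) ∨ nonmultiple′ (suc d) v

  nonmultiple-sound : ∀ {m} d (v : Vec ℤ m) → ¬ T (nonmultiple d (d ⊙ v))
  nonmultiple-sound d v = go ∣ d ∣ refl v
    where
    go : ∀ {m} e → ∣ d ∣ ≡ e → (v : Vec ℤ m) → ¬ T (nonmultiple′ e (d ⊙ v))
    go (suc e) eq (a ∷ v) t = [ (λ u → T-not u (ℕ.≡⇒≡ᵇ _ 0 (trans (cong (ℕ._% suc e) (trans (ℤ.abs-* d a) (trans (cong (ℕ._* ∣ a ∣) eq) (ℕ.*-comm (suc e) ∣ a ∣)))) (m*n%n≡0 ∣ a ∣ (suc e))))) , go (suc e) eq v ]′ (T∨ (not (∣ d ℤ.* a ∣ ℕ.% suc e ≡ᵇ 0)) t)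

  quotient : ∀ {m} → ℤ → Vec ℤ m → Vec ℤ m
  quotient (+ zero)   v = v
  quotient (+ suc d)  v = Vec.map (_/ℕ suc d) v
  quotient -[1+ d ]   v = Vec.map (λ a → - (a /ℕ suc d)) v

  module _ {n : ℕ} where

    -- Faddeev–LeVerrier: w · adjugate w is the norm of w, up to sign; the trace is suc n times the constant coordinate.
    adjugate : Vec ℤ (suc n) → Vec ℤ (suc n)
    adjugate w = go n 0 𝟙
      where
      step : ℕ → Vec ℤ (suc n) → Vec ℤ (suc n)
      step i t = t ⊕ (- ((+ suc n ℤ.* at t 0) /ℕ suc i)) ⊙ 𝟙
      go : ℕ → ℕ → Vec ℤ (suc n) → Vec ℤ (suc n)
      go zero    i M = M
      go (suc r) i M = go r (suc i) (step i (w · M))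

    Unit : Vec ℤ (suc n) → Set
    Unit v = ∃[ v′ ] v · v′ ≡ 𝟙

    nonunit : Vec ℤ (suc n) → Vec ℤ (suc n) → Bool
    nonunit v y = (v · y == at (v · y) 0 ⊙ 𝟙) ∧ nonmultiple (at (v · y) 0) y

    scalar-product : ∀ (v w y : Vec ℤ (suc n)) d → w · y ≡ d ⊙ 𝟙 → (v · w) · y ≡ d ⊙ v
    scalar-product v w y d eq = trans (·-assoc v w y) (trans (cong (v ·_) eq) (trans (·-⊙ v d 𝟙) (cong (d ⊙_) (·-identityʳ v))))

    -- If v had an inverse v′, then v · y = d would give y = d · v′, a multiple of d.
    nonunit-sound : ∀ v y → T (nonunit v y) → ¬ Unit v
    nonunit-sound v y t (v′ , inv) = nonmultiple-sound d v′ (subst (λ z → T (nonmultiple d z)) y≡ (proj₂ parts))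
      where
      d = at (v · y) 0
      parts = T∧ (v · y == d ⊙ 𝟙) t
      y≡ : y ≡ d ⊙ v′
      y≡ = trans (sym (·-identityˡ y)) (trans (cong (_· y) (trans (sym inv) (·-comm v v′))) (scalar-product v′ v y d (==⇒≡ _ _ (proj₁ parts))))

    zeros-nonunit : ¬ Unit (zeros (suc n))
    zeros-nonunit (v′ , inv) = one≢zero (cong (λ v → at v 0) (trans (sym inv) (trans (·-comm (zeros (suc n)) v′) (act-zeros v′))))
      where one≢zero : 1ℤ ≢ 0ℤ
            one≢zero ()

    module Small (ps : List (Place (suc n))) (es xs : List (Vec ℤ (suc n))) where

      settled : Vec ℤ (suc n) → Bool
      settled v = (v == 𝟙) ∨ (v == - 1ℤ ⊙ 𝟙) ∨ (v == zeros (suc n)) ∨ any (λ e → H ps (v · e) <ᵇ H ps v) es ∨ nonunit v (adjugate v)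

      Reduced : Vec ℤ (suc n) → Set
      Reduced v = All (λ e → H ps v ≤ H ps (v · e)) es

      private
        irreducible : ∀ v fs → All (λ e → H ps v ≤ H ps (v · e)) fs → ¬ Any (λ e → T (H ps (v · e) <ᵇ H ps v)) fs
        irreducible v (e ∷ fs) (le ∷ _)  (here t)  = ℕ.<⇒≱ (ℕ.<ᵇ⇒< (H ps (v · e)) (H ps v) t) le
        irreducible v (e ∷ fs) (_ ∷ les) (there t) = irreducible v fs les t

      settled-sound : ∀ v → Unit v → Reduced v → T (settled v) → v ≡ 𝟙 ⊎ v ≡ - 1ℤ ⊙ 𝟙
      settled-sound v unit red t =
        [ (λ u → inj₁ (==⇒≡ v 𝟙 u))
        , [ (λ u → inj₂ (==⇒≡ v (- 1ℤ ⊙ 𝟙) u))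
          , [ (λ u → ⊥-elim (zeros-nonunit (subst Unit (==⇒≡ v (zeros (suc n)) u) unit)))
            , [ (λ u → ⊥-elim (irreducible v es red (Any.any⁻ (λ e → H ps (v · e) <ᵇ H ps v) es u)))
              , (λ u → ⊥-elim (nonunit-sound v (adjugate v) u unit))
              ]′ ∘ T∨ (any (λ e → H ps (v · e) <ᵇ H ps v) es)
            ]′ ∘ T∨ (v == zeros (suc n))
          ]′ ∘ T∨ (v == - 1ℤ ⊙ 𝟙)
        ]′ (T∨ (v == 𝟙) t)

      settles : ℤ → Vec ℤ (suc n) → Vec ℤ (suc n) → Bool
      settles d t q = (d ⊙ q == t) ∧ settled q

      -- The solution v of d ⊙ v = t is settled or does not exist.
      divided : ℤ → Vec ℤ (suc n) → Bool
      divided d t = nonmultiple d t ∨ settles d t (quotient d t)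

      divided-sound : ∀ d t v → d ≢ 0ℤ → t ≡ d ⊙ v → Unit v → Reduced v → T (divided d t) → v ≡ 𝟙 ⊎ v ≡ - 1ℤ ⊙ 𝟙
      divided-sound d t v d≢0 t≡ unit red u = [ (λ m → ⊥-elim (nonmultiple-sound d v (subst (λ z → T (nonmultiple d z)) t≡ m))) , finish ∘ T∧ (d ⊙ q == t) ]′ (T∨ (nonmultiple d t) u)
        where
        q = quotient d t
        finish : T (d ⊙ q == t) × T (settled q) → v ≡ 𝟙 ⊎ v ≡ - 1ℤ ⊙ 𝟙
        finish (dq , s) = settled-sound v unit red (subst (λ z → T (settled z)) (⊙-cancel d d≢0 (trans (==⇒≡ (d ⊙ q) t dq) t≡)) s)

      -- All solutions v of v · w ∈ xs are settled; y is an adjugate and d the norm of w.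
      cofactors : Vec ℤ (suc n) → Vec ℤ (suc n) → ℤ → Bool
      cofactors w y d = ((w == zeros (suc n)) ∧ all (λ x → not (x == zeros (suc n))) xs)
        ∨ ((w · y == d ⊙ 𝟙) ∧ not ⌊ d ℤ.≟ 0ℤ ⌋ ∧ all (λ x → divided d (x · y)) xs)

      cofactors-sound : ∀ v w y d → Unit v → Reduced v → T (cofactors w y d) → Any (λ x → v · w ≡ x) xs → v ≡ 𝟙 ⊎ v ≡ - 1ℤ ⊙ 𝟙
      cofactors-sound v w y d unit red t v·w∈xs = [ ⊥-elim ∘ zero-case ∘ T∧ (w == zeros (suc n)) , nonzero-case ∘ T∧ (w · y == d ⊙ 𝟙) ]′ (T∨ ((w == zeros (suc n)) ∧ all (λ x → not (x == zeros (suc n))) xs) t)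
        where
        zero-case : T (w == zeros (suc n)) × T (all (λ x → not (x == zeros (suc n))) xs) → ⊥
        zero-case (w≡0 , x≢0) = go xs v·w∈xs (All.all⁺ (λ x → not (x == zeros (suc n))) xs x≢0)
          where
          go : ∀ zs → Any (λ x → v · w ≡ x) zs → All (λ x → T (not (x == zeros (suc n)))) zs → ⊥
          go (_ ∷ zs) (here refl) (u ∷ _)  = T-not u (fromWitness (trans (cong (v ·_) (==⇒≡ w (zeros (suc n)) w≡0)) (act-zeros v)))
          go (_ ∷ zs) (there i)   (_ ∷ us) = go zs i us
        nonzero-case : T (w · y == d ⊙ 𝟙) × T (not ⌊ d ℤ.≟ 0ℤ ⌋ ∧ all (λ x → divided d (x · y)) xs) → v ≡ 𝟙 ⊎ v ≡ - 1ℤ ⊙ 𝟙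
        nonzero-case (scalar , u) = go xs v·w∈xs (All.all⁺ (λ x → divided d (x · y)) xs (proj₂ parts))
          where
          parts = T∧ (not ⌊ d ℤ.≟ 0ℤ ⌋) u
          d≢0 : d ≢ 0ℤ
          d≢0 = λ eq → T-not (proj₁ parts) (fromWitness eq)
          go : ∀ zs → Any (λ x → v · w ≡ x) zs → All (λ x → T (divided d (x · y))) zs → v ≡ 𝟙 ⊎ v ≡ - 1ℤ ⊙ 𝟙
          go (_ ∷ zs) (here refl) (t ∷ _)  = divided-sound d (v · w · y) v d≢0 (scalar-product v w y d (==⇒≡ (w · y) (d ⊙ 𝟙) scalar)) unit red t
          go (_ ∷ zs) (there i)   (_ ∷ ts) = go zs i ts

      -- A vector in the list is examined in both roles: as the reduced unit v itself, and as the
      -- cofactor w with v · w in xs.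
      explore : Vec ℤ (suc n) → Vec ℤ (suc n) → Bool
      explore w y = (nonunit w y ∨ settled w) ∧ cofactors w y (at (w · y) 0)

      explored : Vec ℤ (suc n) → Bool
      explored w = explore w (adjugate w)

      private
        neg-neg : ∀ (v : Vec ℤ (suc n)) → - 1ℤ ⊙ (- 1ℤ ⊙ v) ≡ v
        neg-neg v = trans (⊙-⊙ (- 1ℤ) (- 1ℤ) v) (1-⊙ v)

        neg-· : ∀ (u v : Vec ℤ (suc n)) → (- 1ℤ ⊙ u) · (- 1ℤ ⊙ v) ≡ u · v
        neg-· u v = trans (⊙-· (- 1ℤ) u (- 1ℤ ⊙ v)) (trans (cong (- 1ℤ ⊙_) (·-⊙ u (- 1ℤ) v)) (neg-neg (u · v)))

        neg-unit : ∀ v → Unit v → Unit (- 1ℤ ⊙ v)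
        neg-unit v (v′ , inv) = - 1ℤ ⊙ v′ , trans (neg-· v v′) inv

        neg-reduced : ∀ v → Reduced v → Reduced (- 1ℤ ⊙ v)
        neg-reduced v = All.map (λ {e} → subst₂ _≤_ (sym (H-neg ps v)) (sym (trans (cong (H ps) (⊙-· (- 1ℤ) v e)) (H-neg ps (v · e)))))

        neg-±1 : ∀ v → - 1ℤ ⊙ v ≡ 𝟙 ⊎ - 1ℤ ⊙ v ≡ - 1ℤ ⊙ 𝟙 → v ≡ 𝟙 ⊎ v ≡ - 1ℤ ⊙ 𝟙
        neg-±1 v (inj₁ eq) = inj₂ (trans (sym (neg-neg v)) (cong (- 1ℤ ⊙_) eq))
        neg-±1 v (inj₂ eq) = inj₁ (⊙-cancel (- 1ℤ) (λ ()) eq)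

      module _ (g : Vec ℕ (suc n)) (C : ℕ) (g≤H : ∀ v → diagonal g v ≤ H ps v) (certified : T (small⁺ g C explored)) where

        private
          explored-small : ∀ w → Leading⁺ w → H ps w ≤ C → T (nonunit w (adjugate w) ∨ settled w) × T (cofactors w (adjugate w) (at (w · adjugate w) 0))
          explored-small w l le = T∧ (nonunit w (adjugate w) ∨ settled w) (small⁺-sound g C explored certified w l (ℕ.≤-trans (g≤H w) le))

          leading-unit : ∀ v → Leading⁺ v → Unit v → Reduced v → H ps v ≤ C → v ≡ 𝟙 ⊎ v ≡ - 1ℤ ⊙ 𝟙
          leading-unit v l unit red le = [ (λ t → ⊥-elim (nonunit-sound v (adjugate v) t unit)) , settled-sound v unit red ]′ (T∨ (nonunit v (adjugate v)) (proj₁ (explored-small v l le)))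

          leading-cofactor : ∀ v z → Leading⁺ z → Unit v → Reduced v → H ps z ≤ C → Any (λ x → v · z ≡ x) xs → v ≡ 𝟙 ⊎ v ≡ - 1ℤ ⊙ 𝟙
          leading-cofactor v z l unit red le = cofactors-sound v z (adjugate z) (at (z · adjugate z) 0) unit red (proj₂ (explored-small z l le))

        small-unit : ∀ v → Unit v → Reduced v → H ps v ≤ C → v ≡ 𝟙 ⊎ v ≡ - 1ℤ ⊙ 𝟙
        small-unit v unit red le = [ (λ l → leading-unit v l unit red le) , (λ l → neg-±1 v (leading-unit (- 1ℤ ⊙ v) l (neg-unit v unit) (neg-reduced v red) (subst (_≤ C) (sym (H-neg ps v)) le))) ]′ (leading± v)

        small-cofactor : ∀ v z → Unit v → Reduced v → H ps z ≤ C → Any (λ x → v · z ≡ x) xs → v ≡ 𝟙 ⊎ v ≡ - 1ℤ ⊙ 𝟙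
        small-cofactor v z unit red le v·z∈xs = [ (λ l → leading-cofactor v z l unit red le v·z∈xs) , (λ l → neg-±1 v (leading-cofactor (- 1ℤ ⊙ v) (- 1ℤ ⊙ z) l (neg-unit v unit) (neg-reduced v red) (subst (_≤ C) (sym (H-neg ps z)) le) (Any.map (trans (neg-· v z)) v·z∈xs))) ]′ (leading± z)

        -- From H(v)H(z) ≤ C² one of v and z = x/v lies in the enumerated range. The quotient z is
        -- integral because v is a unit.
        reduced-unit : ∀ v → Unit v → Reduced v → H ps v ≡ 0 ⊎ Any (λ x → ∀ z → v · z ≡ x → H ps v ℕ.* H ps z ≤ C ℕ.* C) xs → v ≡ 𝟙 ⊎ v ≡ - 1ℤ ⊙ 𝟙
        reduced-unit v unit red (inj₁ h≡0) = small-unit v unit red (ℕ.≤-trans (ℕ.≤-reflexive h≡0) z≤n)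
        reduced-unit v unit@(v′ , inv) red (inj₂ small-product) = go xs small-product (λ i → i)
          where
          cofactor : ∀ x → v · (v′ · x) ≡ x
          cofactor x = trans (sym (·-assoc v v′ x)) (trans (cong (_· x) inv) (·-identityˡ x))
          go : ∀ zs → Any (λ x → ∀ z → v · z ≡ x → H ps v ℕ.* H ps z ≤ C ℕ.* C) zs → (∀ {z} → Any (λ x → v · z ≡ x) zs → Any (λ x → v · z ≡ x) xs) → v ≡ 𝟙 ⊎ v ≡ - 1ℤ ⊙ 𝟙
          go (x ∷ zs) (there i)  inc = go zs i (λ j → inc (there j))
          go (x ∷ zs) (here prod) inc with ℕ.≤-total (H ps v) C | ℕ.≤-total (H ps (v′ · x)) C
          ... | inj₁ le | _       = small-unit v unit red le
          ... | inj₂ _  | inj₁ le = small-cofactor v (v′ · x) unit red le (inc (here (cofactor x)))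
          ... | inj₂ C≤v | inj₂ C≤z with ℕ.m≤n⇒m<n∨m≡n C≤v
          ...   | inj₂ eq  = small-unit v unit red (ℕ.≤-reflexive (sym eq))
          ...   | inj₁ C<v with ℕ.m≤n⇒m<n∨m≡n C≤z
          ...     | inj₂ eq  = small-cofactor v (v′ · x) unit red (ℕ.≤-reflexive (sym eq)) (inc (here (cofactor x)))
          ...     | inj₁ C<z = ⊥-elim (ℕ.<⇒≱ (ℕ.*-mono-< C<v C<z) (prod (v′ · x) (cofactor x)))

      -- H has natural values, so multiplication by units that decrease it ends at a reduced unit;
      -- the property is carried back along the steps.
      descent : (P : Vec ℤ (suc n) → Set) → (∀ v → Unit v → Reduced v → P v) → All (λ e → Unit e × (∀ v → P (v · e) → P v)) es → ∀ v → Unit v → P v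
      descent P base steps v unit = go v unit (<-wellFounded (H ps v))
        where
        unit-· : ∀ u w → Unit u → Unit w → Unit (u · w)
        unit-· u w (u′ , iu) (w′ , iw) = w′ · u′ , trans (·-assoc u w (w′ · u′)) (trans (cong (u ·_) (trans (sym (·-assoc w w′ u′)) (trans (cong (_· u′) iw) (·-identityˡ u′)))) iu)
        go : ∀ v → Unit v → Acc _<_ (H ps v) → P v
        search : ∀ v → Unit v → (∀ {h} → h < H ps v → Acc _<_ h) → ∀ fs → All (λ e → Unit e × (∀ v → P (v · e) → P v)) fs → All (λ e → H ps v ≤ H ps (v · e)) fs ⊎ P v
        search v unit rs []       []       = inj₁ []
        search v unit rs (e ∷ fs) ((ue , st) ∷ sts) with ℕ.≤-<-connex (H ps v) (H ps (v · e))
        ... | inj₂ lt = inj₂ (st v (go (v · e) (unit-· v e unit ue) (rs lt)))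
        ... | inj₁ le = [ (λ les → inj₁ (le ∷ les)) , inj₂ ]′ (search v unit rs fs sts)
        go v unit (acc rs) = [ base v unit , (λ p → p) ]′ (search v unit rs es steps)

-- Congruences in ℤ[η] and words in units

module Residues where

  open import Data.Nat as ℕ using (ℕ; zero; suc; _<_; s≤s)
  import Data.Nat.Properties as ℕ
  open import Data.Nat.DivMod using (m≡m%n+[m/n]*n; m%n<n)
  open import Data.Integer as ℤ using (ℤ; +_; 0ℤ; 1ℤ; -_; _+_; _*_; _^_)
  import Data.Integer.Properties as ℤ
  open import Data.Integer.Tactic.RingSolver using (solve-∀)
  open import Data.Bool using (Bool; true; _∧_; T)
  open import Data.Vec as Vec using (Vec; []; _∷_)
  open import Data.Vec.Relation.Unary.All as VAll using ([]; _∷_)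
  open import Data.List using ([]; _∷_)
  open import Data.Product using (_,_; proj₁; proj₂; ∃-syntax)
  open import Data.Sum using ([_,_]′)
  open import Relation.Binary.PropositionalEquality
  open Order
  open SmallUnits using (T∧)

  infix 4 _≋_mod_
  _≋_mod_ : ∀ {m} → Vec ℤ m → Vec ℤ m → ℤ → Set
  u ≋ v mod K = ∃[ t ] u ≡ v ⊕ K ⊙ t

  ≡⇒≋ : ∀ {m} {u v : Vec ℤ m} K → u ≡ v → u ≋ v mod K
  ≡⇒≋ {u = u} K refl = zeros _ , sym (trans (cong (u ⊕_) (⊙-zeros _ K)) (⊕-identityʳ u))

  ≋-trans : ∀ {m} {u v w : Vec ℤ m} {K} → u ≋ v mod K → v ≋ w mod K → u ≋ w mod K
  ≋-trans {w = w} {K} (t , refl) (s , refl) = s ⊕ t , trans (⊕-assoc w (K ⊙ s) (K ⊙ t)) (cong (w ⊕_) (sym (⊙-⊕ K s t)))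

  ≋-⊙ : ∀ {m} a {u v : Vec ℤ m} {K} → u ≋ v mod K → a ⊙ u ≋ a ⊙ v mod K
  ≋-⊙ a {v = v} {K} (t , refl) = a ⊙ t , trans (⊙-⊕ a v (K ⊙ t)) (cong (a ⊙ v ⊕_) (⊙-comm a K t))

  at-≋ : ∀ {m} {u v : Vec ℤ m} {K} → u ≋ v mod K → ∀ i → ∃[ q ] at u i ≡ at v i + K * q
  at-≋ {v = v} {K} (t , refl) i = at t i , trans (at-⊕ v (K ⊙ t) i) (cong (λ z → at v i + z) (at-⊙ K t i))

  allBelow : ℕ → (ℕ → Bool) → Bool
  allBelow zero    f = true
  allBelow (suc m) f = f m ∧ allBelow m f

  allBelow-sound : ∀ m f → T (allBelow m f) → ∀ i → i < m → T (f i)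
  allBelow-sound (suc m) f t i (s≤s i≤m) = [ (λ i<m → allBelow-sound m f (proj₂ (T∧ (f m) t)) i i<m) , (λ { refl → proj₁ (T∧ (f m) t) }) ]′ (ℕ.m≤n⇒m<n∨m≡n i≤m)

  module _ {n : ℕ} where

    ≋-·ʳ : ∀ {u v : Vec ℤ (suc n)} {K} w → u ≋ v mod K → u · w ≋ v · w mod K
    ≋-·ʳ {v = v} {K} w (t , refl) = t · w , trans (⊕-· v (K ⊙ t) w) (cong (v · w ⊕_) (⊙-· K t w))

    ≋-·ˡ : ∀ {u v : Vec ℤ (suc n)} {K} w → u ≋ v mod K → w · u ≋ w · v mod K
    ≋-·ˡ {u} {v} {K} w eq = subst₂ (_≋_mod K) (·-comm u w) (·-comm v w) (≋-·ʳ w eq)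

    ·-interchange : ∀ (a b c d : Vec ℤ (suc n)) → (a · b) · (c · d) ≡ (a · c) · (b · d)
    ·-interchange a b c d = trans (·-assoc a b (c · d)) (trans (cong (a ·_) (trans (sym (·-assoc b c d)) (trans (cong (_· d) (·-comm b c)) (·-assoc c b d)))) (sym (·-assoc a c (b · d))))

    ⊙-·-⊙ : ∀ s t (u v : Vec ℤ (suc n)) → (s ⊙ u) · (t ⊙ v) ≡ (s * t) ⊙ (u · v)
    ⊙-·-⊙ s t u v = trans (⊙-· s u (t ⊙ v)) (trans (cong (s ⊙_) (·-⊙ u t v)) (⊙-⊙ s t (u · v)))

    pow : Vec ℤ (suc n) → ℕ → Vec ℤ (suc n)
    pow v zero    = 𝟙
    pow v (suc m) = v · pow v m

    pow-+ : ∀ v a b → pow v (a ℕ.+ b) ≡ pow v a · pow v b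
    pow-+ v zero    b = sym (·-identityˡ (pow v b))
    pow-+ v (suc a) b = trans (cong (v ·_) (pow-+ v a b)) (sym (·-assoc v (pow v a) (pow v b)))

    word : ∀ {r} → Vec (Vec ℤ (suc n)) r → Vec ℕ r → Vec ℤ (suc n)
    word []       []       = 𝟙
    word (ε ∷ εs) (m ∷ ms) = pow ε m · word εs ms

    word-+ : ∀ {r} (εs : Vec (Vec ℤ (suc n)) r) ms ls → word εs (Vec.zipWith ℕ._+_ ms ls) ≡ word εs ms · word εs ls
    word-+ []       []       []       = sym (·-identityˡ 𝟙)
    word-+ (ε ∷ εs) (m ∷ ms) (l ∷ ls) = trans (cong₂ _·_ (pow-+ ε m l) (word-+ εs ms ls)) (·-interchange (pow ε m) (pow ε l) (word εs ms) (word εs ls))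

    word-0 : ∀ {r} (εs : Vec (Vec ℤ (suc n)) r) → word εs (Vec.replicate r 0) ≡ 𝟙
    word-0 []       = refl
    word-0 (ε ∷ εs) = trans (·-identityˡ _) (word-0 εs)

    -- For K = k prime every k-th power is of this kind: by Frobenius (Σ aᵢηⁱ)^k ≡ Σ aᵢ^k 3^i modulo
    -- k. Up to an integer factor, exponents therefore matter only modulo k.
    Scalar : ℤ → Vec ℤ (suc n) → Set
    Scalar K v = ∃[ s ] v ≋ s ⊙ 𝟙 mod K

    pow-scalar : ∀ {K} k ε → Scalar K (pow ε k) → ∀ q → ∃[ s ] pow ε (q ℕ.* k) ≋ s ⊙ 𝟙 mod K
    pow-scalar {K} k ε sc         zero    = 1ℤ , ≡⇒≋ K (sym (1-⊙ 𝟙))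
    pow-scalar {K} k ε sc@(s , e) (suc q) = s * s′ , ≋-trans (≡⇒≋ K (pow-+ ε k (q ℕ.* k))) (≋-trans (≋-·ʳ (pow ε (q ℕ.* k)) e) (≋-trans (≋-·ˡ (s ⊙ 𝟙) e′) (≡⇒≋ K (trans (⊙-·-⊙ s s′ 𝟙 𝟙) (cong ((s * s′) ⊙_) (·-identityˡ 𝟙))))))
      where
      s′ = proj₁ (pow-scalar k ε sc q)
      e′ = proj₂ (pow-scalar k ε sc q)

    word-mod : ∀ {K r} k .{{_ : ℕ.NonZero k}} (εs : Vec (Vec ℤ (suc n)) r) → VAll.All (λ ε → Scalar K (pow ε k)) εs → ∀ ms → ∃[ s ] word εs ms ≋ s ⊙ word εs (Vec.map (ℕ._% k) ms) mod K
    word-mod {K} k []       []         []       = 1ℤ , ≡⇒≋ K (sym (1-⊙ 𝟙))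
    word-mod {K} k (ε ∷ εs) (sc ∷ scs) (m ∷ ms) = s₁ * s₂ , ≋-trans (≡⇒≋ K (cong (_· word εs ms) (trans (cong (pow ε) (m≡m%n+[m/n]*n m k)) (pow-+ ε (m ℕ.% k) (m ℕ./ k ℕ.* k))))) (≋-trans (≋-·ʳ (word εs ms) (≋-·ˡ (pow ε (m ℕ.% k)) e₁)) (≋-trans (≋-·ˡ (pow ε (m ℕ.% k) · (s₁ ⊙ 𝟙)) e₂) (≡⇒≋ K rearrange)))
      where
      s₁ = proj₁ (pow-scalar {K} k ε sc (m ℕ./ k))
      e₁ = proj₂ (pow-scalar {K} k ε sc (m ℕ./ k))
      s₂ = proj₁ (word-mod {K} k εs scs ms)
      e₂ = proj₂ (word-mod {K} k εs scs ms)
      p = pow ε (m ℕ.% k)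
      w = word εs (Vec.map (ℕ._% k) ms)
      rearrange : p · (s₁ ⊙ 𝟙) · (s₂ ⊙ w) ≡ (s₁ * s₂) ⊙ (p · w)
      rearrange = trans (cong (_· (s₂ ⊙ w)) (trans (·-⊙ p s₁ 𝟙) (cong (s₁ ⊙_) (·-identityʳ p)))) (⊙-·-⊙ s₁ s₂ p w)

    -- The factor s absorbs signs and the k-th powers discarded when exponents are reduced. This is
    -- why inverses can be written with nonnegative exponents.
    Generated : ∀ {r} → ℤ → Vec (Vec ℤ (suc n)) r → Vec ℤ (suc n) → Set
    Generated K εs u = ∃[ s ] ∃[ ms ] u ≋ s ⊙ word εs ms mod K

    scalar-generated : ∀ {r} K (εs : Vec (Vec ℤ (suc n)) r) s → Generated K εs (s ⊙ 𝟙)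
    scalar-generated {r} K εs s = s , Vec.replicate r 0 , ≡⇒≋ K (cong (s ⊙_) (sym (word-0 εs)))

    generated-step : ∀ {r} K (εs : Vec (Vec ℤ (suc n)) r) e e′ → e · e′ ≡ 𝟙 → Generated K εs e′ → ∀ v → Generated K εs (v · e) → Generated K εs v
    generated-step K εs e e′ inv (s′ , ms′ , c′) v (s , ms , c) = s * s′ , Vec.zipWith ℕ._+_ ms ms′ , ≋-trans (≡⇒≋ K recover) (≋-trans (≋-·ʳ e′ c) (≋-trans (≋-·ˡ (s ⊙ word εs ms) c′) (≡⇒≋ K (trans (⊙-·-⊙ s s′ (word εs ms) (word εs ms′)) (cong ((s * s′) ⊙_) (sym (word-+ εs ms ms′)))))))
      where
      recover : v ≡ (v · e) · e′
      recover = sym (trans (·-assoc v e e′) (trans (cong (v ·_) inv) (·-identityʳ v)))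

    everyWord : ∀ {r} → ℕ → (Vec ℤ (suc n) → Bool) → Vec (Vec ℤ (suc n)) r → Vec ℤ (suc n) → Bool
    everyWord k f []       g = f g
    everyWord k f (ε ∷ εs) g = allBelow k (λ m → everyWord k f εs (g · pow ε m))

    everyWord-sound : ∀ {r} k .{{_ : ℕ.NonZero k}} f (εs : Vec (Vec ℤ (suc n)) r) g → T (everyWord k f εs g) → ∀ ms → T (f (g · word εs (Vec.map (ℕ._% k) ms)))
    everyWord-sound k f []       g t []       = subst (λ z → T (f z)) (sym (·-identityʳ g)) t
    everyWord-sound k f (ε ∷ εs) g t (m ∷ ms) = subst (λ z → T (f z)) (·-assoc g (pow ε (m ℕ.% k)) _) (everyWord-sound k f εs (g · pow ε (m ℕ.% k)) (allBelow-sound k _ t (m ℕ.% k) (m%n<n m k)) ms)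

    module Geometric (b c : ℤ) (θ : Vec ℤ (suc n)) where

      linear : Vec ℤ (suc n)
      linear = b ⊙ 𝟙 ⊕ (- c) ⊙ θ

      -- Σ b^(j-1-i) c^i θ^i, the cofactor of b - cθ in b^j - c^j θ^j.
      geometric : ℕ → Vec ℤ (suc n)
      geometric zero    = zeros (suc n)
      geometric (suc j) = b ⊙ geometric j ⊕ (c ^ j) ⊙ pow θ j

      linear-· : ∀ v → linear · v ≡ b ⊙ v ⊕ (- c) ⊙ (θ · v)
      linear-· v = trans (⊕-· (b ⊙ 𝟙) ((- c) ⊙ θ) v) (cong₂ _⊕_ (trans (⊙-· b 𝟙 v) (cong (b ⊙_) (·-identityˡ v))) (⊙-· (- c) θ v))

      telescope : ∀ j → linear · geometric j ⊕ (c ^ j) ⊙ pow θ j ≡ (b ^ j) ⊙ 𝟙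
      telescope zero    = trans (cong₂ _⊕_ (act-zeros linear) (1-⊙ 𝟙)) (trans (⊕-comm (zeros (suc n)) 𝟙) (trans (⊕-identityʳ 𝟙) (sym (1-⊙ 𝟙))))
      telescope (suc j) = begin
        linear · (b ⊙ g ⊕ p ⊙ q) ⊕ (c * p) ⊙ (θ · q)
          ≡⟨ cong (_⊕ (c * p) ⊙ (θ · q)) (trans (·-⊕ linear (b ⊙ g) (p ⊙ q)) (cong₂ _⊕_ (·-⊙ linear b g) (trans (·-⊙ linear p q) (trans (cong (p ⊙_) (linear-· q)) (⊙-⊕ p (b ⊙ q) ((- c) ⊙ (θ · q))))))) ⟩
        (b ⊙ (linear · g) ⊕ (p ⊙ (b ⊙ q) ⊕ p ⊙ ((- c) ⊙ (θ · q)))) ⊕ (c * p) ⊙ (θ · q)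
          ≡⟨ trans (cong (_⊕ (c * p) ⊙ (θ · q)) (sym (⊕-assoc _ _ _))) (⊕-assoc _ _ _) ⟩
        (b ⊙ (linear · g) ⊕ p ⊙ (b ⊙ q)) ⊕ (p ⊙ ((- c) ⊙ (θ · q)) ⊕ (c * p) ⊙ (θ · q))
          ≡⟨ cong₂ _⊕_ (trans (cong (b ⊙ (linear · g) ⊕_) (⊙-comm p b q)) (sym (⊙-⊕ b (linear · g) (p ⊙ q)))) (trans (cong (_⊕ (c * p) ⊙ (θ · q)) (⊙-⊙ p (- c) (θ · q))) (trans (sym (+-⊙ (p * - c) (c * p) (θ · q))) (trans (cong (_⊙ (θ · q)) (cancel p c)) (0-⊙ (θ · q))))) ⟩
        b ⊙ (linear · g ⊕ p ⊙ q) ⊕ zeros (suc n)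
          ≡⟨ trans (⊕-identityʳ _) (trans (cong (b ⊙_) (telescope j)) (⊙-⊙ b (b ^ j) 𝟙)) ⟩
        (b * b ^ j) ⊙ 𝟙 ∎
        where
        open ≡-Reasoning
        g = geometric j
        p = c ^ j
        q = pow θ j
        cancel : ∀ p c → p * - c + c * p ≡ 0ℤ
        cancel = solve-∀

    powers : Vec ℤ (suc n) → ℕ → Vec ℤ (suc n)
    powers θ zero    = zeros (suc n)
    powers θ (suc j) = powers θ j ⊕ pow θ j

    geometric≋ : ∀ K c t θ j → Geometric.geometric (c + K * t) c θ (suc j) ≋ (c ^ j) ⊙ powers θ (suc j) mod K
    geometric≋ K c t θ zero    = ≡⇒≋ K (trans (cong (_⊕ 1ℤ ⊙ 𝟙) (⊙-zeros _ (c + K * t))) (trans (⊕-comm (zeros (suc n)) (1ℤ ⊙ 𝟙)) (trans (⊕-identityʳ _) (cong (1ℤ ⊙_) (sym (trans (⊕-comm (zeros (suc n)) 𝟙) (⊕-identityʳ 𝟙)))))))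
    geometric≋ K c t θ (suc j) = c ⊙ r ⊕ t ⊙ g , (begin
      (c + K * t) ⊙ g ⊕ (c * c ^ j) ⊙ q
        ≡⟨ cong (_⊕ (c * c ^ j) ⊙ q) (trans (+-⊙ c (K * t) g) (cong₂ _⊕_ (trans (cong (c ⊙_) eq) (trans (⊙-⊕ c ((c ^ j) ⊙ s) (K ⊙ r)) (cong₂ _⊕_ (⊙-⊙ c (c ^ j) s) (⊙-comm c K r)))) (sym (⊙-⊙ K t g)))) ⟩
      ((A ⊙ s ⊕ K ⊙ (c ⊙ r)) ⊕ K ⊙ (t ⊙ g)) ⊕ A ⊙ q
        ≡⟨ cong (_⊕ A ⊙ q) (trans (⊕-assoc _ _ _) (cong (A ⊙ s ⊕_) (sym (⊙-⊕ K (c ⊙ r) (t ⊙ g))))) ⟩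
      (A ⊙ s ⊕ K ⊙ (c ⊙ r ⊕ t ⊙ g)) ⊕ A ⊙ q
        ≡⟨ trans (⊕-assoc _ _ _) (trans (cong (A ⊙ s ⊕_) (⊕-comm _ (A ⊙ q))) (sym (⊕-assoc _ _ _))) ⟩
      (A ⊙ s ⊕ A ⊙ q) ⊕ K ⊙ (c ⊙ r ⊕ t ⊙ g)
        ≡⟨ cong (_⊕ K ⊙ (c ⊙ r ⊕ t ⊙ g)) (sym (⊙-⊕ A s q)) ⟩
      A ⊙ (s ⊕ q) ⊕ K ⊙ (c ⊙ r ⊕ t ⊙ g) ∎)
      where
      open ≡-Reasoning
      g = Geometric.geometric (c + K * t) c θ (suc j)
      s = powers θ (suc j)
      q = pow θ (suc j)
      A = c * c ^ j
      r = proj₁ (geometric≋ K c t θ j)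
      eq = proj₂ (geometric≋ K c t θ j)

-- Certified unit data and the obstruction modulo k

module UnitCertificate where

  open import Data.Nat as ℕ using (ℕ; suc; _≤_; _≤ᵇ_; _≡ᵇ_; NonZero)
  import Data.Nat.Properties as ℕ
  import Data.Nat.Divisibility as ℕ
  open import Data.Nat.Primality using (Prime)
  open import Data.Integer as ℤ using (ℤ; +_; 0ℤ; 1ℤ; ∣_∣; -_; _+_; _*_; _^_)
  import Data.Integer.Properties as ℤ
  open import Data.Integer.Divisibility.Signed using (divides; ∣⇒∣ᵤ) renaming (_∣_ to _divides′_)
  open import Data.Integer.Tactic.RingSolver using (solve-∀)
  open import Data.Bool using (Bool; true; _∧_; not; T)
  open import Data.Bool.ListAction using (any; all)
  open import Data.Vec as Vec using (Vec; []; _∷_)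
  open import Data.Vec.Relation.Unary.All as VAll using ([]; _∷_)
  open import Data.List using (List; []; _∷_; map)
  open import Data.List.Relation.Unary.All as All using (All; []; _∷_)
  open import Data.List.Relation.Unary.Any as Any using (Any; here; there)
  import Data.List.Relation.Unary.Any.Properties as Any
  import Data.List.Relation.Unary.All.Properties as All
  open import Data.Product using (_×_; _,_; proj₁; proj₂)
  open import Data.Sum using (_⊎_; [_,_]′)
  open import Data.Empty using (⊥-elim)
  open import Function using (_∘_)
  open import Relation.Binary.PropositionalEquality
  open Order
  open QuadraticForms using (S; total; _⊞_; _⊡_; diagMat; diagonal)
  open Embeddings
  open Boxes
  open SmallUnits
  open Residues
  open Fermat using (euclid)

  record Step (n r : ℕ) : Set where
    constructor step
    field
      unit inverse : Vec ℤ n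
      scalar       : ℤ
      exponents    : Vec ℕ r
  open Step

  -- Every unit decreases under multiplication by one of the units in steps until it is reduced; a reduced unit v has
  -- H(v) H(x/v) ≤ C² for some x in xs, so that v or x/v lies in a short list. The inverses in steps are scalars times
  -- words in gens modulo k. If b = c + k t then b − cθ = π (c α₁ + t α₂), since 1 − θ = π α₁ and k = π α₂.
  record UnitData (n r : ℕ) : Set where
    field
      places     : List (Place (suc n))
      diag       : Vec ℕ (suc n)
      off C fuel : ℕ
      steps      : List (Step (suc n) r)
      xs         : List (Vec ℤ (suc n))
      gens       : Vec (Vec ℤ (suc n)) r
      θ π α₁ α₂ τ₀ : Vec ℤ (suc n)
      inner      : List ℕ

  ≋-test : ∀ {m} → ℤ → Vec ℤ m → Vec ℤ m → Bool
  ≋-test K u v = u == v ⊕ K ⊙ quotient K (u ⊕ - 1ℤ ⊙ v)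

  ≋-test-sound : ∀ {m} K (u v : Vec ℤ m) → T (≋-test K u v) → u ≋ v mod K
  ≋-test-sound K u v t = _ , ==⇒≡ u (v ⊕ K ⊙ quotient K (u ⊕ - 1ℤ ⊙ v)) t

  ⊕-cancelʳ : ∀ {m} (u v w : Vec ℤ m) → u ⊕ w ≡ v ⊕ w → u ≡ v
  ⊕-cancelʳ []      []      []      _  = refl
  ⊕-cancelʳ (a ∷ u) (b ∷ v) (c ∷ w) eq = cong₂ _∷_ (trans (lem a c) (trans (cong (λ z → Vec.head z + - c) eq) (sym (lem b c)))) (⊕-cancelʳ u v w (cong Vec.tail eq))
    where lem : ∀ a c → a ≡ a + c + - c
          lem = solve-∀

  vall : ∀ {A : Set} {m} → (A → Bool) → Vec A m → Bool
  vall f []       = true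
  vall f (x ∷ xs) = f x ∧ vall f xs

  vall-sound : ∀ {A : Set} {m} (f : A → Bool) (v : Vec A m) → T (vall f v) → VAll.All (T ∘ f) v
  vall-sound f []      _ = []
  vall-sound f (x ∷ v) t = proj₁ (T∧ (f x) t) ∷ vall-sound f v (proj₂ (T∧ (f x) t))

  module Verify (Q N D τ κ K₀ : ℕ) .{{_ : NonZero Q}} .{{_ : NonZero N}} .{{_ : NonZero κ}} {n r} (d : UnitData n r) where
    open UnitData d

    k : ℕ
    k = suc n
    K : ℤ
    K = + k
    es : List (Vec ℤ (suc n))
    es = map unit steps

    shrink-table′ : Vec ℤ (suc n) → List ℕ × List ℕ
    shrink-table′ e = map (λ p → mult p ℕ.* ((suc N ℕ.* W p e ℕ.+ K₀ ℕ.* S e) ℕ.∸ N ℕ.* (D ℕ.* D))) places , map (λ p → mult p ℕ.* (N ℕ.* (D ℕ.* D) ℕ.∸ (suc N ℕ.* W p e ℕ.+ K₀ ℕ.* S e))) places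

    place-ok : Place (suc n) → Bool
    place-ok p = (1 ≤ᵇ mult p) ∧ (total (reErr D p) ≤ᵇ τ) ∧ (total (imErr D p) ≤ᵇ τ)

    step-ok : Step (suc n) r → Bool
    step-ok s = (unit s · inverse s == 𝟙) ∧ ≋-test K (inverse s) (scalar s ⊙ word gens (exponents s))

    gen-ok : Vec ℤ (suc n) → Bool
    gen-ok ε = ≋-test K (pow ε k) (at (pow ε k) 0 ⊙ 𝟙)

    -- `inner` lists coordinates in which 1 and θ vanish, and with them every b - cθ. An entry prime
    -- to k there separates g from all multiples of such elements.
    moved : Vec ℤ (suc n) → Bool
    moved g = any (λ i → not (∣ at g i ∣ ℕ.% k ≡ᵇ 0)) inner

    record Valid : Set where
      field
        gram-ok   : T (total (gram places ⊞ (- 1ℤ ⊡ diagMat (Vec.map (off ℕ.+_) diag))) ≤ᵇ off)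
        diag-ok   : T (vall (κ ≤ᵇ_) diag)
        places-ok : T (all place-ok places)
        slack-ok  : T (N ℕ.* suc N ℕ.* (2 ℕ.* (τ ℕ.* τ)) ℕ.* ∑ₚ places mult ≤ᵇ K₀ ℕ.* κ)
        box-ok    : T (Check.check Q N D τ κ C (map mult places) (map shrink-table′ es) (map (λ x → map (λ p → mult p ℕ.* W p x) places) xs) fuel (map (λ _ → 0 , Q) places))
        small-ok  : T (small⁺ diag C (Small.explored places es xs))
        steps-ok  : T (all step-ok steps)
        gens-ok   : T (vall gen-ok gens)
        words-ok  : T (everyWord k moved gens π)
        θ-ok      : T (pow θ k == (+ 3) ^ n ⊙ 𝟙)
        α₁-ok     : T (π · α₁ == 𝟙 ⊕ - 1ℤ ⊙ θ)
        α₂-ok     : T (π · α₂ == K ⊙ 𝟙)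
        τ₀-ok     : T (π · powers θ k == K ⊙ τ₀)
        inner-ok  : T (all (λ i → ∣ at {suc n} 𝟙 i ∣ ℕ.+ ∣ at θ i ∣ ≡ᵇ 0) inner)
        θ₀-ok     : T (∣ at θ 0 ∣ ≡ᵇ 0)

    module Obstruction (valid : Valid) where
      open Valid valid

      g≤H : ∀ v → diagonal diag v ≤ H places v
      g≤H = diagonal≤H places off diag (ℕ.≤ᵇ⇒≤ (total (gram places ⊞ (- 1ℤ ⊡ diagMat (Vec.map (off ℕ.+_) diag)))) off gram-ok)

      κS≤H : ∀ v → κ ℕ.* S v ≤ H places v
      κS≤H v = ℕ.≤-trans (diagonal-≥ κ diag (VAll.map (λ {x} → ℕ.≤ᵇ⇒≤ κ x) (vall-sound (κ ≤ᵇ_) diag diag-ok)) v) (g≤H v)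

      place-checks : All (λ p → 1 ≤ mult p × total (reErr D p) ≤ τ × total (imErr D p) ≤ τ) places
      place-checks = All.map (λ {p} t → sound p t) (All.all⁺ place-ok places places-ok)
        where
        sound : ∀ p → T (place-ok p) → 1 ≤ mult p × total (reErr D p) ≤ τ × total (imErr D p) ≤ τ
        sound p t = ℕ.≤ᵇ⇒≤ 1 (mult p) (proj₁ (T∧ (1 ≤ᵇ mult p) t)) , ℕ.≤ᵇ⇒≤ (total (reErr D p)) τ (proj₁ (T∧ (total (reErr D p) ≤ᵇ τ) (proj₂ (T∧ (1 ≤ᵇ mult p) t)))) , ℕ.≤ᵇ⇒≤ (total (imErr D p)) τ (proj₂ (T∧ (total (reErr D p) ≤ᵇ τ) (proj₂ (T∧ (1 ≤ᵇ mult p) t))))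

      open Small places es xs using (Reduced; reduced-unit; descent)

      reduced⇒±1 : ∀ v → Unit v → Reduced v → v ≡ 𝟙 ⊎ v ≡ - 1ℤ ⊙ 𝟙
      reduced⇒±1 v unit red = reduced-unit diag C g≤H small-ok v unit red (check-sound fuel (whole places) v red (in-whole (All.map proj₁ place-checks) v) box-ok)
        where open Reduction places Q N D τ κ C K₀ (All.map proj₂ place-checks) κS≤H (ℕ.≤ᵇ⇒≤ (N ℕ.* suc N ℕ.* (2 ℕ.* (τ ℕ.* τ)) ℕ.* ∑ₚ places mult) (K₀ ℕ.* κ) slack-ok) es xs

      unit-generated : ∀ v → Unit v → Generated K gens v
      unit-generated = descent (Generated K gens) base (All.map⁺ (All.map (λ {s} → move s) (All.all⁺ step-ok steps steps-ok)))
        where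
        base : ∀ v → Unit v → Reduced v → Generated K gens v
        base v unit red = [ (λ { refl → subst (Generated K gens) (1-⊙ 𝟙) (scalar-generated K gens 1ℤ) }) , (λ { refl → scalar-generated K gens (- 1ℤ) }) ]′ (reduced⇒±1 v unit red)
        move : ∀ s → T (step-ok s) → Unit (unit s) × (∀ v → Generated K gens (v · unit s) → Generated K gens v)
        move s t = (inverse s , inv) , generated-step K gens (unit s) (inverse s) inv (scalar s , exponents s , ≋-test-sound K (inverse s) (scalar s ⊙ word gens (exponents s)) (proj₂ parts))
          where
          parts = T∧ (unit s · inverse s == 𝟙) t
          inv = ==⇒≡ (unit s · inverse s) 𝟙 (proj₁ parts)

      gens-scalar : VAll.All (λ ε → Scalar K (pow ε k)) gens
      gens-scalar = VAll.map (λ {ε} t → at (pow ε k) 0 , ≋-test-sound K (pow ε k) (at (pow ε k) 0 ⊙ 𝟙) t) (vall-sound gen-ok gens gens-ok)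

      module _ (prime : Prime k) (c t σ : ℤ) (σ² : σ * σ ≡ 1ℤ) (thue : (c + K * t) ^ k ≡ c ^ k * (+ 3) ^ n + σ * K) where

        open Geometric (c + K * t) c θ

        quot : Vec ℤ (suc n)
        quot = c ⊙ α₁ ⊕ t ⊙ α₂

        π-quot : π · quot ≡ linear
        π-quot = trans (·-⊕ π (c ⊙ α₁) (t ⊙ α₂)) (trans (cong₂ _⊕_ (trans (·-⊙ π c α₁) (trans (cong (c ⊙_) (==⇒≡ _ _ α₁-ok)) (trans (⊙-⊕ c 𝟙 (- 1ℤ ⊙ θ)) (cong (c ⊙ 𝟙 ⊕_) (trans (⊙-⊙ c (- 1ℤ) θ) (cong (_⊙ θ) (neg c))))))) (trans (·-⊙ π t α₂) (trans (cong (t ⊙_) (==⇒≡ _ _ α₂-ok)) (trans (⊙-comm t K 𝟙) (⊙-⊙ K t 𝟙)))))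
          (trans (⊕-assoc (c ⊙ 𝟙) ((- c) ⊙ θ) ((K * t) ⊙ 𝟙)) (trans (cong (c ⊙ 𝟙 ⊕_) (⊕-comm ((- c) ⊙ θ) ((K * t) ⊙ 𝟙))) (trans (sym (⊕-assoc (c ⊙ 𝟙) ((K * t) ⊙ 𝟙) ((- c) ⊙ θ))) (cong (_⊕ (- c) ⊙ θ) (sym (+-⊙ c (K * t) 𝟙)))))))
          where neg : ∀ c → c * - 1ℤ ≡ - c
                neg = solve-∀

        cofactor : Vec ℤ (suc n)
        cofactor = (c ^ n) ⊙ τ₀ ⊕ π · proj₁ (geometric≋ K c t θ n)

        π-geometric : π · geometric k ≡ K ⊙ cofactor
        π-geometric = trans (cong (π ·_) (proj₂ (geometric≋ K c t θ n))) (trans (·-⊕ π ((c ^ n) ⊙ powers θ k) (K ⊙ rest)) (trans (cong₂ _⊕_ (trans (·-⊙ π (c ^ n) (powers θ k)) (trans (cong ((c ^ n) ⊙_) (==⇒≡ _ _ τ₀-ok)) (⊙-comm (c ^ n) K τ₀))) (·-⊙ π K rest)) (sym (⊙-⊕ K ((c ^ n) ⊙ τ₀) (π · rest)))))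
          where rest = proj₁ (geometric≋ K c t θ n)

        norm : linear · geometric k ≡ (σ * K) ⊙ 𝟙
        norm = ⊕-cancelʳ _ _ ((c ^ k) ⊙ pow θ k) (trans (telescope k) (trans (cong (_⊙ 𝟙) (trans thue (ℤ.+-comm _ (σ * K)))) (trans (+-⊙ (σ * K) (c ^ k * (+ 3) ^ n) 𝟙) (cong ((σ * K) ⊙ 𝟙 ⊕_) (trans (sym (⊙-⊙ (c ^ k) ((+ 3) ^ n) 𝟙)) (cong ((c ^ k) ⊙_) (sym (==⇒≡ _ _ θ-ok))))))))

        -- The inverse is ±π · `geometric k` / k. It is integral because b ≡ c modulo k reduces the
        -- geometric sum to a multiple of 1 + θ + ... + θ^(k-1), and π times that sum is divisible
        -- by k, as `τ₀-ok` certifies.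
        quot-unit : Unit quot
        quot-unit = σ ⊙ cofactor , trans (·-⊙ quot σ cofactor) (trans (cong (σ ⊙_) (⊙-cancel K (λ ()) scaled)) (trans (⊙-⊙ σ σ 𝟙) (trans (cong (_⊙ 𝟙) σ²) (1-⊙ 𝟙))))
          where
          scaled : K ⊙ (quot · cofactor) ≡ K ⊙ (σ ⊙ 𝟙)
          scaled = trans (sym (·-⊙ quot K cofactor)) (trans (cong (quot ·_) (sym π-geometric)) (trans (sym (·-assoc quot π (geometric k))) (trans (cong (_· geometric k) (trans (·-comm quot π) π-quot)) (trans norm (trans (sym (⊙-⊙ σ K 𝟙)) (⊙-comm σ K 𝟙))))))

        private
          gen = unit-generated quot quot-unit
          s₁ = proj₁ gen
          ms = proj₁ (proj₂ gen)
          reduced = word-mod {K = K} k gens gens-scalar ms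
          s₂ = proj₁ reduced
          wd = word gens (Vec.map (ℕ._% k) ms)

        linear≋ : linear ≋ (s₁ * s₂) ⊙ (π · wd) mod K
        linear≋ = ≋-trans (≡⇒≋ K (sym π-quot)) (≋-trans (≋-·ˡ π (≋-trans (proj₂ (proj₂ gen)) (≋-trans (≋-⊙ s₁ (proj₂ reduced)) (≡⇒≋ K (⊙-⊙ s₁ s₂ wd))))) (≡⇒≋ K (·-⊙ π (s₁ * s₂) wd)))

        at-linear : ∀ i → at linear i ≡ (c + K * t) * at {suc n} 𝟙 i + - c * at θ i
        at-linear i = trans (at-⊕ ((c + K * t) ⊙ 𝟙) ((- c) ⊙ θ) i) (cong₂ _+_ (at-⊙ (c + K * t) 𝟙 i) (at-⊙ (- c) θ i))

        -- b - cθ has no inner coordinates, whereas π times the word has one prime to k. The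
        -- congruence between them forces the scalar to vanish modulo k.
        K∣s : K divides′ (s₁ * s₂)
        K∣s = go inner (Any.any⁻ (λ i → not (∣ at (π · wd) i ∣ ℕ.% k ≡ᵇ 0)) inner (everyWord-sound k moved gens π words-ok ms)) (All.all⁺ (λ i → ∣ at {suc n} 𝟙 i ∣ ℕ.+ ∣ at θ i ∣ ≡ᵇ 0) inner inner-ok)
          where
          product : ∀ i → T (∣ at {suc n} 𝟙 i ∣ ℕ.+ ∣ at θ i ∣ ≡ᵇ 0) → K divides′ ((s₁ * s₂) * at (π · wd) i)
          product i z = divides (- q) (trans (solveFor ((s₁ * s₂) * at (π · wd) i) (K * q) (trans (sym zero-coordinate) (trans (proj₂ (at-≋ linear≋ i)) (cong (_+ K * q) (at-⊙ (s₁ * s₂) (π · wd) i))))) (trans (cong -_ (ℤ.*-comm K q)) (ℤ.neg-distribˡ-* q K)))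
            where
            q = proj₁ (at-≋ linear≋ i)
            sum≡0 = ℕ.≡ᵇ⇒≡ _ 0 z
            zero-coordinate : at linear i ≡ 0ℤ
            zero-coordinate = trans (at-linear i) (trans (cong₂ (λ x y → (c + K * t) * x + - c * y) (ℤ.∣i∣≡0⇒i≡0 (ℕ.m+n≡0⇒m≡0 _ sum≡0)) (ℤ.∣i∣≡0⇒i≡0 (ℕ.m+n≡0⇒n≡0 ∣ at {suc n} 𝟙 i ∣ sum≡0))) (cong₂ _+_ (ℤ.*-zeroʳ (c + K * t)) (ℤ.*-zeroʳ (- c))))
            solveFor : ∀ x y → 0ℤ ≡ x + y → x ≡ - y
            solveFor x y eq = trans (trans (lem′ x y) (cong (_+ - y) (sym eq))) (ℤ.+-identityˡ (- y))
              where lem′ : ∀ x y → x ≡ x + y + - y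
                    lem′ = solve-∀
          go : ∀ is → Any (λ i → T (not (∣ at (π · wd) i ∣ ℕ.% k ≡ᵇ 0))) is → All (λ i → T (∣ at {suc n} 𝟙 i ∣ ℕ.+ ∣ at θ i ∣ ≡ᵇ 0)) is → K divides′ (s₁ * s₂)
          go (i ∷ is) (there a) (_ ∷ zs) = go is a zs
          go (i ∷ is) (here nz) (z ∷ _)  = [ (λ K∣ → K∣) , (λ K∣ → ⊥-elim (T-not nz (ℕ.≡⇒≡ᵇ _ 0 (ℕ.n∣m⇒m%n≡0 _ k (∣⇒∣ᵤ K∣))))) ]′ (euclid prime (product i z))

        -- The constant coordinate of b - cθ is b, since θ has none.
        K∣b : K divides′ (c + K * t)
        K∣b = combine K∣s
          where
          q = proj₁ (at-≋ linear≋ 0)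
          value : (c + K * t) ≡ (s₁ * s₂) * at (π · wd) 0 + K * q
          value = trans (sym (trans (at-linear 0) (trans (cong (λ y → (c + K * t) * 1ℤ + - c * y) (ℤ.∣i∣≡0⇒i≡0 {at θ 0} (ℕ.≡ᵇ⇒≡ _ 0 θ₀-ok))) (lem (c + K * t) c)))) (trans (proj₂ (at-≋ linear≋ 0)) (cong (_+ K * q) (at-⊙ (s₁ * s₂) (π · wd) 0)))
            where lem : ∀ b c → b * 1ℤ + - c * 0ℤ ≡ b
                  lem = solve-∀
          combine : K divides′ (s₁ * s₂) → K divides′ (c + K * t)
          combine (divides e eq) = divides (e * at (π · wd) 0 + q) (trans value (trans (cong (λ z → z * at (π · wd) 0 + K * q) eq) (lem e K (at (π · wd) 0) q)))
            where lem : ∀ e K x q → e * K * x + K * q ≡ (e * x + q) * K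
                  lem = solve-∀

-- The equation b^k = 3^(k-1) c^k ± k

module Exceptional where

  open import Data.Nat as ℕ using (ℕ; suc; NonZero)
  import Data.Nat.Properties as ℕ
  import Data.Nat.Divisibility as ℕ
  open import Data.Nat.Coprimality using (Coprime)
  open import Data.Nat.Primality using (Prime; prime⇒nonTrivial)
  open import Data.Integer as ℤ using (ℤ; +_; 1ℤ; -_; _+_; _*_; _-_; _^_)
  import Data.Integer.Properties as ℤ
  open import Data.Integer.Divisibility.Signed using (_∣_; divides; ∣⇒∣ᵤ)
  open import Data.Integer.Tactic.RingSolver using (solve-∀)
  open import Data.Product using (_,_)
  open import Data.Sum using (_⊎_; [_,_]′)
  open import Data.Empty using (⊥)
  open import Relation.Binary.PropositionalEquality
  open Arithmetic using (^-distribʳ-*)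
  open ExponentDivisibility using (prime-3; prime∣^; transfer)
  open Fermat using (fermat)
  open Gelfond using (pos-^)
  open UnitCertificate

  private
    -- With B = b^k and C = c^k: by Fermat b ≡ b^k and c ≡ c^k modulo k, and 3^(k-1) ≡ 1, so the
    -- equation gives b ≡ c.
    difference : ∀ K m B C b c σ x y → B ≡ C * (1ℤ + K * m) + σ * K → B - b ≡ x * K → C - c ≡ y * K → b ≡ c + K * (C * m + σ + y - x)
    difference K m B C b c σ x y e₁ e₂ e₃ = trans (r₁ B b) (trans (cong₂ _-_ e₁ e₂) (trans (cong (λ z → z * (1ℤ + K * m) + σ * K - x * K) (trans (r₂ C c) (cong (λ z → c + z) e₃))) (trans (r₃ c y K m σ x) (cong (λ z → c + K * (z * m + σ + y - x)) (sym (trans (r₂ C c) (cong (λ z → c + z) e₃)))))))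
      where
      r₁ : ∀ B b → b ≡ B - (B - b)
      r₁ = solve-∀
      r₂ : ∀ C c → C ≡ c + (C - c)
      r₂ = solve-∀
      r₃ : ∀ c y K m σ x → (c + y * K) * (1ℤ + K * m) + σ * K - x * K ≡ c + K * ((c + y * K) * m + σ + y - x)
      r₃ = solve-∀

  module _ (Q N D τ κ K₀ : ℕ) .{{_ : NonZero Q}} .{{_ : NonZero N}} .{{_ : NonZero κ}} {n r} (d : UnitData n r) (valid : Verify.Valid Q N D τ κ K₀ d)
           (prime : Prime (suc n)) (m : ℤ) (3^n≡ : (+ 3) ^ n ≡ 1ℤ + + suc n * m) where

    private
      k = suc n
      K = + k

    norm-divides : ∀ b c σ → σ * σ ≡ 1ℤ → (+ b) ^ k ≡ (+ c) ^ k * (+ 3) ^ n + σ * K → K ∣ + b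
    norm-divides b c σ σ² eq = subst (K ∣_) (sym b≡) (Verify.Obstruction.K∣b Q N D τ κ K₀ d valid prime (+ c) t σ σ² (trans (cong (_^ k) (sym b≡)) eq))
      where
      x = _∣_.quotient (fermat prime b)
      y = _∣_.quotient (fermat prime c)
      t = (+ c) ^ k * m + σ + y - x
      b≡ : + b ≡ + c + K * t
      b≡ = difference K m ((+ b) ^ k) ((+ c) ^ k) (+ b) (+ c) σ x y (trans eq (cong (λ z → (+ c) ^ k * z + σ * K) 3^n≡)) (_∣_.equality (fermat prime b)) (_∣_.equality (fermat prime c))

    -- Once k divides b it divides q, and through the difference k also p, against coprimality.
    no-exceptional : ∀ p q a b → Coprime p q → p ≡ q ℕ.+ k ⊎ q ≡ p ℕ.+ k → 3 ℕ.* p ≡ a ℕ.^ k → q ≡ b ℕ.^ k → ⊥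
    no-exceptional p q a b cop diff 3p≡ q≡ = ℕ.nonTrivial⇒≢1 {{prime⇒nonTrivial prime}} (cop (transfer diff ℕ.∣-refl k∣q , k∣q))
      where
      3∣a : 3 ℕ.∣ a
      3∣a = prime∣^ prime-3 a k (ℕ.divides p (trans (sym 3p≡) (ℕ.*-comm 3 p)))
      c = ℕ._∣_.quotient 3∣a
      p≡ : p ≡ c ℕ.^ k ℕ.* 3 ℕ.^ n
      p≡ = ℕ.*-cancelˡ-≡ p (c ℕ.^ k ℕ.* 3 ℕ.^ n) 3 (trans 3p≡ (trans (cong (ℕ._^ k) (ℕ._∣_.equality 3∣a)) (trans (^-distribʳ-* c 3 k) (lem (c ℕ.^ k) (3 ℕ.^ n)))))
        where
        lem : ∀ x y → x ℕ.* (3 ℕ.* y) ≡ 3 ℕ.* (x ℕ.* y)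
        lem x y = trans (sym (ℕ.*-assoc x 3 y)) (trans (cong (ℕ._* y) (ℕ.*-comm x 3)) (ℕ.*-assoc 3 x y))
      p′ : + p ≡ (+ c) ^ k * (+ 3) ^ n
      p′ = trans (cong +_ p≡) (trans (ℤ.pos-* (c ℕ.^ k) (3 ℕ.^ n)) (cong₂ _*_ (sym (pos-^ c k)) (sym (pos-^ 3 n))))
      q′ : + q ≡ (+ b) ^ k
      q′ = trans (cong +_ q≡) (sym (pos-^ b k))
      K∣b : K ∣ + b
      K∣b = [ (λ e → norm-divides b c (- 1ℤ) refl (trans (sym q′) (trans (trans (r₁ (+ q) K) (cong (λ z → z + - 1ℤ * K) (trans (sym (ℤ.pos-+ q k)) (cong +_ (sym e))))) (cong (_+ - 1ℤ * K) p′))))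
            , (λ e → norm-divides b c 1ℤ refl (trans (sym q′) (trans (cong +_ e) (trans (ℤ.pos-+ p k) (cong₂ _+_ p′ (sym (ℤ.*-identityˡ K))))))) ]′ diff
        where
        r₁ : ∀ q K → q ≡ q + K + - 1ℤ * K
        r₁ = solve-∀
      k∣q : k ℕ.∣ q
      k∣q = subst (k ℕ.∣_) (sym q≡) (ℕ.∣-trans (∣⇒∣ᵤ K∣b) (ℕ.m∣m*n (b ℕ.^ n)))

-- Numerical data for k = 5 and k = 7

module QuinticSeptic where

  open import Data.Nat using (ℕ)
  open import Data.Integer using (+_; -_)
  open import Data.Vec as Vec using ([]; _∷_)
  open import Data.List as List using ([]; _∷_)
  open import Data.Unit using (tt)
  open import Data.Nat.Primality using (prime?)
  open import Data.Nat.Coprimality using (Coprime)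
  open import Data.Sum using (_⊎_)
  open import Data.Empty using (⊥)
  open import Relation.Nullary.Decidable using (toWitness)
  open import Relation.Binary.PropositionalEquality
  import Data.Nat as ℕ
  open Embeddings using (place)
  open Exceptional
  open UnitCertificate

  -- The units in gens generate the unit group up to sign; the places are scaled by 10¹².
  quintic : UnitData 4 2
  quintic = record
    { places =
        place 1 (+ 1000000000000 ∷ + 1245730939616 ∷ + 1551845573915 ∷ + 1933182044932 ∷ + 2408224685281 ∷ [])
        (+ 0 ∷ + 0 ∷ + 0 ∷ + 0 ∷ + 0 ∷ []) ∷
        place 2 (+ 1000000000000 ∷ + 384952030760 ∷ - + 1255469441943 ∷ - + 1563977127570 ∷ + 744182354025 ∷ [])
        (+ 0 ∷ + 1184760527672 ∷ + 912151942183 ∷ - + 1136295896007 ∷ - + 2290357779639 ∷ []) ∷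
        place 2 (+ 1000000000000 ∷ - + 1007817500568 ∷ + 479546654985 ∷ + 597386105104 ∷ - + 1948294696665 ∷ [])
        (+ 0 ∷ + 732222274630 ∷ - + 1475892845356 ∷ + 1838565381017 ∷ - + 1415518954215 ∷ []) ∷
        []
    -- Up to rounding the entries are 5 · 3^(2i/5) · 10²⁴, lowered by `off`.
    ; diag  = (4999999999977828177306146 ∷ 7759227869557081787287018 ∷ 12041123426379842262808769 ∷ 18685964094205242907098878 ∷ 28997730673954543965473899 ∷ [])
    ; off   = 22171822693854
    ; C     = 20000000000000000000000000
    ; fuel  = 40
    -- The exponents describe the inverse modulo 5, so 4 plays the part of -1.
    ; steps =
        step (- + 2 ∷ - + 1 ∷ + 1 ∷ + 1 ∷ + 0 ∷ []) (+ 1 ∷ + 1 ∷ + 0 ∷ + 1 ∷ + 0 ∷ []) (+ 1) (1 ∷ 0 ∷ []) ∷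
        step (+ 1 ∷ + 1 ∷ + 0 ∷ + 1 ∷ + 0 ∷ []) (- + 2 ∷ - + 1 ∷ + 1 ∷ + 1 ∷ + 0 ∷ []) (+ 1) (4 ∷ 0 ∷ []) ∷
        step (+ 4 ∷ - + 5 ∷ + 4 ∷ - + 2 ∷ + 0 ∷ []) (+ 4 ∷ + 2 ∷ + 0 ∷ + 0 ∷ + 1 ∷ []) (+ 1) (3 ∷ 4 ∷ []) ∷
        step (+ 7 ∷ + 6 ∷ + 5 ∷ + 4 ∷ + 3 ∷ []) (- + 2 ∷ + 0 ∷ + 1 ∷ - + 1 ∷ + 1 ∷ []) (+ 1) (1 ∷ 1 ∷ []) ∷
        step (+ 31 ∷ + 25 ∷ + 20 ∷ + 16 ∷ + 13 ∷ []) (+ 1 ∷ + 2 ∷ - + 1 ∷ - + 1 ∷ + 0 ∷ []) (+ 1) (0 ∷ 1 ∷ []) ∷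
        step (- + 2 ∷ + 0 ∷ + 1 ∷ - + 1 ∷ + 1 ∷ []) (+ 7 ∷ + 6 ∷ + 5 ∷ + 4 ∷ + 3 ∷ []) (+ 1) (4 ∷ 4 ∷ []) ∷
        []
    ; xs =
        (+ 1 ∷ - + 1 ∷ + 0 ∷ + 0 ∷ + 0 ∷ []) ∷
        (- + 2 ∷ - + 1 ∷ + 1 ∷ + 1 ∷ + 0 ∷ []) ∷
        (+ 1 ∷ + 0 ∷ + 0 ∷ + 0 ∷ + 0 ∷ []) ∷
        (+ 1 ∷ - + 2 ∷ + 1 ∷ + 0 ∷ + 0 ∷ []) ∷
        (+ 1 ∷ + 2 ∷ - + 1 ∷ - + 1 ∷ + 0 ∷ []) ∷
        (- + 2 ∷ + 1 ∷ + 2 ∷ + 0 ∷ - + 1 ∷ []) ∷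
        (+ 1 ∷ + 0 ∷ - + 1 ∷ + 1 ∷ - + 1 ∷ []) ∷
        (- + 2 ∷ - + 1 ∷ - + 1 ∷ - + 1 ∷ - + 1 ∷ []) ∷
        (- + 2 ∷ + 0 ∷ + 1 ∷ - + 1 ∷ + 1 ∷ []) ∷
        (+ 1 ∷ + 1 ∷ + 0 ∷ + 1 ∷ + 0 ∷ []) ∷
        (+ 1 ∷ + 1 ∷ + 0 ∷ + 0 ∷ + 0 ∷ []) ∷
        []
    ; gens  =
        (+ 1 ∷ + 1 ∷ + 0 ∷ + 1 ∷ + 0 ∷ []) ∷
        (+ 1 ∷ + 2 ∷ - + 1 ∷ - + 1 ∷ + 0 ∷ []) ∷
        []
    ; θ  = (+ 0 ∷ + 0 ∷ + 0 ∷ + 0 ∷ + 1 ∷ [])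
    -- 2 - η³ has norm 2⁵ - 3³ = 5.
    ; π  = (+ 2 ∷ + 0 ∷ + 0 ∷ - + 1 ∷ + 0 ∷ [])
    ; α₁ = (- + 4 ∷ - + 3 ∷ - + 3 ∷ - + 2 ∷ - + 2 ∷ [])
    ; α₂ = (+ 16 ∷ + 12 ∷ + 9 ∷ + 8 ∷ + 6 ∷ [])
    ; τ₀ = (- + 5 ∷ + 9 ∷ + 3 ∷ + 1 ∷ - + 5 ∷ [])
    ; inner = (1 ∷ 2 ∷ 3 ∷ [])
    }

  septic : UnitData 6 3
  septic = record
    { places =
        place 1 (+ 1000000000000 ∷ + 1169930812759 ∷ + 1368738106642 ∷ + 1601328885558 ∷ + 1873444004574 ∷ + 2191799866930 ∷ + 2564254199721 ∷ [])
        (+ 0 ∷ + 0 ∷ + 0 ∷ + 0 ∷ + 0 ∷ + 0 ∷ + 0 ∷ []) ∷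
        place 2 (+ 1000000000000 ∷ + 729439930635 ∷ - + 304572881832 ∷ - + 1442747473160 ∷ - + 1687914723880 ∷ - + 487721353435 ∷ + 1598786342900 ∷ [])
        (+ 0 ∷ + 914688741724 ∷ + 1334420984632 ∷ + 694790564423 ∷ - + 812856889732 ∷ - + 2136846868186 ∷ - + 2004814662393 ∷ []) ∷
        place 2 (+ 1000000000000 ∷ - + 260334097119 ∷ - + 1233190422396 ∷ + 998412229567 ∷ + 1168073231206 ∷ - + 1974743444776 ∷ - + 570600239423 ∷ [])
        (+ 0 ∷ + 1140598204680 ∷ - + 593873207583 ∷ - + 1251969336514 ∷ + 1464717503417 ∷ + 950986321661 ∷ - + 2499962993238 ∷ []) ∷
        place 2 (+ 1000000000000 ∷ - + 1054071239895 ∷ + 853394250907 ∷ - + 356329199186 ∷ - + 416880509613 ∷ + 1366564864746 ∷ - + 2310313203337 ∷ [])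
        (+ 0 ∷ + 507613955549 ∷ - + 1070122543027 ∷ + 1561180227113 ∷ - + 1826472851969 ∷ + 1713618139235 ∷ - + 1112588200223 ∷ []) ∷
        []
    ; diag  = (6999999999927984445902842 ∷ 9581166746421552514095699 ∷ 13114108031948961129578468 ∷ 17949779397974777586405364 ∷ 24568547067855849300350876 ∷ 33627906596639077523025060 ∷ 46027797205449420504739323 ∷ [])
    ; off   = 72015554097158
    ; C     = 56000000000000000000000000
    ; fuel  = 40
    ; steps =
        step (+ 1 ∷ - + 1 ∷ - + 2 ∷ - + 1 ∷ + 0 ∷ + 1 ∷ + 1 ∷ []) (+ 1 ∷ + 1 ∷ + 0 ∷ + 0 ∷ + 1 ∷ + 0 ∷ + 0 ∷ []) (+ 1) (1 ∷ 0 ∷ 0 ∷ []) ∷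
        step (+ 1 ∷ + 1 ∷ + 0 ∷ + 0 ∷ + 1 ∷ + 0 ∷ + 0 ∷ []) (+ 1 ∷ - + 1 ∷ - + 2 ∷ - + 1 ∷ + 0 ∷ + 1 ∷ + 1 ∷ []) (+ 1) (6 ∷ 0 ∷ 0 ∷ []) ∷
        step (- + 2 ∷ + 0 ∷ + 1 ∷ - + 1 ∷ + 1 ∷ - + 1 ∷ + 1 ∷ []) (+ 10 ∷ + 9 ∷ + 8 ∷ + 7 ∷ + 6 ∷ + 5 ∷ + 4 ∷ []) (+ 1) (6 ∷ 6 ∷ 0 ∷ []) ∷
        step (+ 5 ∷ - + 4 ∷ - + 2 ∷ + 4 ∷ + 0 ∷ - + 3 ∷ + 1 ∷ []) (- + 7 ∷ - + 5 ∷ - + 5 ∷ - + 4 ∷ - + 3 ∷ - + 3 ∷ - + 2 ∷ []) (- + 1) (6 ∷ 0 ∷ 6 ∷ []) ∷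
        step (+ 43 ∷ + 37 ∷ + 32 ∷ + 27 ∷ + 23 ∷ + 20 ∷ + 17 ∷ []) (+ 1 ∷ - + 1 ∷ + 2 ∷ + 0 ∷ + 0 ∷ + 0 ∷ - + 1 ∷ []) (+ 1) (0 ∷ 1 ∷ 0 ∷ []) ∷
        step (+ 2 ∷ + 1 ∷ - + 3 ∷ + 4 ∷ - + 4 ∷ + 3 ∷ - + 2 ∷ []) (- + 1 ∷ + 2 ∷ - + 1 ∷ - + 2 ∷ + 1 ∷ + 1 ∷ - + 1 ∷ []) (+ 1) (0 ∷ 6 ∷ 1 ∷ []) ∷
        step (- + 7 ∷ - + 5 ∷ - + 5 ∷ - + 4 ∷ - + 3 ∷ - + 3 ∷ - + 2 ∷ []) (+ 5 ∷ - + 4 ∷ - + 2 ∷ + 4 ∷ + 0 ∷ - + 3 ∷ + 1 ∷ []) (+ 1) (1 ∷ 0 ∷ 1 ∷ []) ∷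
        step (- + 25 ∷ - + 21 ∷ - + 19 ∷ - + 15 ∷ - + 14 ∷ - + 11 ∷ - + 10 ∷ []) (+ 2 ∷ + 0 ∷ + 1 ∷ + 0 ∷ - + 2 ∷ - + 1 ∷ + 1 ∷ []) (+ 1) (0 ∷ 0 ∷ 1 ∷ []) ∷
        step (+ 10 ∷ + 9 ∷ + 8 ∷ + 7 ∷ + 6 ∷ + 5 ∷ + 4 ∷ []) (- + 2 ∷ + 0 ∷ + 1 ∷ - + 1 ∷ + 1 ∷ - + 1 ∷ + 1 ∷ []) (+ 1) (1 ∷ 1 ∷ 0 ∷ []) ∷
        step (- + 1885 ∷ - + 1611 ∷ - + 1377 ∷ - + 1177 ∷ - + 1006 ∷ - + 860 ∷ - + 735 ∷ []) (- + 4 ∷ + 3 ∷ + 0 ∷ - + 2 ∷ + 1 ∷ + 2 ∷ - + 1 ∷ []) (+ 1) (1 ∷ 1 ∷ 1 ∷ []) ∷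
        step (- + 1 ∷ + 2 ∷ - + 1 ∷ - + 2 ∷ + 1 ∷ + 1 ∷ - + 1 ∷ []) (+ 2 ∷ + 1 ∷ - + 3 ∷ + 4 ∷ - + 4 ∷ + 3 ∷ - + 2 ∷ []) (- + 1) (0 ∷ 1 ∷ 6 ∷ []) ∷
        step (+ 1 ∷ - + 1 ∷ + 2 ∷ + 0 ∷ + 0 ∷ + 0 ∷ - + 1 ∷ []) (+ 43 ∷ + 37 ∷ + 32 ∷ + 27 ∷ + 23 ∷ + 20 ∷ + 17 ∷ []) (+ 1) (0 ∷ 6 ∷ 0 ∷ []) ∷
        step (+ 2 ∷ + 0 ∷ + 1 ∷ + 0 ∷ - + 2 ∷ - + 1 ∷ + 1 ∷ []) (- + 25 ∷ - + 21 ∷ - + 19 ∷ - + 15 ∷ - + 14 ∷ - + 11 ∷ - + 10 ∷ []) (- + 1) (0 ∷ 0 ∷ 6 ∷ []) ∷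
        step (- + 4 ∷ + 3 ∷ + 0 ∷ - + 2 ∷ + 1 ∷ + 2 ∷ - + 1 ∷ []) (- + 1885 ∷ - + 1611 ∷ - + 1377 ∷ - + 1177 ∷ - + 1006 ∷ - + 860 ∷ - + 735 ∷ []) (- + 1) (6 ∷ 6 ∷ 6 ∷ []) ∷
        []
    ; xs =
        (+ 1 ∷ - + 2 ∷ + 1 ∷ + 0 ∷ + 0 ∷ + 0 ∷ + 0 ∷ []) ∷
        (- + 2 ∷ - + 2 ∷ - + 1 ∷ + 1 ∷ + 1 ∷ + 1 ∷ + 0 ∷ []) ∷
        (+ 1 ∷ - + 1 ∷ - + 2 ∷ - + 1 ∷ + 0 ∷ + 1 ∷ + 1 ∷ []) ∷
        (+ 1 ∷ + 0 ∷ + 0 ∷ + 0 ∷ + 0 ∷ + 0 ∷ + 0 ∷ []) ∷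
        (+ 1 ∷ - + 1 ∷ + 2 ∷ + 0 ∷ + 0 ∷ + 0 ∷ - + 1 ∷ []) ∷
        (+ 1 ∷ + 0 ∷ - + 1 ∷ + 0 ∷ + 0 ∷ + 0 ∷ + 0 ∷ []) ∷
        (+ 2 ∷ + 0 ∷ + 1 ∷ + 0 ∷ - + 2 ∷ - + 1 ∷ + 1 ∷ []) ∷
        (+ 1 ∷ - + 1 ∷ + 0 ∷ + 0 ∷ + 0 ∷ + 0 ∷ + 0 ∷ []) ∷
        (+ 1 ∷ - + 1 ∷ + 0 ∷ - + 1 ∷ + 0 ∷ + 0 ∷ + 0 ∷ []) ∷
        (- + 1 ∷ + 4 ∷ - + 1 ∷ - + 2 ∷ + 2 ∷ + 1 ∷ - + 2 ∷ []) ∷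
        (+ 2 ∷ - + 2 ∷ - + 2 ∷ + 0 ∷ + 0 ∷ + 0 ∷ + 1 ∷ []) ∷
        (+ 2 ∷ + 0 ∷ - + 1 ∷ + 1 ∷ + 0 ∷ - + 1 ∷ + 0 ∷ []) ∷
        (- + 4 ∷ - + 1 ∷ + 3 ∷ + 0 ∷ - + 2 ∷ + 1 ∷ + 1 ∷ []) ∷
        (- + 1 ∷ - + 2 ∷ + 1 ∷ - + 1 ∷ - + 2 ∷ + 1 ∷ + 2 ∷ []) ∷
        (- + 1 ∷ + 2 ∷ + 0 ∷ + 1 ∷ + 1 ∷ + 0 ∷ + 1 ∷ []) ∷
        (- + 1 ∷ + 0 ∷ + 0 ∷ + 0 ∷ + 1 ∷ + 1 ∷ + 0 ∷ []) ∷
        (- + 1 ∷ + 2 ∷ - + 1 ∷ - + 2 ∷ + 1 ∷ + 1 ∷ - + 1 ∷ []) ∷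
        (+ 1 ∷ + 1 ∷ + 0 ∷ + 0 ∷ - + 1 ∷ + 0 ∷ + 0 ∷ []) ∷
        (- + 2 ∷ - + 1 ∷ - + 1 ∷ - + 1 ∷ - + 1 ∷ - + 1 ∷ - + 1 ∷ []) ∷
        (- + 1 ∷ + 3 ∷ + 3 ∷ + 0 ∷ - + 1 ∷ - + 1 ∷ - + 1 ∷ []) ∷
        (+ 1 ∷ + 0 ∷ + 1 ∷ + 0 ∷ + 0 ∷ + 0 ∷ + 0 ∷ []) ∷
        (- + 1 ∷ + 0 ∷ + 3 ∷ + 1 ∷ + 1 ∷ - + 1 ∷ - + 1 ∷ []) ∷
        (+ 2 ∷ + 0 ∷ - + 4 ∷ + 1 ∷ + 1 ∷ + 0 ∷ + 0 ∷ []) ∷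
        (- + 2 ∷ + 0 ∷ - + 1 ∷ - + 1 ∷ + 0 ∷ - + 1 ∷ + 0 ∷ []) ∷
        (- + 4 ∷ + 3 ∷ + 0 ∷ - + 2 ∷ + 1 ∷ + 2 ∷ - + 1 ∷ []) ∷
        (- + 2 ∷ + 1 ∷ - + 1 ∷ + 0 ∷ + 1 ∷ - + 1 ∷ + 1 ∷ []) ∷
        (- + 4 ∷ + 1 ∷ + 3 ∷ - + 1 ∷ - + 1 ∷ + 1 ∷ + 0 ∷ []) ∷
        (+ 1 ∷ + 2 ∷ + 1 ∷ + 1 ∷ - + 2 ∷ + 0 ∷ - + 1 ∷ []) ∷
        (+ 1 ∷ + 2 ∷ + 1 ∷ + 0 ∷ + 1 ∷ + 1 ∷ + 0 ∷ []) ∷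
        (+ 2 ∷ + 1 ∷ + 2 ∷ + 1 ∷ + 2 ∷ + 1 ∷ + 1 ∷ []) ∷
        (+ 4 ∷ - + 2 ∷ + 3 ∷ - + 2 ∷ + 0 ∷ + 0 ∷ - + 1 ∷ []) ∷
        (- + 1 ∷ + 2 ∷ + 3 ∷ + 0 ∷ + 0 ∷ + 2 ∷ + 1 ∷ []) ∷
        (+ 2 ∷ - + 1 ∷ - + 2 ∷ + 0 ∷ + 0 ∷ - + 1 ∷ + 0 ∷ []) ∷
        []
    ; gens  =
        (+ 1 ∷ + 1 ∷ + 0 ∷ + 0 ∷ + 1 ∷ + 0 ∷ + 0 ∷ []) ∷
        (+ 1 ∷ - + 1 ∷ + 2 ∷ + 0 ∷ + 0 ∷ + 0 ∷ - + 1 ∷ []) ∷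
        (+ 2 ∷ + 0 ∷ + 1 ∷ + 0 ∷ - + 2 ∷ - + 1 ∷ + 1 ∷ []) ∷
        []
    ; θ  = (+ 0 ∷ + 0 ∷ + 0 ∷ + 0 ∷ + 0 ∷ + 0 ∷ + 1 ∷ [])
    -- 1 - η + η² = (1 + η³)/(1 + η) has norm 28/4 = 7.
    ; π  = (+ 1 ∷ - + 1 ∷ + 1 ∷ + 0 ∷ + 0 ∷ + 0 ∷ + 0 ∷ [])
    ; α₁ = (+ 1 ∷ + 1 ∷ + 0 ∷ - + 1 ∷ - + 1 ∷ + 0 ∷ + 0 ∷ [])
    ; α₂ = (+ 1 ∷ - + 2 ∷ - + 3 ∷ - + 1 ∷ + 2 ∷ + 3 ∷ + 1 ∷ [])
    ; τ₀ = (+ 1 ∷ + 35 ∷ - + 23 ∷ + 27 ∷ + 9 ∷ + 3 ∷ + 1 ∷ [])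
    ; inner = (1 ∷ 2 ∷ 3 ∷ 4 ∷ 5 ∷ [])
    }

  abstract
    no-quintic : ∀ p q a b → Coprime p q → p ≡ q ℕ.+ 5 ⊎ q ≡ p ℕ.+ 5 → 3 ℕ.* p ≡ a ℕ.^ 5 → q ≡ b ℕ.^ 5 → ⊥
    -- In order: units per side of a box, the N of `perturb`, the scale of the places, the bound for
    -- the error forms, the lower bound for `diag`, and the constant in `slack-ok`. The 16 at the
    -- end comes from 3⁴ = 1 + 5 · 16.
    no-quintic = no-exceptional 1000000000 100000 1000000000000 40000000000000 2000000000000000000000000 200000000000000 quintic
      (record
        { gram-ok = tt ; diag-ok = tt ; places-ok = tt ; slack-ok = tt ; box-ok = tt ; small-ok = tt ; steps-ok = tt ; gens-ok = tt
        ; words-ok = tt ; θ-ok = tt ; α₁-ok = tt ; α₂-ok = tt ; τ₀-ok = tt ; inner-ok = tt ; θ₀-ok = tt })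
      (toWitness {a? = prime? 5} tt) (+ 16) refl

  abstract
    no-septic : ∀ p q a b → Coprime p q → p ≡ q ℕ.+ 7 ⊎ q ≡ p ℕ.+ 7 → 3 ℕ.* p ≡ a ℕ.^ 7 → q ≡ b ℕ.^ 7 → ⊥
    no-septic = no-exceptional 1000000000 100000 1000000000000 40000000000000 2000000000000000000000000 200000000000000 septic
      (record
        { gram-ok = tt ; diag-ok = tt ; places-ok = tt ; slack-ok = tt ; box-ok = tt ; small-ok = tt ; steps-ok = tt ; gens-ok = tt
        ; words-ok = tt ; θ-ok = tt ; α₁-ok = tt ; α₂-ok = tt ; τ₀-ok = tt ; inner-ok = tt ; θ₀-ok = tt })
      (toWitness {a? = prime? 7} tt) (+ 104) refl

-- Assembly over all exponents k ≥ 3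

module ThueEquation where

  open import Data.Nat using (ℕ; _≤_; _<_; z≤n; s≤s; _+_; _*_; _^_; _!; _≤?_)
  open import Data.Nat.Properties
  open import Data.Nat.Divisibility using (m%n≡0⇒n∣m)
  open import Data.Nat.Coprimality using (Coprime)
  open import Data.Integer as ℤ using (+_; ∣_∣)
  import Data.Integer.Properties as ℤ
  import Data.Integer.Tactic.RingSolver as ℤS
  open import Data.Nat.Tactic.RingSolver using (solve-∀)
  open import Data.Product using (_,_; proj₁; proj₂)
  open import Data.Sum using (_⊎_; inj₁; inj₂; [_,_]′)
  open import Data.Empty using (⊥)
  open import Relation.Nullary using (¬_; yes; no)
  open import Relation.Binary.PropositionalEquality
  open ToThue using (ThueSol)
  open ExponentDivisibility using (no-3∣k; no-4∣k)
  open LargeExponents using (no-large-solution; 300n≤2^n)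
  open SmallExponents using (sieve; d∣N!; Excluded; Good)
  open QuinticSeptic using (no-quintic; no-septic)

  Equation : ℕ → ℕ → ℕ → ℕ → Set
  Equation k c a b = a ^ k ≡ 3 * b ^ k + c ⊎ a ^ k + c ≡ 3 * b ^ k

  equation₃ : ∀ {k p q a b} → p ≡ q + k ⊎ q ≡ p + k → 3 * p ≡ a ^ k → q ≡ b ^ k → Equation k (3 * k) a b
  equation₃ {k} {p} {q} (inj₁ e) p≡ q≡ = inj₁ (trans (sym p≡) (trans (cong (3 *_) e) (trans (*-distribˡ-+ 3 q k) (cong (λ z → 3 * z + 3 * k) q≡))))
  equation₃ {k} {p} {q} (inj₂ e) p≡ q≡ = inj₂ (trans (cong (_+ 3 * k) (sym p≡)) (trans (sym (*-distribˡ-+ 3 p k)) (trans (cong (3 *_) (sym e)) (cong (3 *_) q≡))))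

  equation₁ : ∀ {k p q a b} → p ≡ q + k ⊎ q ≡ p + k → p ≡ a ^ k → q ≡ 3 * b ^ k → Equation k k a b
  equation₁ (inj₁ e) p≡ q≡ = inj₁ (trans (sym p≡) (trans e (cong (_+ _) q≡)))
  equation₁ (inj₂ e) p≡ q≡ = inj₂ (trans (cong (_+ _) (sym p≡)) (trans (sym e) q≡))

  excluded : ∀ {k c a b} → Excluded (2000 !) d∣N! k c → ¬ Equation k c a b
  excluded {a = a} {b} ex (inj₁ e) = proj₁ (ex a b) e
  excluded {a = a} {b} ex (inj₂ e) = proj₂ (ex a b) e

  -- If a ≤ b, only a^k + c = 3b^k is possible, and then 2b^k ≤ c ≤ 3k. For b ≥ 2 this is too small
  -- against 2^k; for b = 1 also a = 1, and c would be 2.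
  equation⇒b<a : ∀ {k c a b} → 20 ≤ k → 3 ≤ c → c ≤ 3 * k → a ≢ 0 → b ≢ 0 → Equation k c a b → b < a
  equation⇒b<a {k} {c} {a} {b} 20≤k 3≤c c≤3k a≢0 b≢0 eq = ≰⇒> λ a≤b → absurd a≤b eq
    where
    absurd : a ≤ b → Equation k c a b → ⊥
    absurd a≤b (inj₁ e) = <⇒≱ (≤-trans (s≤s (^-monoˡ-≤ k a≤b)) (≤-trans (≤-reflexive (+-comm 1 (b ^ k))) (+-mono-≤ (m≤m+n (b ^ k) (2 * b ^ k)) (≤-trans (s≤s z≤n) 3≤c)))) (≤-reflexive (sym e))
    absurd a≤b (inj₂ e) with b ≤? 1
    ... | yes b≤1 = <⇒≱ 3≤c (≤-reflexive (+-cancelˡ-≡ 1 c 2 (trans (cong (_+ c) (sym (trans (cong (_^ k) a≡1) (^-zeroˡ k)))) (trans e (trans (cong (λ z → 3 * z ^ k) b≡1) (cong (3 *_) (^-zeroˡ k)))))))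
      where
      b≡1 : b ≡ 1
      b≡1 = ≤-antisym b≤1 (n≢0⇒n>0 b≢0)
      a≡1 : a ≡ 1
      a≡1 = ≤-antisym (≤-trans a≤b b≤1) (n≢0⇒n>0 a≢0)
    ... | no b≰1 = <⇒≱ c< (≤-trans (≤-reflexive (lem (b ^ k))) (+-cancelˡ-≤ (b ^ k) _ _ (≤-trans (≤-reflexive (sym e)) (+-monoˡ-≤ c (^-monoˡ-≤ k a≤b)))))
      where
      lem : ∀ x → x + x ≡ 2 * x
      lem = solve-∀
      0<b^k : 0 < b ^ k
      0<b^k = n≢0⇒n>0 (λ z → b≢0 (m^n≡0⇒m≡0 b k z))
      c< : c < b ^ k + b ^ k
      c< = ≤-trans (s≤s (≤-trans c≤3k (≤-trans (*-monoˡ-≤ k (m≤m+n 3 297)) (≤-trans (300n≤2^n k 20≤k) (^-monoˡ-≤ k (≰⇒> b≰1)))))) (+-monoˡ-≤ (b ^ k) 0<b^k)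

  equation⇒close : ∀ {k c a b} → Equation k c a b → ∣ + (a ^ k) ℤ.- + (3 * b ^ k) ∣ ≡ c
  equation⇒close {k} {c} {a} {b} (inj₁ e) = cong ∣_∣ (trans (cong (λ z → + z ℤ.- + (3 * b ^ k)) e) (trans (cong (ℤ._- + (3 * b ^ k)) (ℤ.pos-+ (3 * b ^ k) c)) (lem (+ (3 * b ^ k)) (+ c))))
    where lem : ∀ x c → x ℤ.+ c ℤ.- x ≡ c
          lem = ℤS.solve-∀
  equation⇒close {k} {c} {a} {b} (inj₂ e) = trans (cong ∣_∣ (trans (cong (λ z → + (a ^ k) ℤ.- + z) (sym e)) (trans (cong (λ z → + (a ^ k) ℤ.- z) (ℤ.pos-+ (a ^ k) c)) (lem (+ (a ^ k)) (+ c))))) (ℤ.∣-i∣≡∣i∣ (+ c))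
    where lem : ∀ x c → x ℤ.- (x ℤ.+ c) ≡ ℤ.- c
          lem = ℤS.solve-∀

  no-large-equation : ∀ {k c a b} → 41370 ≤ k → 3 ≤ c → c ≤ 3 * k → a ≢ 0 → b ≢ 0 → ¬ Equation k c a b
  no-large-equation {k} {c} {a} {b} large 3≤c c≤3k a≢0 b≢0 eq = no-large-solution large (n≢0⇒n>0 b≢0) (equation⇒b<a {k} (≤-trans (m≤m+n 20 41350) large) 3≤c c≤3k a≢0 b≢0 eq) (≤-trans (≤-reflexive (equation⇒close {k} {c} {a} {b} eq)) c≤3k) (up eq)
    where
    up : Equation k c a b → a ^ k ≤ 3 * b ^ k + 3 * k
    up (inj₁ e) = ≤-trans (≤-reflexive e) (+-monoʳ-≤ (3 * b ^ k) c≤3k)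
    up (inj₂ e) = ≤-trans (m≤m+n (a ^ k) c) (≤-trans (≤-reflexive e) (m≤m+n (3 * b ^ k) (3 * k)))

  no-thue : ∀ k p q a b → 3 ≤ k → Coprime p q → p ≢ 0 → q ≢ 0 → a ≢ 0 → b ≢ 0 → ¬ ThueSol k p q a b
  no-thue k p q a b 3≤k cop p≢0 q≢0 a≢0 b≢0 sol = [ (λ k< → below (sieve k 3≤k k<) sol) , (λ k≥ → above k≥ sol) ]′ (<-≤-connex k 41370)
    where
    k≤3k = m≤m+n k (2 * k)
    above : 41370 ≤ k → ¬ ThueSol k p q a b
    above k≥ (diff , inj₁ (p≡ , q≡)) = no-large-equation k≥ (≤-trans 3≤k k≤3k) ≤-refl a≢0 b≢0 (equation₃ {k} {p} {q} {a} {b} diff p≡ q≡)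
    above k≥ (diff , inj₂ (p≡ , q≡)) = no-large-equation k≥ 3≤k k≤3k a≢0 b≢0 (equation₁ {k} {p} {q} {a} {b} diff p≡ q≡)
    exceptional : k ≡ 5 ⊎ k ≡ 7 → p ≡ q + k ⊎ q ≡ p + k → 3 * p ≡ a ^ k → q ≡ b ^ k → ⊥
    exceptional (inj₁ refl) = no-quintic p q a b cop
    exceptional (inj₂ refl) = no-septic p q a b cop
    below : Good (2000 !) d∣N! k → ¬ ThueSol k p q a b
    below (inj₁ (inj₁ 3∣k)) = no-3∣k (≤-trans (s≤s (s≤s z≤n)) 3≤k) (m%n≡0⇒n∣m k 3 3∣k) cop
    below (inj₁ (inj₂ 4∣k)) = no-4∣k (≤-trans (s≤s z≤n) 3≤k) (m%n≡0⇒n∣m k 4 4∣k) cop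
    below (inj₂ (ex , _)) (diff , inj₂ (p≡ , q≡)) = excluded {k} {k} {a} {b} ex (equation₁ diff p≡ q≡)
    below (inj₂ (_ , inj₂ ex)) (diff , inj₁ (p≡ , q≡)) = excluded {k} {3 * k} {a} {b} ex (equation₃ diff p≡ q≡)
    below (inj₂ (_ , inj₁ ex)) (diff , inj₁ (p≡ , q≡)) = exceptional ex diff p≡ q≡

open import Defs
open import Data.Nat as ℕ using (ℕ)
open import Data.Integer as ℤ using (ℤ; +_; -[1+_])
open import Data.Rational as ℚ using (ℚ; Positive)
open import Data.Product using (_×_; ∃-syntax)
open import Data.Sum using (_⊎_)
open import Relation.Binary.PropositionalEquality using (_≡_; _≢_)

open Rationals using (param)
open ToThue using (module Concluded; conclude)
open ThueEquation using (no-thue)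

theorem3 : (x y : ℚ) → Positive x → Positive y →
    RealPowEq x y y (ℕtoℚ 3 ℚ.* x) →
    (∃[ n ] (n ≢ + 0 × n ≢ -[1+ 0 ] ×
    x ≡ (ℕtoℚ 3 ℚ.+ ℕtoℚ 3 ℚ.* inv (ℤtoℚ n)) ^ℤ n ×
    y ≡ (ℕtoℚ 3 ℚ.+ ℕtoℚ 3 ℚ.* inv (ℤtoℚ n)) ^ℤ (+ 1 ℤ.+ n)))
    ⊎ (∃[ n ] (x ≡ (ℕtoℚ (3 ℕ.* w n) ℚ.* inv (ℕtoℚ (v n))) ^ℕ (v n ℕ.^ 2) ×
    y ≡ (ℕtoℚ (3 ℕ.* w n) ℚ.* inv (ℕtoℚ (v n))) ^ℕ (3 ℕ.* w n ℕ.^ 2)))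
    ⊎ (∃[ n ] (x ≡ (ℕtoℚ (w n) ℚ.* inv (ℕtoℚ (v n))) ^ℕ (3 ℕ.* w n ℕ.^ 2) ×
    y ≡ (ℕtoℚ (w n) ℚ.* inv (ℕtoℚ (v n))) ^ℕ (v n ℕ.^ 2)))
theorem3 x y x>0 y>0 eq = Concluded.conclusion (conclude no-thue (param x y x>0 y>0 eq))
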